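{- The satisfiability problem for DBEL with $n\ge 2$ agents and the satisfiability problem for EDPAL are PSPACE-complete.
   Context: Satisfiability problem of a logic: given a formula $\varphi$ of its language, decide whether there exist a model $M$ of the logic and a state $s$ of $M$ with $(M,s)\models\varphi$. For a set $\mathcal{A}$ of agents and a set $\mathcal{P}$ of propositional atoms, $\mathcal{L}^\infty$ is generated by $\varphi ::= p \mid E_a^d \mid P_a^d \mid \neg\varphi \mid \varphi\wedge\varphi \mid K_a\varphi \mid K_a^\infty\varphi \mid [\varphi]\varphi$ with $p\in\mathcal{P}$, $a\in\mathcal{A}$, $d\in\mathbb{N}=\{0,1,\dots\}$; $\mathcal{H}^\infty$ is the fragment without public announcements $[\varphi]\psi$. DBEL formulas are those of $\mathcal{H}^\infty$, EDPAL formulas are those of $\mathcal{L}^\infty$ (multi-agent). Modal depth: $d(p)=d(E_a^d)=d(P_a^d)=0$, $d(\neg\varphi)=d(\varphi)$, $d(\varphi\wedge\psi)=\max(d(\varphi),d(\psi))$, $d(K_a\varphi)=d(K_a^\infty\varphi)=1+d(\varphi)$, $d([\varphi]\psi)=d(\varphi)+d(\psi)$. A DBEL model is a tuple $M=(\mathcal{S},\sim,V,d)$ with $\mathcal{S}$ a set of states, $\sim_a$ an equivalence relation on $\mathcal{S}$ for each agent $a$, $V:\mathcal{S}\to 2^{\mathcal{P}}$, and $d:\mathcal{A}\times\mathcal{S}\to\mathbb{N}$. Semantics: $(M,s)\models p$ iff $p\in V(s)$; $(M,s)\models E_a^d$ iff $d(a,s)=d$; $(M,s)\models P_a^d$ iff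 $d(a,s)\ge d$; $\neg,\wedge$ as usual; $(M,s)\models K_a^\infty\varphi$ iff $(M,s')\models\varphi$ for all $s'$ with $s\sim_a s'$; $(M,s)\models K_a\varphi$ iff $(M,s)\models P_a^{d(\varphi)}\wedge K_a^\infty\varphi$. EDPAL extends this: the depth function may take values in $\mathbb{Z}$, and $(M,s)\models[\varphi]\psi$ iff ($(M,s)\models\varphi$ implies $(M\mid\varphi,s)\models\psi$), where $M\mid\varphi=(\mathcal{S}',\sim',V,d')$ with $\mathcal{S}'=\{s\in\mathcal{S}:(M,s)\models\varphi\}$, $\sim'_a$ the restriction of $\sim_a$ to $\mathcal{S}'$, $V$ restricted to $\mathcal{S}'$, and $d'(a,s)=d(a,s)-d(\varphi)$. -}

module Defs where

open import Data.Bool.Base using (Bool; true; false)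
open import Data.Fin.Base using (Fin; toℕ)
open import Data.Integer.Base as ℤ using (ℤ; +_)
open import Data.List.Base as List using (List; []; _∷_; _++_; foldr; length)
open import Data.Maybe.Base using (Maybe; just; nothing)
open import Data.Nat.Base as ℕ using (ℕ; zero; suc; _+_; _*_; _≤_; _⊔_)
open import Data.Nat.Binary.Base using (ℕᵇ; zero; 2[1+_]; 1+[2_]; fromℕ)
open import Data.Nat.GeneralisedArithmetic using (fold)
open import Data.Product.Base using (Σ; Σ-syntax; ∃; ∃-syntax; _×_; _,_; proj₁; proj₂)
open import Data.Vec.Base as Vec using (Vec; _∷_)
open import Function.Bundles using (_⇔_; _↔_)
open import Level using (0ℓ) renaming (suc to lsuc)
open import Relation.Binary.Core using (Rel)
open import Relation.Binary.Structures using (IsEquivalence)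
open import Relation.Binary.PropositionalEquality.Core using (_≡_)
open import Relation.Nullary.Negation.Core using (¬_)
open import Relation.Unary using (Pred; _∈_)

------------------------------------------------------------------------
-- Turing machines

data Symbol (Γ : Set) : Set where
  blank : Symbol Γ
  bit   : Bool → Symbol Γ
  work  : Γ → Symbol Γ

data Move : Set where
  left stay right : Move

IsFinite : Set → Set
IsFinite A = ∃[ n ] (A ↔ Fin n)

-- Deterministic machines with 1 + extraTapes two-way infinite tapes. A
-- state q with verdict q = just b is halting (accepting if b is true,
-- rejecting if b is false), and δ is not consulted there.
record Machine : Set₁ where
  field
    State       : Set
    Γ           : Set
    extraTapes  : ℕ
    stateFinite : IsFinite State
    Γ-finite    : IsFinite Γ
    start       : State
    verdict     : State → Maybe Bool
    δ           : State → Vec (Symbol Γ) (suc extraTapes) →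
                  State × Vec (Symbol Γ × Move) (suc extraTapes)

-- The visited part of a tape; everything outside it is blank. The list
-- leftward is read away from the head, so it is in reverse order.
record Tape (Γ : Set) : Set where
  constructor tape
  field
    leftward  : List (Symbol Γ)
    head      : Symbol Γ
    rightward : List (Symbol Γ)

Word : Set
Word = List Bool

module _ {Γ : Set} where

  move : Move → Tape Γ → Tape Γ
  move left  (tape []       x rs)       = tape [] blank (x ∷ rs)
  move left  (tape (l ∷ ls) x rs)       = tape ls l (x ∷ rs)
  move stay  t                          = t
  move right (tape ls       x [])       = tape (x ∷ ls) blank []
  move right (tape ls       x (r ∷ rs)) = tape (x ∷ ls) r rs

  writeMove : Tape Γ → Symbol Γ × Move → Tape Γ
  writeMove (tape ls _ rs) (x , m) = move m (tape ls x rs)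

  tapeSize : Tape Γ → ℕ
  tapeSize (tape ls _ rs) = length ls + suc (length rs)

  blankTape : Tape Γ
  blankTape = tape [] blank []

  inputTape : Word → Tape Γ
  inputTape []      = blankTape
  inputTape (b ∷ w) = tape [] (bit b) (List.map bit w)

  leadingBits : List (Symbol Γ) → Word
  leadingBits (bit b ∷ xs) = b ∷ leadingBits xs
  leadingBits _            = []

  -- The word starting under the head and ending before the first non-bit.
  outputOf : Tape Γ → Word
  outputOf (tape _ x rs) = leadingBits (x ∷ rs)

module _ (T : Machine) where
  open Machine T

  record Config : Set where
    constructor config
    field
      state : State
      tapes : Vec (Tape Γ) (suc extraTapes)

  open Config

  initial : Word → Config
  initial w = config start (inputTape w ∷ Vec.replicate extraTapes blankTape)

  step : Config → Config
  step (config q ts) with verdict q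
  ... | just _  = config q ts
  ... | nothing with δ q (Vec.map Tape.head ts)
  ...   | q′ , actions = config q′ (Vec.zipWith writeMove ts actions)

  after : ℕ → Word → Config
  after t w = fold (initial w) step t

  verdictAfter : ℕ → Word → Maybe Bool
  verdictAfter t w = verdict (state (after t w))

  outputAfter : ℕ → Word → Word
  outputAfter t w = outputOf (Vec.head (tapes (after t w)))

  -- All tapes are counted, including the one holding the input; this
  -- makes no difference for polynomial bounds.
  spaceAfter : ℕ → Word → ℕ
  spaceAfter t w = Vec.sum (Vec.map tapeSize (tapes (after t w)))

------------------------------------------------------------------------
-- PSPACE

-- Coefficients, constant term first.
Polynomial : Set
Polynomial = List ℕ

eval : Polynomial → ℕ → ℕ
eval p n = foldr (λ a v → a + n * v) 0 p

-- Satisfiability quantifies over models, hence over sets of states, and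
-- so lives in Set₁.
Language : Set₂
Language = Pred Word (lsuc 0ℓ)

Decides : Machine → Language → Set₁
Decides T L = ∀ w → ∃[ t ] ∃[ b ]
  (verdictAfter T t w ≡ just b × (b ≡ true ⇔ w ∈ L))

RunsInSpace : Machine → Polynomial → Set
RunsInSpace T p = ∀ w t → spaceAfter T t w ≤ eval p (length w)

ComputesInTime : Machine → Polynomial → (Word → Word) → Set
ComputesInTime T p f = ∀ w → ∃[ t ]
  (t ≤ eval p (length w) ×
   (∃[ b ] verdictAfter T t w ≡ just b) ×
   outputAfter T t w ≡ f w)

InPSPACE : Language → Set₁
InPSPACE L = Σ[ T ∈ Machine ] Σ[ p ∈ Polynomial ] (Decides T L × RunsInSpace T p)

PolyTime : (Word → Word) → Set₁
PolyTime f = Σ[ T ∈ Machine ] Σ[ p ∈ Polynomial ] ComputesInTime T p f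

_≤ₚ_ : Language → Language → Set₁
L ≤ₚ L′ = Σ[ f ∈ (Word → Word) ] (PolyTime f × (∀ w → w ∈ L ⇔ f w ∈ L′))

PSPACE-hard : Language → Set₂
PSPACE-hard L = ∀ (L′ : Language) → InPSPACE L′ → L′ ≤ₚ L

PSPACE-complete : Language → Set₂
PSPACE-complete L = InPSPACE L × PSPACE-hard L

------------------------------------------------------------------------
-- Formulas

data Logic : Set where
  DBEL EDPAL : Logic

infix  9 ∼_
infixr 8 _∧_
infixr 9 [_]_

-- Formula n DBEL is 𝓗^∞ and Formula n EDPAL is 𝓛^∞, for n agents and
-- countably many atoms.
data Formula (n : ℕ) : Logic → Set where
  atom : ∀ {l} → ℕ → Formula n l
  E P  : ∀ {l} → Fin n → ℕ → Formula n l
  ∼_   : ∀ {l} → Formula n l → Formula n l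
  _∧_  : ∀ {l} → Formula n l → Formula n l → Formula n l
  K K∞ : ∀ {l} → Fin n → Formula n l → Formula n l
  [_]_ : Formula n EDPAL → Formula n EDPAL → Formula n EDPAL

modalDepth : ∀ {n l} → Formula n l → ℕ
modalDepth (atom p)  = 0
modalDepth (E a k)   = 0
modalDepth (P a k)   = 0
modalDepth (∼ φ)     = modalDepth φ
modalDepth (φ ∧ ψ)   = modalDepth φ ⊔ modalDepth ψ
modalDepth (K a φ)   = 1 + modalDepth φ
modalDepth (K∞ a φ)  = 1 + modalDepth φ
modalDepth ([ φ ] ψ) = modalDepth φ + modalDepth ψ

------------------------------------------------------------------------
-- Models and satisfaction

Depth : Logic → Set
Depth DBEL  = ℕ
Depth EDPAL = ℤ

HasDepth : ∀ l → Depth l → ℕ → Set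
HasDepth DBEL  d k = d ≡ k
HasDepth EDPAL d k = d ≡ + k

HasDepthAtLeast : ∀ l → Depth l → ℕ → Set
HasDepthAtLeast DBEL  d k = d ℕ.≥ k
HasDepthAtLeast EDPAL d k = d ℤ.≥ + k

record Model (n : ℕ) (l : Logic) : Set₁ where
  field
    S             : Set
    _~[_]_        : S → Fin n → S → Set
    ~-equivalence : ∀ a → IsEquivalence (λ s t → s ~[ a ] t)
    V             : S → ℕ → Bool
    d             : Fin n → S → Depth l

-- Keep the states satisfying Q and lower every depth by k.
restrict : ∀ {n} (M : Model n EDPAL) → Pred (Model.S M) 0ℓ → ℕ → Model n EDPAL
restrict M Q k = record
  { S             = Σ S Q
  ; _~[_]_        = λ s a t → proj₁ s ~[ a ] proj₁ t
  ; ~-equivalence = λ a → record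
    { refl  = IsEquivalence.refl  (~-equivalence a)
    ; sym   = IsEquivalence.sym   (~-equivalence a)
    ; trans = IsEquivalence.trans (~-equivalence a)
    }
  ; V             = λ s → V (proj₁ s)
  ; d             = λ a s → d a (proj₁ s) ℤ.- + k
  }
  where open Model M

Sat : ∀ {n l} (M : Model n l) → Model.S M → Formula n l → Set
Sat M s (atom p)          = Model.V M s p ≡ true
Sat {l = l} M s (E a k)   = HasDepth l (Model.d M a s) k
Sat {l = l} M s (P a k)   = HasDepthAtLeast l (Model.d M a s) k
Sat M s (∼ φ)             = ¬ Sat M s φ
Sat M s (φ ∧ ψ)           = Sat M s φ × Sat M s ψ
Sat {l = l} M s (K a φ)   = HasDepthAtLeast l (Model.d M a s) (modalDepth φ) ×
                            (∀ t → Model._~[_]_ M s a t → Sat M t φ)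
Sat M s (K∞ a φ)          = ∀ t → Model._~[_]_ M s a t → Sat M t φ
Sat M s ([ φ ] ψ)         = (h : Sat M s φ) →
                            Sat (restrict M (λ t → Sat M t φ) (modalDepth φ)) (s , h) ψ

Satisfiable : ∀ {n l} → Formula n l → Set₁
Satisfiable {n} {l} φ = Σ[ M ∈ Model n l ] Σ[ s ∈ Model.S M ] Sat M s φ

------------------------------------------------------------------------
-- The satisfiability problems as languages

-- Self-delimiting code of the bijective binary numeral of a natural
-- number, of length 1 + 2 ⌊log₂ (1 + k)⌋.
encodeℕᵇ : ℕᵇ → Word
encodeℕᵇ zero       = false ∷ []
encodeℕᵇ 2[1+ b ]   = true ∷ true ∷ encodeℕᵇ b
encodeℕᵇ 1+[2 b ]   = true ∷ false ∷ encodeℕᵇ b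

encodeℕ : ℕ → Word
encodeℕ k = encodeℕᵇ (fromℕ k)

-- Polish notation with a three-bit tag per connective, a prefix code.
encode : ∀ {n l} → Formula n l → Word
encode (atom p)  = false ∷ false ∷ false ∷ encodeℕ p
encode (E a k)   = false ∷ false ∷ true  ∷ encodeℕ (toℕ a) ++ encodeℕ k
encode (P a k)   = false ∷ true  ∷ false ∷ encodeℕ (toℕ a) ++ encodeℕ k
encode (∼ φ)     = false ∷ true  ∷ true  ∷ encode φ
encode (φ ∧ ψ)   = true  ∷ false ∷ false ∷ encode φ ++ encode ψ
encode (K a φ)   = true  ∷ false ∷ true  ∷ encodeℕ (toℕ a) ++ encode φ
encode (K∞ a φ)  = true  ∷ true  ∷ false ∷ encodeℕ (toℕ a) ++ encode φ
encode ([ φ ] ψ) = true  ∷ true  ∷ true  ∷ encode φ ++ encode ψ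

-- Words that encode no formula are no-instances.
SAT : ℕ → Logic → Language
SAT n l w = Σ[ φ ∈ Formula n l ] (encode φ ≡ w × Satisfiable φ)

-- Membership. After desugaring, E and K are expressed by P and K∞. A type gives each node of
-- the formula its truth value and says whether the current state survives the announcements
-- in whose scope the node lies. Satisfiability is a game: one player picks a false K∞ node,
-- the other answers with the type of a successor that refutes it and agrees with the current
-- type on all boxes of that agent. No agent is picked twice in a row, because the earlier
-- answers already belong to one equivalence class, and as many rounds as there are nodes
-- suffice, because a node of modal depth k is evaluated correctly while k rounds remain. The
-- plays won by the second player form a model. An odometer running through the plays decides
-- the game in polynomial space; it is a term of a first-order list language, which compiles to
-- while programs on three bit stacks and then to machines.
--
-- Hardness. As in Savitch's theorem, runs are split in halves. Each state of a model carries
-- both ends x, y and the middle z of a block of steps, and reaches through K∞ for two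
-- different agents a state for the first and a state for the second half. Cells are described
-- by positive literals only, so a model contains at least the literals of the true run. The
-- formula uses no depth atoms, no K and no announcements, so one formula serves both logics.
module Submission where

open import Defs
open import Data.Bool.Base using (Bool; true; false; if_then_else_; not) renaming (_∧_ to _&&_; _∨_ to _||_)
open import Data.Bool.Properties using () renaming (_≟_ to _≟ᵇ_)
open import Data.Empty using (⊥; ⊥-elim)
open import Data.Fin.Base as Fin using (Fin; toℕ; fromℕ<)
open import Data.Fin.Properties as Fin using (+↔⊎; 0↔⊥; 1↔⊤; 2↔Bool; finToFun-funToFin; remQuot-combine; pigeonhole; toℕ-fromℕ<; toℕ<n; toℕ-injective)
open import Data.Integer.Base as ℤ using (ℤ; -[1+_])
import Data.Integer.Properties as ℤ
open import Data.List.Base as List using (List; []; _∷_; length; _++_; _ʳ++_; take; drop; replicate; allFin; cartesianProductWith; foldl)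
open import Data.List.Membership.Propositional using () renaming (_∈_ to _∈ₗ_)
open import Data.List.Membership.Propositional.Properties using (∈-map⁺; ∈-allFin; ∈-++⁺ˡ; ∈-++⁺ʳ; ∈-cartesianProductWith⁺)
open import Data.List.Properties using (++-assoc; length-++; length-drop; length-map; length-replicate; length-reverse; ++-identityʳ; take++drop≡id; ++-ʳ++; map-++; reverse-foldl; ʳ++-ʳ++; map-ʳ++; foldl-++)
open import Data.List.Relation.Unary.All using (All; []; _∷_)
open import Data.List.Relation.Unary.All.Properties using (++⁺)
open import Data.List.Relation.Unary.Any as Any using (here; there)
open import Data.List.Relation.Unary.Any.Properties using (lookup-index)
open import Data.Maybe.Base as Maybe using (Maybe; just; nothing; maybe)
open import Data.Maybe.Properties using (just-injective)
open import Data.Nat.Base using (ℕ; zero; suc; _+_; _*_; _^_; _∸_; _≤_; _<_; _⊔_; _≡ᵇ_; _<ᵇ_; z≤n; s≤s)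
open import Data.Nat.Binary.Base as ℕᵇ using (ℕᵇ; zero; 2[1+_]; 1+[2_]; fromℕ)
open import Data.Nat.Binary.Properties using (toℕ-fromℕ)
open import Data.Nat.GeneralisedArithmetic using (fold)
open import Data.Nat.Induction using (<-rec)
open import Data.Nat.Properties
open import Data.Nat.Solver using (module +-*-Solver)
open import Data.Product.Base as Prod using (Σ; Σ-syntax; ∃; ∃₂; ∃-syntax; _×_; _,_; proj₁; proj₂; map₁; map₂)
open import Data.Sum.Base using (_⊎_; inj₁; inj₂)
open import Data.Sum.Function.Propositional using (_⊎-↔_)
open import Data.Unit.Base using (⊤; tt)
open import Data.Vec.Base as Vec using (Vec; []; _∷_)
open import Data.Vec.Properties using (lookup-zipWith; lookup-map; lookup-replicate; tabulate∘lookup; tabulate-cong)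
open import Function.Base using (_∘_)
open import Function.Bundles using (_⇔_; _↔_; mk⇔; Equivalence; Inverse)
open import Function.Properties.Inverse using (↔-sym; ↔-trans)
open import Relation.Binary.PropositionalEquality hiding ([_])
open import Relation.Binary.Structures using (IsEquivalence)
open import Relation.Nullary.Decidable.Core as Dec using (decidable-stable)
open import Relation.Nullary.Negation.Core using (¬_)
open import Relation.Nullary.Reflects using (Reflects; ofʸ; ofⁿ; det; ¬-reflects; _×-reflects_; _→-reflects_)
open import Relation.Unary using (_∈_)

open +-*-Solver using (solve; _:+_; _:*_; _:=_) renaming (con to :con)

-- Satisfaction is read constructively, so the type of a given state exists only up to double
-- negation. That suffices, since the game has a Boolean value and the truth of a query is stable:
-- there is no disjunction and no diamond. Announcements stay in place as nodes, because eliminating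
-- them by reduction axioms duplicates subformulas. What an announcement does to depths is a fixed
-- subtraction, so it is moved into the thresholds of the depth atoms beforehand; apart from the
-- announcements themselves the two logics then differ only in whether `P a 0` can fail. What it
-- does to the set of states is recorded by the survival flag. In the hardness half the relations
-- are reflexive, so the box of two agents also leads back to the state itself and to states at a
-- wrong level; level atoms pick out the intended successors. No clause makes successors unique or
-- configurations well formed, and none has to: every argument follows one state that is known to
-- exist.

module Bounds where

  -- Polynomial bounds

  infixl 6 _⊕_
  infixl 7 _⊗_
  infixl 8 _∘ᵇ_

  -- Composition is a constructor, so that the bound of a sequence of programs can be assembled
  -- without normalization. Only the final bound is turned into a list of coefficients, by
  -- `toPolynomial`.
  data Bound : Set where
    con : ℕ → Bound
    arg : Bound
    _⊕_ _⊗_ _∘ᵇ_ : Bound → Bound → Bound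

  ⟪_⟫ : Bound → ℕ → ℕ
  ⟪ con a ⟫ n = a
  ⟪ arg ⟫     n = n
  ⟪ p ⊕ q ⟫ n = ⟪ p ⟫ n + ⟪ q ⟫ n
  ⟪ p ⊗ q ⟫ n = ⟪ p ⟫ n * ⟪ q ⟫ n
  ⟪ p ∘ᵇ q ⟫ n = ⟪ p ⟫ (⟪ q ⟫ n)

  ⟪⟫-mono : ∀ p {m n} → m ≤ n → ⟪ p ⟫ m ≤ ⟪ p ⟫ n
  ⟪⟫-mono (con a) h = ≤-refl
  ⟪⟫-mono arg       h = h
  ⟪⟫-mono (p ⊕ q) h = +-mono-≤ (⟪⟫-mono p h) (⟪⟫-mono q h)
  ⟪⟫-mono (p ⊗ q) h = *-mono-≤ (⟪⟫-mono p h) (⟪⟫-mono q h)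
  ⟪⟫-mono (p ∘ᵇ q) h = ⟪⟫-mono p (⟪⟫-mono q h)

  private
    addP : Polynomial → Polynomial → Polynomial
    addP []       q        = q
    addP (a ∷ p) []        = a ∷ p
    addP (a ∷ p) (b ∷ q)   = a + b ∷ addP p q

    addP-eval : ∀ p q n → eval (addP p q) n ≡ eval p n + eval q n
    addP-eval []      q       n = refl
    addP-eval (a ∷ p) []      n = sym (+-identityʳ _)
    addP-eval (a ∷ p) (b ∷ q) n = trans (cong (λ v → a + b + n * v) (addP-eval p q n))
      (solve 5 (λ a b n x y → a :+ b :+ n :* (x :+ y) := (a :+ n :* x) :+ (b :+ n :* y))
         refl a b n (eval p n) (eval q n))

    scaleP : ℕ → Polynomial → Polynomial
    scaleP c = List.map (c *_)

    scaleP-eval : ∀ c p n → eval (scaleP c p) n ≡ c * eval p n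
    scaleP-eval c []      n = sym (*-zeroʳ c)
    scaleP-eval c (a ∷ p) n = trans (cong (λ v → c * a + n * v) (scaleP-eval c p n))
      (solve 4 (λ a c n x → c :* a :+ n :* (c :* x) := c :* (a :+ n :* x)) refl a c n (eval p n))

    mulP : Polynomial → Polynomial → Polynomial
    mulP []      q = []
    mulP (a ∷ p) q = addP (scaleP a q) (0 ∷ mulP p q)

    mulP-eval : ∀ p q n → eval (mulP p q) n ≡ eval p n * eval q n
    mulP-eval []      q n = refl
    mulP-eval (a ∷ p) q n = trans (addP-eval (scaleP a q) (0 ∷ mulP p q) n)
      (trans (cong₂ (λ u v → u + n * v) (scaleP-eval a q n) (mulP-eval p q n))
        (solve 4 (λ a n x y → a :* y :+ n :* (x :* y) := (a :+ n :* x) :* y) refl a n (eval p n) (eval q n)))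

    composeP : Polynomial → Polynomial → Polynomial
    composeP []      q = []
    composeP (a ∷ p) q = addP (a ∷ []) (mulP q (composeP p q))

    composeP-eval : ∀ p q n → eval (composeP p q) n ≡ eval p (eval q n)
    composeP-eval []      q n = refl
    composeP-eval (a ∷ p) q n = trans (addP-eval (a ∷ []) (mulP q (composeP p q)) n)
      (cong₂ _+_ (trans (cong (a +_) (*-zeroʳ n)) (+-identityʳ a))
        (trans (mulP-eval q (composeP p q) n) (cong (eval q n *_) (composeP-eval p q n))))

  toPolynomial : ∀ p → ∃[ q ] (∀ n → eval q n ≡ ⟪ p ⟫ n)
  toPolynomial (con a) = a ∷ [] , λ n → trans (cong (a +_) (*-zeroʳ n)) (+-identityʳ a)
  toPolynomial arg       = 0 ∷ 1 ∷ [] , λ n → trans (cong (λ v → n * (1 + v)) (*-zeroʳ n)) (*-identityʳ n)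
  toPolynomial (p ⊕ q) with p′ , e ← toPolynomial p | q′ , e′ ← toPolynomial q =
    addP p′ q′ , λ n → trans (addP-eval p′ q′ n) (cong₂ _+_ (e n) (e′ n))
  toPolynomial (p ⊗ q) with p′ , e ← toPolynomial p | q′ , e′ ← toPolynomial q =
    mulP p′ q′ , λ n → trans (mulP-eval p′ q′ n) (cong₂ _*_ (e n) (e′ n))
  toPolynomial (p ∘ᵇ q) with p′ , e ← toPolynomial p | q′ , e′ ← toPolynomial q =
    composeP p′ q′ , λ n → trans (composeP-eval p′ q′ n) (trans (e _) (cong ⟪ p ⟫ (e′ n)))

-- Stack programs, their time and space, and the machines that simulate them

module Programs where

  open Bounds

  -- While programs on three bit stacks

  data Reg : Set where
    main aux₁ aux₂ : Reg

  record Store : Set where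
    constructor ⟨_,_,_⟩
    field
      main-of aux₁-of aux₂-of : Word

  get : Reg → Store → Word
  get main ⟨ s , t , u ⟩ = s
  get aux₁ ⟨ s , t , u ⟩ = t
  get aux₂ ⟨ s , t , u ⟩ = u

  put : Reg → Word → Store → Store
  put main v ⟨ s , t , u ⟩ = ⟨ v , t , u ⟩
  put aux₁ v ⟨ s , t , u ⟩ = ⟨ s , v , u ⟩
  put aux₂ v ⟨ s , t , u ⟩ = ⟨ s , t , v ⟩

  size : Store → ℕ
  size ⟨ s , t , u ⟩ = length s + (length t + length u)

  get≤size : ∀ r σ → length (get r σ) ≤ size σ
  get≤size main ⟨ s , t , u ⟩ = m≤m+n _ _
  get≤size aux₁ ⟨ s , t , u ⟩ = ≤-trans (m≤m+n _ _) (m≤n+m _ (length s))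
  get≤size aux₂ ⟨ s , t , u ⟩ = ≤-trans (m≤n+m _ (length t)) (m≤n+m _ (length s))

  size-push : ∀ r b σ → size (put r (b ∷ get r σ) σ) ≡ suc (size σ)
  size-push main b ⟨ s , t , u ⟩ = refl
  size-push aux₁ b ⟨ s , t , u ⟩ = +-suc (length s) _
  size-push aux₂ b ⟨ s , t , u ⟩ = trans (cong (length s +_) (+-suc (length t) _)) (+-suc (length s) _)

  size-pop : ∀ r σ {b v} → get r σ ≡ b ∷ v → suc (size (put r v σ)) ≡ size σ
  size-pop main ⟨ _ , t , u ⟩ refl = refl
  size-pop aux₁ ⟨ s , _ , u ⟩ refl = sym (+-suc (length s) _)
  size-pop aux₂ ⟨ s , t , _ ⟩ refl = sym (trans (cong (length s +_) (+-suc (length t) _)) (+-suc (length s) _))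

  infixr 5 _⨟_

  -- branch pops; while pops before every round, ends on an empty stack, and
  -- also on a popped false if its flag is set.
  data Prog : Set where
    skip   : Prog
    push   : Reg → Bool → Prog
    _⨟_    : Prog → Prog → Prog
    branch : Reg → (onEmpty onFalse onTrue : Prog) → Prog
    while  : Reg → (stop : Bool) → (onFalse onTrue : Prog) → Prog

  -- Run π σ σ′ k: from σ, π ends in σ′ within k machine steps.
  data Run : Prog → Store → Store → ℕ → Set where
    skip    : ∀ {σ} → Run skip σ σ 1
    push    : ∀ {r b σ} → Run (push r b) σ (put r (b ∷ get r σ) σ) 2
    _⨟_     : ∀ {π ρ σ σ₁ σ₂ m n} → Run π σ σ₁ m → Run ρ σ₁ σ₂ n → Run (π ⨟ ρ) σ σ₂ (m + n)
    branch₋ : ∀ {r π₋ π₀ π₁ σ σ′ k} → get r σ ≡ [] → Run π₋ σ σ′ k → Run (branch r π₋ π₀ π₁) σ σ′ (suc k)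
    branch₀ : ∀ {r π₋ π₀ π₁ σ σ′ k v} → get r σ ≡ false ∷ v → Run π₀ (put r v σ) σ′ k →
              Run (branch r π₋ π₀ π₁) σ σ′ (suc k)
    branch₁ : ∀ {r π₋ π₀ π₁ σ σ′ k v} → get r σ ≡ true ∷ v → Run π₁ (put r v σ) σ′ k →
              Run (branch r π₋ π₀ π₁) σ σ′ (suc k)
    while₋  : ∀ {r e π₀ π₁ σ} → get r σ ≡ [] → Run (while r e π₀ π₁) σ σ 1
    while∙  : ∀ {r π₀ π₁ σ v} → get r σ ≡ false ∷ v → Run (while r true π₀ π₁) σ (put r v σ) 1
    while₀  : ∀ {r π₀ π₁ σ σ₁ σ₂ v m n} → get r σ ≡ false ∷ v → Run π₀ (put r v σ) σ₁ m →
              Run (while r false π₀ π₁) σ₁ σ₂ n → Run (while r false π₀ π₁) σ σ₂ (suc (m + n))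
    while₁  : ∀ {r e π₀ π₁ σ σ₁ σ₂ v m n} → get r σ ≡ true ∷ v → Run π₁ (put r v σ) σ₁ m →
              Run (while r e π₀ π₁) σ₁ σ₂ n → Run (while r e π₀ π₁) σ σ₂ (suc (m + n))
    -- Makes the index an upper bound, so that different branches can share one bound.
    slack   : ∀ {π σ σ′ k k′} → k ≤ k′ → Run π σ σ′ k → Run π σ σ′ k′

  -- The stacks never hold more than b bits in total.
  Fits : ∀ {π σ σ′ k} → ℕ → Run π σ σ′ k → Set
  Fits b skip                = ⊤
  Fits b (push {σ = σ})      = suc (size σ) ≤ b
  Fits b (x ⨟ y)             = Fits b x × Fits b y
  Fits b (branch₋ _ x)       = Fits b x
  Fits b (branch₀ _ x)       = Fits b x
  Fits b (branch₁ _ x)       = Fits b x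
  Fits b (while₋ _)          = ⊤
  Fits b (while∙ _)          = ⊤
  Fits b (while₀ _ x y)      = Fits b x × Fits b y
  Fits b (while₁ _ x y)      = Fits b x × Fits b y
  Fits b (slack _ x)         = Fits b x

  private
    shuffle : ∀ {a b c m n} → c ≤ b + n → b ≤ a + m → c ≤ a + (m + n)
    shuffle {a} {b} {c} {m} {n} h h′ = ≤-trans h (≤-trans (+-monoˡ-≤ n h′) (≤-reflexive (+-assoc a m n)))

    popped : ∀ {s s₁ c k} → suc s₁ ≡ s → c ≤ s₁ + k → c ≤ s + suc k
    popped {s₁ = s₁} {k = k} refl h = ≤-trans h (≤-trans (+-monoʳ-≤ s₁ (n≤1+n k)) (n≤1+n _))

  -- A push takes two steps and adds one bit, and nothing else adds any. Time therefore bounds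
  -- growth.
  run-size : ∀ {π σ σ′ k} → Run π σ σ′ k → size σ′ ≤ size σ + k
  run-size {σ = σ} skip = m≤m+n _ 1
  run-size (push {r} {b} {σ}) = ≤-trans (≤-reflexive (size-push r b σ))
    (≤-trans (≤-reflexive (+-comm 1 (size σ))) (+-monoʳ-≤ (size σ) (s≤s z≤n)))
  run-size {σ = σ} (x ⨟ y) = shuffle {size σ} (run-size y) (run-size x)
  run-size {σ = σ} (branch₋ e x) = ≤-trans (run-size x) (+-monoʳ-≤ (size σ) (n≤1+n _))
  run-size {σ = σ} (branch₀ {r} e x) = popped (size-pop r σ e) (run-size x)
  run-size {σ = σ} (branch₁ {r} e x) = popped (size-pop r σ e) (run-size x)
  run-size (while₋ e) = m≤m+n _ 1
  run-size {σ = σ} (while∙ {r} e) = popped (size-pop r σ e) (m≤m+n _ 0)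
  run-size {σ = σ} (while₀ {r} {v = v} e x y) =
    popped (size-pop r σ e) (shuffle {size (put r v σ)} (run-size y) (run-size x))
  run-size {σ = σ} (while₁ {r} {v = v} e x y) =
    popped (size-pop r σ e) (shuffle {size (put r v σ)} (run-size y) (run-size x))
  run-size {σ = σ} (slack h x) = ≤-trans (run-size x) (+-monoʳ-≤ (size σ) h)

  private
    first : ∀ {a m n b} → a + (m + n) ≤ b → a + m ≤ b
    first {a} {m} {n} h = ≤-trans (+-monoʳ-≤ a (m≤m+n m n)) h

    second : ∀ {a c m n b} → a + (m + n) ≤ b → c ≤ a + m → c + n ≤ b
    second {a} {c} {m} {n} h h′ =
      ≤-trans (+-monoˡ-≤ n h′) (≤-trans (≤-reflexive (+-assoc a m n)) h)

    unpopped : ∀ {s s₁ k b} → suc s₁ ≡ s → s + suc k ≤ b → s₁ + k ≤ b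
    unpopped {s₁ = s₁} {k} refl h =
      ≤-trans (+-monoʳ-≤ s₁ (n≤1+n k)) (≤-trans (n≤1+n _) h)

  -- At any moment the stacks hold at most the initial bits plus one per step made so far, so a time
  -- bound gives a space bound for free. For a loop that runs exponentially often this is too weak,
  -- and `Fits` is then put together round by round.
  fits : ∀ {π σ σ′ k} b (x : Run π σ σ′ k) → size σ + k ≤ b → Fits b x
  fits b skip h = tt
  fits b (push {σ = σ}) h = ≤-trans (≤-reflexive (+-comm 1 (size σ))) (≤-trans (+-monoʳ-≤ (size σ) (s≤s z≤n)) h)
  fits {σ = σ} b (_⨟_ {m = m} x y) h =
    fits b x (first {size σ} h) , fits b y (second {size σ} {m = m} h (run-size x))
  fits {σ = σ} b (branch₋ e x) h = fits b x (≤-trans (+-monoʳ-≤ (size σ) (n≤1+n _)) h)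
  fits {σ = σ} b (branch₀ {r} e x) h = fits b x (unpopped (size-pop r σ e) h)
  fits {σ = σ} b (branch₁ {r} e x) h = fits b x (unpopped (size-pop r σ e) h)
  fits b (while₋ e) h = tt
  fits b (while∙ e) h = tt
  fits {σ = σ} b (while₀ {r} {v = v} {m} e x y) h =
    let h′ = unpopped (size-pop r σ e) h in
    fits b x (first {size (put r v σ)} h′) , fits b y (second {size (put r v σ)} {m = m} h′ (run-size x))
  fits {σ = σ} b (while₁ {r} {v = v} {m} e x y) h =
    let h′ = unpopped (size-pop r σ e) h in
    fits b x (first {size (put r v σ)} h′) , fits b y (second {size (put r v σ)} {m = m} h′ (run-size x))
  fits {σ = σ} b (slack k≤ x) h = fits b x (≤-trans (+-monoʳ-≤ (size σ) k≤) h)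

  -- Compilation to Turing machines

  Cell : Set
  Cell = Symbol ⊥

  Tapes : Set
  Tapes = Vec (Tape ⊥) 3

  Action : Set
  Action = Reg × Cell × Move

  tapeOf : Reg → Tapes → Tape ⊥
  tapeOf main (s ∷ t ∷ u ∷ []) = s
  tapeOf aux₁ (s ∷ t ∷ u ∷ []) = t
  tapeOf aux₂ (s ∷ t ∷ u ∷ []) = u

  look : Reg → Vec Cell 3 → Cell
  look main (s ∷ t ∷ u ∷ []) = s
  look aux₁ (s ∷ t ∷ u ∷ []) = t
  look aux₂ (s ∷ t ∷ u ∷ []) = u

  actions : Action → Vec Cell 3 → Vec (Cell × Move) 3
  actions (main , a) (s ∷ t ∷ u ∷ []) = a ∷ (t , stay) ∷ (u , stay) ∷ []
  actions (aux₁ , a) (s ∷ t ∷ u ∷ []) = (s , stay) ∷ a ∷ (u , stay) ∷ []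
  actions (aux₂ , a) (s ∷ t ∷ u ∷ []) = (s , stay) ∷ (t , stay) ∷ a ∷ []

  St : Prog → Set
  St skip                 = ⊤
  St (push r b)           = Bool
  St (π ⨟ ρ)              = St π ⊎ St ρ
  St (branch r π₋ π₀ π₁)  = ⊤ ⊎ (St π₋ ⊎ (St π₀ ⊎ St π₁))
  St (while r e π₀ π₁)    = ⊤ ⊎ (St π₀ ⊎ St π₁)

  entry : ∀ π → St π
  entry skip                = tt
  entry (push r b)          = false
  entry (π ⨟ ρ)             = inj₁ (entry π)
  entry (branch r π₋ π₀ π₁) = inj₁ tt
  entry (while r e π₀ π₁)   = inj₁ tt

  -- The control of π; nothing stands for its exit.
  ctl : ∀ π → St π → Vec Cell 3 → Maybe (St π) × Action
  ctl skip tt h = nothing , main , look main h , stay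
  ctl (push r b) false h = just true , r , look r h , left
  ctl (push r b) true  h = nothing , r , bit b , stay
  ctl (π ⨟ ρ) (inj₁ q) h = map₁ (just ∘ maybe inj₁ (inj₂ (entry ρ))) (ctl π q h)
  ctl (π ⨟ ρ) (inj₂ q) h = map₁ (Maybe.map inj₂) (ctl ρ q h)
  ctl (branch r π₋ π₀ π₁) (inj₁ tt) h with look r h
  ... | blank     = just (inj₂ (inj₁ (entry π₋))) , r , blank , stay
  ... | bit false = just (inj₂ (inj₂ (inj₁ (entry π₀)))) , r , blank , right
  ... | bit true  = just (inj₂ (inj₂ (inj₂ (entry π₁)))) , r , blank , right
  ctl (branch r π₋ π₀ π₁) (inj₂ (inj₁ q)) h = map₁ (Maybe.map (inj₂ ∘ inj₁)) (ctl π₋ q h)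
  ctl (branch r π₋ π₀ π₁) (inj₂ (inj₂ (inj₁ q))) h = map₁ (Maybe.map (inj₂ ∘ inj₂ ∘ inj₁)) (ctl π₀ q h)
  ctl (branch r π₋ π₀ π₁) (inj₂ (inj₂ (inj₂ q))) h = map₁ (Maybe.map (inj₂ ∘ inj₂ ∘ inj₂)) (ctl π₁ q h)
  ctl (while r e π₀ π₁) (inj₁ tt) h with look r h | e
  ... | blank     | _     = nothing , r , blank , stay
  ... | bit false | true  = nothing , r , blank , right
  ... | bit false | false = just (inj₂ (inj₁ (entry π₀))) , r , blank , right
  ... | bit true  | _     = just (inj₂ (inj₂ (entry π₁))) , r , blank , right
  ctl (while r e π₀ π₁) (inj₂ (inj₁ q)) h = map₁ (just ∘ maybe (inj₂ ∘ inj₁) (inj₁ tt)) (ctl π₀ q h)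
  ctl (while r e π₀ π₁) (inj₂ (inj₂ q)) h = map₁ (just ∘ maybe (inj₂ ∘ inj₂) (inj₁ tt)) (ctl π₁ q h)

  heads : Tapes → Vec Cell 3
  heads = Vec.map Tape.head

  perform : Action → Tapes → Tapes
  perform a ts = Vec.zipWith writeMove ts (actions a (heads ts))

  Small : ℕ → Tapes → Set
  Small b ts = ∀ r → tapeSize (tapeOf r ts) ≤ suc b

  -- Leaving `π` is not a state of `π`, so the final step has a constructor of its own; `chain`
  -- redirects it.
  data Exec (b : ℕ) (π : Prog) : St π → Tapes → ℕ → Tapes → Set where
    last : ∀ {q ts a} → ctl π q (heads ts) ≡ (nothing , a) → Exec b π q ts 1 (perform a ts)
    more : ∀ {q q′ ts a n ts′} → ctl π q (heads ts) ≡ (just q′ , a) → Small b (perform a ts) →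
           Exec b π q′ (perform a ts) n ts′ → Exec b π q ts (suc n) ts′

  into : ∀ {b π ρ q ts n ts′} (f : St π → St ρ) →
         (∀ q h → ctl ρ (f q) h ≡ map₁ (Maybe.map f) (ctl π q h)) →
         Exec b π q ts n ts′ → Exec b ρ (f q) ts n ts′
  into f e (last h)     = last (trans (e _ _) (cong (map₁ (Maybe.map f)) h))
  into f e (more h s x) = more (trans (e _ _) (cong (map₁ (Maybe.map f)) h)) s (into f e x)

  -- The exit of `π` is redirected to `q₁`. Both sequencing and the back edge of a loop arise in
  -- this way.
  chain : ∀ {b π ρ q ts m ts₁ n ts₂} (f : St π → St ρ) (q₁ : St ρ) →
          (∀ q h → ctl ρ (f q) h ≡ map₁ (just ∘ maybe f q₁) (ctl π q h)) →
          Exec b π q ts m ts₁ → Small b ts₁ → Exec b ρ q₁ ts₁ n ts₂ → Exec b ρ (f q) ts (m + n) ts₂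
  chain f q₁ e (last h)     s y = more (trans (e _ _) (cong (map₁ (just ∘ maybe f q₁)) h)) s y
  chain f q₁ e (more h t x) s y = more (trans (e _ _) (cong (map₁ (just ∘ maybe f q₁)) h)) t (chain f q₁ e x s y)

  -- A tape holding a stack whose top is under the head; cells to the left
  -- were popped, and at most one blank follows the bottom.
  trail : Word → Bool → List Cell
  trail []      false = []
  trail []      true  = blank ∷ []
  trail (b ∷ v) e     = bit b ∷ trail v e

  blanks : ℕ → List Cell
  blanks j = replicate j blank

  stackTape : ℕ → Word → Bool → Tape ⊥
  stackTape j []      e = tape (blanks j) blank []
  stackTape j (b ∷ v) e = tape (blanks j) (bit b) (trail v e)

  -- The `j` cells left behind by pops remain part of the visited tape and count towards the bound.
  -- A push takes one of them back before it extends the tape.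
  data Holds (b : ℕ) : Tape ⊥ → Word → Set where
    holds : ∀ {v} j e → j + length v ≤ b → Holds b (stackTape j v e) v

  length-trail : ∀ v e → length (trail v e) ≤ suc (length v)
  length-trail []      false = z≤n
  length-trail []      true  = s≤s z≤n
  length-trail (b ∷ v) e     = s≤s (length-trail v e)

  length-blanks : ∀ j → length (blanks j) ≡ j
  length-blanks zero    = refl
  length-blanks (suc j) = cong suc (length-blanks j)

  stackTape-size : ∀ j v e → tapeSize (stackTape j v e) ≤ suc (j + length v)
  stackTape-size j [] e rewrite length-blanks j | +-identityʳ j = ≤-reflexive (+-comm j 1)
  stackTape-size j (b ∷ v) e rewrite length-blanks j =
    ≤-trans (+-monoʳ-≤ j (s≤s (length-trail v e))) (≤-reflexive (+-suc j _))

  holds-size : ∀ {b t v} → Holds b t v → tapeSize t ≤ suc b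
  holds-size (holds {v} j e h) = ≤-trans (stackTape-size j v e) (s≤s h)

  holds-pop : ∀ {b t c v} → Holds b t (c ∷ v) → Tape.head t ≡ bit c × Holds b (writeMove t (blank , right)) v
  holds-pop {b} (holds {c ∷ []}    j false h) = refl , holds (suc j) true (≤-trans (≤-reflexive (sym (+-suc j 0))) h)
  holds-pop {b} (holds {c ∷ []}    j true  h) = refl , holds (suc j) true (≤-trans (≤-reflexive (sym (+-suc j 0))) h)
  holds-pop {b} (holds {c ∷ d ∷ v} j e     h) = refl , holds (suc j) e (≤-trans (≤-reflexive (sym (+-suc j _))) h)

  holds-blank : ∀ {b t} → Holds b t [] → Tape.head t ≡ blank × Holds b (writeMove t (blank , stay)) []
  holds-blank (holds j e h) = refl , holds j e h

  holds-push : ∀ {b t v} c → Holds b t v → suc (length v) ≤ b →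
    let t′ = writeMove t (Tape.head t , left) in
    tapeSize t′ ≤ suc b × Holds b (writeMove t′ (bit c , stay)) (c ∷ v)
  holds-push {b} c (holds {[]} zero e h) k = s≤s k , holds zero true k
  holds-push {b} c (holds {x ∷ v} zero e h) k =
    ≤-trans (stackTape-size 0 (c ∷ x ∷ v) e) (s≤s k) , holds zero e k
  holds-push {b} c (holds {[]} (suc j) e h) k =
    (≤-trans (stackTape-size j (c ∷ []) true) (s≤s h′)) , holds j true h′
    where h′ = ≤-trans (≤-reflexive (+-suc j 0)) h
  holds-push {b} c (holds {x ∷ v} (suc j) e h) k =
    (≤-trans (stackTape-size j (c ∷ x ∷ v) e) (s≤s h′)) , holds j e h′
    where h′ = ≤-trans (≤-reflexive (+-suc j _)) h

  Represents : ℕ → Tapes → Store → Set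
  Represents b ts σ = ∀ r → Holds b (tapeOf r ts) (get r σ)

  represents-put : ∀ {b ts σ v} r a → Represents b ts σ → Holds b (writeMove (tapeOf r ts) a) v →
                   Represents b (perform (r , a) ts) (put r v σ)
  represents-put {ts = _ ∷ _ ∷ _ ∷ []} main a R h main = h
  represents-put {ts = _ ∷ _ ∷ _ ∷ []} main a R h aux₁ = R aux₁
  represents-put {ts = _ ∷ _ ∷ _ ∷ []} main a R h aux₂ = R aux₂
  represents-put {ts = _ ∷ _ ∷ _ ∷ []} aux₁ a R h main = R main
  represents-put {ts = _ ∷ _ ∷ _ ∷ []} aux₁ a R h aux₁ = h
  represents-put {ts = _ ∷ _ ∷ _ ∷ []} aux₁ a R h aux₂ = R aux₂
  represents-put {ts = _ ∷ _ ∷ _ ∷ []} aux₂ a R h main = R main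
  represents-put {ts = _ ∷ _ ∷ _ ∷ []} aux₂ a R h aux₁ = R aux₁
  represents-put {ts = _ ∷ _ ∷ _ ∷ []} aux₂ a R h aux₂ = h

  small-put : ∀ {b ts} r a → Small b ts → tapeSize (writeMove (tapeOf r ts) a) ≤ suc b → Small b (perform (r , a) ts)
  small-put {ts = _ ∷ _ ∷ _ ∷ []} main a R h main = h
  small-put {ts = _ ∷ _ ∷ _ ∷ []} main a R h aux₁ = R aux₁
  small-put {ts = _ ∷ _ ∷ _ ∷ []} main a R h aux₂ = R aux₂
  small-put {ts = _ ∷ _ ∷ _ ∷ []} aux₁ a R h main = R main
  small-put {ts = _ ∷ _ ∷ _ ∷ []} aux₁ a R h aux₁ = h
  small-put {ts = _ ∷ _ ∷ _ ∷ []} aux₁ a R h aux₂ = R aux₂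
  small-put {ts = _ ∷ _ ∷ _ ∷ []} aux₂ a R h main = R main
  small-put {ts = _ ∷ _ ∷ _ ∷ []} aux₂ a R h aux₁ = R aux₁
  small-put {ts = _ ∷ _ ∷ _ ∷ []} aux₂ a R h aux₂ = h

  represents-small : ∀ {b ts σ} → Represents b ts σ → Small b ts
  represents-small R r = holds-size (R r)

  look-heads : ∀ r ts → look r (heads ts) ≡ Tape.head (tapeOf r ts)
  look-heads main (_ ∷ _ ∷ _ ∷ []) = refl
  look-heads aux₁ (_ ∷ _ ∷ _ ∷ []) = refl
  look-heads aux₂ (_ ∷ _ ∷ _ ∷ []) = refl

  represents-put₂ : ∀ {b ts σ v} r a a′ → Represents b ts σ →
                    Holds b (writeMove (writeMove (tapeOf r ts) a) a′) v →
                    Represents b (perform (r , a′) (perform (r , a) ts)) (put r v σ)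
  represents-put₂ {ts = _ ∷ _ ∷ _ ∷ []} main a a′ R h main = h
  represents-put₂ {ts = _ ∷ _ ∷ _ ∷ []} main a a′ R h aux₁ = R aux₁
  represents-put₂ {ts = _ ∷ _ ∷ _ ∷ []} main a a′ R h aux₂ = R aux₂
  represents-put₂ {ts = _ ∷ _ ∷ _ ∷ []} aux₁ a a′ R h main = R main
  represents-put₂ {ts = _ ∷ _ ∷ _ ∷ []} aux₁ a a′ R h aux₁ = h
  represents-put₂ {ts = _ ∷ _ ∷ _ ∷ []} aux₁ a a′ R h aux₂ = R aux₂
  represents-put₂ {ts = _ ∷ _ ∷ _ ∷ []} aux₂ a a′ R h main = R main
  represents-put₂ {ts = _ ∷ _ ∷ _ ∷ []} aux₂ a a′ R h aux₁ = R aux₁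
  represents-put₂ {ts = _ ∷ _ ∷ _ ∷ []} aux₂ a a′ R h aux₂ = h

  represents-same : ∀ {b ts σ} r → Represents b ts σ → Holds b (writeMove (tapeOf r ts) (Tape.head (tapeOf r ts) , stay)) (get r σ)
  represents-same r R = R r

  put-get : ∀ r σ → put r (get r σ) σ ≡ σ
  put-get main _ = refl
  put-get aux₁ _ = refl
  put-get aux₂ _ = refl

  private
    pops : ∀ {b ts σ c v} r → Represents b ts σ → get r σ ≡ c ∷ v →
           look r (heads ts) ≡ bit c × Represents b (perform (r , blank , right) ts) (put r v σ)
    pops {ts = ts} r R e with h , k ← holds-pop (subst (Holds _ (tapeOf r ts)) e (R r)) =
      trans (look-heads r ts) h , represents-put r _ R k

    keeps : ∀ {b ts σ} r → Represents b ts σ → get r σ ≡ [] →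
            look r (heads ts) ≡ blank × Represents b (perform (r , blank , stay) ts) σ
    keeps {b} {ts} {σ} r R e with h , k ← holds-blank (subst (Holds _ (tapeOf r ts)) e (R r)) =
      trans (look-heads r ts) h ,
      subst (Represents _ _) (trans (cong (λ v → put r v σ) (sym e)) (put-get r σ)) (represents-put r (blank , stay) R k)

  Finishes : ℕ → (π : Prog) → Tapes → ℕ → Store → Set
  Finishes b π ts k σ′ =
    ∃₂ λ n ts′ → n ≤ k × Exec b π (entry π) ts n ts′ × Represents b ts′ σ′

  run-finishes : ∀ {b π σ σ′ k ts} (x : Run π σ σ′ k) → Fits b x → Represents b ts σ → Finishes b π ts k σ′
  run-finishes {ts = ts} skip f R =
    1 , _ , ≤-refl , last refl ,
    subst (λ h → Represents _ (perform (main , h , stay) ts) _) (sym (look-heads main ts))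
      (subst (Represents _ _) (put-get main _) (represents-put main _ R (represents-same main R)))
  run-finishes {b} {ts = ts} (push {r} {c} {σ}) f R
    with small , h ← subst (λ x → tapeSize (writeMove (tapeOf r ts) (x , left)) ≤ suc b ×
                                  Holds b (writeMove (writeMove (tapeOf r ts) (x , left)) (bit c , stay)) (c ∷ get r σ))
                       (sym (look-heads r ts)) (holds-push c (R r) (≤-trans (s≤s (get≤size r σ)) f)) =
    2 , _ , ≤-refl , more refl (small-put r _ (represents-small R) small) (last refl) ,
    represents-put₂ r _ _ R h
  run-finishes (x ⨟ y) (f , g) R
    with m , ts₁ , m≤ , X , R₁ ← run-finishes x f R
    with n , ts₂ , n≤ , Y , R₂ ← run-finishes y g R₁ =
    m + n , ts₂ , +-mono-≤ m≤ n≤ ,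
    chain inj₁ _ (λ _ _ → refl) X (represents-small R₁) (into inj₂ (λ _ _ → refl) Y) , R₂
  run-finishes {π = π@(branch r π₋ π₀ π₁)} {ts = ts} (branch₋ e x) f R
    with l , R₀ ← keeps r R e
    with m , ts₁ , m≤ , X , R₁ ← run-finishes x f R₀ =
    suc m , ts₁ , s≤s m≤ , more at (represents-small R₀) (into (inj₂ ∘ inj₁) (λ _ _ → refl) X) , R₁
    where
    at : ctl π (inj₁ tt) (heads ts) ≡ (just (inj₂ (inj₁ (entry π₋))) , r , blank , stay)
    at rewrite l = refl
  run-finishes {π = π@(branch r π₋ π₀ π₁)} {ts = ts} (branch₀ e x) f R
    with l , R₀ ← pops r R e
    with m , ts₁ , m≤ , X , R₁ ← run-finishes x f R₀ =
    suc m , ts₁ , s≤s m≤ , more at (represents-small R₀) (into (inj₂ ∘ inj₂ ∘ inj₁) (λ _ _ → refl) X) , R₁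
    where
    at : ctl π (inj₁ tt) (heads ts) ≡ (just (inj₂ (inj₂ (inj₁ (entry π₀)))) , r , blank , right)
    at rewrite l = refl
  run-finishes {π = π@(branch r π₋ π₀ π₁)} {ts = ts} (branch₁ e x) f R
    with l , R₀ ← pops r R e
    with m , ts₁ , m≤ , X , R₁ ← run-finishes x f R₀ =
    suc m , ts₁ , s≤s m≤ , more at (represents-small R₀) (into (inj₂ ∘ inj₂ ∘ inj₂) (λ _ _ → refl) X) , R₁
    where
    at : ctl π (inj₁ tt) (heads ts) ≡ (just (inj₂ (inj₂ (inj₂ (entry π₁)))) , r , blank , right)
    at rewrite l = refl
  run-finishes {π = π@(while r e′ π₀ π₁)} {ts = ts} (while₋ e) f R
    with l , R₀ ← keeps r R e = 1 , _ , ≤-refl , last at , R₀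
    where
    at : ctl π (inj₁ tt) (heads ts) ≡ (nothing , r , blank , stay)
    at rewrite l = refl
  run-finishes {π = π@(while r true π₀ π₁)} {ts = ts} (while∙ e) f R
    with l , R₀ ← pops r R e = 1 , _ , ≤-refl , last at , R₀
    where
    at : ctl π (inj₁ tt) (heads ts) ≡ (nothing , r , blank , right)
    at rewrite l = refl
  run-finishes {π = π@(while r false π₀ π₁)} {ts = ts} (while₀ e x y) (f , g) R
    with l , R₀ ← pops r R e
    with m , ts₁ , m≤ , X , R₁ ← run-finishes x f R₀
    with n , ts₂ , n≤ , Y , R₂ ← run-finishes y g R₁ =
    suc (m + n) , ts₂ , s≤s (+-mono-≤ m≤ n≤) ,
    more at (represents-small R₀)
      (chain (inj₂ ∘ inj₁) _ (λ _ _ → refl) X (represents-small R₁) Y) , R₂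
    where
    at : ctl π (inj₁ tt) (heads ts) ≡ (just (inj₂ (inj₁ (entry π₀))) , r , blank , right)
    at rewrite l = refl
  run-finishes {π = π@(while r e′ π₀ π₁)} {ts = ts} (while₁ e x y) (f , g) R
    with l , R₀ ← pops r R e
    with m , ts₁ , m≤ , X , R₁ ← run-finishes x f R₀
    with n , ts₂ , n≤ , Y , R₂ ← run-finishes y g R₁ =
    suc (m + n) , ts₂ , s≤s (+-mono-≤ m≤ n≤) ,
    more at (represents-small R₀)
      (chain (inj₂ ∘ inj₂) _ (λ _ _ → refl) X (represents-small R₁) Y) , R₂
    where
    at : ctl π (inj₁ tt) (heads ts) ≡ (just (inj₂ (inj₂ (entry π₁))) , r , blank , right)
    at rewrite l = refl
  run-finishes (slack k≤ x) f R
    with m , ts₁ , m≤ , X , R₁ ← run-finishes x f R = m , ts₁ , ≤-trans m≤ k≤ , X , R₁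

  private
    infixr 2 _⊎ᶠ_
    _⊎ᶠ_ : ∀ {A B : Set} → IsFinite A → IsFinite B → IsFinite (A ⊎ B)
    (m , f) ⊎ᶠ (n , g) = m + n , ↔-trans (f ⊎-↔ g) (↔-sym +↔⊎)

    ⊤ᶠ : IsFinite ⊤
    ⊤ᶠ = 1 , ↔-sym 1↔⊤

    Boolᶠ : IsFinite Bool
    Boolᶠ = 2 , ↔-sym 2↔Bool

  St-finite : ∀ π → IsFinite (St π)
  St-finite skip                = ⊤ᶠ
  St-finite (push r b)          = Boolᶠ
  St-finite (π ⨟ ρ)             = St-finite π ⊎ᶠ St-finite ρ
  St-finite (branch r π₋ π₀ π₁) = ⊤ᶠ ⊎ᶠ St-finite π₋ ⊎ᶠ St-finite π₀ ⊎ᶠ St-finite π₁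
  St-finite (while r e π₀ π₁)   = ⊤ᶠ ⊎ᶠ St-finite π₀ ⊎ᶠ St-finite π₁

  isTrue : Cell → Bool
  isTrue (bit b) = b
  isTrue blank   = false

  -- After π the machine reads its verdict off the first tape.
  machine : Prog → Machine
  machine π = record
    { State       = State
    ; Γ           = ⊥
    ; extraTapes  = 2
    ; stateFinite = St-finite π ⊎ᶠ ⊤ᶠ ⊎ᶠ Boolᶠ
    ; Γ-finite    = 0 , ↔-sym 0↔⊥
    ; start       = inj₁ (entry π)
    ; verdict     = λ { (inj₂ (inj₂ b)) → just b ; _ → nothing }
    ; δ           = δ
    }
    where
    State = St π ⊎ (⊤ ⊎ Bool)

    δ : State → Vec Cell 3 → State × Vec (Cell × Move) 3
    δ (inj₁ q) h = maybe inj₁ (inj₂ (inj₁ tt)) (proj₁ (ctl π q h)) , actions (proj₂ (ctl π q h)) h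
    δ (inj₂ _) h = inj₂ (inj₂ (isTrue (look main h))) , actions (main , look main h , stay) h

  top : Word → Bool
  top []      = false
  top (b ∷ _) = b

  module _ (π : Prog) where

    private
      M = machine π
      open Machine M using (State)

      iter : ℕ → Config M → Config M
      iter n c = fold c (step M) n

      iter-suc : ∀ n c → iter (suc n) c ≡ iter n (step M c)
      iter-suc zero    c = refl
      iter-suc (suc n) c = cong (step M) (iter-suc n c)

      space : Config M → ℕ
      space c = Vec.sum (Vec.map tapeSize (Config.tapes c))

      small-space : ∀ {b ts} q → Small b ts → space (config q ts) ≤ 3 * suc b
      small-space {ts = _ ∷ _ ∷ _ ∷ []} q s =
        +-mono-≤ (s main) (+-mono-≤ (s aux₁) (+-mono-≤ (s aux₂) z≤n))

      exec-iter : ∀ {b q ts n ts′} → Exec b π q ts n ts′ →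
                  iter n (config (inj₁ q) ts) ≡ config (inj₂ (inj₁ tt)) ts′
      exec-iter {q = q} {ts} (last e) rewrite e = refl
      exec-iter {q = q} {ts} {suc n} (more e s x) =
        trans (iter-suc n (config (inj₁ q) ts)) (trans (cong (iter n) at) (exec-iter x))
        where
        at = cong (λ (z : Maybe (St π) × Action) → config (maybe inj₁ (inj₂ (inj₁ tt)) (proj₁ z)) (perform (proj₂ z) ts)) e

      exec-space : ∀ {b q ts n ts′} → Exec b π q ts n ts′ → Small b ts → ∀ {m} → m ≤ n → Small b ts′ →
                   space (iter m (config (inj₁ q) ts)) ≤ 3 * suc b
      exec-space x s {zero} h s′ = small-space (inj₂ (inj₁ tt)) s
      exec-space {q = q} {ts} (last e) s {suc zero} h s′ rewrite e = small-space (inj₂ (inj₁ tt)) s′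
      exec-space (last e) s {suc (suc m)} (s≤s ()) s′
      exec-space {q = q} {ts} (more e s₁ x) s {suc m} (s≤s h) s′
        rewrite iter-suc m (config (inj₁ q) ts) | e = exec-space x s₁ h s′

      final : Tapes → Config M
      final ts = config (inj₂ (inj₂ (isTrue (look main (heads ts)))))
                        (perform (main , look main (heads ts) , stay) ts)

      iter-final : ∀ m ts → iter m (final ts) ≡ final ts
      iter-final zero    ts = refl
      iter-final (suc m) ts rewrite iter-final m ts = refl

      iter-+ : ∀ m n c → iter (m + n) c ≡ iter m (iter n c)
      iter-+ zero    n c = refl
      iter-+ (suc m) n c = cong (step M) (iter-+ m n c)

      trail-false : ∀ w → trail w false ≡ List.map bit w
      trail-false []      = refl
      trail-false (b ∷ w) = cong (bit b ∷_) (trail-false w)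

      inputTape-stack : ∀ w → inputTape w ≡ stackTape 0 w false
      inputTape-stack []      = refl
      inputTape-stack (b ∷ w) = cong (tape [] (bit b)) (sym (trail-false w))

      initially : ∀ {b} w → length w ≤ b →
                  Represents b (inputTape w ∷ blankTape ∷ blankTape ∷ []) ⟨ w , [] , [] ⟩
      initially w h main rewrite inputTape-stack w = holds 0 false h
      initially w h aux₁ = holds 0 true z≤n
      initially w h aux₂ = holds 0 true z≤n

      holds-top : ∀ {b t v} → Holds b t v → isTrue (Tape.head t) ≡ top v
      holds-top (holds {[]}    j e h) = refl
      holds-top (holds {c ∷ v} j e h) = refl

      trail-output : ∀ v e → leadingBits (trail v e) ≡ v
      trail-output []      false = refl
      trail-output []      true  = refl
      trail-output (b ∷ v) e     = cong (b ∷_) (trail-output v e)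

      holds-output : ∀ {b t v} → Holds b t v → outputOf t ≡ v
      holds-output (holds {[]}    j e h) = refl
      holds-output (holds {c ∷ v} j e h) = cong (c ∷_) (trail-output v e)

    record Outcome (w : Word) (σ : Store) (b k : ℕ) : Set where
      field
        halts  : ℕ
        soon   : halts ≤ suc k
        says   : verdictAfter M halts w ≡ just (top (get main σ))
        output : outputAfter M halts w ≡ get main σ
        spaces : ∀ m → spaceAfter M m w ≤ 3 * suc b

    outcome : ∀ {w σ k b} (x : Run π ⟨ w , [] , [] ⟩ σ k) → Fits b x → length w ≤ b → Outcome w σ b k
    outcome {w} {σ} {k} {b} x f h
      with n , ts′ , n≤ , X , R ← run-finishes x f (initially w h) = record
      { halts  = suc n
      ; soon   = s≤s n≤
      ; says   = trans (cong (Machine.verdict M ∘ Config.state) at)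
                   (cong just (trans (cong isTrue (look-heads main ts′)) (holds-top (R main))))
      ; output = trans (cong (outputOf ∘ Vec.head ∘ Config.tapes) at) (holds-output (fin-main ts′ R))
      ; spaces = spaces
      }
      where
      at : after M (suc n) w ≡ final ts′
      at rewrite exec-iter X = refl

      fin-main : ∀ ts → Represents b ts σ → Holds b (Vec.head (Config.tapes (final ts))) (get main σ)
      fin-main (_ ∷ _ ∷ _ ∷ []) R = R main

      fin-small : ∀ ts → Represents b ts σ → space (final ts) ≤ 3 * suc b
      fin-small (_ ∷ _ ∷ _ ∷ []) R = small-space (inj₂ (inj₂ (top []))) (represents-small R)

      d+ : ∀ {m} → suc n ≤ m → ∃ λ d → d + suc n ≡ m
      d+ h = _ , m∸n+n≡m h

      -- Space is demanded at all times, hence three ranges: while `π` runs, at its exit, and after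
      -- the verdict, where the configuration no longer changes.
      spaces : ∀ m → spaceAfter M m w ≤ 3 * suc b
      spaces m with ≤-total m n
      ... | inj₁ m≤n = exec-space X (represents-small (initially w h)) m≤n (represents-small R)
      ... | inj₂ n≤m with m≤n⇒m<n∨m≡n n≤m
      ...   | inj₂ refl = exec-space X (represents-small (initially w h)) ≤-refl (represents-small R)
      ...   | inj₁ n<m with d , refl ← d+ n<m
        rewrite iter-+ d (suc n) (initial M w) | at | iter-final d ts′ = fin-small ts′ R

-- A list language whose programs run in polynomial time

module Terms where

  open Bounds
  open Programs

  -- A first-order language over booleans, pairs and lists

  infixr 6 _⊠_

  data Ty : Set where
    bool : Ty
    _⊠_  : Ty → Ty → Ty
    list : Ty → Ty

  El : Ty → Set
  El bool     = Bool
  El (A ⊠ B)  = El A × El B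
  El (list A) = List (El A)

  elems : ∀ {X : Set} → (X → Word) → List X → Word
  elems f []       = []
  elems f (x ∷ xs) = true ∷ f x ++ elems f xs

  -- The codes delimit themselves: a value on top of the stack can be traversed knowing only its
  -- type, as each list element is announced by `true` and the end by `false`.
  enc : ∀ A → El A → Word
  enc bool     b       = b ∷ []
  enc (A ⊠ B)  (a , b) = enc A a ++ enc B b
  enc (list A) xs      = elems (enc A) xs ++ false ∷ []

  # : ∀ A → El A → ℕ
  # A x = length (enc A x)

  Ctx : Set
  Ctx = List Ty

  Env : Ctx → Set
  Env []      = ⊤
  Env (A ∷ Γ) = El A × Env Γ

  encEnv : ∀ Γ → Env Γ → Word
  encEnv []      _       = []
  encEnv (A ∷ Γ) (a , γ) = enc A a ++ encEnv Γ γ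

  ## : ∀ Γ → Env Γ → ℕ
  ## Γ γ = length (encEnv Γ γ)

  data Var : Ctx → Ty → Set where
    here  : ∀ {Γ A} → Var (A ∷ Γ) A
    there : ∀ {Γ A B} → Var Γ A → Var (B ∷ Γ) A

  lookup : ∀ {Γ A} → Var Γ A → Env Γ → El A
  lookup here      (a , γ) = a
  lookup (there x) (_ , γ) = lookup x γ

  infix 4 _⊆_

  -- Temporaries are pushed above the environment, so a term meets a stack that contains its context
  -- with further entries in between but in the same order. Thinnings describe exactly this.
  data _⊆_ : Ctx → Ctx → Set where
    done : [] ⊆ []
    keep : ∀ {Γ Δ A} → Γ ⊆ Δ → A ∷ Γ ⊆ A ∷ Δ
    skip⊆ : ∀ {Γ Δ A} → Γ ⊆ Δ → Γ ⊆ A ∷ Δ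

  all : ∀ {Γ} → Γ ⊆ Γ
  all {[]}    = done
  all {A ∷ Γ} = keep all

  none : ∀ {Γ} → [] ⊆ Γ
  none {[]}    = done
  none {A ∷ Γ} = skip⊆ none

  thin : ∀ {Γ Δ} → Γ ⊆ Δ → Env Δ → Env Γ
  thin done     _       = tt
  thin (keep ρ) (a , δ) = a , thin ρ δ
  thin (skip⊆ ρ) (_ , δ) = thin ρ δ

  thin-all : ∀ {Γ} (γ : Env Γ) → thin all γ ≡ γ
  thin-all {[]}    γ       = refl
  thin-all {A ∷ Γ} (a , γ) = cong (a ,_) (thin-all γ)

  thin-size : ∀ {Γ Δ} (ρ : Γ ⊆ Δ) δ → ## Γ (thin ρ δ) ≤ ## Δ δ
  thin-size done δ = z≤n
  thin-size (keep {A = A} ρ) (a , δ) rewrite length-++ (enc A a) {encEnv _ (thin ρ δ)} | length-++ (enc A a) {encEnv _ δ} =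
    +-monoʳ-≤ (# A a) (thin-size ρ δ)
  thin-size (skip⊆ {A = A} ρ) (a , δ) rewrite length-++ (enc A a) {encEnv _ δ} =
    ≤-trans (thin-size ρ δ) (m≤n+m _ (# A a))

  rename : ∀ {Γ Δ A} → Γ ⊆ Δ → Var Γ A → Var Δ A
  rename (keep ρ) here      = here
  rename (keep ρ) (there x) = there (rename ρ x)
  rename (skip⊆ ρ) x         = there (rename ρ x)

  lookup-rename : ∀ {Γ Δ A} (ρ : Γ ⊆ Δ) (x : Var Γ A) δ → lookup (rename ρ x) δ ≡ lookup x (thin ρ δ)
  lookup-rename (keep ρ) here      δ       = refl
  lookup-rename (keep ρ) (there x) (_ , δ) = lookup-rename ρ x δ
  lookup-rename (skip⊆ ρ) x         (_ , δ) = lookup-rename ρ x δ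

  infixr 5 _⊆∘_
  _⊆∘_ : ∀ {Γ Δ Θ} → Γ ⊆ Δ → Δ ⊆ Θ → Γ ⊆ Θ
  ρ      ⊆∘ done   = ρ
  keep ρ ⊆∘ keep τ = keep (ρ ⊆∘ τ)
  skip⊆ ρ ⊆∘ keep τ = skip⊆ (ρ ⊆∘ τ)
  ρ      ⊆∘ skip⊆ τ = skip⊆ (ρ ⊆∘ τ)

  thin-∘ : ∀ {Γ Δ Θ} (ρ : Γ ⊆ Δ) (τ : Δ ⊆ Θ) θ → thin (ρ ⊆∘ τ) θ ≡ thin ρ (thin τ θ)
  thin-∘ done     done     θ       = refl
  thin-∘ (keep ρ) (keep τ) (a , θ) = cong (a ,_) (thin-∘ ρ τ θ)
  thin-∘ (skip⊆ ρ) (keep τ) (a , θ) = thin-∘ ρ τ θ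
  thin-∘ done     (skip⊆ τ) (a , θ) = thin-∘ done τ θ
  thin-∘ (keep ρ) (skip⊆ τ) (a , θ) = thin-∘ (keep ρ) τ θ
  thin-∘ (skip⊆ ρ) (skip⊆ τ) (a , θ) = thin-∘ (skip⊆ ρ) τ θ

  -- The step sees an element, the elements after it and the state; it yields
  -- a new state and a chunk, which is put in front of the output.
  iterate : ∀ {A F O : Set} → (A → List A → F → F × List O) → F → List O → List A → F × List O
  iterate s f o []      = f , o
  iterate s f o (a ∷ l) = iterate s (proj₁ (s a l f)) (proj₂ (s a l f) ++ o) l

  data Tm : Ctx → Ty → Set
  ⟦_⟧ : ∀ {Γ A} → Tm Γ A → Env Γ → El A

  -- State growth per round that does not depend on the state, so that
  -- iteration stays polynomial.
  Growth : ∀ {Γ A F O} → Tm (A ∷ list A ∷ F ∷ Γ) (F ⊠ list O) → Set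
  Growth {Γ} {A} {F} b = Σ[ g ∈ Bound ] (∀ a l f γ →
    # F (proj₁ (⟦ b ⟧ (a , l , f , γ))) ≤ # F f + ⟪ g ⟫ (# A a + (# (list A) l + ## Γ γ)))

  data Tm where
    var   : ∀ {Γ A} → Var Γ A → Tm Γ A
    val   : ∀ {Γ A} → El A → Tm Γ A
    if    : ∀ {Γ A} → Tm Γ bool → Tm Γ A → Tm Γ A → Tm Γ A
    pair  : ∀ {Γ A B} → Tm Γ A → Tm Γ B → Tm Γ (A ⊠ B)
    split : ∀ {Γ A B C} → Tm Γ (A ⊠ B) → Tm (A ∷ B ∷ Γ) C → Tm Γ C
    cons  : ∀ {Γ A} → Tm Γ A → Tm Γ (list A) → Tm Γ (list A)
    app   : ∀ {Γ A} → Tm Γ (list A) → Tm Γ (list A) → Tm Γ (list A)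
    caseL : ∀ {Γ A C} → Tm Γ (list A) → Tm Γ C → Tm (A ∷ list A ∷ Γ) C → Tm Γ C
    let′  : ∀ {Γ A C} → Tm Γ A → Tm (A ∷ Γ) C → Tm Γ C
    wk    : ∀ {Γ Δ A} → Γ ⊆ Δ → Tm Γ A → Tm Δ A
    loop  : ∀ {Γ A F O} (b : Tm (A ∷ list A ∷ F ∷ Γ) (F ⊠ list O)) → Growth b →
            Tm Γ F → Tm Γ (list O) → Tm Γ (list A) → Tm Γ (F ⊠ list O)

  caseList : ∀ {X Y : Set} → List X → Y → (X → List X → Y) → Y
  caseList []       n c = n
  caseList (x ∷ xs) n c = c x xs

  ⟦ var x ⟧ γ         = lookup x γ
  ⟦ val v ⟧ γ         = v
  ⟦ if t a b ⟧ γ      = if ⟦ t ⟧ γ then ⟦ a ⟧ γ else ⟦ b ⟧ γ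
  ⟦ pair a b ⟧ γ      = ⟦ a ⟧ γ , ⟦ b ⟧ γ
  ⟦ split t u ⟧ γ     = ⟦ u ⟧ (proj₁ (⟦ t ⟧ γ) , proj₂ (⟦ t ⟧ γ) , γ)
  ⟦ cons h t ⟧ γ      = ⟦ h ⟧ γ ∷ ⟦ t ⟧ γ
  ⟦ app t u ⟧ γ       = ⟦ t ⟧ γ ++ ⟦ u ⟧ γ
  ⟦ caseL t n c ⟧ γ   = caseList (⟦ t ⟧ γ) (⟦ n ⟧ γ) (λ x xs → ⟦ c ⟧ (x , xs , γ))
  ⟦ let′ t u ⟧ γ      = ⟦ u ⟧ (⟦ t ⟧ γ , γ)
  ⟦ wk ρ t ⟧ γ        = ⟦ t ⟧ (thin ρ γ)
  ⟦ loop b g z o t ⟧ γ = iterate (λ a l f → ⟦ b ⟧ (a , l , f , γ)) (⟦ z ⟧ γ) (⟦ o ⟧ γ) (⟦ t ⟧ γ)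

  -- Compilation to programs: the environment is the main stack, and the
  -- value of the term is put on top of it.

  -- Unlike `walk`, `walkElems` consumes the terminator of a list without reporting it to `f`, so
  -- that the elements can be put in front of another list.
  walkElems walk : Ty → (Bool → Prog) → Prog
  walkElems A f   = while main true skip (f true ⨟ walk A f)
  walk bool     f = branch main skip (f false) (f true)
  walk (A ⊠ B)  f = walk A f ⨟ walk B f
  walk (list A) f = while main true skip (f true ⨟ walk A f) ⨟ f false

  pour : Reg → Prog
  pour r = while r false (push main false) (push main true)

  discard : Ty → Prog
  discard A = walk A (λ _ → skip)

  discards : List Ty → Prog
  discards []       = skip
  discards (A ∷ As) = discard A ⨟ discards As

  slide : Ty → List Ty → Prog
  slide C As = walk C (push aux₁) ⨟ discards As ⨟ pour aux₁

  -- Everything down to and including the variable goes to `aux₁`, which restores the environment;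
  -- `aux₂` receives only the variable, whose copy ends up on top.
  pick : ∀ {Γ A} → Var Γ A → Prog
  pick {A ∷ _} here      = walk A (λ b → push aux₁ b ⨟ push aux₂ b) ⨟ pour aux₁ ⨟ pour aux₂
  pick {B ∷ _} (there x) = walk B (push aux₁) ⨟ pick x

  pushAll : Word → Prog
  pushAll []      = skip
  pushAll (b ∷ w) = pushAll w ⨟ push main b

  -- After a round the stack reads new state, chunk, element, rest, old state, output; the next
  -- round expects rest, new state, output. The chunk loses its terminator and so merges with the
  -- output.
  regroup : Ty → Ty → Ty → Prog
  regroup A F O = walk F (push aux₁) ⨟ walkElems O (push aux₁) ⨟ discard A ⨟
                  walk (list A) (push aux₂) ⨟ discard F ⨟ pour aux₁ ⨟ pour aux₂

  compile : ∀ {Γ Δ A} → Tm Γ A → Γ ⊆ Δ → Prog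
  compile (var x) ρ = pick (rename ρ x)
  compile {A = A} (val v) ρ = pushAll (enc A v)
  compile (if t a b) ρ = compile t ρ ⨟ branch main skip (compile b ρ) (compile a ρ)
  -- The right component is computed first, so that the left one comes out on top.
  compile (pair {B = B} a b) ρ = compile b ρ ⨟ compile a (skip⊆ {A = B} ρ)
  compile {A = C} (split {A = A} {B} t u) ρ = compile t ρ ⨟ compile u (keep (keep ρ)) ⨟ slide C (A ∷ B ∷ [])
  compile (cons {A = A} h t) ρ = compile t ρ ⨟ compile h (skip⊆ {A = list A} ρ) ⨟ push main true
  compile (app {A = A} t u) ρ = compile u ρ ⨟ compile t (skip⊆ {A = list A} ρ) ⨟ walkElems A (push aux₁) ⨟ pour aux₁
  compile {A = C} (caseL {A = A} t n c) ρ =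
    compile t ρ ⨟ branch main skip (compile n ρ) (compile c (keep (keep ρ)) ⨟ slide C (A ∷ list A ∷ []))
  compile {A = C} (let′ {A = A} t u) ρ = compile t ρ ⨟ compile u (keep ρ) ⨟ slide C (A ∷ [])
  compile (wk τ t) ρ = compile t (τ ⊆∘ ρ)
  compile (loop {A = A} {F} {O} b g z o t) ρ =
    compile o ρ ⨟ compile z (skip⊆ {A = list O} ρ) ⨟ compile t (skip⊆ {A = F} (skip⊆ {A = list O} ρ)) ⨟
    -- Once `while` has popped the marker of an element, the stack reads element, rest, state,
    -- output, environment: the context of the body with the output skipped.
    while main true skip (compile b (keep (keep (keep (skip⊆ {A = list O} ρ)))) ⨟ regroup A F O)

  record Timed (π : Prog) (σ σ′ : Store) (p : Bound) : Set where
    constructor timed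
    field run : Run π σ σ′ (⟪ p ⟫ (size σ))

  infixr 5 _then_
  -- By `run-size` the second program starts from a store that exceeds the first one by at most the
  -- time already spent, hence the argument `arg ⊕ p`.
  _then_ : ∀ {π ρ σ σ₁ σ₂ p q} → Timed π σ σ₁ p → Timed ρ σ₁ σ₂ q → Timed (π ⨟ ρ) σ σ₂ (p ⊕ q ∘ᵇ (arg ⊕ p))
  _then_ {q = q} (timed x) (timed y) = timed (x ⨟ slack (⟪⟫-mono q (run-size x)) y)

  module _ {π₋ π₀ π₁ : Prog} {s t u : Word} {σ : Store} where

    timed-branch₀ : ∀ {p} → Timed π₀ ⟨ s , t , u ⟩ σ p →
                    Timed (branch main π₋ π₀ π₁) ⟨ false ∷ s , t , u ⟩ σ (con 1 ⊕ p)
    timed-branch₀ {p} (timed x) = timed (slack (s≤s (⟪⟫-mono p (n≤1+n _))) (branch₀ refl x))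

    timed-branch₁ : ∀ {p} → Timed π₁ ⟨ s , t , u ⟩ σ p →
                    Timed (branch main π₋ π₀ π₁) ⟨ true ∷ s , t , u ⟩ σ (con 1 ⊕ p)
    timed-branch₁ {p} (timed x) = timed (slack (s≤s (⟪⟫-mono p (n≤1+n _))) (branch₁ refl x))

  begin-at : ∀ {π σ σ₁ σ₂ p} → σ ≡ σ₁ → Timed π σ σ₂ p → Timed π σ₁ σ₂ p
  begin-at refl x = x

  end-at : ∀ {π σ σ₁ σ₂ p} → σ₁ ≡ σ₂ → Timed π σ σ₁ p → Timed π σ σ₂ p
  end-at refl x = x

  after-push : ∀ {π σ σ′ σ″ k} → σ′ ≡ σ″ → Run π σ σ′ k → Run π σ σ″ k
  after-push refl x = x

  run-from : ∀ {π s s′ t u σ k} → s ≡ s′ → Run π ⟨ s , t , u ⟩ σ k → Run π ⟨ s′ , t , u ⟩ σ k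
  run-from refl x = x

  effect : (Bool → Word → Word) → Word → Word → Word
  effect F w t = foldl (λ t b → F b t) t w

  effect-++ : ∀ F v w t → effect F (v ++ w) t ≡ effect F w (effect F v t)
  effect-++ F v w t = foldl-++ (λ t b → F b t) t v w

  module Walk {f : Bool → Prog} {c : ℕ} (F G : Bool → Word → Word)
              (each : ∀ b {s t u} → Run (f b) ⟨ s , t , u ⟩ ⟨ s , F b t , G b u ⟩ c) where

    run-walk : ∀ A x {s t u} → Run (walk A f) ⟨ enc A x ++ s , t , u ⟩
               ⟨ s , effect F (enc A x) t , effect G (enc A x) u ⟩ (suc c * # A x)
    run-walkElems : ∀ A xs {s t u} → Run (walkElems A f) ⟨ enc (list A) xs ++ s , t , u ⟩
      ⟨ s , effect F (elems (enc A) xs) t , effect G (elems (enc A) xs) u ⟩ (suc c * length (elems (enc A) xs) + 1)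

    run-walk bool false = slack (≤-reflexive (sym (*-identityʳ (suc c)))) (branch₀ refl (each false))
    run-walk bool true  = slack (≤-reflexive (sym (*-identityʳ (suc c)))) (branch₁ refl (each true))
    run-walk (A ⊠ B) (a , b) {s} {t} {u}
      rewrite effect-++ F (enc A a) (enc B b) t | effect-++ G (enc A a) (enc B b) u
            | ++-assoc (enc A a) (enc B b) s | length-++ (enc A a) {enc B b} =
      slack (≤-reflexive (sym (*-distribˡ-+ (suc c) (# A a) (# B b)))) (run-walk A a ⨟ run-walk B b)
    run-walk (list A) xs {s} {t} {u}
      rewrite effect-++ F (elems (enc A) xs) (false ∷ []) t | effect-++ G (elems (enc A) xs) (false ∷ []) u
            | length-++ (elems (enc A) xs) {false ∷ []} =
      slack (≤-reflexive (trans (+-assoc (suc c * L) 1 c)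
              (trans (cong (suc c * L +_) (sym (*-identityʳ (suc c)))) (sym (*-distribˡ-+ (suc c) L 1)))))
        (run-walkElems A xs ⨟ each false)
      where L = length (elems (enc A) xs)
    run-walkElems A [] = slack (m≤n+m 1 (suc c * 0)) (while∙ refl)
    run-walkElems A (x ∷ xs) {s} {t} {u}
      rewrite effect-++ F (enc A x) (elems (enc A) xs) (F true t) | effect-++ G (enc A x) (elems (enc A) xs) (G true u)
            | length-++ (enc A x) {elems (enc A) xs} =
      slack (≤-reflexive (solve 3 (λ c l m → :con 1 :+ ((c :+ (:con 1 :+ c) :* l) :+ ((:con 1 :+ c) :* m :+ :con 1)) :=
                                    (:con 1 :+ c) :* (:con 1 :+ (l :+ m)) :+ :con 1) refl c (# A x) (length (elems (enc A) xs))))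
        (while₁ refl (run-from (sym assoc) (each true ⨟ run-walk A x)) (run-walkElems A xs))
      where
      assoc : ((enc A x ++ elems (enc A) xs) ++ false ∷ []) ++ s ≡ enc A x ++ (enc (list A) xs ++ s)
      assoc = trans (cong (_++ s) (++-assoc (enc A x) _ _)) (++-assoc (enc A x) _ s)

  effect-none : ∀ w t → effect (λ _ t → t) w t ≡ t
  effect-none []      t = refl
  effect-none (b ∷ w) t = effect-none w t

  size-main : ∀ v s t u → length v ≤ size ⟨ v ++ s , t , u ⟩
  size-main v s t u = ≤-trans (m≤m+n (length v) (length s))
    (≤-trans (≤-reflexive (sym (length-++ v))) (m≤m+n _ (length t + length u)))

  perBit : ℕ → Bound
  perBit c = con (suc c) ⊗ arg

  move₁ : ∀ A x {s t u} → Timed (walk A (push aux₁)) ⟨ enc A x ++ s , t , u ⟩ ⟨ s , enc A x ʳ++ t , u ⟩ (perBit 2)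
  move₁ A x {s} {t} {u} = timed (slack (*-monoʳ-≤ 3 (size-main (enc A x) s t u))
    (after-push (cong ⟨ s , enc A x ʳ++ t ,_⟩ (effect-none (enc A x) u))
      (Walk.run-walk _∷_ (λ _ t → t) (λ b → push) A x)))

  move₂ : ∀ A x {s t u} → Timed (walk A (push aux₂)) ⟨ enc A x ++ s , t , u ⟩ ⟨ s , t , enc A x ʳ++ u ⟩ (perBit 2)
  move₂ A x {s} {t} {u} = timed (slack (*-monoʳ-≤ 3 (size-main (enc A x) s t u))
    (after-push (cong ⟨ s ,_, enc A x ʳ++ u ⟩ (effect-none (enc A x) t))
      (Walk.run-walk (λ _ t → t) _∷_ (λ b → push) A x)))

  move₁₂ : ∀ A x {s t u} → Timed (walk A (λ b → push aux₁ b ⨟ push aux₂ b)) ⟨ enc A x ++ s , t , u ⟩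
           ⟨ s , enc A x ʳ++ t , enc A x ʳ++ u ⟩ (perBit 4)
  move₁₂ A x {s} {t} {u} = timed (slack (*-monoʳ-≤ 5 (size-main (enc A x) s t u)) (Walk.run-walk _∷_ _∷_ (λ b → push ⨟ push) A x))

  run-discard : ∀ A x {s t u} → Timed (discard A) ⟨ enc A x ++ s , t , u ⟩ ⟨ s , t , u ⟩ (perBit 1)
  run-discard A x {s} {t} {u} = timed (slack (*-monoʳ-≤ 2 (size-main (enc A x) s t u))
    (after-push (cong₂ ⟨ s ,_,_⟩ (effect-none (enc A x) t) (effect-none (enc A x) u))
      (Walk.run-walk (λ _ t → t) (λ _ t → t) (λ b → skip) A x)))

  moveElems : ∀ A xs {s t u} → Timed (walkElems A (push aux₁)) ⟨ enc (list A) xs ++ s , t , u ⟩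
              ⟨ s , elems (enc A) xs ʳ++ t , u ⟩ (perBit 2 ⊕ con 1)
  moveElems A xs {s} {t} {u} =
    timed (slack (+-monoˡ-≤ 1 (*-monoʳ-≤ 3 (≤-trans (≤-trans (m≤m+n _ 1) (≤-reflexive (sym (length-++ (elems (enc A) xs)))))
                                           (size-main (enc (list A) xs) s t u))))
    (after-push (cong ⟨ s , elems (enc A) xs ʳ++ t ,_⟩ (effect-none (elems (enc A) xs) u))
      (Walk.run-walkElems _∷_ (λ _ t → t) (λ b → push) A xs)))

  run-pour₁ : ∀ t {s u} → Run (pour aux₁) ⟨ s , t , u ⟩ ⟨ t ʳ++ s , [] , u ⟩ (3 * length t + 1)
  run-pour₁ []          = while₋ refl
  run-pour₁ (false ∷ t) = slack (≤-reflexive (cong (_+ 1) (sym (*-suc 3 (length t))))) (while₀ refl push (run-pour₁ t))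
  run-pour₁ (true ∷ t)  = slack (≤-reflexive (cong (_+ 1) (sym (*-suc 3 (length t))))) (while₁ refl push (run-pour₁ t))

  run-pour₂ : ∀ u {s t} → Run (pour aux₂) ⟨ s , t , u ⟩ ⟨ u ʳ++ s , t , [] ⟩ (3 * length u + 1)
  run-pour₂ []          = while₋ refl
  run-pour₂ (false ∷ t) = slack (≤-reflexive (cong (_+ 1) (sym (*-suc 3 (length t))))) (while₀ refl push (run-pour₂ t))
  run-pour₂ (true ∷ t)  = slack (≤-reflexive (cong (_+ 1) (sym (*-suc 3 (length t))))) (while₁ refl push (run-pour₂ t))

  pour₁ : ∀ t {s u} → Timed (pour aux₁) ⟨ s , t , u ⟩ ⟨ t ʳ++ s , [] , u ⟩ (perBit 2 ⊕ con 1)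
  pour₁ t {s} {u} = timed (slack (+-monoˡ-≤ 1 (*-monoʳ-≤ 3 (get≤size aux₁ ⟨ s , t , u ⟩))) (run-pour₁ t))

  pour₂ : ∀ u {s t} → Timed (pour aux₂) ⟨ s , t , u ⟩ ⟨ u ʳ++ s , t , [] ⟩ (perBit 2 ⊕ con 1)
  pour₂ u {s} {t} = timed (slack (+-monoˡ-≤ 1 (*-monoʳ-≤ 3 (get≤size aux₂ ⟨ s , t , u ⟩))) (run-pour₂ u))

  state : Word → Store
  state s = ⟨ s , [] , [] ⟩

  discardsBound : List Ty → Bound
  discardsBound []       = con 1
  discardsBound (A ∷ As) = perBit 1 ⊕ discardsBound As ∘ᵇ (arg ⊕ perBit 1)

  onTop : ∀ As → Env As → Word → Word
  onTop []       x       s = s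
  onTop (A ∷ As) (a , x) s = enc A a ++ onTop As x s

  run-discards : ∀ As (x : Env As) {s t u} → Timed (discards As) ⟨ onTop As x s , t , u ⟩ ⟨ s , t , u ⟩ (discardsBound As)
  run-discards []       x       = timed skip
  run-discards (A ∷ As) (a , x) = run-discard A a then run-discards As x

  slideBound : List Ty → Bound
  slideBound As = perBit 2 ⊕ (discardsBound As ⊕ (perBit 2 ⊕ con 1) ∘ᵇ (arg ⊕ discardsBound As)) ∘ᵇ (arg ⊕ perBit 2)

  run-slide : ∀ C As c (x : Env As) s →
    Timed (slide C As) (state (enc C c ++ onTop As x s)) (state (enc C c ++ s)) (slideBound As)
  run-slide C As c x s = end-at (cong state (ʳ++-ʳ++ (enc C c)))
    (move₁ C c then run-discards As x then pour₁ (enc C c ʳ++ []))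

  pickBound : ∀ {Γ A} → Var Γ A → Bound
  pickBound here      = perBit 4 ⊕ ((perBit 2 ⊕ con 1) ⊕ (perBit 2 ⊕ con 1) ∘ᵇ (arg ⊕ (perBit 2 ⊕ con 1))) ∘ᵇ (arg ⊕ perBit 4)
  pickBound (there x) = perBit 2 ⊕ pickBound x ∘ᵇ (arg ⊕ perBit 2)

  run-pick : ∀ {Γ A} (x : Var Γ A) γ t → Timed (pick x) ⟨ encEnv Γ γ , t , [] ⟩
             (state (enc A (lookup x γ) ++ (t ʳ++ encEnv Γ γ))) (pickBound x)
  run-pick {A ∷ Γ} here (a , γ) t = end-at (cong state eq)
    (move₁₂ A a then pour₁ (enc A a ʳ++ t) then pour₂ (enc A a ʳ++ []))
    where
    eq : (enc A a ʳ++ []) ʳ++ ((enc A a ʳ++ t) ʳ++ encEnv Γ γ) ≡ enc A a ++ (t ʳ++ (enc A a ++ encEnv Γ γ))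
    eq = trans (ʳ++-ʳ++ (enc A a)) (cong (enc A a ++_) (ʳ++-ʳ++ (enc A a)))
  run-pick {B ∷ Γ} {A} (there x) (b , γ) t = end-at (cong (λ v → state (enc A (lookup x γ) ++ v)) (ʳ++-ʳ++ (enc B b)))
    (move₁ B b then run-pick x γ (enc B b ʳ++ t))

  run-pushAll : ∀ w s → Timed (pushAll w) (state s) (state (w ++ s)) (con (2 * length w + 1))
  run-pushAll []      s = timed skip
  run-pushAll (b ∷ w) s with timed x ← run-pushAll w s =
    timed (slack (≤-reflexive (solve 1 (λ l → (:con 2 :* l :+ :con 1) :+ :con 2 := :con 2 :* (:con 1 :+ l) :+ :con 1) refl (length w)))
      (x ⨟ push))

  enc-cons : ∀ A x xs s → true ∷ enc A x ++ (enc (list A) xs ++ s) ≡ enc (list A) (x ∷ xs) ++ s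
  enc-cons A x xs s = cong (true ∷_) (sym
    (trans (cong (_++ s) (++-assoc (enc A x) _ _)) (++-assoc (enc A x) _ s)))

  elems-++ : ∀ A xs {ys} → elems (enc A) (xs ++ ys) ≡ elems (enc A) xs ++ elems (enc A) ys
  elems-++ A []       = refl
  elems-++ A (x ∷ xs) = cong (true ∷_) (trans (cong (enc A x ++_) (elems-++ A xs)) (sym (++-assoc (enc A x) _ _)))

  enc-++ : ∀ A xs ys s → elems (enc A) xs ++ (enc (list A) ys ++ s) ≡ enc (list A) (xs ++ ys) ++ s
  enc-++ A xs ys s = trans (sym (++-assoc (elems (enc A) xs) _ s))
    (cong (_++ s) (trans (sym (++-assoc (elems (enc A) xs) _ _)) (cong (_++ false ∷ []) (sym (elems-++ A xs)))))

  #-++ : ∀ A xs ys → # (list A) (xs ++ ys) ≤ # (list A) xs + # (list A) ys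
  #-++ A xs ys rewrite elems-++ A xs {ys} | ++-assoc (elems (enc A) xs) (elems (enc A) ys) (false ∷ [])
    | length-++ (elems (enc A) xs) {elems (enc A) ys ++ false ∷ []} | length-++ (elems (enc A) xs) {false ∷ []} =
    +-monoˡ-≤ (# (list A) ys) (m≤m+n (length (elems (enc A) xs)) 1)

  #-cons : ∀ A x xs → # (list A) (x ∷ xs) ≡ suc (# A x + # (list A) xs)
  #-cons A x xs = cong suc (trans (cong length (++-assoc (enc A x) (elems (enc A) xs) _)) (length-++ (enc A x)))

  length≤# : ∀ A xs → length xs ≤ # (list A) xs
  length≤# A []       = z≤n
  length≤# A (x ∷ xs) rewrite #-cons A x xs = s≤s (≤-trans (length≤# A xs) (m≤n+m _ (# A x)))

  widenˡ : ∀ {π σ σ′ p} q → Timed π σ σ′ p → Timed π σ σ′ (p ⊕ q)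
  widenˡ q (timed x) = timed (slack (m≤m+n _ _) x)

  widenʳ : ∀ {π σ σ′ p} q → Timed π σ σ′ p → Timed π σ σ′ (q ⊕ p)
  widenʳ q (timed x) = timed (slack (m≤n+m _ (⟪ q ⟫ _)) x)

  Feasible : ∀ {Γ Δ A} → Tm Γ A → Γ ⊆ Δ → Bound → Set
  Feasible {Γ} {Δ} {A} t ρ p = ∀ δ →
    Timed (compile t ρ) (state (encEnv Δ δ)) (state (enc A (⟦ t ⟧ (thin ρ δ)) ++ encEnv Δ δ)) p

  run-regroup : ∀ A F O → ∃[ p ] (∀ f′ ch a l f o s →
    Timed (regroup A F O)
      (state (enc F f′ ++ (enc (list O) ch ++ (enc A a ++ (enc (list A) l ++ (enc F f ++ (enc (list O) o ++ s)))))))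
      (state (enc (list A) l ++ (enc F f′ ++ (enc (list O) (ch ++ o) ++ s)))) p)
  run-regroup A F O = _ , λ f′ ch a l f o s → end-at (cong state (eq f′ ch l o s))
    (move₁ F f′ then moveElems O ch then run-discard A a then move₂ (list A) l then run-discard F f then
     pour₁ (elems (enc O) ch ʳ++ (enc F f′ ʳ++ [])) then pour₂ (enc (list A) l ʳ++ []))
    where
    eq : ∀ f′ ch l o s → (enc (list A) l ʳ++ []) ʳ++ ((elems (enc O) ch ʳ++ (enc F f′ ʳ++ [])) ʳ++ (enc (list O) o ++ s))
         ≡ enc (list A) l ++ (enc F f′ ++ (enc (list O) (ch ++ o) ++ s))
    eq f′ ch l o s = trans (ʳ++-ʳ++ (enc (list A) l)) (cong (enc (list A) l ++_)
      (trans (ʳ++-ʳ++ (elems (enc O) ch)) (trans (ʳ++-ʳ++ (enc F f′)) (cong (enc F f′ ++_) (enc-++ O ch o s)))))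

  -- The value has been written within the time bound, so that bound limits its size too. This
  -- controls what a loop puts out.
  result-size : ∀ {Γ A} (t : Tm Γ A) {p} → Feasible t all p → ∀ γ → # A (⟦ t ⟧ γ) ≤ ⟪ arg ⊕ p ⟫ (## Γ γ)
  result-size {Γ} {A} t {p} h γ with timed x ← h γ rewrite thin-all γ =
    ≤-trans (≤-trans (m≤m+n _ _) (≤-reflexive (sym (length-++ (enc A (⟦ t ⟧ γ))))))
      (≤-trans (m≤m+n _ 0) (≤-trans (run-size x) (≤-reflexive (cong (λ n → n + ⟪ p ⟫ n) (+-identityʳ (## Γ γ))))))

  -- The body is measured twice. Its running time `pb` depends on the whole stack, including the
  -- output so far; if it also bounded the chunks, the output could feed its own growth and become
  -- exponential. Chunks are therefore bounded by `pb′`, obtained for the body in its own context,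
  -- where the output is absent.
  module LoopRun {Γ Δ A F O} (b : Tm (A ∷ list A ∷ F ∷ Γ) (F ⊠ list O)) (G : Growth b) (ρ : Γ ⊆ Δ) {pb pb′ : Bound}
    (hb : Feasible b (keep (keep (keep (skip⊆ {A = list O} ρ)))) pb) (hb′ : Feasible b all pb′) where

    private
      g = proj₁ G
      pr = proj₁ (run-regroup A F O)
      pbody = pb ⊕ pr ∘ᵇ (arg ⊕ pb)
      round-of : Env Δ → El A → List (El A) → El F → El F × List (El O)
      round-of δ a l f = ⟦ b ⟧ (a , l , f , thin ρ δ)

      W : Prog
      W = while main true skip (compile b (keep (keep (keep (skip⊆ {A = list O} ρ)))) ⨟ regroup A F O)

    module _ (δ : Env Δ) (N : ℕ) where
      private
        growth = ⟪ g ⟫ N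
        Fb = N + N * growth
        chunk = ⟪ arg ⊕ pb′ ⟫ (N + Fb)
        Ob = N + N * chunk
        round = suc (⟪ pbody ⟫ (N + Fb + Ob))

      -- The hypotheses on `f` and `o` reserve the growth of all rounds still to come, so that `Fb`
      -- and `Ob` bound state and output throughout, and each round fits into the same `round`
      -- steps.
      rounds : ∀ l f o → # (list A) l + ## Δ δ ≤ N →
        # F f + length l * growth ≤ Fb → # (list O) o + length l * chunk ≤ Ob →
        Run W (state (enc (list A) l ++ (enc F f ++ (enc (list O) o ++ encEnv Δ δ))))
          (state (enc F (proj₁ (iterate (round-of δ) f o l)) ++ (enc (list O) (proj₂ (iterate (round-of δ) f o l)) ++ encEnv Δ δ)))
          (length l * round + 1)
      rounds [] f o hl hf ho = while∙ refl
      rounds (a ∷ l) f o hl hf ho = from-state (enc-cons A a l _)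
        (slack (≤-reflexive (cong suc (sym (+-assoc (⟪ pbody ⟫ (N + Fb + Ob)) (length l * round) 1))))
          (while₁ refl (slack (⟪⟫-mono pbody small) body) (rounds l f′ (ch ++ o) hl′ hf′ ho′)))
        where
        f′ = proj₁ (round-of δ a l f)
        ch = proj₂ (round-of δ a l f)
        from-state : ∀ {s s′ σ k} → s ≡ s′ → Run W (state s) σ k → Run W (state s′) σ k
        from-state refl x = x
        δ′ : Env (A ∷ list A ∷ F ∷ list O ∷ Δ)
        δ′ = a , l , f , o , δ
        reassoc : (enc F f′ ++ enc (list O) ch) ++ encEnv _ δ′ ≡ enc F f′ ++ (enc (list O) ch ++ encEnv _ δ′)
        reassoc = ++-assoc (enc F f′) _ _
        body : Run _ (state (encEnv _ δ′)) _ (⟪ pbody ⟫ (size (state (encEnv _ δ′))))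
        body = Timed.run (end-at (cong state reassoc) (hb δ′) then proj₂ (run-regroup A F O) f′ ch a l f o (encEnv Δ δ))
        sizes : # A a + # (list A) l + ## Δ δ ≤ N
        sizes = ≤-trans (n≤1+n _) (≤-trans (≤-reflexive (cong (_+ ## Δ δ) (sym (#-cons A a l)))) hl)
        hl′ : # (list A) l + ## Δ δ ≤ N
        hl′ = ≤-trans (+-monoˡ-≤ (## Δ δ) (m≤n+m _ (# A a))) sizes
        f≤ : # F f ≤ Fb
        f≤ = ≤-trans (m≤m+n _ _) hf
        γ-size : # A a + (# (list A) l + ## Γ (thin ρ δ)) ≤ N
        γ-size = ≤-trans (+-monoʳ-≤ (# A a) (+-monoʳ-≤ (# (list A) l) (thin-size ρ δ)))
                   (≤-trans (≤-reflexive (sym (+-assoc (# A a) _ _))) sizes)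
        f′≤ : # F f′ ≤ # F f + growth
        f′≤ = ≤-trans (proj₂ G a l f (thin ρ δ)) (+-monoʳ-≤ (# F f) (⟪⟫-mono g γ-size))
        hf′ : # F f′ + length l * growth ≤ Fb
        hf′ = ≤-trans (+-monoˡ-≤ _ f′≤) (≤-trans (≤-reflexive (+-assoc (# F f) _ _)) hf)
        local : ## (A ∷ list A ∷ F ∷ Γ) (a , l , f , thin ρ δ) ≤ N + Fb
        local rewrite length-++ (enc A a) {encEnv (list A ∷ F ∷ Γ) (l , f , thin ρ δ)}
          | length-++ (enc (list A) l) {encEnv (F ∷ Γ) (f , thin ρ δ)} | length-++ (enc F f) {encEnv Γ (thin ρ δ)} =
          ≤-trans (≤-reflexive (solve 4 (λ a l f x → a :+ (l :+ (f :+ x)) := (a :+ (l :+ x)) :+ f) refl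
                    (# A a) (# (list A) l) (# F f) (## Γ (thin ρ δ))))
            (+-mono-≤ γ-size f≤)
        ch≤ : # (list O) ch ≤ chunk
        ch≤ = ≤-trans (≤-trans (m≤n+m _ (# F f′)) (≤-reflexive (sym (length-++ (enc F f′)))))
                (≤-trans (result-size b hb′ (a , l , f , thin ρ δ)) (⟪⟫-mono (arg ⊕ pb′) local))
        ho′ : # (list O) (ch ++ o) + length l * chunk ≤ Ob
        ho′ = ≤-trans (+-monoˡ-≤ _ (≤-trans (#-++ O ch o) (+-monoˡ-≤ _ ch≤)))
                (≤-trans (≤-reflexive (solve 3 (λ c o x → (c :+ o) :+ x := o :+ (c :+ x)) refl chunk (# (list O) o) (length l * chunk))) ho)
        small : size (state (encEnv _ δ′)) ≤ N + Fb + Ob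
        small rewrite +-identityʳ (length (encEnv _ δ′)) | length-++ (enc A a) {encEnv (list A ∷ F ∷ list O ∷ Δ) (l , f , o , δ)}
          | length-++ (enc (list A) l) {encEnv (F ∷ list O ∷ Δ) (f , o , δ)} | length-++ (enc F f) {encEnv (list O ∷ Δ) (o , δ)}
          | length-++ (enc (list O) o) {encEnv Δ δ} =
          ≤-trans (≤-reflexive (solve 5 (λ a l f o x → a :+ (l :+ (f :+ (o :+ x))) := ((a :+ l :+ x) :+ f) :+ o) refl
                    (# A a) (# (list A) l) (# F f) (# (list O) o) (## Δ δ)))
            (+-mono-≤ (+-mono-≤ sizes f≤) (≤-trans (m≤m+n _ _) ho))

    loopBound : Bound → Bound
    loopBound n = n ⊗ (con 1 ⊕ pbody ∘ᵇ (n ⊕ fb ⊕ (n ⊕ n ⊗ ((arg ⊕ pb′) ∘ᵇ (n ⊕ fb))))) ⊕ con 1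
      where fb = n ⊕ n ⊗ (g ∘ᵇ n)

    run-loop : ∀ δ l f o → Timed W (state (enc (list A) l ++ (enc F f ++ (enc (list O) o ++ encEnv Δ δ))))
      (state (enc F (proj₁ (iterate (round-of δ) f o l)) ++ (enc (list O) (proj₂ (iterate (round-of δ) f o l)) ++ encEnv Δ δ)))
      (loopBound arg)
    run-loop δ l f o = timed (slack (+-monoˡ-≤ 1 (*-monoˡ-≤ _ len≤))
      (rounds δ N l f o hl (+-mono-≤ hf (*-monoˡ-≤ _ len≤)) (+-mono-≤ ho (*-monoˡ-≤ _ len≤))))
      where
      N = size (state (enc (list A) l ++ (enc F f ++ (enc (list O) o ++ encEnv Δ δ))))
      N≡ : N ≡ # (list A) l + (# F f + (# (list O) o + ## Δ δ))
      N≡ = trans (+-identityʳ _) (trans (length-++ (enc (list A) l)) (cong (# (list A) l +_)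
        (trans (length-++ (enc F f)) (cong (# F f +_) (length-++ (enc (list O) o))))))
      hl : # (list A) l + ## Δ δ ≤ N
      hl = ≤-trans (+-monoʳ-≤ (# (list A) l) (≤-trans (m≤n+m _ (# (list O) o)) (m≤n+m _ (# F f)))) (≤-reflexive (sym N≡))
      len≤ : length l ≤ N
      len≤ = ≤-trans (length≤# A l) (≤-trans (m≤m+n _ _) (≤-reflexive (sym N≡)))
      hf : # F f ≤ N
      hf = ≤-trans (≤-trans (m≤m+n _ _) (m≤n+m _ (# (list A) l))) (≤-reflexive (sym N≡))
      ho : # (list O) o ≤ N
      ho = ≤-trans (≤-trans (m≤m+n _ _) (≤-trans (m≤n+m _ (# F f)) (m≤n+m _ (# (list A) l)))) (≤-reflexive (sym N≡))

  feas : ∀ {Γ Δ A} (t : Tm Γ A) (ρ : Γ ⊆ Δ) → ∃ (Feasible t ρ)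
  feas (var x) ρ = _ , λ δ → end-at (cong (λ v → state (enc _ v ++ encEnv _ δ)) (lookup-rename ρ x δ)) (run-pick (rename ρ x) δ [])
  feas {A = A} (val v) ρ = _ , λ δ → run-pushAll (enc A v) (encEnv _ δ)
  feas (if t a b) ρ with _ , x ← feas t ρ | _ , y ← feas a ρ | _ , z ← feas b ρ =
    _ , λ δ → x δ then choose δ (⟦ t ⟧ (thin ρ δ))
    where
    choose : ∀ δ c → Timed _ (state (c ∷ encEnv _ δ)) (state (enc _ (if c then ⟦ a ⟧ (thin ρ δ) else ⟦ b ⟧ (thin ρ δ)) ++ encEnv _ δ)) _
    choose δ true  = widenˡ (con 1 ⊕ proj₁ (feas b ρ)) (timed-branch₁ (proj₂ (feas a ρ) δ))
    choose δ false = widenʳ (con 1 ⊕ proj₁ (feas a ρ)) (timed-branch₀ (proj₂ (feas b ρ) δ))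
  feas (pair {A = A} {B} a b) ρ with _ , x ← feas b ρ | _ , y ← feas a (skip⊆ {A = B} ρ) =
    _ , λ δ → end-at (cong state (sym (++-assoc (enc A (⟦ a ⟧ (thin ρ δ))) _ _))) (x δ then y (⟦ b ⟧ (thin ρ δ) , δ))
  feas (split {A = A} {B} {C} t u) ρ with _ , x ← feas t ρ | _ , y ← feas u (keep (keep ρ)) =
    _ , λ δ → let a , b = ⟦ t ⟧ (thin ρ δ) in
      end-at (cong state (++-assoc (enc A a) _ _)) (x δ) then y (a , b , δ)
      then run-slide C (A ∷ B ∷ []) _ (a , b , tt) (encEnv _ δ)
  feas (cons {A = A} h t) ρ with _ , x ← feas t ρ | _ , y ← feas h (skip⊆ {A = list A} ρ) =
    _ , λ δ → end-at (cong state (enc-cons A _ _ _))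
      (x δ then y (⟦ t ⟧ (thin ρ δ) , δ) then timed {p = con 2} push)
  feas (app {A = A} t u) ρ with _ , x ← feas u ρ | _ , y ← feas t (skip⊆ {A = list A} ρ) =
    _ , λ δ → let ts = ⟦ t ⟧ (thin ρ δ) in
      end-at (cong state (trans (ʳ++-ʳ++ (elems (enc A) ts)) (enc-++ A ts _ _)))
      (x δ then y (⟦ u ⟧ (thin ρ δ) , δ) then moveElems A ts then pour₁ (elems (enc A) ts ʳ++ []))
  feas (caseL {A = A} {C} t n c) ρ with _ , x ← feas t ρ =
    _ , λ δ → x δ then choose δ (⟦ t ⟧ (thin ρ δ))
    where
    choose : ∀ δ ts → Timed _ (state (enc (list A) ts ++ encEnv _ δ))
      (state (enc C (caseList ts (⟦ n ⟧ (thin ρ δ)) (λ x xs → ⟦ c ⟧ (x , xs , thin ρ δ))) ++ encEnv _ δ)) _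
    choose δ []       = widenʳ _ (timed-branch₀ (proj₂ (feas n ρ) δ))
    choose δ (a ∷ as) = begin-at (cong state (enc-cons A a as _)) (widenˡ (con 1 ⊕ proj₁ (feas n ρ))
      (timed-branch₁ (proj₂ (feas c (keep (keep ρ))) (a , as , δ) then run-slide C (A ∷ list A ∷ []) _ (a , as , tt) (encEnv _ δ))))
  feas (let′ {A = A} {C} t u) ρ with _ , x ← feas t ρ | _ , y ← feas u (keep ρ) =
    _ , λ δ → x δ then y (_ , δ) then run-slide C (A ∷ []) _ (_ , tt) (encEnv _ δ)
  feas {A = A} (wk τ t) ρ with p , x ← feas t (τ ⊆∘ ρ) =
    p , λ δ → end-at (cong (λ γ → state (enc A (⟦ t ⟧ γ) ++ encEnv _ δ)) (thin-∘ τ ρ δ)) (x δ)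
  feas {Δ = Δ} (loop {A = A} {F} {O} b g z o t) ρ
    with _ , x ← feas o ρ | _ , y ← feas z (skip⊆ {A = list O} ρ)
       | _ , w ← feas t (skip⊆ {A = F} (skip⊆ {A = list O} ρ))
       | _ , hb ← feas b (keep (keep (keep (skip⊆ {A = list O} ρ)))) | _ , hb′ ← feas b all =
    _ , λ δ → let γ = thin ρ δ in
      end-at (cong state (sym (++-assoc (enc F (proj₁ (⟦ loop b g z o t ⟧ γ))) _ _)))
      (x δ then y (⟦ o ⟧ γ , δ) then w (⟦ z ⟧ γ , ⟦ o ⟧ γ , δ) then
       LoopRun.run-loop b g ρ hb hb′ δ (⟦ t ⟧ γ) (⟦ z ⟧ γ) (⟦ o ⟧ γ))

  opaque
    feasible : ∀ {Γ Δ A} (t : Tm Γ A) (ρ : Γ ⊆ Δ) → ∃ (Feasible t ρ)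
    feasible = feas

-- From terms to machines

module Compilation where

  open Bounds
  open Programs
  open Terms

  -- Terms as polynomial time functions, iterated terms as space bounded deciders

  private
    -- The input stands bare on the tape. `wrap` turns it into the code of a `list bool`, and
    -- `unwrap` turns such a code into a bare output.
    wrap unwrap : Prog
    wrap = while main false (push aux₁ false) (push aux₁ true) ⨟ push main false ⨟
           while aux₁ false (push main false ⨟ push main true) (push main true ⨟ push main true)
    unwrap = while main true skip (branch main skip (push aux₁ false) (push aux₁ true)) ⨟ pour aux₁

    run-drain : ∀ w t → Run (while main false (push aux₁ false) (push aux₁ true)) ⟨ w , t , [] ⟩ ⟨ [] , w ʳ++ t , [] ⟩ (3 * length w + 1)
    run-drain []          t = while₋ refl
    run-drain (false ∷ w) t = slack (≤-reflexive (cong (_+ 1) (sym (*-suc 3 (length w))))) (while₀ refl push (run-drain w _))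
    run-drain (true ∷ w)  t = slack (≤-reflexive (cong (_+ 1) (sym (*-suc 3 (length w))))) (while₁ refl push (run-drain w _))

    run-mark : ∀ t w → Run (while aux₁ false (push main false ⨟ push main true) (push main true ⨟ push main true))
               ⟨ enc (list bool) w , t , [] ⟩ (state (enc (list bool) (t ʳ++ w))) (5 * length t + 1)
    run-mark []          w = while₋ refl
    run-mark (false ∷ t) w = slack (≤-reflexive (cong (_+ 1) (sym (*-suc 5 (length t))))) (while₀ refl (push ⨟ push) (run-mark t _))
    run-mark (true ∷ t)  w = slack (≤-reflexive (cong (_+ 1) (sym (*-suc 5 (length t))))) (while₁ refl (push ⨟ push) (run-mark t _))

    run-unmark : ∀ w t → Run (while main true skip (branch main skip (push aux₁ false) (push aux₁ true)))
                 ⟨ enc (list bool) w , t , [] ⟩ ⟨ [] , w ʳ++ t , [] ⟩ (4 * length w + 1)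
    run-unmark []          t = while∙ refl
    run-unmark (false ∷ w) t = slack (≤-reflexive (cong (_+ 1) (sym (*-suc 4 (length w)))))
      (while₁ refl (branch₀ refl push) (run-unmark w _))
    run-unmark (true ∷ w)  t = slack (≤-reflexive (cong (_+ 1) (sym (*-suc 4 (length w)))))
      (while₁ refl (branch₁ refl push) (run-unmark w _))

    opaque
      run-wrap : ∃[ p ] (∀ w → Timed wrap (state w) (state (encEnv (list bool ∷ []) (w , tt))) p)
      run-wrap = _ , λ w → end-at (cong state (trans (cong (enc (list bool)) (trans (ʳ++-ʳ++ w) (++-identityʳ w))) (sym (++-identityʳ _))))
        (timed {p = perBit 2 ⊕ con 1} (slack (+-monoˡ-≤ 1 (*-monoʳ-≤ 3 (get≤size main (state w)))) (run-drain w []))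
         then timed {p = con 2} push
         then timed {p = perBit 4 ⊕ con 1} (slack (+-monoˡ-≤ 1 (*-monoʳ-≤ 5 (get≤size aux₁ ⟨ enc (list bool) [] , w ʳ++ [] , [] ⟩))) (run-mark (w ʳ++ []) [])))

      run-unwrap : ∃[ p ] (∀ v → Timed unwrap (state (enc (list bool) v ++ [])) (state v) p)
      run-unwrap = _ , λ v → begin-at (cong state (sym (++-identityʳ (enc (list bool) v))))
        (end-at (cong state (trans (ʳ++-ʳ++ v) (++-identityʳ v)))
        (timed {p = perBit 3 ⊕ con 1} (slack (+-monoˡ-≤ 1 (*-monoʳ-≤ 4 (≤-trans (length≤# bool v) (get≤size main (state (enc (list bool) v))))))
           (run-unmark v [])) then pour₁ (v ʳ++ [])))

    size-state : ∀ w → size (state w) ≡ length w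
    size-state w = +-identityʳ (length w)

    opaque
      run-closed : ∀ {A B} (t : Tm (A ∷ []) B) → ∃[ p ] (∀ a →
        Timed (compile t all ⨟ slide B (A ∷ [])) (state (enc A a ++ [])) (state (enc B (⟦ t ⟧ (a , tt)) ++ [])) p)
      run-closed {A} {B} t with _ , x ← feasible t all = _ , λ a →
        end-at (cong (λ b → state (enc B b ++ enc A a ++ [])) refl) (x (a , tt)) then run-slide B (A ∷ []) _ (a , tt) []

  polyTime : (t : Tm (list bool ∷ []) (list bool)) → PolyTime (λ w → ⟦ t ⟧ (w , tt))
  polyTime t = machine π , proj₁ poly , computes
    where
    π : Prog
    π = wrap ⨟ (compile t all ⨟ slide (list bool) (list bool ∷ [])) ⨟ unwrap

    opaque
      whole : ∃[ p ] (∀ w → Timed π (state w) (state (⟦ t ⟧ (w , tt))) p)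
      whole = _ , λ w → proj₂ run-wrap w then proj₂ (run-closed t) w then proj₂ run-unwrap _

    poly = toPolynomial (con 1 ⊕ proj₁ whole)

    computes : ComputesInTime (machine π) (proj₁ poly) (λ w → ⟦ t ⟧ (w , tt))
    computes w = halts , ≤-trans soon (≤-reflexive (trans (cong (λ n → suc (⟪ proj₁ whole ⟫ n)) (size-state w)) (sym (proj₂ poly (length w))))) ,
      (_ , says) , output
      where
      x = Timed.run (proj₂ whole w)
      open Outcome (outcome π x (fits _ x ≤-refl) (≤-trans (get≤size main (state w)) (m≤m+n _ _)))

  -- Ends s n p z: starting from the flagged state p and applying s as long as
  -- the flag is set leads to z, and no state on the way is larger than n.
  data Ends {Y : Ty} (s : El Y → Bool × El Y) (n : ℕ) : Bool × El Y → El Y → Set where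
    ended : ∀ {y} → Ends s n (false , y) y
    again : ∀ {y z} → # Y y ≤ n → Ends {Y} s n (s y) z → Ends s n (true , y) z

  module _ {X : Ty} (init : Tm (list bool ∷ []) (bool ⊠ bool ⊠ X)) (next : Tm (bool ⊠ X ∷ []) (bool ⊠ bool ⊠ X)) where

    private
      Y : Ty
      Y = bool ⊠ X

      once repeat π₀ : Prog
      once = compile next all ⨟ slide (bool ⊠ Y) (Y ∷ [])
      repeat = while main true skip once
      π₀ = wrap ⨟ (compile init all ⨟ slide (bool ⊠ Y) (list bool ∷ []))

      opaque
        run₀ : ∃[ p ] (∀ w → Timed π₀ (state w) (state (enc (bool ⊠ Y) (⟦ init ⟧ (w , tt)) ++ [])) p)
        run₀ = _ , λ w → proj₂ run-wrap w then proj₂ (run-closed init) w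

      pn = proj₁ (run-closed next)

      run-repeat : ∀ {n b p z} → n + ⟪ pn ⟫ n ≤ b → Ends {Y} (λ y → ⟦ next ⟧ (y , tt)) n p z →
        ∃[ k ] Σ[ x ∈ Run repeat (state (enc (bool ⊠ Y) p ++ [])) (state (enc Y z ++ [])) k ] Fits b x
      run-repeat h ended = 1 , while∙ refl , tt
      run-repeat {n} {b} h (again {y} small e) with k , x , f ← run-repeat h e =
        _ , while₁ refl once-run x , fits b once-run enough , f
        where
        once-run : Run once (state (enc Y y ++ [])) (state (enc (bool ⊠ Y) (⟦ next ⟧ (y , tt)) ++ [])) (⟪ pn ⟫ (size (state (enc Y y ++ []))))
        once-run = Timed.run (proj₂ (run-closed next) y)
        size≤ : size (state (enc Y y ++ [])) ≤ n
        size≤ = ≤-trans (≤-reflexive (trans (size-state (enc Y y ++ [])) (cong length (++-identityʳ (enc Y y))))) small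
        enough = ≤-trans (+-mono-≤ size≤ (⟪⟫-mono pn size≤)) h

    -- The number of rounds is not restricted. Every round starts from a store holding nothing but a
    -- state of size at most `q` and adds at most its own running time, so space for the initial
    -- phase and for a single round is enough.
    inPSPACE : ∀ {L : Language} (q : Bound) →
      (∀ w → Σ[ z ∈ El Y ] Ends {Y} (λ y → ⟦ next ⟧ (y , tt)) (⟪ q ⟫ (length w)) (⟦ init ⟧ (w , tt)) z × (proj₁ z ≡ true ⇔ w ∈ L)) →
      InPSPACE L
    inPSPACE {L} q correct = machine (π₀ ⨟ repeat) , proj₁ poly , decides , inSpace
      where
      bound = (arg ⊕ proj₁ run₀) ⊕ (q ⊕ pn ∘ᵇ q)
      poly = toPolynomial (con 3 ⊗ (con 1 ⊕ bound))

      result : ∀ w → ∃[ k ] Outcome (π₀ ⨟ repeat) w (state (enc Y (proj₁ (correct w)) ++ [])) (⟪ bound ⟫ (length w)) k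
      result w with z , e , _ ← correct w
        with k , x , f ← run-repeat {b = ⟪ bound ⟫ (length w)} (m≤n+m _ (⟪ arg ⊕ proj₁ run₀ ⟫ (length w))) e =
        _ , outcome (π₀ ⨟ repeat) (x₀ ⨟ x) (fits _ x₀ enough , f) (≤-trans (m≤m+n (length w) _) (m≤m+n _ (⟪ q ⊕ pn ∘ᵇ q ⟫ (length w))))
        where
        x₀ = Timed.run (proj₂ run₀ w)
        enough : size (state w) + ⟪ proj₁ run₀ ⟫ (size (state w)) ≤ ⟪ bound ⟫ (length w)
        enough = ≤-trans (≤-reflexive (cong (λ n → n + ⟪ proj₁ run₀ ⟫ n) (size-state w))) (m≤m+n _ _)

      decides : Decides (machine (π₀ ⨟ repeat)) L
      decides w = halts , _ , says , proj₂ (proj₂ (correct w))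
        where open Outcome (proj₂ (result w))

      inSpace : RunsInSpace (machine (π₀ ⨟ repeat)) (proj₁ poly)
      inSpace w t = ≤-trans (spaces t) (≤-reflexive (sym (proj₂ poly (length w))))
        where open Outcome (proj₂ (result w))

-- Terms for tables, list traversals and pushdown automata

module ListTerms where

  open Bounds
  open Terms

  pattern v0 = var here
  pattern v1 = var (there here)
  pattern v2 = var (there (there here))
  pattern v3 = var (there (there (there here)))
  pattern v4 = var (there (there (there (there here))))
  pattern v5 = var (there (there (there (there (there here)))))
  pattern v6 = var (there (there (there (there (there (there here))))))

  fst′ : ∀ {Γ A B} → Tm Γ (A ⊠ B) → Tm Γ A
  fst′ t = split t v0

  snd′ : ∀ {Γ A B} → Tm Γ (A ⊠ B) → Tm Γ B
  snd′ t = split t v1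

  call₁ : ∀ {Γ A C} → Tm (A ∷ []) C → Tm Γ A → Tm Γ C
  call₁ f a = let′ a (wk (keep none) f)

  call₂ : ∀ {Γ A B C} → Tm (A ∷ B ∷ []) C → Tm Γ A → Tm Γ B → Tm Γ C
  call₂ f a b = split (pair a b) (wk (keep (keep none)) f)

  call₃ : ∀ {Γ A B C D} → Tm (A ∷ B ∷ C ∷ []) D → Tm Γ A → Tm Γ B → Tm Γ C → Tm Γ D
  call₃ f a b c = split (pair c (pair a b)) (split v1 (let′ v1 (let′ v1 (wk (keep (keep (skip⊆ (skip⊆ (keep (skip⊆ none)))))) f))))

  data Finite : Ty → Set where
    bool : Finite bool
    _⊠_  : ∀ {A B} → Finite A → Finite B → Finite (A ⊠ B)

  cases : ∀ {Γ A B} → Finite A → (El A → Tm Γ B) → Tm Γ A → Tm Γ B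
  cases bool    k t = if t (k true) (k false)
  cases (p ⊠ q) k t = split t (cases p (λ a → cases q (λ b → wk (skip⊆ (skip⊆ all)) (k (a , b))) v1) v0)

  cases-⟦⟧ : ∀ {Γ A B} (p : Finite A) (k : El A → Tm Γ B) t γ → ⟦ cases p k t ⟧ γ ≡ ⟦ k (⟦ t ⟧ γ) ⟧ γ
  cases-⟦⟧ bool k t γ with ⟦ t ⟧ γ
  ... | true  = refl
  ... | false = refl
  cases-⟦⟧ (p ⊠ q) k t γ = trans (cases-⟦⟧ p _ v0 γ′) (trans (cases-⟦⟧ q _ v1 γ′)
    (cong ⟦ k (⟦ t ⟧ γ) ⟧ (thin-all γ)))
    where γ′ = proj₁ (⟦ t ⟧ γ) , proj₂ (⟦ t ⟧ γ) , γ

  -- Every function on a finite type becomes a term, since its graph unfolds into nested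
  -- conditionals.
  table : ∀ {Γ A B} → Finite A → (El A → El B) → Tm Γ A → Tm Γ B
  table p f = cases p (λ a → val (f a))

  table-⟦⟧ : ∀ {Γ A B} (p : Finite A) (f : El A → El B) (t : Tm Γ A) γ → ⟦ table {B = B} p f t ⟧ γ ≡ f (⟦ t ⟧ γ)
  table-⟦⟧ p f = cases-⟦⟧ p (λ a → val (f a))

  greatest : ∀ {A} → Finite A → (f : El A → ℕ) → ∃[ c ] (∀ x → f x ≤ c)
  greatest bool f = f false ⊔ f true , λ { false → m≤m⊔n _ _ ; true → m≤n⊔m (f false) _ }
  greatest (p ⊠ q) f =
    let c , h = greatest p (λ a → proj₁ (greatest q (λ b → f (a , b)))) in
    c , λ (a , b) → ≤-trans (proj₂ (greatest q (λ b → f (a , b))) b) (h a)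

  -- The values of a finite type have bounded size, whatever the step does.
  finite-growth : ∀ {Γ A F O} → Finite F → (b : Tm (A ∷ list A ∷ F ∷ Γ) (F ⊠ list O)) → Growth b
  finite-growth {F = F} p b with c , h ← greatest p (# F) =
    con c , λ a l f γ → ≤-trans (h (proj₁ (⟦ b ⟧ (a , l , f , γ)))) (m≤n+m c _)

  scan : ∀ {Γ A F O} → Finite F → Tm (A ∷ list A ∷ F ∷ Γ) (F ⊠ list O) → Tm Γ F → Tm Γ (list O) → Tm Γ (list A) → Tm Γ (F ⊠ list O)
  scan p b = loop b (finite-growth p b)

  each : ∀ {Γ A O} → Tm (A ∷ list A ∷ bool ∷ Γ) (list O) → Tm Γ (list O) → Tm Γ (list A) → Tm Γ (list O)
  each c o t = snd′ (scan bool (pair (val false) c) (val false) o t)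

  accumulate : ∀ {X O : Set} → (X → List X → List O) → List O → List X → List O
  accumulate c o []      = o
  accumulate c o (a ∷ l) = accumulate c (c a l ++ o) l

  accumulate-iterate : ∀ {X O : Set} (c : X → List X → Bool → List O) (c′ : X → List X → List O) → (∀ a l f → c a l f ≡ c′ a l) →
    ∀ f o l → proj₂ (iterate (λ a l f → false , c a l f) f o l) ≡ accumulate c′ o l
  accumulate-iterate c c′ h f o []      = refl
  accumulate-iterate c c′ h f o (a ∷ l) rewrite h a l f = accumulate-iterate c c′ h false (c′ a l ++ o) l

  revT : ∀ {Γ A} → Tm Γ (list A) → Tm Γ (list A)
  revT t = each (cons v0 (val [])) (val []) t

  iterate-rev : ∀ {X : Set} (o l : List X) → proj₂ (iterate {F = Bool} (λ a _ _ → false , a ∷ []) false o l) ≡ l ʳ++ o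
  iterate-rev o []      = refl
  iterate-rev o (a ∷ l) = iterate-rev (a ∷ o) l

  opaque
    mapT : ∀ {Γ A B} → Tm (A ∷ []) B → Tm Γ (list A) → Tm Γ (list B)
    -- A loop puts each chunk in front of the output and thereby reverses, so the list is reversed
    -- beforehand.
    mapT f t = each (cons (wk (keep none) f) (val [])) (val []) (revT t)

    mapT-⟦⟧ : ∀ {Γ A B} (f : Tm (A ∷ []) B) (t : Tm Γ (list A)) γ → ⟦ mapT f t ⟧ γ ≡ List.map (λ a → ⟦ f ⟧ (a , tt)) (⟦ t ⟧ γ)
    mapT-⟦⟧ {A = A} {B} f t γ rewrite iterate-rev [] (⟦ t ⟧ γ) = trans (go (⟦ t ⟧ γ ʳ++ []) []) (trans (cong (_ʳ++ []) (map-ʳ++ g (⟦ t ⟧ γ)))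
        (trans (ʳ++-ʳ++ (List.map g (⟦ t ⟧ γ))) (++-identityʳ _)))
      where
      g : El A → El B
      g a = ⟦ f ⟧ (a , tt)
      go : ∀ l o → proj₂ (iterate {F = Bool} (λ a _ _ → false , g a ∷ []) false o l) ≡ List.map g l ʳ++ o
      go []      o = refl
      go (a ∷ l) o = go l (g a ∷ o)

  andT orT : ∀ {Γ} → Tm Γ bool → Tm Γ bool → Tm Γ bool
  andT a b = if a b (val false)
  orT a b = if a (val true) b

  notT : ∀ {Γ} → Tm Γ bool → Tm Γ bool
  notT a = if a (val false) (val true)

  allT : ∀ {Γ A} → Tm (A ∷ list A ∷ bool ∷ Γ) bool → Tm Γ (list A) → Tm Γ bool
  allT {A = A} c t = fst′ (scan {O = bool} bool (pair (andT v2 c) (val [])) (val true) (val []) t)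

  every : ∀ {X : Set} → (X → Bool) → List X → Bool
  every c []       = true
  every c (x ∷ xs) = c x && every c xs

  iterate-all : ∀ {X : Set} (c : X → Bool) (step : X → List X → Bool → Bool) l →
    (∀ x l → step x l true ≡ c x) → (∀ x l → step x l false ≡ false) →
    proj₁ (iterate {O = Bool} (λ a l f → step a l f , []) true [] l) ≡ every c l
  iterate-all c step []      h h′ = refl
  iterate-all c step (a ∷ l) h h′ rewrite h a l with c a
  ... | true  = iterate-all c step l h h′
  ... | false = dead l
    where
    dead : ∀ l → proj₁ (iterate {O = Bool} (λ a l f → step a l f , []) false [] l) ≡ false
    dead []      = refl
    dead (a ∷ l) rewrite h′ a l = dead l

  opaque
    dropT : ∀ {A B} → Tm (list A ∷ list B ∷ []) (list B)
    dropT {A} {B} = fst′ (loop {O = bool} (pair (caseL v2 (val []) v1) (val [])) growth v1 (val []) v0)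
      where
      growth : Growth {list A ∷ list B ∷ []} {A} {list B} {bool} (pair (caseL v2 (val []) v1) (val []))
      growth = con 0 , λ { a l [] γ → m≤m+n _ _ ; a l (x ∷ xs) γ → ≤-trans (≤-trans (m≤n+m _ (suc (# B x))) (≤-reflexive (sym (#-cons B x xs)))) (m≤m+n _ _) }

    dropT-⟦⟧ : ∀ {A B} (ks : List (El A)) (xs : List (El B)) → ⟦ dropT {A} {B} ⟧ (ks , xs , tt) ≡ drop (length ks) xs
    dropT-⟦⟧ []       xs       = refl
    dropT-⟦⟧ {A} {B} (k ∷ ks) []       = trans (dropT-⟦⟧ {A} {B} ks []) (drop-[] (length ks))
      where
      drop-[] : ∀ n → drop {A = El B} n [] ≡ []
      drop-[] zero    = refl
      drop-[] (suc n) = refl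
    dropT-⟦⟧ {A} {B} (k ∷ ks) (x ∷ xs) = dropT-⟦⟧ {A} {B} ks xs

  -- A pushdown automaton: f sees a key of the current element and at most two
  -- symbols from the top of the stack, which it replaces.
  module Pushdown {A D S O} (p : Finite D) (q : Finite S) (key : Tm (A ∷ []) D)
                  (f : El D → List (El S) → Bool × List (El S) × List (El O)) where

    onTops : El A → List (El S) → Bool × List (El S) × List (El O)
    onTops a st = f (⟦ key ⟧ (a , tt)) (take 2 st)

    turn : El A → Bool × List (El S) → (Bool × List (El S)) × List (El O)
    turn a (ok , st) = let ok′ , new , ch = onTops a st in (ok && ok′ , new ++ drop 2 st) , ch

    run : Bool × List (El S) → List (El O) → List (El A) → (Bool × List (El S)) × List (El O)
    run = iterate (λ a l f → turn a f)

    Answer : Ty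
    Answer = bool ⊠ list S ⊠ list O

    answer₀ : ∀ {Γ} → Tm (D ∷ Γ) Answer
    answer₀ = table p (λ d → f d []) v0

    answer₁ : ∀ {Γ} → Tm (S ∷ list S ∷ D ∷ Γ) Answer
    answer₁ = table (p ⊠ q) (λ (d , s) → f d (s ∷ [])) (pair v2 v0)

    answer₂ : ∀ {Γ} → Tm (S ∷ list S ∷ S ∷ list S ∷ D ∷ Γ) Answer
    answer₂ = table (p ⊠ q ⊠ q) (λ (d , s , s′) → f d (s ∷ s′ ∷ [])) (pair v4 (pair v2 v0))

    finish : ∀ {Γ} → Tm Γ Answer → Tm Γ (list S) → Tm Γ bool → Tm Γ ((bool ⊠ list S) ⊠ list O)
    finish a rest ok = split a (split v1 (pair (pair (andT (wk (skip⊆ (skip⊆ (skip⊆ (skip⊆ all)))) ok) v2)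
                                                    (app v0 (wk (skip⊆ (skip⊆ (skip⊆ (skip⊆ all)))) rest))) v1))

    finish-⟦⟧ : ∀ {Γ} (a : Tm Γ Answer) rest ok γ → ⟦ finish a rest ok ⟧ γ ≡
      ((⟦ ok ⟧ γ && proj₁ (⟦ a ⟧ γ) , proj₁ (proj₂ (⟦ a ⟧ γ)) ++ ⟦ rest ⟧ γ) , proj₂ (proj₂ (⟦ a ⟧ γ)))
    finish-⟦⟧ a rest ok γ rewrite thin-all γ with ⟦ ok ⟧ γ
    ... | true  = refl
    ... | false = refl

    body : ∀ {Γ} → Tm (A ∷ list A ∷ (bool ⊠ list S) ∷ Γ) ((bool ⊠ list S) ⊠ list O)
    body = split v2 (let′ (wk (skip⊆ (skip⊆ (keep none))) key)
      (caseL v2 (finish answer₀ (val []) v1)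
        (caseL v1 (finish answer₁ (val []) v3)
          (finish answer₂ v1 v5))))

    body-⟦⟧ : ∀ {Γ} a l s γ → ⟦ body {Γ} ⟧ (a , l , s , γ) ≡ turn a s
    body-⟦⟧ a l (ok , []) γ = trans (finish-⟦⟧ answer₀ (val []) v1 _)
      (cong (λ r → (ok && proj₁ r , proj₁ (proj₂ r) ++ []) , proj₂ (proj₂ r)) (table-⟦⟧ p _ v0 _))
    body-⟦⟧ a l (ok , s ∷ []) γ = trans (finish-⟦⟧ answer₁ (val []) v3 _)
      (cong (λ r → (ok && proj₁ r , proj₁ (proj₂ r) ++ []) , proj₂ (proj₂ r)) (table-⟦⟧ (p ⊠ q) _ (pair v2 v0) _))
    body-⟦⟧ a l (ok , s ∷ s′ ∷ st) γ = trans (finish-⟦⟧ answer₂ v1 v5 _)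
      (cong (λ r → (ok && proj₁ r , proj₁ (proj₂ r) ++ st) , proj₂ (proj₂ r)) (table-⟦⟧ (p ⊠ q ⊠ q) _ (pair v4 (pair v2 v0)) _))

    private
      new-size : ∃[ c ] (∀ d st → # (list S) (proj₁ (proj₂ (f d (take 2 st)))) ≤ c)
      new-size =
        let c₀ , h₀ = greatest p (λ d → # (list S) (proj₁ (proj₂ (f d []))))
            c₁ , h₁ = greatest (p ⊠ q) (λ (d , s) → # (list S) (proj₁ (proj₂ (f d (s ∷ [])))))
            c₂ , h₂ = greatest (p ⊠ q ⊠ q) (λ (d , s , s′) → # (list S) (proj₁ (proj₂ (f d (s ∷ s′ ∷ [])))))
        in c₀ + (c₁ + c₂) , λ { d [] → ≤-trans (h₀ d) (m≤m+n _ _)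
                              ; d (s ∷ []) → ≤-trans (h₁ (d , s)) (≤-trans (m≤m+n c₁ c₂) (m≤n+m _ c₀))
                              ; d (s ∷ s′ ∷ st) → ≤-trans (h₂ (d , s , s′)) (≤-trans (m≤n+m c₂ c₁) (m≤n+m _ c₀)) }

      tail-size : ∀ st → # (list S) (drop 2 st) ≤ # (list S) st
      tail-size []            = ≤-refl
      tail-size (s ∷ [])      = s≤s z≤n
      tail-size (s ∷ s′ ∷ st) rewrite #-cons S s (s′ ∷ st) | #-cons S s′ st =
        ≤-trans (≤-trans (m≤n+m _ (suc (# S s′))) (m≤n+m _ (# S s))) (n≤1+n _)

    growth : ∀ {Γ} → Growth (body {Γ})
    growth = con (proj₁ new-size) , λ a l (ok , st) γ → ≤-trans (≤-reflexive (cong (λ r → # (bool ⊠ list S) (proj₁ r)) (body-⟦⟧ a l (ok , st) γ)))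
      (s≤s (≤-trans (#-++ S (proj₁ (proj₂ (onTops a st))) (drop 2 st))
        (≤-trans (+-mono-≤ (proj₂ new-size _ st) (tail-size st)) (≤-reflexive (+-comm (proj₁ new-size) _)))))

    pushdown : ∀ {Γ} → Tm Γ (list S) → Tm Γ (list A) → Tm Γ ((bool ⊠ list S) ⊠ list O)
    pushdown st t = loop body growth (pair (val true) st) (val []) t

    pushdown-⟦⟧ : ∀ {Γ} st (t : Tm Γ (list A)) γ → ⟦ pushdown st t ⟧ γ ≡ run (true , ⟦ st ⟧ γ) [] (⟦ t ⟧ γ)
    pushdown-⟦⟧ st t γ = go (true , ⟦ st ⟧ γ) [] (⟦ t ⟧ γ)
      where
      go : ∀ s o l → iterate (λ a l f → ⟦ body ⟧ (a , l , f , γ)) s o l ≡ run s o l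
      go s o []      = refl
      go s o (a ∷ l) rewrite body-⟦⟧ a l s γ = go _ _ l

-- Binary numerals, and scanning of the input word

module Numerals where

  open Bounds
  open Terms
  open ListTerms

  -- Numerals: digits of the bijective binary notation, least significant first

  Digits : Set
  Digits = List Bool

  digits : ℕᵇ → Digits
  digits zero     = []
  digits 2[1+ b ] = true ∷ digits b
  digits 1+[2 b ] = false ∷ digits b

  digit : Bool → ℕ
  digit false = 0
  digit true  = 1

  double : ℕ → ℕ
  double zero    = zero
  double (suc n) = suc (suc (double n))

  value : Digits → ℕ
  value []       = 0
  value (b ∷ ds) = suc (digit b + double (value ds))

  double≡2* : ∀ n → double n ≡ 2 * n
  double≡2* zero    = refl
  double≡2* (suc n) = trans (cong (λ m → suc (suc m)) (double≡2* n)) (sym (*-suc 2 n))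

  value-digits : ∀ b → value (digits b) ≡ ℕᵇ.toℕ b
  value-digits zero     = refl
  value-digits 2[1+ b ] = trans (cong (λ m → suc (suc (double m))) (value-digits b)) (double≡2* (suc (ℕᵇ.toℕ b)))
  value-digits 1+[2 b ] = cong suc (trans (cong double (value-digits b)) (double≡2* (ℕᵇ.toℕ b)))

  numeral : ℕ → Digits
  numeral k = digits (fromℕ k)

  value-numeral : ∀ k → value (numeral k) ≡ k
  value-numeral k = trans (value-digits (fromℕ k)) (toℕ-fromℕ k)

  digit-double-injective : ∀ b c m n → digit b + double m ≡ digit c + double n → b ≡ c × m ≡ n
  digit-double-injective false false zero    zero    e = refl , refl
  digit-double-injective true  true  zero    zero    e = refl , refl
  digit-double-injective false true  zero    zero    ()
  digit-double-injective true  false zero    zero    ()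
  digit-double-injective false false (suc m) (suc n) e = Prod.map₂ (cong suc) (digit-double-injective false false m n (suc-injective (suc-injective e)))
  digit-double-injective true  true  (suc m) (suc n) e = Prod.map₂ (cong suc) (digit-double-injective true true m n (suc-injective (suc-injective e)))
  digit-double-injective false true  (suc m) (suc n) e = Prod.map₂ (cong suc) (digit-double-injective false true m n (suc-injective (suc-injective e)))
  digit-double-injective true  false (suc m) (suc n) e = Prod.map₂ (cong suc) (digit-double-injective true false m n (suc-injective (suc-injective e)))
  digit-double-injective true  false zero    (suc n) ()
  digit-double-injective false true  (suc zero) zero ()

  -- Bijective notation knows no leading zeros, so agents and atoms can be compared digit by digit.
  value-injective : ∀ ds es → value ds ≡ value es → ds ≡ es
  value-injective []       []       e = refl
  value-injective (b ∷ ds) (c ∷ es) e with refl , h ← digit-double-injective b c _ _ (suc-injective e) =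
    cong (b ∷_) (value-injective ds es h)

  increment : Digits → Digits
  increment []           = false ∷ []
  increment (false ∷ ds) = true ∷ ds
  increment (true ∷ ds)  = false ∷ increment ds

  value-increment : ∀ ds → value (increment ds) ≡ suc (value ds)
  value-increment []           = refl
  value-increment (false ∷ ds) = refl
  value-increment (true ∷ ds)  = cong (λ m → suc (double m)) (value-increment ds)

  numeral-suc : ∀ k → increment (numeral k) ≡ numeral (suc k)
  numeral-suc k = value-injective _ _ (trans (value-increment (numeral k))
    (trans (cong suc (value-numeral k)) (sym (value-numeral (suc k)))))

  opaque
    incrementT : Tm (list bool ∷ []) (list bool)
    incrementT = split (scan bool (pair (andT v2 v0) (cons (if v2 (notT v0) v0) (val []))) (val true) (val []) v0)
      (revT (if v0 (cons (val false) v1) v1))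

    incrementT-⟦⟧ : ∀ ds → ⟦ incrementT ⟧ (ds , tt) ≡ increment ds
    incrementT-⟦⟧ ds = trans (iterate-rev [] (if proj₁ R then false ∷ proj₂ R else proj₂ R)) (carry ds [])
      where
      step′ : Bool → List Bool → Bool → Bool × List Bool
      step′ a l f = (if f then a else false) , (if f then (if a then false else true) else a) ∷ []
      R : Bool × Digits
      R = iterate step′ true [] ds
      finish : Bool × Digits → Digits
      finish (c , o) = (if c then false ∷ o else o) ʳ++ []
      done′ : ∀ ds o → finish (iterate step′ false o ds) ≡ o ʳ++ ds
      done′ []       o = refl
      done′ (d ∷ ds) o = done′ ds (d ∷ o)
      carry : ∀ ds o → finish (iterate step′ true o ds) ≡ o ʳ++ increment ds
      carry []           o = refl
      carry (false ∷ ds) o = done′ ds (true ∷ o)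
      carry (true ∷ ds)  o = carry ds (false ∷ o)

  -- Repeated incrementing is affordable because the second summand is unary: only modal depths and
  -- their sums are added, and these are bounded by the length of the formula.
  add : Digits → List Bool → Digits
  add ds []      = ds
  add ds (_ ∷ l) = add (increment ds) l

  add-numeral : ∀ k l → add (numeral k) l ≡ numeral (length l + k)
  add-numeral k []      = refl
  add-numeral k (_ ∷ l) = trans (cong (λ ds → add ds l) (numeral-suc k))
    (trans (add-numeral (suc k) l) (cong numeral (+-suc (length l) k)))

  #-digits : ∀ ds → # (list bool) (increment ds) ≤ # (list bool) ds + 2
  #-digits []           = s≤s (s≤s (s≤s z≤n))
  #-digits (false ∷ ds) = m≤m+n _ 2
  #-digits (true ∷ ds)  = s≤s (s≤s (#-digits ds))

  opaque
    addT : Tm (list bool ∷ list bool ∷ []) (list bool)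
    addT = fst′ (loop {O = bool} (pair (call₁ incrementT v2) (val [])) growth v0 (val []) v1)
      where
      growth : Growth {list bool ∷ list bool ∷ []} {bool} {list bool} {bool} (pair (call₁ incrementT v2) (val []))
      growth = con 2 , λ a l f γ → ≤-trans (≤-reflexive (cong (# (list bool)) (incrementT-⟦⟧ f))) (#-digits f)

    addT-⟦⟧ : ∀ ds l → ⟦ addT ⟧ (ds , l , tt) ≡ add ds l
    addT-⟦⟧ ds l = go ds l
      where
      go : ∀ f l → proj₁ (iterate {O = Bool} (λ _ _ f → ⟦ incrementT ⟧ (f , tt) , []) f [] l) ≡ add f l
      go f []      = refl
      go f (_ ∷ l) rewrite incrementT-⟦⟧ f = go (increment f) l

  -- s is the verdict on the digits already read.
  compareFrom : Bool → Digits → Digits → Bool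
  compareFrom s []       []       = s
  compareFrom s []       (_ ∷ _)  = false
  compareFrom s (_ ∷ _)  []       = true
  compareFrom s (x ∷ xs) (y ∷ ys) = compareFrom (if x then (if y then s else true) else (if y then false else s)) xs ys

  atLeast : Digits → Digits → Bool
  atLeast = compareFrom true

  private
    halve : ∀ s m n → (double m <ᵇ digit s + double n) ≡ (m <ᵇ digit s + n)
    halve false zero    zero    = refl
    halve true  zero    zero    = refl
    halve false zero    (suc n) = refl
    halve true  zero    (suc n) = refl
    halve false (suc m) zero    = refl
    halve true  (suc m) zero    = sym (no m)
      where
      no : ∀ m → (m <ᵇ 0) ≡ false
      no m = refl
    halve false (suc m) (suc n) = halve false m n
    halve true  (suc m) (suc n) = halve true m n

    halve₊ : ∀ m n → (double m <ᵇ suc (suc (double n))) ≡ (m <ᵇ suc n)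
    halve₊ m n = halve false m (suc n)

    halve₋ : ∀ m n → (suc (double m) <ᵇ double n) ≡ (m <ᵇ n)
    halve₋ m       zero    = refl
    halve₋ zero    (suc n) = refl
    halve₋ (suc m) (suc n) = halve₋ m n

    halve₋₊ : ∀ m n → (suc (double m) <ᵇ suc (double n)) ≡ (m <ᵇ n)
    halve₋₊ m n = halve false m n

  -- The verdict on the lower digits matters only if the rest is equal, so it acts like one unit
  -- added on the left: `true` stands for at least, `false` for greater.
  compareFrom-value : ∀ s xs ys → compareFrom s xs ys ≡ (value ys <ᵇ digit s + value xs)
  compareFrom-value false []       []       = refl
  compareFrom-value true  []       []       = refl
  compareFrom-value false []       (y ∷ ys) = refl
  compareFrom-value true  []       (y ∷ ys) = refl
  compareFrom-value false (x ∷ xs) []       = refl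
  compareFrom-value true  (x ∷ xs) []       = refl
  compareFrom-value s (true ∷ xs) (true ∷ ys) = trans (compareFrom-value s xs ys) (at s)
    where
    at : ∀ s → (value ys <ᵇ digit s + value xs) ≡ (value (true ∷ ys) <ᵇ digit s + value (true ∷ xs))
    at false = sym (halve false (value ys) (value xs))
    at true  = sym (halve true (value ys) (value xs))
  compareFrom-value s (false ∷ xs) (false ∷ ys) = trans (compareFrom-value s xs ys) (at s)
    where
    at : ∀ s → (value ys <ᵇ digit s + value xs) ≡ (value (false ∷ ys) <ᵇ digit s + value (false ∷ xs))
    at false = sym (halve false (value ys) (value xs))
    at true  = sym (halve true (value ys) (value xs))
  compareFrom-value s (true ∷ xs) (false ∷ ys) = trans (compareFrom-value true xs ys) (at s)
    where
    at : ∀ s → (value ys <ᵇ suc (value xs)) ≡ (value (false ∷ ys) <ᵇ digit s + value (true ∷ xs))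
    at false = sym (halve true (value ys) (value xs))
    at true  = sym (halve₊ (value ys) (value xs))
  compareFrom-value s (false ∷ xs) (true ∷ ys) = trans (compareFrom-value false xs ys) (at s)
    where
    at : ∀ s → (value ys <ᵇ value xs) ≡ (value (true ∷ ys) <ᵇ digit s + value (false ∷ xs))
    at false = sym (halve₋ (value ys) (value xs))
    at true  = sym (halve₋₊ (value ys) (value xs))

  atLeast-value : ∀ xs ys → atLeast xs ys ≡ (value ys <ᵇ suc (value xs))
  atLeast-value = compareFrom-value true

  opaque
    atLeastT : Tm (list bool ∷ list bool ∷ []) bool
    atLeastT = split (fst′ (loop {O = bool} body growth (pair v1 (val true)) (val []) v0)) (caseL v0 v1 (val false))
      where
      body : Tm (bool ∷ list bool ∷ (list bool ⊠ bool) ∷ list bool ∷ list bool ∷ []) ((list bool ⊠ bool) ⊠ list bool)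
      body = pair (split v2 (caseL v0 (pair (val []) (val true))
                     (pair v1 (if v4 (if v0 v3 (val true)) (if v0 (val false) v3))))) (val [])
      growth : Growth body
      growth = con 0 , λ { a l ([] , s) γ → s≤s (s≤s z≤n) ; a l (y ∷ ys , s) γ → ≤-trans (≤-trans (≤-reflexive (flat ys _ s)) (m≤n+m _ 2)) (m≤m+n _ 0) }
        where
        flat : ∀ (ys : List Bool) (b c : Bool) → length (enc (list bool) ys ++ b ∷ []) ≡ length (enc (list bool) ys ++ c ∷ [])
        flat ys b c = trans (length-++ (enc (list bool) ys)) (sym (length-++ (enc (list bool) ys)))

    atLeastT-⟦⟧ : ∀ xs ys → ⟦ atLeastT ⟧ (xs , ys , tt) ≡ atLeast xs ys
    atLeastT-⟦⟧ xs ys = go xs ys true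
      where
      step′ : Bool → List Bool → List Bool × Bool → (List Bool × Bool) × List Bool
      step′ a l (ys , s) = caseList ys ([] , true) (λ y ys → ys , (if a then (if y then s else true) else (if y then false else s))) , []
      finish : List Bool × Bool → Bool
      finish (ys , s) = caseList ys s (λ _ _ → false)
      longer : ∀ xs → finish (proj₁ (iterate step′ ([] , true) [] xs)) ≡ true
      longer []       = refl
      longer (x ∷ xs) = longer xs
      go : ∀ xs ys s → finish (proj₁ (iterate step′ (ys , s) [] xs)) ≡ compareFrom s xs ys
      go []       []       s = refl
      go []       (y ∷ ys) s = refl
      go (x ∷ xs) []       s = longer xs
      go (x ∷ xs) (y ∷ ys) s = go xs ys _

  same : Digits → Digits → Bool
  same xs ys = atLeast xs ys && atLeast ys xs

  opaque
    sameT : Tm (list bool ∷ list bool ∷ []) bool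
    sameT = andT (call₂ atLeastT v0 v1) (call₂ atLeastT v1 v0)

    sameT-⟦⟧ : ∀ xs ys → ⟦ sameT ⟧ (xs , ys , tt) ≡ same xs ys
    sameT-⟦⟧ xs ys rewrite atLeastT-⟦⟧ xs ys | atLeastT-⟦⟧ ys xs with atLeast xs ys
    ... | true  = refl
    ... | false = refl

  private
    <ᵇ-suc : ∀ m n → (m <ᵇ suc n) ≡ true → m ≤ n
    <ᵇ-suc zero    n       h = z≤n
    <ᵇ-suc (suc m) (suc n) h = s≤s (<ᵇ-suc m n h)

    suc-<ᵇ : ∀ {m n} → m ≤ n → (m <ᵇ suc n) ≡ true
    suc-<ᵇ z≤n     = refl
    suc-<ᵇ (s≤s h) = suc-<ᵇ h

  atLeast⁻ : ∀ xs ys → atLeast xs ys ≡ true → value ys ≤ value xs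
  atLeast⁻ xs ys h = <ᵇ-suc _ _ (trans (sym (atLeast-value xs ys)) h)

  atLeast⁺ : ∀ xs ys → value ys ≤ value xs → atLeast xs ys ≡ true
  atLeast⁺ xs ys h = trans (atLeast-value xs ys) (suc-<ᵇ h)

  same⁻ : ∀ xs ys → same xs ys ≡ true → xs ≡ ys
  same⁻ xs ys h with atLeast xs ys in e | atLeast ys xs in e′
  same⁻ xs ys h | true | true = value-injective xs ys (≤-antisym (atLeast⁻ ys xs e′) (atLeast⁻ xs ys e))

  same-refl : ∀ xs → same xs xs ≡ true
  same-refl xs rewrite atLeast⁺ xs xs ≤-refl = refl

  -- Formulas with numerals in place of numbers and agents

  data Raw : Set where
    atomR : Digits → Raw
    leafR : Bool → Digits → Digits → Raw
    negR  : Raw → Raw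
    binR  : Bool → Raw → Raw → Raw
    modR  : Bool → Digits → Raw → Raw

  Tag : Set
  Tag = Bool × Bool × Bool

  -- The flag `false` stands for `E`, `∧` and `K`, the flag `true` for `P`, announcements and `K∞`.
  leafTag binTag modTag : Bool → Tag
  leafTag false = false , false , true
  leafTag true  = false , true , false
  binTag  false = true , false , false
  binTag  true  = true , true , true
  modTag  false = true , false , true
  modTag  true  = true , true , false

  tagWord : Tag → Word
  tagWord (a , b , c) = a ∷ b ∷ c ∷ []

  encodeDigits : Digits → Word
  encodeDigits []       = false ∷ []
  encodeDigits (b ∷ ds) = true ∷ b ∷ encodeDigits ds

  encodeR : Raw → Word
  encodeR (atomR x)     = false ∷ false ∷ false ∷ encodeDigits x
  encodeR (leafR k x y) = tagWord (leafTag k) ++ encodeDigits x ++ encodeDigits y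
  encodeR (negR r)      = false ∷ true ∷ true ∷ encodeR r
  encodeR (binR k r s)  = tagWord (binTag k) ++ encodeR r ++ encodeR s
  encodeR (modR k x r)  = tagWord (modTag k) ++ encodeDigits x ++ encodeR r

  -- Pushdown scanner from words to symbols

  Ty₄ : Ty
  Ty₄ = bool ⊠ bool ⊠ bool ⊠ bool

  finite₄ : Finite Ty₄
  finite₄ = bool ⊠ bool ⊠ bool ⊠ bool

  pattern tagS a b c = true , a , b , c
  pattern digitS b   = false , true , b , false
  pattern endS       = false , false , false , false

  -- What the scanner still expects. In `tag₂` and `tag₃` one or two bits of a tag have been read;
  -- `digit₁` is the digit after a continuation bit.
  data Item : Set where
    formula      : Item
    tag₂         : Bool → Item
    tag₃         : Bool → Bool → Item
    number digit₁ : Item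

  code : Item → El Ty₄
  code formula    = false , false , false , false
  code (tag₂ a)   = false , true , a , false
  code (tag₃ a b) = true , false , a , b
  code number     = true , true , false , false
  code digit₁     = true , true , true , false

  item : El Ty₄ → Item
  item (false , false , _)        = formula
  item (false , true , a , _)     = tag₂ a
  item (true , false , a , b)     = tag₃ a b
  item (true , true , false , _)  = number
  item (true , true , true , _)   = digit₁

  operands : Tag → List Item
  operands (false , false , false) = number ∷ []
  operands (false , false , true)  = number ∷ number ∷ []
  operands (false , true , false)  = number ∷ number ∷ []
  operands (false , true , true)   = formula ∷ []
  operands (true , false , false)  = formula ∷ formula ∷ []
  operands (true , false , true)   = number ∷ formula ∷ []
  operands (true , true , false)   = number ∷ formula ∷ []
  operands (true , true , true)    = formula ∷ formula ∷ []

  read : Bool → Item → List Item × List (El Ty₄)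
  read b     formula    = tag₂ b ∷ [] , []
  read b     (tag₂ a)   = tag₃ a b ∷ [] , []
  read c     (tag₃ a b) = operands (a , b , c) , tagS a b c ∷ []
  read false number     = [] , endS ∷ []
  read true  number     = digit₁ ∷ number ∷ [] , []
  read b     digit₁     = [] , digitS b ∷ []

  scanStep : Bool → List (El Ty₄) → Bool × List (El Ty₄) × List (El Ty₄)
  scanStep b []      = false , [] , []
  scanStep b (s ∷ l) = true , List.map code (proj₁ (read b (item s))) ++ l , proj₂ (read b (item s))

  module Scanner = Pushdown {bool} bool finite₄ v0 scanStep

  scanFrom : Bool → List Item → List (El Ty₄) → Word → (Bool × List (El Ty₄)) × List (El Ty₄)
  scanFrom ok is o w = Scanner.run (ok , List.map code is) o w

  item-code : ∀ i → item (code i) ≡ i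
  item-code formula    = refl
  item-code (tag₂ a)   = refl
  item-code (tag₃ a b) = refl
  item-code number     = refl
  item-code digit₁     = refl

  scanFrom-step : ∀ ok i is o b w → scanFrom ok (i ∷ is) o (b ∷ w) ≡
    scanFrom (ok && true) (proj₁ (read b i) ++ is) (proj₂ (read b i) ++ o) w
  scanFrom-step ok i is o b w rewrite item-code i =
    cong (λ st → Scanner.run (ok && true , st) (proj₂ (read b i) ++ o) w)
      (trans (++-assoc new (take 1 st) (drop 1 st)) (trans (cong (new ++_) (take++drop≡id 1 st)) (sym (map-++ code (proj₁ (read b i)) is))))
    where
    st = List.map code is
    new = List.map code (proj₁ (read b i))

  digitSyms : Digits → List (El Ty₄)
  digitSyms []       = endS ∷ []
  digitSyms (b ∷ ds) = digitS b ∷ digitSyms ds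

  tagSym : Tag → El Ty₄
  tagSym (a , b , c) = tagS a b c

  syms : Raw → List (El Ty₄)
  syms (atomR x)     = tagS false false false ∷ digitSyms x
  syms (leafR k x y) = tagSym (leafTag k) ∷ digitSyms x ++ digitSyms y
  syms (negR r)      = tagS false true true ∷ syms r
  syms (binR k r s)  = tagSym (binTag k) ∷ syms r ++ syms s
  syms (modR k x r)  = tagSym (modTag k) ∷ digitSyms x ++ syms r

  scan-digits : ∀ ds is o w → scanFrom true (number ∷ is) o (encodeDigits ds ++ w) ≡ scanFrom true is (digitSyms ds ʳ++ o) w
  scan-digits [] is o w = scanFrom-step true number is o false w
  scan-digits (b ∷ ds) is o w = trans (scanFrom-step true number is o true (b ∷ encodeDigits ds ++ w))
    (trans (scanFrom-step true digit₁ (number ∷ is) o b (encodeDigits ds ++ w)) (scan-digits ds is (digitS b ∷ o) w))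

  scan-tag : ∀ t is o w → scanFrom true (formula ∷ is) o (tagWord t ++ w) ≡ scanFrom true (operands t ++ is) (tagSym t ∷ o) w
  scan-tag (a , b , c) is o w = trans (scanFrom-step true formula is o a (b ∷ c ∷ w))
    (trans (scanFrom-step true (tag₂ a) is o b (c ∷ w)) (scanFrom-step true (tag₃ a b) is o c w))

  scan-raw : ∀ r is o w → scanFrom true (formula ∷ is) o (encodeR r ++ w) ≡ scanFrom true is (syms r ʳ++ o) w
  scan-raw (atomR x) is o w = trans (scan-tag (false , false , false) is o (encodeDigits x ++ w)) (scan-digits x is (tagS false false false ∷ o) w)
  scan-raw (leafR k x y) is o w
    rewrite ++-assoc (encodeDigits x) (encodeDigits y) w | ++-ʳ++ (digitSyms x) {digitSyms y} {tagSym (leafTag k) ∷ o} =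
    trans (scan-tag t is o v) (trans (cong (λ os → scanFrom true (os ++ is) (tagSym t ∷ o) v) (ops k))
      (trans (scan-digits x (number ∷ is) (tagSym t ∷ o) (encodeDigits y ++ w)) (scan-digits y is (digitSyms x ʳ++ (tagSym t ∷ o)) w)))
    where
    t = leafTag k
    v = encodeDigits x ++ encodeDigits y ++ w
    ops : ∀ k → operands (leafTag k) ≡ number ∷ number ∷ []
    ops false = refl
    ops true  = refl
  scan-raw (negR r) is o w = trans (scan-tag (false , true , true) is o (encodeR r ++ w)) (scan-raw r is (tagS false true true ∷ o) w)
  scan-raw (binR k r s) is o w
    rewrite ++-assoc (encodeR r) (encodeR s) w | ++-ʳ++ (syms r) {syms s} {tagSym (binTag k) ∷ o} =
    trans (scan-tag t is o v) (trans (cong (λ os → scanFrom true (os ++ is) (tagSym t ∷ o) v) (ops k))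
      (trans (scan-raw r (formula ∷ is) (tagSym t ∷ o) (encodeR s ++ w)) (scan-raw s is (syms r ʳ++ (tagSym t ∷ o)) w)))
    where
    t = binTag k
    v = encodeR r ++ encodeR s ++ w
    ops : ∀ k → operands (binTag k) ≡ formula ∷ formula ∷ []
    ops false = refl
    ops true  = refl
  scan-raw (modR k x r) is o w
    rewrite ++-assoc (encodeDigits x) (encodeR r) w | ++-ʳ++ (digitSyms x) {syms r} {tagSym (modTag k) ∷ o} =
    trans (scan-tag t is o v) (trans (cong (λ os → scanFrom true (os ++ is) (tagSym t ∷ o) v) (ops k))
      (trans (scan-digits x (formula ∷ is) (tagSym t ∷ o) (encodeR r ++ w)) (scan-raw r is (digitSyms x ʳ++ (tagSym t ∷ o)) w)))
    where
    t = modTag k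
    v = encodeDigits x ++ encodeR r ++ w
    ops : ∀ k → operands (modTag k) ≡ number ∷ formula ∷ []
    ops false = refl
    ops true  = refl

  -- A suffix w can follow the items on the stack.
  Derives : List Item → Word → Set
  Derives []              w = w ≡ []
  Derives (formula ∷ is)  w = Σ[ r ∈ Raw ] Σ[ v ∈ Word ] w ≡ encodeR r ++ v × Derives is v
  Derives (tag₂ a ∷ is)   w = Σ[ r ∈ Raw ] Σ[ v ∈ Word ] a ∷ w ≡ encodeR r ++ v × Derives is v
  Derives (tag₃ a b ∷ is) w = Σ[ r ∈ Raw ] Σ[ v ∈ Word ] a ∷ b ∷ w ≡ encodeR r ++ v × Derives is v
  Derives (number ∷ is)   w = Σ[ ds ∈ Digits ] Σ[ v ∈ Word ] w ≡ encodeDigits ds ++ v × Derives is v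
  Derives (digit₁ ∷ is)   w = Σ[ b ∈ Bool ] Σ[ v ∈ Word ] w ≡ b ∷ v × Derives is v

  Accepting : (Bool × List (El Ty₄)) × List (El Ty₄) → Set
  Accepting ((ok , st) , _) = ok ≡ true × st ≡ []

  derives-tag : ∀ t is w → Derives (operands t ++ is) w → Σ[ r ∈ Raw ] Σ[ v ∈ Word ] tagWord t ++ w ≡ encodeR r ++ v × Derives is v
  derives-tag (false , false , false) is w (ds , v , refl , d) = atomR ds , v , refl , d
  derives-tag (false , false , true) is w (x , _ , refl , y , v , refl , d) =
    leafR false x y , v , cong (tagWord (leafTag false) ++_) (sym (++-assoc (encodeDigits x) _ v)) , d
  derives-tag (false , true , false) is w (x , _ , refl , y , v , refl , d) =
    leafR true x y , v , cong (tagWord (leafTag true) ++_) (sym (++-assoc (encodeDigits x) _ v)) , d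
  derives-tag (false , true , true) is w (r , v , refl , d) = negR r , v , refl , d
  derives-tag (true , false , false) is w (r , _ , refl , s , v , refl , d) =
    binR false r s , v , cong (tagWord (binTag false) ++_) (sym (++-assoc (encodeR r) _ v)) , d
  derives-tag (true , false , true) is w (x , _ , refl , s , v , refl , d) =
    modR false x s , v , cong (tagWord (modTag false) ++_) (sym (++-assoc (encodeDigits x) _ v)) , d
  derives-tag (true , true , false) is w (x , _ , refl , s , v , refl , d) =
    modR true x s , v , cong (tagWord (modTag true) ++_) (sym (++-assoc (encodeDigits x) _ v)) , d
  derives-tag (true , true , true) is w (r , _ , refl , s , v , refl , d) =
    binR true r s , v , cong (tagWord (binTag true) ++_) (sym (++-assoc (encodeR r) _ v)) , d

  scan-rejects : ∀ st o w → Accepting (Scanner.run (false , st) o w) → false ≡ true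
  scan-rejects st o []      (e , _) = e
  scan-rejects st o (b ∷ w) a =
    scan-rejects (proj₂ (proj₁ (Scanner.turn b (false , st)))) (proj₂ (Scanner.turn b (false , st)) ++ o) w a

  -- Each step of the scanner inverts one production of the grammar. An accepting run, followed from
  -- its end, thus builds a derivation for every item on the stack.
  scan-derives : ∀ w is o → Accepting (scanFrom true is o w) → Derives is w
  scan-derives []      []       o a = refl
  scan-derives []      (i ∷ is) o (_ , ())
  scan-derives (b ∷ w) []       o a with () ← scan-rejects [] o w a
  scan-derives (b ∷ w) (i ∷ is) o a with scan-derives w (proj₁ (read b i) ++ is) (proj₂ (read b i) ++ o) (subst Accepting (scanFrom-step true i is o b w) a)
  scan-derives (b ∷ w)     (formula ∷ is)  o a | d = d
  scan-derives (b ∷ w)     (tag₂ c ∷ is)   o a | d = d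
  scan-derives (b ∷ w)     (tag₃ c d ∷ is) o a | e = derives-tag (c , d , b) is w e
  scan-derives (false ∷ w) (number ∷ is)   o a | d = [] , w , refl , d
  scan-derives (true ∷ w)  (number ∷ is)   o a | b , _ , refl , ds , v , refl , d = b ∷ ds , v , refl , d
  scan-derives (b ∷ w)     (digit₁ ∷ is)   o a | d = b , w , refl , d

-- Tokens, modal depths and desugaring

module Parsing where

  open Bounds
  open Terms
  open ListTerms
  open Numerals

  -- Grouping symbols, read backwards, into tokens

  TagT Token : Ty
  TagT  = bool ⊠ bool ⊠ bool
  Token = TagT ⊠ (list bool ⊠ list bool)

  finiteTag : Finite TagT
  finiteTag = bool ⊠ bool ⊠ bool

  tokens : Raw → List (El Token)
  tokens (atomR x)     = ((false , false , false) , x , []) ∷ []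
  tokens (leafR k x y) = (leafTag k , x , y) ∷ []
  tokens (negR r)      = ((false , true , true) , [] , []) ∷ tokens r
  tokens (binR k r s)  = (binTag k , [] , []) ∷ tokens r ++ tokens s
  tokens (modR k x r)  = (modTag k , x , []) ∷ tokens r

  -- The state holds the numerals completed or under way since the last tag.
  group : El Ty₄ → Digits × Digits → (Digits × Digits) × List (El Token)
  group (true , t)              (x , y) = ([] , []) , (t , x , y) ∷ []
  group (false , true , b , _)  (x , y) = (b ∷ x , y) , []
  group (false , false , _)     (x , y) = ([] , x) , []

  groupCase : ∀ {Γ} → El Ty₄ → Tm (Ty₄ ∷ list Ty₄ ∷ (list bool ⊠ list bool) ∷ Γ) ((list bool ⊠ list bool) ⊠ list Token)
  groupCase (true , t)             = pair (val ([] , [])) (cons (pair (val t) v2) (val []))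
  groupCase (false , true , b , _) = split v2 (pair (pair (cons (val b) v0) v1) (val []))
  groupCase (false , false , _)    = split v2 (pair (pair (val []) v0) (val []))

  groupBody : ∀ {Γ} → Tm (Ty₄ ∷ list Ty₄ ∷ (list bool ⊠ list bool) ∷ Γ) ((list bool ⊠ list bool) ⊠ list Token)
  groupBody = cases finite₄ groupCase v0

  groupBody-⟦⟧ : ∀ {Γ} s l f γ → ⟦ groupBody {Γ} ⟧ (s , l , f , γ) ≡ group s f
  groupBody-⟦⟧ s l f γ = trans (cases-⟦⟧ finite₄ groupCase v0 (s , l , f , γ)) (at s)
    where
    at : ∀ s → ⟦ groupCase s ⟧ (s , l , f , γ) ≡ group s f
    at (true , t)             = refl
    at (false , true , b , _) = refl
    at (false , false , _)    = refl

  #-pair : ∀ A B a b → # (A ⊠ B) (a , b) ≡ # A a + # B b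
  #-pair A B a b = length-++ (enc A a)

  1≤#list : ∀ A xs → 1 ≤ # (list A) xs
  1≤#list A []       = s≤s z≤n
  1≤#list A (x ∷ xs) = s≤s z≤n

  groupGrowth : ∀ {Γ} → Growth (groupBody {Γ})
  groupGrowth {Γ} = con 2 , λ s l f γ → ≤-trans (≤-reflexive (cong (λ r → # (list bool ⊠ list bool) (proj₁ r)) (groupBody-⟦⟧ {Γ} s l f γ))) (at s f)
    where
    at : ∀ s f → # (list bool ⊠ list bool) (proj₁ (group s f)) ≤ # (list bool ⊠ list bool) f + 2
    at (true , t) (x , y) = m≤n+m 2 _
    at (false , true , b , _) (x , y) = ≤-reflexive (+-comm 2 _)
    at (false , false , _) (x , y) rewrite #-pair (list bool) (list bool) x y =
      ≤-trans (s≤s (m≤m+n (# (list bool) x) _)) (≤-trans (≤-reflexive (+-comm 1 _)) (+-monoʳ-≤ (# (list bool) x + # (list bool) y) (s≤s z≤n)))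

  grouping : Digits × Digits → List (El Token) → List (El Ty₄) → (Digits × Digits) × List (El Token)
  grouping = iterate (λ s _ → group s)

  opaque
    groupT : Tm (list Ty₄ ∷ []) (list Token)
    groupT = snd′ (loop groupBody groupGrowth (val ([] , [])) (val []) v0)

    groupT-⟦⟧ : ∀ ss → ⟦ groupT ⟧ (ss , tt) ≡ proj₂ (grouping ([] , []) [] ss)
    groupT-⟦⟧ ss = cong proj₂ (go ([] , []) [] ss)
      where
      go : ∀ f o l → iterate (λ s l f → ⟦ groupBody ⟧ (s , l , f , ss , tt)) f o l ≡ grouping f o l
      go f o []      = refl
      go f o (s ∷ l) rewrite groupBody-⟦⟧ s l f (ss , tt) = go _ _ l

  group-digits : ∀ ds x y o l → grouping (x , y) o (digitSyms ds ʳ++ l) ≡ grouping (ds , x) o l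
  group-digits []       x y o l = refl
  group-digits (b ∷ ds) x y o l = group-digits ds x y o (digitS b ∷ l)

  group-raw : ∀ r o l → grouping ([] , []) o (syms r ʳ++ l) ≡ grouping ([] , []) (tokens r ++ o) l
  group-raw (atomR x) o l = group-digits x [] [] o (tagS false false false ∷ l)
  group-raw (leafR k x y) o l rewrite ++-ʳ++ (digitSyms x) {digitSyms y} {tagSym (leafTag k) ∷ l} =
    trans (group-digits y [] [] o (digitSyms x ʳ++ (tagSym (leafTag k) ∷ l))) (group-digits x y [] o (tagSym (leafTag k) ∷ l))
  group-raw (negR r) o l = group-raw r o (tagS false true true ∷ l)
  group-raw (binR k r s) o l rewrite ++-ʳ++ (syms r) {syms s} {tagSym (binTag k) ∷ l} | ++-assoc (tokens r) (tokens s) o =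
    trans (group-raw s o (syms r ʳ++ (tagSym (binTag k) ∷ l))) (group-raw r (tokens s ++ o) (tagSym (binTag k) ∷ l))
  group-raw (modR k x r) o l rewrite ++-ʳ++ (digitSyms x) {syms r} {tagSym (modTag k) ∷ l} =
    trans (group-raw r o (digitSyms x ʳ++ (tagSym (modTag k) ∷ l))) (group-digits x [] [] (tokens r ++ o) (tagSym (modTag k) ∷ l))

  -- Modal depths in unary, and the total depth of the announcements in whose
  -- scope a token lies

  Nat : Ty
  Nat = list bool

  Depths : Ty
  Depths = list Nat ⊠ Nat

  -- The stack holds the depths of the formulas completed after some position;
  -- a binary connective with one of them on the stack has the other operand
  -- around that position.
  depthStep : Tag → El Depths → El Depths
  depthStep (false , false , _)     (s , o)         = [] ∷ s , o
  depthStep (false , true , false)  (s , o)         = [] ∷ s , o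
  depthStep (false , true , true)   (s , o)         = s , o
  depthStep (true , false , false)  ([] , o)        = [] , o
  depthStep (true , false , false)  (d ∷ [] , o)    = [] , o
  -- In unary, `d + (e ∸ d)` is the maximum.
  depthStep (true , false , false)  (d ∷ e ∷ s , o) = (d ++ drop (length d) e) ∷ s , o
  depthStep (true , true , true)    ([] , o)        = [] , o
  -- The completed operand is the announced formula, and the position lies in its scope.
  depthStep (true , true , true)    (d ∷ [] , o)    = [] , d ++ o
  depthStep (true , true , true)    (d ∷ e ∷ s , o) = (d ++ e) ∷ s , o
  depthStep (true , _ , _)          ([] , o)        = [] , o
  depthStep (true , _ , _)          (d ∷ s , o)     = (false ∷ d) ∷ s , o

  depthCase : Tag → Tm (TagT ∷ Depths ∷ []) Depths
  depthCase (false , false , _)    = split v1 (pair (cons (val []) v0) v1)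
  depthCase (false , true , false) = split v1 (pair (cons (val []) v0) v1)
  depthCase (false , true , true)  = v1
  depthCase (true , false , false) = split v1 (caseL v0 (pair (val []) v1) (caseL v1 (pair (val []) v3)
    (pair (cons (app v2 (call₂ dropT v2 v0)) v1) v5)))
  depthCase (true , true , true)   = split v1 (caseL v0 (pair (val []) v1) (caseL v1 (pair (val []) (app v0 v3))
    (pair (cons (app v2 v0) v1) v5)))
  depthCase _                      = split v1 (caseL v0 (pair (val []) v1) (pair (cons (cons (val false) v0) v1) v3))

  opaque
    depthStepT : Tm (TagT ∷ Depths ∷ []) Depths
    depthStepT = cases finiteTag depthCase v0

    depthStepT-⟦⟧ : ∀ t s → ⟦ depthStepT ⟧ (t , s , tt) ≡ depthStep t s
    depthStepT-⟦⟧ t s = trans (cases-⟦⟧ finiteTag depthCase v0 (t , s , tt)) (at t s)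
      where
      at : ∀ t s → ⟦ depthCase t ⟧ (t , s , tt) ≡ depthStep t s
      at (false , false , _)    s = refl
      at (false , true , false) s = refl
      at (false , true , true)  s = refl
      at (true , false , false) ([] , o) = refl
      at (true , false , false) (d ∷ [] , o) = refl
      at (true , false , false) (d ∷ e ∷ s , o) = cong (λ x → (d ++ x) ∷ s , o) (dropT-⟦⟧ d e)
      at (true , true , true)   ([] , o) = refl
      at (true , true , true)   (d ∷ [] , o) = refl
      at (true , true , true)   (d ∷ e ∷ s , o) = refl
      at (true , true , false)  ([] , o) = refl
      at (true , true , false)  (d ∷ s , o) = refl
      at (true , false , true)  ([] , o) = refl
      at (true , false , true)  (d ∷ s , o) = refl

  depthSize : El Depths → ℕ
  depthSize (s , o) = # (list Nat) s + # Nat o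

  #-drop : ∀ n e → # Nat (drop n e) ≤ # Nat e
  #-drop zero    e       = ≤-refl
  #-drop (suc n) []      = ≤-refl
  #-drop (suc n) (b ∷ e) = ≤-trans (#-drop n e) (m≤n+m _ 2)

  merge-size : ∀ d e x s o → # Nat x ≤ # Nat d + # Nat e → depthSize (x ∷ s , o) ≤ depthSize (d ∷ e ∷ s , o) + 2
  merge-size d e x s o h = ≤-trans (≤-reflexive (cong (_+ # Nat o) (#-cons Nat x s)))
    (≤-trans (s≤s (+-monoˡ-≤ (# Nat o) (+-monoˡ-≤ (# (list Nat) s) h)))
      (≤-trans (m≤m+n _ 3) (≤-reflexive (trans
        (solve 4 (λ d e s o → :con 1 :+ ((d :+ e) :+ s :+ o) :+ :con 3 := :con 1 :+ (d :+ (:con 1 :+ (e :+ s))) :+ o :+ :con 2) refl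
          (# Nat d) (# Nat e) (# (list Nat) s) (# Nat o))
        (cong (λ m → m + # Nat o + 2) (sym (trans (#-cons Nat d (e ∷ s)) (cong (λ m → suc (# Nat d + m)) (#-cons Nat e s)))))))))

  depthStep-size : ∀ t s → depthSize (depthStep t s) ≤ depthSize s + 2
  depthStep-size (false , false , _)    (s , o) = ≤-reflexive (+-comm 2 _)
  depthStep-size (false , true , false) (s , o) = ≤-reflexive (+-comm 2 _)
  depthStep-size (false , true , true)  (s , o) = m≤m+n _ 2
  depthStep-size (true , false , false) ([] , o) = m≤m+n _ 2
  depthStep-size (true , false , false) (d ∷ [] , o) = ≤-trans (+-monoˡ-≤ (# Nat o) (1≤#list Nat (d ∷ []))) (m≤m+n _ 2)
  depthStep-size (true , false , false) (d ∷ e ∷ s , o) =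
    merge-size d e (d ++ drop (length d) e) s o (≤-trans (#-++ bool d _) (+-monoʳ-≤ (# Nat d) (#-drop (length d) e)))
  depthStep-size (true , true , true)   ([] , o) = m≤m+n _ 2
  depthStep-size (true , true , true)   (d ∷ [] , o) =
    ≤-trans (s≤s (#-++ bool d o)) (≤-trans (m≤m+n _ 3) (≤-reflexive
      (trans (solve 2 (λ d o → :con 1 :+ (d :+ o) :+ :con 3 := (:con 1 :+ (d :+ :con 1)) :+ o :+ :con 2) refl (# Nat d) (# Nat o))
        (cong (λ m → m + # Nat o + 2) (sym (#-cons Nat d []))))))
  depthStep-size (true , true , true)   (d ∷ e ∷ s , o) = merge-size d e (d ++ e) s o (#-++ bool d e)
  depthStep-size (true , true , false)  ([] , o) = m≤m+n _ 2
  depthStep-size (true , true , false)  (d ∷ s , o) = ≤-reflexive (+-comm 2 _)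
  depthStep-size (true , false , true)  ([] , o) = m≤m+n _ 2
  depthStep-size (true , false , true)  (d ∷ s , o) = ≤-reflexive (+-comm 2 _)

  depths-growth : ∀ t s {n} → # Depths (depthStep t s) ≤ # Depths s + (2 + n)
  depths-growth t s {n} = ≤-trans (≤-reflexive (size-depths (depthStep t s)))
    (≤-trans (depthStep-size t s) (≤-trans (+-monoʳ-≤ (depthSize s) (m≤m+n 2 n)) (≤-reflexive (cong (_+ (2 + n)) (sym (size-depths s))))))
    where
    size-depths : ∀ s → # Depths s ≡ depthSize s
    size-depths (s , o) = #-pair (list Nat) Nat s o

  depthsOf : El Depths → List (El Token) → El Depths
  depthsOf s []      = s
  depthsOf s (t ∷ l) = depthsOf (depthStep (proj₁ t) s) l

  -- Desugaring runs from right to left, whereas the announcements around a token stand to its left;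
  -- they are recovered by a scan of the tokens not yet processed.
  offset : List (El Token) → List Bool
  offset l = proj₂ (depthsOf ([] , []) l)

  opaque
    offsetT : Tm (list Token ∷ []) Nat
    offsetT = snd′ (fst′ (loop {O = bool} body growth (val ([] , [])) (val []) v0))
      where
      body : Tm (Token ∷ list Token ∷ Depths ∷ list Token ∷ []) (Depths ⊠ list bool)
      body = pair (call₂ depthStepT (fst′ v0) v2) (val [])
      growth : Growth body
      growth = con 2 , λ t l s γ → ≤-trans (≤-reflexive (cong (# Depths) (depthStepT-⟦⟧ (proj₁ t) s))) (depths-growth (proj₁ t) s)

    offsetT-⟦⟧ : ∀ l → ⟦ offsetT ⟧ (l , tt) ≡ offset l
    offsetT-⟦⟧ l = cong proj₂ (go ([] , []) l)
      where
      go : ∀ s l → proj₁ (iterate {O = Bool} (λ t _ s → ⟦ depthStepT ⟧ (proj₁ t , s , tt) , []) s [] l) ≡ depthsOf s l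
      go s []      = refl
      go s (t ∷ l) rewrite depthStepT-⟦⟧ (proj₁ t) s = go _ l

  depthR : Raw → List Bool
  depthR (atomR x)        = []
  depthR (leafR k x y)    = []
  depthR (negR r)         = depthR r
  depthR (binR false r s) = depthR r ++ drop (length (depthR r)) (depthR s)
  depthR (binR true r s)  = depthR r ++ depthR s
  depthR (modR k x r)     = false ∷ depthR r

  depthsOf-raw : ∀ r s o l → depthsOf (s , o) (tokens r ʳ++ l) ≡ depthsOf (depthR r ∷ s , o) l
  depthsOf-raw (atomR x) s o l = refl
  depthsOf-raw (leafR false x y) s o l = refl
  depthsOf-raw (leafR true x y) s o l = refl
  depthsOf-raw (negR r) s o l = depthsOf-raw r s o (((false , true , true) , [] , []) ∷ l)
  depthsOf-raw (binR k r₁ r₂) s o l rewrite ++-ʳ++ (tokens r₁) {tokens r₂} {(binTag k , [] , []) ∷ l} =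
    trans (depthsOf-raw r₂ s o (tokens r₁ ʳ++ ((binTag k , [] , []) ∷ l)))
      (trans (depthsOf-raw r₁ (depthR r₂ ∷ s) o ((binTag k , [] , []) ∷ l)) (at k))
    where
    at : ∀ k → depthsOf (depthR r₁ ∷ depthR r₂ ∷ s , o) ((binTag k , [] , []) ∷ l) ≡ depthsOf (depthR (binR k r₁ r₂) ∷ s , o) l
    at false = refl
    at true  = refl
  depthsOf-raw (modR k x r) s o l = trans (depthsOf-raw r s o ((modTag k , x , []) ∷ l)) (at k)
    where
    at : ∀ k → depthsOf (depthR r ∷ s , o) ((modTag k , x , []) ∷ l) ≡ depthsOf ((false ∷ depthR r) ∷ s , o) l
    at false = refl
    at true  = refl

  depthStep-offset : ∀ t s o p → depthStep t (s , o ++ p) ≡ map₂ (_++ p) (depthStep t (s , o))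
  depthStep-offset (false , false , _)    s o p = refl
  depthStep-offset (false , true , false) s o p = refl
  depthStep-offset (false , true , true)  s o p = refl
  depthStep-offset (true , false , false) [] o p = refl
  depthStep-offset (true , false , false) (d ∷ []) o p = refl
  depthStep-offset (true , false , false) (d ∷ e ∷ s) o p = refl
  depthStep-offset (true , true , true)   [] o p = refl
  depthStep-offset (true , true , true)   (d ∷ []) o p = cong ([] ,_) (sym (++-assoc d o p))
  depthStep-offset (true , true , true)   (d ∷ e ∷ s) o p = refl
  depthStep-offset (true , true , false)  [] o p = refl
  depthStep-offset (true , true , false)  (d ∷ s) o p = refl
  depthStep-offset (true , false , true)  [] o p = refl
  depthStep-offset (true , false , true)  (d ∷ s) o p = refl

  depthsOf-offset : ∀ l s o p → depthsOf (s , o ++ p) l ≡ map₂ (_++ p) (depthsOf (s , o) l)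
  depthsOf-offset []      s o p = refl
  depthsOf-offset (t ∷ l) s o p rewrite depthStep-offset (proj₁ t) s o p =
    depthsOf-offset l (proj₁ (depthStep (proj₁ t) (s , o))) (proj₂ (depthStep (proj₁ t) (s , o))) p

  -- Desugaring: E a k becomes P a k ∧ ∼ P a (k + 1) and K a φ becomes
  -- P a d ∧ K∞ a φ, and offsets are added to the arguments of P.

  pattern andTag  = true , false , false
  pattern negTag  = false , true , true
  pattern atomTag = false , false , false
  pattern litTag  = false , true , false
  pattern boxTag  = true , true , false
  pattern annTag  = true , true , true

  bare : Tag → El Token
  bare t = t , [] , []

  expand : El Token → List Bool → List Bool → List (El Token)
  expand ((false , false , true) , x , y) o d =
    bare andTag ∷ (litTag , x , add y o) ∷ bare negTag ∷ (litTag , x , increment (add y o)) ∷ []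
  expand (litTag , x , y)                 o d = (litTag , x , add y o) ∷ []
  expand ((true , false , true) , x , y)  o d = bare andTag ∷ (litTag , x , add (add [] d) o) ∷ (boxTag , x , []) ∷ []
  expand t                                o d = t ∷ []

  expandCase : Tag → Tm (list bool ∷ list bool ∷ TagT ∷ (list bool ⊠ list bool) ∷ Token ∷ Nat ∷ Nat ∷ []) (list Token)
  expandCase (false , false , true) = let′ (call₂ addT v1 v5) (cons (val (bare andTag)) (cons (pair (val litTag) (pair v1 v0))
    (cons (val (bare negTag)) (cons (pair (val litTag) (pair v1 (call₁ incrementT v0))) (val [])))))
  expandCase litTag                 = cons (pair (val litTag) (pair v0 (call₂ addT v1 v5))) (val [])
  expandCase (true , false , true)  = cons (val (bare andTag))
    (cons (pair (val litTag) (pair v0 (call₂ addT (call₂ addT (val []) v6) v5))) (cons (pair (val boxTag) (pair v0 (val []))) (val [])))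
  expandCase _                      = cons v4 (val [])

  opaque
    expandT : Tm (Token ∷ Nat ∷ Nat ∷ []) (list Token)
    expandT = split v0 (split v1 (cases finiteTag expandCase v2))

    expandT-⟦⟧ : ∀ t o d → ⟦ expandT ⟧ (t , o , d , tt) ≡ expand t o d
    expandT-⟦⟧ (g , x , y) o d = trans (cases-⟦⟧ finiteTag expandCase v2 (x , y , g , (x , y) , (g , x , y) , o , d , tt)) (at g)
      where
      at : ∀ g → ⟦ expandCase g ⟧ (x , y , g , (x , y) , (g , x , y) , o , d , tt) ≡ expand (g , x , y) o d
      at (false , false , false) = refl
      at (false , false , true) = cong₂ (λ u v → bare andTag ∷ (litTag , x , u) ∷ bare negTag ∷ (litTag , x , v) ∷ [])
        (addT-⟦⟧ y o) (trans (incrementT-⟦⟧ _) (cong increment (addT-⟦⟧ y o)))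
      at litTag = cong (λ u → (litTag , x , u) ∷ []) (addT-⟦⟧ y o)
      at negTag = refl
      at andTag = refl
      at (true , false , true) = cong (λ u → bare andTag ∷ (litTag , x , u) ∷ (boxTag , x , []) ∷ [])
        (trans (addT-⟦⟧ _ o) (cong (λ z → add z o) (addT-⟦⟧ [] d)))
      at boxTag = refl
      at annTag = refl

  topOf : List (List Bool) → List Bool
  topOf []      = []
  topOf (d ∷ _) = d

  -- When the pass meets a `K`, its body is already complete, so the depth of the body is on top of
  -- the stack.
  desugarStep : El Token → List (El Token) → El Depths → El Depths × List (El Token)
  desugarStep t l s = depthStep (proj₁ t) s , expand t (offset l) (topOf (proj₁ s))

  desugaring : El Depths → List (El Token) → List (El Token) → El Depths × List (El Token)
  desugaring = iterate desugarStep

  opaque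
    desugarT : Tm (list Token ∷ []) (list Token)
    desugarT = snd′ (loop body growth (val ([] , [])) (val []) v0)
      where
      body : Tm (Token ∷ list Token ∷ Depths ∷ list Token ∷ []) (Depths ⊠ list Token)
      body = pair (call₂ depthStepT (fst′ v0) v2)
        (call₃ expandT v0 (call₁ offsetT v1) (caseL (fst′ v2) (val []) v0))
      growth : Growth body
      growth = con 2 , λ t l s γ → ≤-trans (≤-reflexive (cong (# Depths) (depthStepT-⟦⟧ (proj₁ t) s))) (depths-growth (proj₁ t) s)

    desugarT-⟦⟧ : ∀ ts → ⟦ desugarT ⟧ (ts , tt) ≡ proj₂ (desugaring ([] , []) [] ts)
    desugarT-⟦⟧ ts = cong proj₂ (go ([] , []) [] ts)
      where
      top : ∀ s → caseList s [] (λ d _ → d) ≡ topOf s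
      top []      = refl
      top (d ∷ s) = refl
      go : ∀ s o l → iterate (λ t l s → ⟦ depthStepT ⟧ (proj₁ t , s , tt) ,
             ⟦ expandT ⟧ (t , ⟦ offsetT ⟧ (l , tt) , caseList (proj₁ s) [] (λ d _ → d) , tt)) s o l ≡ desugaring s o l
      go s o []      = refl
      go s o (t ∷ l) rewrite depthStepT-⟦⟧ (proj₁ t) s | offsetT-⟦⟧ l | top (proj₁ s) | expandT-⟦⟧ t (offset l) (topOf (proj₁ s)) = go _ _ l

  nodesR : Raw → List Bool → List (El Token)
  nodesR (atomR x)        o = (atomTag , x , []) ∷ []
  nodesR (leafR k x y)    o = expand (leafTag k , x , y) o []
  nodesR (negR r)         o = bare negTag ∷ nodesR r o
  nodesR (binR false r s) o = bare andTag ∷ nodesR r o ++ nodesR s o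
  nodesR (binR true r s)  o = bare annTag ∷ nodesR r o ++ nodesR s (o ++ depthR r)
  nodesR (modR false x r) o = bare andTag ∷ (litTag , x , add (add [] (depthR r)) o) ∷ (boxTag , x , []) ∷ nodesR r o
  nodesR (modR true x r)  o = (boxTag , x , []) ∷ nodesR r o

  desugar-raw : ∀ r s o out l → desugaring (s , o) out (tokens r ʳ++ l) ≡ desugaring (depthR r ∷ s , o) (nodesR r (offset l) ++ out) l
  desugar-raw (atomR x) s o out l = refl
  desugar-raw (leafR false x y) s o out l = refl
  desugar-raw (leafR true x y) s o out l = refl
  desugar-raw (negR r) s o out l = desugar-raw r s o out (bare negTag ∷ l)
  desugar-raw (binR false r₁ r₂) s o out l
    rewrite ++-ʳ++ (tokens r₁) {tokens r₂} {bare andTag ∷ l} | ++-assoc (nodesR r₁ (offset l)) (nodesR r₂ (offset l)) out =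
    trans (desugar-raw r₂ s o out (tokens r₁ ʳ++ (bare andTag ∷ l)))
      (trans (cong (λ p → desugaring (depthR r₂ ∷ s , o) (nodesR r₂ p ++ out) (tokens r₁ ʳ++ (bare andTag ∷ l)))
               (cong proj₂ (depthsOf-raw r₁ [] [] (bare andTag ∷ l))))
             (desugar-raw r₁ (depthR r₂ ∷ s) o (nodesR r₂ (offset l) ++ out) (bare andTag ∷ l)))
  desugar-raw (binR true r₁ r₂) s o out l
    rewrite ++-ʳ++ (tokens r₁) {tokens r₂} {bare annTag ∷ l} | ++-assoc (nodesR r₁ (offset l)) (nodesR r₂ (offset l ++ depthR r₁)) out =
    trans (desugar-raw r₂ s o out (tokens r₁ ʳ++ (bare annTag ∷ l)))
      (trans (cong (λ p → desugaring (depthR r₂ ∷ s , o) (nodesR r₂ p ++ out) (tokens r₁ ʳ++ (bare annTag ∷ l))) shifted)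
             (desugar-raw r₁ (depthR r₂ ∷ s) o (nodesR r₂ (offset l ++ depthR r₁) ++ out) (bare annTag ∷ l)))
    where
    shifted : offset (tokens r₁ ʳ++ (bare annTag ∷ l)) ≡ offset l ++ depthR r₁
    shifted = trans (cong proj₂ (depthsOf-raw r₁ [] [] (bare annTag ∷ l)))
      (trans (cong (λ p → proj₂ (depthsOf ([] , p) l)) (++-identityʳ (depthR r₁))) (cong proj₂ (depthsOf-offset l [] [] (depthR r₁))))
  desugar-raw (modR false x r) s o out l = desugar-raw r s o out ((modTag false , x , []) ∷ l)
  desugar-raw (modR true x r) s o out l = desugar-raw r s o out ((modTag true , x , []) ∷ l)

  -- Well-formedness: agents below n, and announcements only in EDPAL

  known : ℕ → Digits → Bool
  known zero    x = false
  known (suc m) x = if same x (numeral m) then true else known m x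

  hasAnnouncements : Logic → Bool
  hasAnnouncements DBEL  = false
  hasAnnouncements EDPAL = true

  allowed : ℕ → Logic → El Token → Bool
  allowed n l ((false , false , true) , x , _) = known n x
  allowed n l (litTag , x , _)                 = known n x
  allowed n l ((true , false , true) , x , _)  = known n x
  allowed n l (boxTag , x , _)                 = known n x
  allowed n l (annTag , _)                     = hasAnnouncements l
  allowed n l _                                = true

  knownT : ∀ {Γ} → ℕ → Tm Γ (list bool) → Tm Γ bool
  knownT zero    t = val false
  knownT (suc m) t = orT (call₂ sameT t (val (numeral m))) (knownT m t)

  knownT-⟦⟧ : ∀ {Γ} m (t : Tm Γ (list bool)) γ → ⟦ knownT m t ⟧ γ ≡ known m (⟦ t ⟧ γ)
  knownT-⟦⟧ zero    t γ = refl
  knownT-⟦⟧ (suc m) t γ = cong₂ (λ a b → if a then true else b) (sameT-⟦⟧ (⟦ t ⟧ γ) (numeral m)) (knownT-⟦⟧ m t γ)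

  allowedCase : ∀ {Γ} → ℕ → Logic → Tag → Tm (Token ∷ Γ) bool
  allowedCase n l (false , false , true) = knownT n (fst′ (snd′ v0))
  allowedCase n l litTag                 = knownT n (fst′ (snd′ v0))
  allowedCase n l (true , false , true)  = knownT n (fst′ (snd′ v0))
  allowedCase n l boxTag                 = knownT n (fst′ (snd′ v0))
  allowedCase n l annTag                 = val (hasAnnouncements l)
  allowedCase n l _                      = val true

  allowedT : ∀ {Γ} → ℕ → Logic → Tm (Token ∷ Γ) bool
  allowedT n l = cases finiteTag (allowedCase n l) (fst′ v0)

  allowedT-⟦⟧ : ∀ {Γ} n l t γ → ⟦ allowedT {Γ} n l ⟧ (t , γ) ≡ allowed n l t
  allowedT-⟦⟧ n l (g , x , y) γ = trans (cases-⟦⟧ finiteTag (allowedCase n l) (fst′ v0) ((g , x , y) , γ)) (at g)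
    where
    ag : ∀ g → ⟦ knownT n (fst′ (snd′ v0)) ⟧ ((g , x , y) , γ) ≡ known n x
    ag g = knownT-⟦⟧ n (fst′ (snd′ v0)) ((g , x , y) , γ)
    at : ∀ g → ⟦ allowedCase n l g ⟧ ((g , x , y) , γ) ≡ allowed n l (g , x , y)
    at g@(false , false , false) = refl
    at g@(false , false , true) = ag g
    at g@litTag = ag g
    at negTag = refl
    at andTag = refl
    at g@(true , false , true) = ag g
    at g@boxTag = ag g
    at annTag = refl

-- Coherent types and the rules of the game

module Referees where

  open Bounds
  open Terms
  open Compilation
  open ListTerms
  open Numerals
  open Parsing

  -- The referee. A type labels every node of the desugared formula, in prefix
  -- order, with its truth value and with whether the state survives the
  -- announcements in whose scope the node lies.

  Label Type Marks Round History : Ty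
  Label   = Token ⊠ bool ⊠ bool
  Type    = list Label
  Marks   = list bool
  Round   = Marks ⊠ Type
  History = list Round

  infix 4 _==_
  _==_ : Bool → Bool → Bool
  true  == b = b
  false == b = not b

  Verdicts : Ty
  Verdicts = bool ⊠ bool

  -- The flag tells whether depths are natural numbers and the literal is P a 0.
  Key : Ty
  Key = TagT ⊠ bool ⊠ bool ⊠ bool

  -- The clause for boxes expresses reflexivity: a true box has a true body at its own state, if
  -- that is alive. An announcement is an implication whose right operand is alive exactly if, in
  -- addition, the left one is true.
  locally : El Key → List (El Verdicts) → Bool × List (El Verdicts) × List Bool
  locally (atomTag , z , t , c) s                             = true , (t , c) ∷ s , []
  locally (litTag , z , t , c)  s                             = not z || t , (t , c) ∷ s , []
  locally (negTag , z , t , c)  ((t₁ , c₁) ∷ s)               = (t == not t₁) && (c₁ == c) , (t , c) ∷ s , []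
  locally (boxTag , z , t , c)  ((t₁ , c₁) ∷ s)               = (not t || (not c₁ || t₁)) && (c₁ == c) , (t , c) ∷ s , []
  locally (andTag , z , t , c)  ((t₁ , c₁) ∷ (t₂ , c₂) ∷ s)   = (t == (t₁ && t₂)) && ((c₁ == c) && (c₂ == c)) , (t , c) ∷ s , []
  locally (annTag , z , t , c)  ((t₁ , c₁) ∷ (t₂ , c₂) ∷ s)   = (t == (not t₁ || t₂)) && ((c₁ == c) && (c₂ == (c && t₁))) , (t , c) ∷ s , []
  locally _ s                                                 = false , s , []

  and-cong : ∀ {a b c d} → a ≡ c → b ≡ d → (if a then b else false) ≡ (c && d)
  and-cong {true}  refl refl = refl
  and-cong {false} refl refl = refl

  not-cong : ∀ {a b} → a ≡ b → (if a then false else true) ≡ not b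
  not-cong {true}  refl = refl
  not-cong {false} refl = refl

  &&-assoc : ∀ a b c → (a && (b && c)) ≡ ((a && b) && c)
  &&-assoc true  b c = refl
  &&-assoc false b c = refl

  if-cong : ∀ {A : Set} {a a′ : Bool} {x x′ y y′ : A} → a ≡ a′ → x ≡ x′ → y ≡ y′ → (if a then x else y) ≡ (if a′ then x′ else y′)
  if-cong refl refl refl = refl

  isZero : Digits → Bool
  isZero []      = true
  isZero (_ ∷ _) = false

  module Local (l : Logic) where

    natural : Bool
    natural = not (hasAnnouncements l)

    keyOf : El Label → El Key
    keyOf ((g , x , y) , t , c) = g , (natural && isZero y) , t , c

    keyT : Tm (Label ∷ []) Key
    keyT = split v0 (split v0 (pair v0 (pair (andT (val natural) (caseL (snd′ v1) (val true) (val false))) v3)))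

    keyT-⟦⟧ : ∀ e → ⟦ keyT ⟧ (e , tt) ≡ keyOf e
    keyT-⟦⟧ ((g , x , []) , t , c)    = cong (λ b → g , b , t , c) (and-cong {natural} refl refl)
    keyT-⟦⟧ ((g , x , _ ∷ _) , t , c) = cong (λ b → g , b , t , c) (and-cong {natural} refl refl)

    module Evaluator = Pushdown {Label} (finiteTag ⊠ bool ⊠ bool ⊠ bool) (bool ⊠ bool) keyT locally

  -- One test serves atoms and depth literals. A true `P a j` contradicts a false `P a k` if
  -- `k ≤ j`; atoms carry an empty second numeral, so for them the comparison succeeds trivially.
  conflict : El Label → El Label → Bool
  conflict (((a , b , c) , x , y) , t , _) (((a′ , b′ , c′) , x′ , y′) , t′ , _) =
    (t && not t′) && (((not a && not c) && (not a′ && not c′)) && (b == b′)) && (same x x′ && atLeast y y′)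

  conflictTags : Tag × Tag × Bool × Bool → Bool
  conflictTags ((a , b , c) , (a′ , b′ , c′) , t , t′) = (t && not t′) && (((not a && not c) && (not a′ && not c′)) && (b == b′))

  opaque
    conflictT : Tm (Label ∷ Label ∷ []) bool
    conflictT = split v0 (split v3 (split v2 (split v2 (andT tags (andT (call₂ sameT (fst′ v3) (fst′ v1)) (call₂ atLeastT (snd′ v3) (snd′ v1)))))))
      where
      tags : Tm (TagT ∷ (list bool ⊠ list bool) ∷ TagT ∷ (list bool ⊠ list bool) ∷ Token ∷ Verdicts ∷ Token ∷ Verdicts ∷ Label ∷ Label ∷ []) bool
      tags = table (finiteTag ⊠ finiteTag ⊠ bool ⊠ bool) conflictTags
        (pair v2 (pair v0 (pair (fst′ (var (there (there (there (there (there (there (there here))))))))) (fst′ v5))))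

    conflictT-⟦⟧ : ∀ e e′ → ⟦ conflictT ⟧ (e , e′ , tt) ≡ conflict e e′
    conflictT-⟦⟧ (((a , b , c) , x , y) , t , z) (((a′ , b′ , c′) , x′ , y′) , t′ , z′) = trans
      (and-cong (table-⟦⟧ (finiteTag ⊠ finiteTag ⊠ bool ⊠ bool) conflictTags
                  (pair v2 (pair v0 (pair (fst′ (var (there (there (there (there (there (there (there here))))))))) (fst′ v5))))
                  ((a′ , b′ , c′) , (x′ , y′) , (a , b , c) , (x , y) , ((a′ , b′ , c′) , x′ , y′) , (t′ , z′) , ((a , b , c) , x , y) , (t , z) ,
                   (((a , b , c) , x , y) , t , z) , (((a′ , b′ , c′) , x′ , y′) , t′ , z′) , tt))
                (and-cong (sameT-⟦⟧ x x′) (atLeastT-⟦⟧ y y′)))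
      (sym (&&-assoc (t && not t′) (((not a && not c) && (not a′ && not c′)) && (b == b′)) (same x x′ && atLeast y y′)))

  every-cong : ∀ {X : Set} {f g : X → Bool} → (∀ x → f x ≡ g x) → ∀ xs → every f xs ≡ every g xs
  every-cong h []       = refl
  every-cong h (x ∷ xs) = cong₂ _&&_ (h x) (every-cong h xs)

  allT-⟦⟧ : ∀ {Γ A} (c : Tm (A ∷ list A ∷ bool ∷ Γ) bool) (t : Tm Γ (list A)) γ (p : El A → Bool) →
    (∀ x l f → ⟦ c ⟧ (x , l , f , γ) ≡ p x) → ⟦ allT c t ⟧ γ ≡ every p (⟦ t ⟧ γ)
  allT-⟦⟧ c t γ p h = iterate-all p (λ a l f → if f then ⟦ c ⟧ (a , l , f , γ) else false) (⟦ t ⟧ γ) (λ x l → h x l true) (λ x l → refl)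

  consistent : List (El Label) → Bool
  consistent τ = every (λ e → every (λ e′ → not (conflict e e′)) τ) τ

  opaque
    consistentT : Tm (Type ∷ []) bool
    consistentT = allT (allT (notT (call₂ conflictT v3 v0)) v3) v0

    consistentT-⟦⟧ : ∀ τ → ⟦ consistentT ⟧ (τ , tt) ≡ consistent τ
    consistentT-⟦⟧ τ = allT-⟦⟧ (allT (notT (call₂ conflictT v3 v0)) v3) v0 (τ , tt) _ (λ e l f →
      allT-⟦⟧ (notT (call₂ conflictT v3 v0)) v3 (e , l , f , τ , tt) _ (λ e′ l′ f′ →
        not-cong (conflictT-⟦⟧ e e′)))

  rootAlive : List (El Label) → Bool
  rootAlive τ = caseList τ false (λ e _ → proj₂ (proj₂ e))

  module Coherent (l : Logic) where
    open Local l

    coherent : List (El Label) → Bool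
    -- Read backwards, prefix order presents operands before their connective, as evaluation on a
    -- stack requires.
    coherent τ = proj₁ (proj₁ (Evaluator.run (true , []) [] (τ ʳ++ []))) && (rootAlive τ && consistent τ)

    opaque
      coherentT : Tm (Type ∷ []) bool
      coherentT = andT (fst′ (fst′ (Evaluator.pushdown (val []) (revT v0)))) (andT (caseL v0 (val false) (snd′ (snd′ v0))) (call₁ consistentT v0))

      coherentT-⟦⟧ : ∀ τ → ⟦ coherentT ⟧ (τ , tt) ≡ coherent τ
      coherentT-⟦⟧ τ = (and-cong
        (trans (cong (proj₁ ∘ proj₁) (Evaluator.pushdown-⟦⟧ (val []) (revT v0) (τ , tt)))
          (cong (λ ρ → proj₁ (proj₁ (Evaluator.run (true , []) [] ρ))) (iterate-rev [] τ)))
        (and-cong (alive τ) (consistentT-⟦⟧ τ)))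
        where
        alive : ∀ τ → caseList τ false (λ e _ → proj₂ (proj₂ e)) ≡ rootAlive τ
        alive []      = refl
        alive (_ ∷ _) = refl

  isBox : Tag → Bool
  isBox (a , b , c) = a && (b && not c)

  boxValue : Digits → El Label → List Bool
  boxValue x ((g , x′ , _) , t , _) = if isBox g && same x x′ then t ∷ [] else []

  -- A list of truth values is also a numeral, so `same` can compare the boxes of two types with the
  -- same nodes.
  boxValues : Digits → List (El Label) → List Bool
  boxValues x = accumulate (λ e _ → boxValue x e) []

  boxValueT : Tm (Label ∷ list Label ∷ bool ∷ list bool ∷ Type ∷ []) (list bool)
  boxValueT = if (andT (table finiteTag isBox (fst′ (fst′ v0))) (call₂ sameT v3 (fst′ (snd′ (fst′ v0))))) (cons (fst′ (snd′ v0)) (val [])) (val [])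

  opaque
    boxValuesT : Tm (list bool ∷ Type ∷ []) (list bool)
    boxValuesT = each boxValueT (val []) v1

    boxValuesT-⟦⟧ : ∀ x τ → ⟦ boxValuesT ⟧ (x , τ , tt) ≡ boxValues x τ
    boxValuesT-⟦⟧ x τ = accumulate-iterate (λ e l f → ⟦ boxValueT ⟧ (e , l , f , x , τ , tt)) (λ e _ → boxValue x e) at false [] τ
      where
      at : ∀ e l f → ⟦ boxValueT ⟧ (e , l , f , x , τ , tt) ≡ boxValue x e
      at ((g , x′ , y) , t , c) l f = if-cong
        (and-cong (table-⟦⟧ finiteTag isBox (fst′ (fst′ v0)) (((g , x′ , y) , t , c) , l , f , x , τ , tt)) (sameT-⟦⟧ x x′)) refl refl

  -- The marks select the node of the first true, if there is one.
  lead : List Bool → ℕ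
  lead []          = 0
  lead (true ∷ us) = 0
  lead (false ∷ us) = suc (lead us)

  select : List Bool → List (El Label) → List (El Label)
  select us = drop (lead us)

  opaque
    selectT : Tm (Marks ∷ Type ∷ []) Type
    selectT = call₂ dropT (snd′ (scan bool (pair (orT v2 v0) (if (orT v2 v0) (val []) (cons v0 (val [])))) (val false) (val []) v0)) v1

    selectT-⟦⟧ : ∀ us τ → ⟦ selectT ⟧ (us , τ , tt) ≡ select us τ
    selectT-⟦⟧ us τ = trans (dropT-⟦⟧ (proj₂ (iterate s false [] us)) τ) (cong (λ n → drop n τ) (trans (go us []) (+-identityʳ (lead us))))
      where
      s : Bool → List Bool → Bool → Bool × List Bool
      s a _ f = (if f then true else a) , (if (if f then true else a) then [] else a ∷ [])
      found : ∀ us o → length (proj₂ (iterate s true o us)) ≡ length o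
      found []       o = refl
      found (u ∷ us) o = found us o
      go : ∀ us o → length (proj₂ (iterate s false o us)) ≡ lead us + length o
      go []           o = refl
      go (true ∷ us)  o = found us o
      go (false ∷ us) o = trans (go us (false ∷ o)) (+-suc (lead us) (length o))

  -- active, flag, the agent of the last move, and the current type. Before the
  -- root type is known flag is false; once the play is over flag is the winner.
  Play : Ty
  Play = bool ⊠ bool ⊠ list (list bool) ⊠ Type

  Positive Negative : El Label → Bool
  Positive (_ , t , c) = t && c
  Negative (_ , t , c) = not t && c

  rootHolds : List (El Label) → Bool
  rootHolds τ = caseList τ false (λ e _ → Positive e)

  -- In prefix order the body of the selected box comes right after it. The body must be false at a
  -- live state, since a dead one refutes nothing.
  childFails : List (El Label) → Bool
  childFails τ = caseList τ false (λ _ τ′ → caseList τ′ false (λ e _ → Negative e))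

  moved : List Digits → Digits → Bool
  moved ag x = caseList ag false (λ y _ → same x y)

  demand : List Digits → El Label → Bool
  demand ag ((g , x , _) , t , _) = isBox g && (not t && not (moved ag x))

  -- From the point of view of the player who supplies types. Selecting no node, or one that is not
  -- a legal challenge, ends the play in favour of that player.
  won lost : El Play
  won  = false , true , [] , []
  lost = false , false , [] , []

  module Referee (l : Logic) where
    open Coherent l

    answer : List Digits → List (El Label) → List Bool → List (El Label) → El Label → El Play
    answer ag τ us τ′ e@((_ , x , _) , _) =
      if demand ag e
        then (if coherent τ′ && (same (boxValues x τ) (boxValues x τ′) && childFails (select us τ′)) then (true , true , x ∷ [] , τ′) else lost)
        else won

    rule : El Round → El Play → El Play
    rule (us , τ′) (false , p)               = false , p
    rule (us , τ′) (true , false , _)        = if coherent τ′ && rootHolds τ′ then (true , true , [] , τ′) else lost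
    rule (us , τ′) (true , true , ag , τ)    = caseList (select us τ) won (λ e _ → answer ag τ us τ′ e)

    rootHoldsT : Tm (Type ∷ []) bool
    rootHoldsT = caseL v0 (val false) (table (bool ⊠ bool) (λ (t , c) → t && c) (snd′ v0))

    childFailsT : Tm (Type ∷ []) bool
    childFailsT = caseL v0 (val false) (caseL v1 (val false) (table (bool ⊠ bool) (λ (t , c) → not t && c) (snd′ v0)))

    movedT : Tm (list bool ∷ list (list bool) ∷ []) bool
    movedT = caseL v1 (val false) (call₂ sameT v2 v0)

    -- label, agent, type, marks, new type
    answerT : Tm (Label ∷ list (list bool) ∷ Type ∷ Marks ∷ Type ∷ []) Play
    answerT = let′ (fst′ (snd′ (fst′ v0)))
      (if (andT (table finiteTag isBox (fst′ (fst′ v1))) (andT (notT (fst′ (snd′ v1))) (notT (call₂ movedT v0 v2))))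
        (if (andT (call₁ coherentT v5) (andT (call₂ sameT (call₂ boxValuesT v0 v3) (call₂ boxValuesT v0 v5)) (call₁ childFailsT (call₂ selectT v4 v5))))
          (pair (val true) (pair (val true) (pair (cons v0 (val [])) v5)))
          (val lost))
        (val won))

    ruleT : Tm (Round ∷ Play ∷ []) Play
    ruleT = split v1 (if v0 (if (fst′ v1) playing starting) (pair v0 v1))
      where
      Γ = bool ∷ (bool ⊠ list (list bool) ⊠ Type) ∷ Round ∷ Play ∷ []
      starting playing : Tm Γ Play
      starting = let′ (snd′ v2) (if (andT (call₁ coherentT v0) (call₁ rootHoldsT v0))
        (pair (val true) (pair (val true) (pair (val []) v0))) (val lost))
      playing = let′ (snd′ v2) (let′ (fst′ v3) (let′ (snd′ (snd′ v3)) (let′ (fst′ (snd′ v4))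
        (caseL (call₂ selectT v2 v1) (val won)
          (let′ v0 (wk (keep (skip⊆ (skip⊆ (keep (keep (keep (keep none))))))) answerT))))))

    rootHoldsT-⟦⟧ : ∀ τ → ⟦ rootHoldsT ⟧ (τ , tt) ≡ rootHolds τ
    rootHoldsT-⟦⟧ []      = refl
    rootHoldsT-⟦⟧ (e ∷ τ) = table-⟦⟧ (bool ⊠ bool) (λ (t , c) → t && c) (snd′ v0) (e , τ , e ∷ τ , tt)

    childFailsT-⟦⟧ : ∀ τ → ⟦ childFailsT ⟧ (τ , tt) ≡ childFails τ
    childFailsT-⟦⟧ []           = refl
    childFailsT-⟦⟧ (e ∷ [])     = refl
    childFailsT-⟦⟧ (d ∷ e ∷ τ) = table-⟦⟧ (bool ⊠ bool) (λ (t , c) → not t && c) (snd′ v0) (e , τ , d , e List.∷ τ , d List.∷ e List.∷ τ , tt)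

    movedT-⟦⟧ : ∀ x ag → ⟦ movedT ⟧ (x , ag , tt) ≡ moved ag x
    movedT-⟦⟧ x []       = refl
    movedT-⟦⟧ x (y ∷ ag) = sameT-⟦⟧ x y

    answerT-⟦⟧ : ∀ e ag τ us τ′ → ⟦ answerT ⟧ (e , ag , τ , us , τ′ , tt) ≡ answer ag τ us τ′ e
    answerT-⟦⟧ e@((g , x , y) , t , c) ag τ us τ′ = if-cong
      ((and-cong (table-⟦⟧ finiteTag isBox (fst′ (fst′ v1)) (x , e , ag , τ , us , τ′ , tt))
        ((and-cong (not-cong refl) (not-cong (movedT-⟦⟧ x ag))))))
      (if-cong ((and-cong (coherentT-⟦⟧ τ′) ((and-cong
          (trans (cong₂ (λ a b → ⟦ sameT ⟧ (a , b , tt)) (boxValuesT-⟦⟧ x τ) (boxValuesT-⟦⟧ x τ′)) (sameT-⟦⟧ (boxValues x τ) (boxValues x τ′)))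
          (trans (cong (λ σ → ⟦ childFailsT ⟧ (σ , tt)) (selectT-⟦⟧ us τ′)) (childFailsT-⟦⟧ (select us τ′))))))) refl refl)
      refl

    ruleT-⟦⟧ : ∀ r p → ⟦ ruleT ⟧ (r , p , tt) ≡ rule r p
    ruleT-⟦⟧ (us , τ′) (false , p) = refl
    ruleT-⟦⟧ (us , τ′) (true , false , ag , τ) =
      if-cong ((and-cong (coherentT-⟦⟧ τ′) (rootHoldsT-⟦⟧ τ′))) refl refl
    ruleT-⟦⟧ (us , τ′) (true , true , ag , τ) rewrite selectT-⟦⟧ us τ = at (select us τ)
      where
      at : ∀ σ → caseList σ won (λ e _ → ⟦ answerT ⟧ (e , ag , τ , us , τ′ , tt)) ≡ caseList σ won (λ e _ → answer ag τ us τ′ e)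
      at []      = refl
      at (e ∷ σ) = answerT-⟦⟧ e ag τ us τ′

    play : List (El Round) → El Play
    play []      = true , false , [] , []
    play (r ∷ h) = rule r (play h)

    -- Surviving all rounds counts as a win for the player who supplies types.
    verdictOf : El Play → Bool
    verdictOf (active , flag , _) = if active then true else flag


    private
      play-size : ∀ a b ag τ → # Play (a , b , ag , τ) ≡ 2 + (# (list (list bool)) ag + # Type τ)
      play-size a b ag τ = cong (λ n → suc (suc n)) (#-pair (list (list bool)) Type ag τ)

      drop-size : ∀ k τ → # Type (drop k τ) ≤ # Type τ
      drop-size zero    τ       = ≤-refl
      drop-size (suc k) []      = ≤-refl
      drop-size (suc k) (e ∷ τ) = ≤-trans (drop-size k τ) (≤-trans (m≤n+m _ (suc (# Label e))) (≤-reflexive (sym (#-cons Label e τ))))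

      agent-size : ∀ g x y v → # (list bool) x ≤ # Label ((g , x , y) , v)
      agent-size g x y v = ≤-trans (≤-trans (m≤m+n _ _) (≤-reflexive (sym (#-pair (list bool) (list bool) x y))))
        (≤-trans (≤-trans (m≤n+m _ (# TagT g)) (≤-reflexive (sym (#-pair TagT (list bool ⊠ list bool) g (x , y)))))
          (≤-trans (m≤m+n _ _) (≤-reflexive (sym (#-pair Token Verdicts (g , x , y) v)))))

      round-size : ∀ us τ → # Type τ ≤ # Round (us , τ)
      round-size us τ = ≤-trans (m≤n+m _ (# Marks us)) (≤-reflexive (sym (#-pair Marks Type us τ)))

      small : ∀ {m n} → 4 ≤ m + (n + 6)
      small {m} {n} = ≤-trans (≤-trans (s≤s (s≤s (s≤s (s≤s z≤n)))) (m≤n+m 6 n)) (m≤n+m _ m)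

      moved-size : ∀ x us τ′ {m} → # (list bool) x ≤ m → # Play (true , true , x ∷ [] , τ′) ≤ m + (# Round (us , τ′) + 6)
      moved-size x us τ′ {m} h = ≤-trans (≤-reflexive (trans (play-size true true (x ∷ []) τ′)
          (cong (λ k → 2 + (k + # Type τ′)) (#-cons (list bool) x []))))
        (≤-trans (s≤s (s≤s (s≤s (+-mono-≤ (+-monoˡ-≤ 1 h) (round-size us τ′)))))
          (≤-trans (m≤m+n _ 2) (≤-reflexive (solve 2 (λ m r → (:con 3 :+ ((m :+ :con 1) :+ r)) :+ :con 2 := m :+ (r :+ :con 6)) refl m (# Round (us , τ′))))))

    -- The agent that is kept is copied from a node of the old type and so is paid for by the old
    -- play; the new type is paid for by the round.
    rule-size : ∀ r p → # Play (rule r p) ≤ # Play p + (# Round r + 6)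
    rule-size r (false , p) = m≤m+n _ _
    rule-size (us , τ′) (true , false , ag , τ) with coherent τ′ && rootHolds τ′
    ... | false = small {# Play (true , false , ag , τ)}
    ... | true  = ≤-trans (s≤s (s≤s (s≤s (round-size us τ′)))) (≤-trans (≤-trans (m≤n+m _ 3) (≤-reflexive (+-comm 6 (# Round (us , τ′))))) (m≤n+m _ (# Play (true , false , ag , τ))))
    rule-size (us , τ′) (true , true , ag , τ) with select us τ | drop-size (lead us) τ
    ... | []                        | h = small {# Play (true , true , ag , τ)}
    ... | e@((g , x , y) , v) ∷ σ | h with demand ag e | coherent τ′ && (same (boxValues x τ) (boxValues x τ′) && childFails (select us τ′))
    ...   | false | _     = small {# Play (true , true , ag , τ)}
    ...   | true  | false = small {# Play (true , true , ag , τ)}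
    ...   | true  | true  = moved-size x us τ′ (≤-trans (agent-size g x y v) (≤-trans
        (≤-trans (≤-trans (m≤m+n _ _) (n≤1+n _)) (≤-reflexive (sym (#-cons Label e σ))))
        (≤-trans h (≤-trans (m≤n+m _ (2 + # (list (list bool)) ag)) (≤-reflexive (sym (play-size true true ag τ)))))))

    opaque
      refereeT : Tm (History ∷ []) bool
      refereeT = split (fst′ (loop {O = bool} body growth (val (true , false , [] , [])) (val []) (revT v0))) (orT v0 (fst′ v1))
        where
        body : Tm (Round ∷ History ∷ Play ∷ History ∷ []) (Play ⊠ list bool)
        body = pair (call₂ ruleT v0 v2) (val [])
        growth : Growth body
        growth = arg ⊕ con 6 , λ r l p γ → ≤-trans (≤-reflexive (cong (# Play) (ruleT-⟦⟧ r p)))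
          (≤-trans (rule-size r p) (+-monoʳ-≤ (# Play p) (+-monoˡ-≤ 6 (m≤m+n (# Round r) _))))

      refereeT-⟦⟧ : ∀ h → ⟦ refereeT ⟧ (h , tt) ≡ verdictOf (play h)
      refereeT-⟦⟧ h = cong verdictOf (trans (cong (λ k → proj₁ (iterate s (true , false , [] , []) [] k)) (iterate-rev [] h))
          (trans (go (h ʳ++ []) (true , false , [] , []))
            (trans (reverse-foldl (λ p r → rule r p) (true , false , [] , []) h) (as-foldr h))))
        where
        s : El Round → List (El Round) → El Play → El Play × List Bool
        s r _ p = ⟦ ruleT ⟧ (r , p , tt) , []
        go : ∀ k p → proj₁ (iterate s p [] k) ≡ List.foldl (λ p r → rule r p) p k
        go []      p = refl
        go (r ∷ k) p rewrite ruleT-⟦⟧ r p = go k (rule r p)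
        as-foldr : ∀ h → List.foldr rule (true , false , [] , []) h ≡ play h
        as-foldr []      = refl
        as-foldr (r ∷ h) = cong (rule r) (as-foldr h)

-- Backtracking through all plays

module Odometers where

  open Bounds
  open Terms
  open Compilation
  open ListTerms
  open Numerals
  open Parsing
  open Referees

  -- The odometer. Given the referee's verdict v on a history, it backtracks
  -- from the most recent choice: an existential bit is exhausted if v is true
  -- or it already was tried as true, dually for universal bits. Climbing stops
  -- at the first bit that is not exhausted; exhausted bits are reset.
  existential universal : Bool → Bool → Bool → Bool × Bool
  existential v c b = if c then (b || v , not b && not v) else (false , b)
  universal   v c b = if c then (b || not v , not b && v) else (false , b)

  sweep : ∀ {X : Set} → (Bool → X → Bool × X) → Bool → List X → Bool × List X
  sweep s c []       = c , []
  sweep s c (x ∷ xs) = let c₁ , x′ = s c x ; c₂ , xs′ = sweep s c₁ xs in c₂ , x′ ∷ xs′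

  nextVerdicts : Bool → Bool → El Verdicts → Bool × El Verdicts
  nextVerdicts v c (s , a) = let c₁ , s′ = existential v c s ; c₂ , a′ = existential v c₁ a in c₂ , s′ , a′

  nextLabel : Bool → Bool → El Label → Bool × El Label
  nextLabel v c (nd , b) = let c′ , b′ = nextVerdicts v c b in c′ , nd , b′

  -- The carry runs from the innermost choice outwards. The type answers the marks, so it is swept
  -- first; likewise the head of a history is the latest round.
  nextRound : Bool → Bool → El Round → Bool × El Round
  nextRound v c (us , τ) = let c₁ , τ′ = sweep (nextLabel v) c τ ; c₂ , us′ = sweep (universal v) c₁ us in c₂ , us′ , τ′

  nextHistory : Bool → Bool → List (El Round) → Bool × List (El Round)
  nextHistory v = sweep (nextRound v)

  StepT : Ty → Set
  StepT A = Tm (bool ∷ bool ∷ A ∷ []) (bool ⊠ A)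

  opaque
    sweepT : ∀ {A} → StepT A → StepT (list A)
    sweepT s = split (scan bool (split (call₃ s v3 v2 v0) (pair v0 (cons v1 (val [])))) v1 (val []) v2) (pair v0 (revT v1))

    sweepT-⟦⟧ : ∀ {A} (s : StepT A) (f : Bool → Bool → El A → Bool × El A) → (∀ v c x → ⟦ s ⟧ (v , c , x , tt) ≡ f v c x) →
      ∀ v c xs → ⟦ sweepT s ⟧ (v , c , xs , tt) ≡ sweep (f v) c xs
    sweepT-⟦⟧ {A} s f h v c xs = trans (cong₂ _,_ (proj₁-go c [] xs) (trans (iterate-rev [] (proj₂ (iterate g c [] xs))) (proj₂-go c [] xs))) refl
      where
      g : El A → List (El A) → Bool → Bool × List (El A)
      g x _ c = proj₁ (⟦ s ⟧ (v , c , x , tt)) , proj₂ (⟦ s ⟧ (v , c , x , tt)) ∷ []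
      proj₁-go : ∀ c o xs → proj₁ (iterate g c o xs) ≡ proj₁ (sweep (f v) c xs)
      proj₁-go c o []       = refl
      proj₁-go c o (x ∷ xs) rewrite h v c x = proj₁-go _ _ xs
      proj₂-go : ∀ c o xs → proj₂ (iterate g c o xs) ʳ++ [] ≡ o ʳ++ proj₂ (sweep (f v) c xs)
      proj₂-go c o []       = refl
      proj₂-go c o (x ∷ xs) rewrite h v c x = proj₂-go _ (_ ∷ o) xs

  universalT : StepT bool
  universalT = table (bool ⊠ bool ⊠ bool) (λ (v , c , b) → universal v c b) (pair v0 (pair v1 v2))

  universalT-⟦⟧ : ∀ v c b → ⟦ universalT ⟧ (v , c , b , tt) ≡ universal v c b
  universalT-⟦⟧ v c b = table-⟦⟧ (bool ⊠ bool ⊠ bool) (λ (v , c , b) → universal v c b) (pair v0 (pair v1 v2)) (v , c , b , tt)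

  opaque
    labelT : StepT Label
    labelT = split (table (bool ⊠ bool ⊠ bool ⊠ bool) (λ (v , c , b) → nextVerdicts v c b) (pair v0 (pair v1 (snd′ v2)))) (pair v0 (pair (fst′ v4) v1))

    labelT-⟦⟧ : ∀ v c e → ⟦ labelT ⟧ (v , c , e , tt) ≡ nextLabel v c e
    labelT-⟦⟧ v c e = cong (λ r → proj₁ r , proj₁ e , proj₂ r)
      (table-⟦⟧ (bool ⊠ bool ⊠ bool ⊠ bool) (λ (v , c , b) → nextVerdicts v c b) (pair v0 (pair v1 (snd′ v2))) (v , c , e , tt))

  opaque
    roundT : StepT Round
    roundT = split (call₃ (sweepT labelT) v0 v1 (snd′ v2)) (split (call₃ (sweepT universalT) v2 v0 (fst′ v4)) (pair v0 (pair v1 v3)))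

    roundT-⟦⟧ : ∀ v c r → ⟦ roundT ⟧ (v , c , r , tt) ≡ nextRound v c r
    roundT-⟦⟧ v c (us , τ) rewrite sweepT-⟦⟧ labelT nextLabel labelT-⟦⟧ v c τ
      | sweepT-⟦⟧ universalT universal universalT-⟦⟧ v (proj₁ (sweep (nextLabel v) c τ)) us = refl

  module _ (l : Logic) where
    open Referee l

    opaque
      nextT : Tm (bool ⊠ History ∷ []) (bool ⊠ bool ⊠ History)
      nextT = let′ (call₁ refereeT (snd′ v0)) (split (call₃ (sweepT roundT) v0 (val true) (snd′ v1)) (pair (notT v0) (pair v2 v1)))

      nextT-⟦⟧ : ∀ v h → ⟦ nextT ⟧ ((v , h) , tt) ≡
        (let w = verdictOf (play h) ; c , h′ = nextHistory w true h in not c , w , h′)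
      nextT-⟦⟧ v h rewrite refereeT-⟦⟧ h | sweepT-⟦⟧ roundT nextRound roundT-⟦⟧ (verdictOf (play h)) true h =
        cong (_, (verdictOf (play h) , proj₂ (nextHistory (verdictOf (play h)) true h))) (not-cong {proj₁ (nextHistory (verdictOf (play h)) true h)} refl)

  blankLabel : El Token → El Label
  blankLabel nd = nd , false , false

  blankRound : List (El Token) → El Round
  blankRound nds = List.map (λ _ → false) nds , List.map blankLabel nds

  -- One round chooses the root type, and one challenge is granted per node.
  blankHistory : List (El Token) → List (El Round)
  blankHistory nds = List.replicate (suc (length nds)) (blankRound nds)

  opaque
    blankHistoryT : Tm (list Token ∷ []) History
    blankHistoryT = each (cons (pair (mapT (val false) v3) (mapT (pair v0 (val (false , false))) v3)) (val [])) (val []) (cons (val (bare atomTag)) v0)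

    blankHistoryT-⟦⟧ : ∀ nds → ⟦ blankHistoryT ⟧ (nds , tt) ≡ blankHistory nds
    blankHistoryT-⟦⟧ nds = trans
      (accumulate-iterate (λ a l f → round a l f ∷ []) (λ _ _ → blankRound nds ∷ []) (λ a l f → cong (_∷ []) (round≡ a l f)) false [] (bare atomTag ∷ nds))
      (trans (go 0 (bare atomTag ∷ nds)) (cong (λ m → List.replicate m (blankRound nds)) (+-identityʳ (suc (length nds)))))
      where
      round : El Token → List (El Token) → Bool → El Round
      round a l f = ⟦ mapT (val false) v3 ⟧ (a , l , f , nds , tt) , ⟦ mapT (pair v0 (val (false , false))) v3 ⟧ (a , l , f , nds , tt)
      round≡ : ∀ a l f → round a l f ≡ blankRound nds
      round≡ a l f = cong₂ _,_ (mapT-⟦⟧ (val false) v3 (a , l , f , nds , tt)) (mapT-⟦⟧ (pair v0 (val (false , false))) v3 (a , l , f , nds , tt))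
      go : ∀ k (ts : List (El Token)) → accumulate (λ _ _ → blankRound nds ∷ []) (List.replicate k (blankRound nds)) ts ≡
           List.replicate (length ts + k) (blankRound nds)
      go k []       = refl
      go k (t ∷ ts) = trans (go (suc k) ts) (cong (λ m → List.replicate m (blankRound nds)) (+-suc (length ts) k))

  isEmpty : List (El Ty₄) → Bool
  isEmpty []      = true
  isEmpty (_ ∷ _) = false

  module Setup (n : ℕ) (l : Logic) where

    scanned : Word → (Bool × List (El Ty₄)) × List (El Ty₄)
    scanned w = scanFrom true (formula ∷ []) [] w

    tokensOf : Word → List (El Token)
    tokensOf w = proj₂ (grouping ([] , []) [] (proj₂ (scanned w)))

    wellFormed : Word → Bool
    wellFormed w = (proj₁ (proj₁ (scanned w)) && isEmpty (proj₂ (proj₁ (scanned w)))) && every (allowed n l) (tokensOf w)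

    nodesOf : Word → List (El Token)
    nodesOf w = proj₂ (desugaring ([] , []) [] (tokensOf w ʳ++ []))

    opaque
      setupT : Tm (list bool ∷ []) (bool ⊠ bool ⊠ History)
      setupT = split (Scanner.pushdown (val (code formula ∷ [])) v0) (let′ (call₁ groupT v1)
        (pair (andT (andT (fst′ v1) (caseL (snd′ v1) (val true) (val false))) (allT (allowedT n l) v0))
          (pair (val false) (call₁ blankHistoryT (call₁ desugarT (revT v0))))))

      setupT-⟦⟧ : ∀ w → ⟦ setupT ⟧ (w , tt) ≡ (wellFormed w , false , blankHistory (nodesOf w))
      setupT-⟦⟧ w = trans (at (⟦ Scanner.pushdown (val (code formula ∷ [])) v0 ⟧ (w , tt)))
        (cong result (Scanner.pushdown-⟦⟧ (val (code formula ∷ [])) v0 (w , tt)))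
        where
        result : (Bool × List (El Ty₄)) × List (El Ty₄) → Bool × Bool × List (El Round)
        result ((ok , st) , ss) = let ts = proj₂ (grouping ([] , []) [] ss) in
          ((ok && isEmpty st) && every (allowed n l) ts) , false , blankHistory (proj₂ (desugaring ([] , []) [] (ts ʳ++ [])))
        empty : ∀ st → caseList {Y = Bool} st true (λ _ _ → false) ≡ isEmpty st
        empty []      = refl
        empty (_ ∷ _) = refl
        at : ∀ r → ⟦ let′ (call₁ groupT v1)
          (pair (andT (andT (fst′ v1) (caseL (snd′ v1) (val true) (val false))) (allT (allowedT n l) v0))
          (pair (val false) (call₁ blankHistoryT (call₁ desugarT (revT v0))))) ⟧ (proj₁ r , proj₂ r , w , tt) ≡ result r
        at ((ok , st) , ss) rewrite groupT-⟦⟧ ss = cong₂ _,_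
          (and-cong (and-cong {ok} refl (empty st)) (allT-⟦⟧ (allowedT n l) v0 (ts , (ok , st) , ss , w , tt) (allowed n l) (λ t l′ f → allowedT-⟦⟧ n l t _)))
          (cong (false ,_) (trans (blankHistoryT-⟦⟧ _) (cong blankHistory (trans (cong (λ k → ⟦ desugarT ⟧ (k , tt)) (iterate-rev [] ts)) (desugarT-⟦⟧ (ts ʳ++ []))))))
          where
          ts : List (El Token)
          ts = proj₂ (grouping ([] , []) [] ss)

-- The odometer computes the value of the game

module Searches where

  open Bounds
  open Terms
  open Compilation
  open ListTerms
  open Numerals
  open Parsing
  open Referees
  open Odometers

  Next : Set → Set
  Next X = Bool → Bool → X → Bool × X

  -- Starting from x, the search ends with the verdict v and is reset to z.
  data Settles {X : Set} (nx : Next X) (z : X) (f : X → Bool) : X → Bool → Set where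
    exhausted : ∀ {x} → nx (f x) true x ≡ (true , z) → Settles nx z f x (f x)
    advance   : ∀ {x x′ v} → nx (f x) true x ≡ (false , x′) → Settles nx z f x′ v → Settles nx z f x v

  record Searches {X : Set} (nx : Next X) (z : X) (best : (X → Bool) → Bool) : Set where
    field
      idle    : ∀ v x → nx v false x ≡ (false , x)
      settles : ∀ f → Settles nx z f z (best f)
  open Searches

  either both : (Bool → Bool) → Bool
  either f = if f false then true else f true
  both   f = if f false then f true else false

  search-existential : Searches existential false either
  search-existential .idle v x = refl
  search-existential .settles f with f false in e
  ... | true  = subst (Settles existential false f false) e (exhausted (cong (λ v → existential v true false) e))
  ... | false = advance (cong (λ v → existential v true false) e) (exhausted refl)

  search-universal : Searches universal false both
  search-universal .idle v x = refl
  search-universal .settles f with f false in e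
  ... | false = subst (Settles universal false f false) e (exhausted (cong (λ v → universal v true false) e))
  ... | true  = advance (cong (λ v → universal v true false) e) (exhausted refl)

  -- While the inner search goes on, the outer component idles. The inner search ends with its
  -- optimal verdict, reset to `zy` and with a carry, so the outer component advances on the verdict
  -- `by (f ∘ join x)` and the inner search starts afresh. Nested quantifiers thus become one
  -- search.
  module Combine {X Y Z : Set} {nxX : Next X} {nxY : Next Y} {zx : X} {zy : Y} {bx : (X → Bool) → Bool} {by : (Y → Bool) → Bool}
    (join : X → Y → Z) (nxZ : Next Z)
    (law : ∀ v c x y → nxZ v c (join x y) ≡ (proj₁ (nxX v (proj₁ (nxY v c y)) x) , join (proj₂ (nxX v (proj₁ (nxY v c y)) x)) (proj₂ (nxY v c y))))
    (sx : Searches nxX zx bx) (sy : Searches nxY zy by) where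

    private
      module _ (f : Z → Bool) where
        carry : ∀ {x y w c x′} → nxY w true y ≡ (true , zy) → nxX w true x ≡ (c , x′) → nxZ w true (join x y) ≡ (c , join x′ zy)
        carry {x} {y} {w} e e′ = trans (law w true x y) (trans (cong (λ r → let c₂ , x′ = nxX w (proj₁ r) x in c₂ , join x′ (proj₂ r)) e)
          (cong (λ r → proj₁ r , join (proj₂ r) zy) e′))

        within : ∀ {x y w y′} → nxY w true y ≡ (false , y′) → nxZ w true (join x y) ≡ (false , join x y′)
        within {x} {y} {w} {y′} e = trans (law w true x y) (trans (cong (λ r → let c₂ , x′ = nxX w (proj₁ r) x in c₂ , join x′ (proj₂ r)) e)
          (cong (λ r → proj₁ r , join (proj₂ r) y′) (idle sx w x)))

        finish : ∀ {x y w} → Settles nxY zy (f ∘ join x) y w → nxX w true x ≡ (true , zx) → Settles nxZ (join zx zy) f (join x y) w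
        finish {x} {y} (exhausted e) e′ = exhausted (carry e e′)
        finish (advance e s) e′ = advance (within e) (finish s e′)

        continue : ∀ {x y w x′ v} → Settles nxY zy (f ∘ join x) y w → nxX w true x ≡ (false , x′) →
                   Settles nxZ (join zx zy) f (join x′ zy) v → Settles nxZ (join zx zy) f (join x y) v
        continue (exhausted e) e′ t = advance (carry e e′) t
        continue (advance e s) e′ t = advance (within e) (continue s e′ t)

        outer : ∀ {x v} → Settles nxX zx (λ x → by (f ∘ join x)) x v → Settles nxZ (join zx zy) f (join x zy) v
        outer {x} (exhausted e) = finish (settles sy (f ∘ join x)) e
        outer {x} (advance e s) = continue (settles sy (f ∘ join x)) e (outer s)

    combine-settles : ∀ f → Settles nxZ (join zx zy) f (join zx zy) (bx (λ x → by (f ∘ join x)))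
    combine-settles f = outer f (settles sx (λ x → by (f ∘ join x)))

  search-verdicts : Searches nextVerdicts (false , false) (λ f → either (λ a → either (λ s → f (s , a))))
  search-verdicts .idle v x = refl
  search-verdicts .settles = Combine.combine-settles (λ a s → s , a) nextVerdicts (λ _ _ _ _ → refl) search-existential search-existential

  bestLabel : El Token → (El Label → Bool) → Bool
  bestLabel nd f = either (λ a → either (λ s → f (nd , s , a)))

  search-label : ∀ nd → Searches nextLabel (blankLabel nd) (bestLabel nd)
  search-label nd .idle v x = refl
  search-label nd .settles f = go (settles search-verdicts (λ b → f (nd , b)))
    where
    go : ∀ {b v} → Settles nextVerdicts (false , false) (λ b → f (nd , b)) b v → Settles nextLabel (blankLabel nd) f (nd , b) v
    go (exhausted e) = exhausted (cong (λ r → proj₁ r , nd , proj₂ r) e)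
    go (advance e s) = advance (cong (λ r → proj₁ r , nd , proj₂ r) e) (go s)

  sweep-idle : ∀ {X : Set} (nx : Next X) → (∀ v x → nx v false x ≡ (false , x)) → ∀ v xs → sweep (nx v) false xs ≡ (false , xs)
  sweep-idle nx h v []       = refl
  sweep-idle nx h v (x ∷ xs) rewrite h v x | sweep-idle nx h v xs = refl

  search-nil : ∀ {X : Set} {nx : Next X} → (∀ v x → nx v false x ≡ (false , x)) → Searches (λ v → sweep (nx v)) [] (λ f → f [])
  search-nil {nx = nx} h .idle = sweep-idle nx h
  search-nil h .settles f = exhausted refl

  search-cons : ∀ {X : Set} {nx : Next X} {z zs b bs} → Searches nx z b → Searches (λ v → sweep (nx v)) zs bs →
    Searches (λ v → sweep (nx v)) (z ∷ zs) (λ f → bs (λ xs → b (λ x → f (x ∷ xs))))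
  search-cons {nx = nx} s t .idle = sweep-idle nx (idle s)
  search-cons {nx = nx} s t .settles = Combine.combine-settles (λ xs x → x ∷ xs) (λ v → sweep (nx v)) (λ _ _ _ _ → refl) t s

  bestType : List (El Token) → (List (El Label) → Bool) → Bool
  bestType []         f = f []
  bestType (nd ∷ nds) f = bestType nds (λ τ → bestLabel nd (λ e → f (e ∷ τ)))

  bestMarks : List (El Token) → (List Bool → Bool) → Bool
  bestMarks []         f = f []
  bestMarks (nd ∷ nds) f = bestMarks nds (λ us → both (λ u → f (u ∷ us)))

  search-type : ∀ nds → Searches (λ v → sweep (nextLabel v)) (List.map blankLabel nds) (bestType nds)
  search-type []         = search-nil (λ _ _ → refl)
  search-type (nd ∷ nds) = search-cons (search-label nd) (search-type nds)

  search-marks : ∀ nds → Searches (λ v → sweep (universal v)) (List.map (λ _ → false) nds) (bestMarks nds)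
  search-marks []         = search-nil (λ _ _ → refl)
  search-marks (nd ∷ nds) = search-cons search-universal (search-marks nds)

  bestRound : List (El Token) → (El Round → Bool) → Bool
  bestRound nds f = bestMarks nds (λ us → bestType nds (λ τ → f (us , τ)))

  search-round : ∀ nds → Searches nextRound (blankRound nds) (bestRound nds)
  search-round nds .idle v (us , τ)
    rewrite sweep-idle nextLabel (λ _ _ → refl) v τ | sweep-idle universal (λ _ _ → refl) v us = refl
  search-round nds .settles = Combine.combine-settles _,_ nextRound (λ _ _ _ _ → refl) (search-marks nds) (search-type nds)

  bestHistory : List (El Token) → ℕ → (List (El Round) → Bool) → Bool
  bestHistory nds zero    f = f []
  bestHistory nds (suc m) f = bestHistory nds m (λ h → bestRound nds (λ r → f (r ∷ h)))

  search-history : ∀ nds m → Searches nextHistory (List.replicate m (blankRound nds)) (bestHistory nds m)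
  search-history nds zero    = search-nil (idle (search-round nds))
  search-history nds (suc m) = search-cons (search-round nds) (search-history nds m)

  bestType-∃ : ∀ nds f → bestType nds f ≡ true → Σ[ τ ∈ List (El Label) ] List.map proj₁ τ ≡ nds × f τ ≡ true
  bestType-∃ []         f h = [] , refl , h
  bestType-∃ (nd ∷ nds) f h with bestType-∃ nds _ h
  ... | τ , refl , h′ with f ((nd , false , false) ∷ τ) in e₀ | f ((nd , true , false) ∷ τ) in e₁ | f ((nd , false , true) ∷ τ) in e₂
  ... | true  | _     | _     = _ , refl , e₀
  ... | false | true  | _     = _ , refl , e₁
  ... | false | false | true  = _ , refl , e₂
  ... | false | false | false = _ , refl , h′

  bestLabel-any : ∀ nd f b → f (nd , b) ≡ true → bestLabel nd f ≡ true
  bestLabel-any nd f (s , a) h with f (nd , false , false) in e₀ | f (nd , true , false) in e₁ | f (nd , false , true) in e₂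
  ... | true  | _     | _     = refl
  ... | false | true  | _     = refl
  ... | false | false | true  = refl
  bestLabel-any nd f (false , false) h | false | false | false with () ← trans (sym h) e₀
  bestLabel-any nd f (true , false)  h | false | false | false with () ← trans (sym h) e₁
  bestLabel-any nd f (false , true)  h | false | false | false with () ← trans (sym h) e₂
  bestLabel-any nd f (true , true)   h | false | false | false = h

  bestType-any : ∀ τ f → f τ ≡ true → bestType (List.map proj₁ τ) f ≡ true
  bestType-any []             f h = h
  bestType-any ((nd , b) ∷ τ) f h = bestType-any τ (λ τ → bestLabel nd (λ e → f (e ∷ τ))) (bestLabel-any nd (λ e → f (e ∷ τ)) b h)

  bestMarks-∀ : ∀ nds f → bestMarks nds f ≡ true → ∀ us → length us ≡ length nds → f us ≡ true
  bestMarks-∀ []         f h []       e = h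
  bestMarks-∀ (nd ∷ nds) f h (u ∷ us) e = at u (bestMarks-∀ nds _ h us (suc-injective e))
    where
    at : ∀ u → both (λ u → f (u ∷ us)) ≡ true → f (u ∷ us) ≡ true
    at u h with f (false ∷ us) in e
    at false h | true = e
    at true  h | true = h

  bestMarks-all : ∀ nds f → (∀ us → length us ≡ length nds → f us ≡ true) → bestMarks nds f ≡ true
  bestMarks-all []         f h = h [] refl
  bestMarks-all (nd ∷ nds) f h = bestMarks-all nds _ (λ us e → at us (h (false ∷ us) (cong suc e)) (h (true ∷ us) (cong suc e)))
    where
    at : ∀ us → f (false ∷ us) ≡ true → f (true ∷ us) ≡ true → both (λ u → f (u ∷ us)) ≡ true
    at us e e′ rewrite e = e′

  -- The odometer only flips bits in place, so every history is as large as the first one, which the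
  -- set-up writes in polynomial time.
  sweep-size : ∀ {A} (s : Bool → El A → Bool × El A) → (∀ c x → # A (proj₂ (s c x)) ≡ # A x) →
    ∀ c xs → # (list A) (proj₂ (sweep s c xs)) ≡ # (list A) xs
  sweep-size s h c []       = refl
  sweep-size {A} s h c (x ∷ xs) = trans (#-cons A _ _)
    (trans (cong suc (cong₂ _+_ (h c x) (sweep-size {A} s h _ xs))) (sym (#-cons A x xs)))

  nextLabel-size : ∀ v c e → # Label (proj₂ (nextLabel v c e)) ≡ # Label e
  nextLabel-size v c (nd , b) = trans (#-pair Token Verdicts nd _) (sym (#-pair Token Verdicts nd b))

  nextRound-size : ∀ v c r → # Round (proj₂ (nextRound v c r)) ≡ # Round r
  nextRound-size v c (us , τ) = trans (#-pair Marks Type (proj₂ (sweep (universal v) (proj₁ (sweep (nextLabel v) c τ)) us)) (proj₂ (sweep (nextLabel v) c τ)))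
    (trans (cong₂ _+_ (sweep-size {bool} (universal v) (λ _ _ → refl) (proj₁ (sweep (nextLabel v) c τ)) us) (sweep-size {Label} (nextLabel v) (nextLabel-size v) c τ))
      (sym (#-pair Marks Type us τ)))

  module Game (l : Logic) where
    open Referee l

    value-of : List (El Token) → ℕ → El Play → Bool
    value-of nds zero    p = verdictOf p
    value-of nds (suc m) p = bestRound nds (λ r → value-of nds m (rule r p))

    -- Histories grow at the head, so the oldest round is quantified outermost, and optimizing over
    -- whole histories agrees with playing round by round.
    bestHistory-value : ∀ nds m k → bestHistory nds m (λ h → value-of nds k (play h)) ≡ value-of nds (m + k) (play [])
    bestHistory-value nds zero    k = refl
    bestHistory-value nds (suc m) k = trans (bestHistory-value nds m (suc k)) (cong (λ j → value-of nds j (play [])) (+-suc m k))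

    module _ (n : ℕ) where
      open Setup n l

      accepts : Word → Bool
      accepts w = wellFormed w && value-of (nodesOf w) (suc (length (nodesOf w))) (play [])

      private
        Y = bool ⊠ History
        step′ : El Y → Bool × El Y
        step′ y = ⟦ nextT l ⟧ (y , tt)

        bound : Bound
        -- A word of length `n` has a code of `2 n + 1` bits as a list.
        bound = (arg ⊕ proj₁ (feasible setupT all)) ∘ᵇ (con 2 ⊗ arg ⊕ con 1)

        input-size : ∀ w → ## (list bool ∷ []) (w , tt) ≡ 2 * length w + 1
        input-size w = trans (cong length (++-identityʳ (enc (list bool) w))) (trans (length-++ (elems (enc bool) w)) (cong (_+ 1) (go w)))
          where
          go : ∀ w → length (elems (enc bool) w) ≡ 2 * length w
          go []      = refl
          go (b ∷ w) = trans (cong (λ m → suc (suc m)) (go w)) (sym (*-suc 2 (length w)))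

        setup-size : ∀ w b → # Y (b , blankHistory (nodesOf w)) ≤ ⟪ bound ⟫ (length w)
        setup-size w b = ≤-trans (≤-trans (n≤1+n _) (≤-reflexive (sym (cong (# (bool ⊠ Y)) (setupT-⟦⟧ w)))))
          (≤-trans (result-size setupT (proj₂ (feasible setupT all)) (w , tt)) (≤-reflexive (cong (λ m → ⟪ arg ⊕ proj₁ (feasible setupT all) ⟫ m) (input-size w))))

        settles-ends : ∀ {m z h v} b → # Y (b , h) ≤ m → Settles nextHistory z (verdictOf ∘ play) h v →
          Ends {Y} step′ m (true , b , h) (v , z)
        settles-ends {h = h} b le (exhausted e) = again le (subst (λ p → Ends {Y} step′ _ p _)
          (sym (trans (nextT-⟦⟧ l b h) (cong (λ r → not (proj₁ r) , verdictOf (play h) , proj₂ r) e))) ended)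
        settles-ends {m} {h = h} b le (advance {x′ = h′} e s) = again le (subst (λ p → Ends {Y} step′ _ p _)
          (sym (trans (nextT-⟦⟧ l b h) (cong (λ r → not (proj₁ r) , verdictOf (play h) , proj₂ r) e)))
          (settles-ends (verdictOf (play h)) (≤-trans (≤-reflexive (cong suc same-size)) le) s))
          where
          same-size : # History h′ ≡ # History h
          same-size = trans (cong (# History ∘ proj₂) (sym e)) (sweep-size {Round} (nextRound (verdictOf (play h))) (nextRound-size (verdictOf (play h))) true h)

      game-inPSPACE : ∀ {L : Language} → (∀ w → accepts w ≡ true ⇔ w ∈ L) → InPSPACE L
      game-inPSPACE {L} h = inPSPACE setupT (nextT l) bound correct
        where
        correct : ∀ w → Σ[ z ∈ El Y ] Ends {Y} step′ (⟪ bound ⟫ (length w)) (⟦ setupT ⟧ (w , tt)) z × (proj₁ z ≡ true ⇔ w ∈ L)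
        correct w rewrite setupT-⟦⟧ w with wellFormed w in good | h w
        ... | false | h′ = (false , blankHistory (nodesOf w)) , ended , h′
        ... | true  | h′ = (value-of (nodesOf w) (suc (length (nodesOf w))) (play []) , blankHistory (nodesOf w)) ,
          settles-ends false (setup-size w false)
            (subst (Settles nextHistory (blankHistory (nodesOf w)) (verdictOf ∘ play) (blankHistory (nodesOf w)))
              (trans (bestHistory-value (nodesOf w) (suc (length (nodesOf w))) 0)
                (cong (λ j → value-of (nodesOf w) j (play [])) (+-identityʳ (suc (length (nodesOf w))))))
              (settles (search-history (nodesOf w) (suc (length (nodesOf w)))) (verdictOf ∘ play))) ,
          h′

-- Desugared formulas and their semantics

module Queries where

  open Bounds
  open Terms
  open ListTerms
  open Numerals
  open Parsing
  open Referees
  open Odometers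
  open Equivalence using (to; from)

  data Query (n : ℕ) : Set where
    atomQ     : ℕ → Query n
    litQ      : Fin n → ℕ → Query n
    negQ      : Query n → Query n
    andQ annQ : Query n → Query n → Query n
    boxQ      : Fin n → Query n → Query n

  agent : ∀ {n} → Fin n → Digits
  agent a = numeral (toℕ a)

  nodes : ∀ {n} → Query n → List (El Token)
  nodes (atomQ p)  = (atomTag , numeral p , []) ∷ []
  nodes (litQ a k) = (litTag , agent a , numeral k) ∷ []
  nodes (negQ q)   = bare negTag ∷ nodes q
  nodes (andQ q r) = bare andTag ∷ nodes q ++ nodes r
  nodes (annQ q r) = bare annTag ∷ nodes q ++ nodes r
  nodes (boxQ a q) = (boxTag , agent a , []) ∷ nodes q

  -- The second argument is the total depth of the announcements around.
  query : ∀ {n l} → Formula n l → ℕ → Query n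
  query (atom p)  o = atomQ p
  query (E a k)   o = andQ (litQ a (o + k)) (negQ (litQ a (suc (o + k))))
  query (P a k)   o = litQ a (o + k)
  query (∼ φ)     o = negQ (query φ o)
  query (φ ∧ ψ)   o = andQ (query φ o) (query ψ o)
  query (K a φ)   o = andQ (litQ a (o + modalDepth φ)) (boxQ a (query φ o))
  query (K∞ a φ)  o = boxQ a (query φ o)
  query ([ φ ] ψ) o = annQ (query φ o) (query ψ (o + modalDepth φ))

  raw : ∀ {n l} → Formula n l → Raw
  raw (atom p)  = atomR (numeral p)
  raw (E a k)   = leafR false (agent a) (numeral k)
  raw (P a k)   = leafR true (agent a) (numeral k)
  raw (∼ φ)     = negR (raw φ)
  raw (φ ∧ ψ)   = binR false (raw φ) (raw ψ)
  raw (K a φ)   = modR false (agent a) (raw φ)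
  raw (K∞ a φ)  = modR true (agent a) (raw φ)
  raw ([ φ ] ψ) = binR true (raw φ) (raw ψ)

  encodeℕ-digits : ∀ k → encodeℕ k ≡ encodeDigits (numeral k)
  encodeℕ-digits k = go (fromℕ k)
    where
    go : ∀ b → encodeℕᵇ b ≡ encodeDigits (digits b)
    go zero     = refl
    go 2[1+ b ] = cong (λ w → true ∷ true ∷ w) (go b)
    go 1+[2 b ] = cong (λ w → true ∷ false ∷ w) (go b)

  encode-raw : ∀ {n l} (φ : Formula n l) → encode φ ≡ encodeR (raw φ)
  encode-raw (atom p)  = cong (λ w → false ∷ false ∷ false ∷ w) (encodeℕ-digits p)
  encode-raw (E a k)   = cong₂ (λ v w → false ∷ false ∷ true ∷ v ++ w) (encodeℕ-digits (toℕ a)) (encodeℕ-digits k)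
  encode-raw (P a k)   = cong₂ (λ v w → false ∷ true ∷ false ∷ v ++ w) (encodeℕ-digits (toℕ a)) (encodeℕ-digits k)
  encode-raw (∼ φ)     = cong (λ w → false ∷ true ∷ true ∷ w) (encode-raw φ)
  encode-raw (φ ∧ ψ)   = cong₂ (λ v w → true ∷ false ∷ false ∷ v ++ w) (encode-raw φ) (encode-raw ψ)
  encode-raw (K a φ)   = cong₂ (λ v w → true ∷ false ∷ true ∷ v ++ w) (encodeℕ-digits (toℕ a)) (encode-raw φ)
  encode-raw (K∞ a φ)  = cong₂ (λ v w → true ∷ true ∷ false ∷ v ++ w) (encodeℕ-digits (toℕ a)) (encode-raw φ)
  encode-raw ([ φ ] ψ) = cong₂ (λ v w → true ∷ true ∷ true ∷ v ++ w) (encode-raw φ) (encode-raw ψ)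

  private
    m+[n∸m] : ∀ m n → m + (n ∸ m) ≡ m ⊔ n
    m+[n∸m] zero    n       = refl
    m+[n∸m] (suc m) zero    = cong suc (+-identityʳ m)
    m+[n∸m] (suc m) (suc n) = cong suc (m+[n∸m] m n)

  depthR-raw : ∀ {n l} (φ : Formula n l) → length (depthR (raw φ)) ≡ modalDepth φ
  depthR-raw (atom p)  = refl
  depthR-raw (E a k)   = refl
  depthR-raw (P a k)   = refl
  depthR-raw (∼ φ)     = depthR-raw φ
  depthR-raw (φ ∧ ψ)   = trans (length-++ (depthR (raw φ))) (trans (cong (length (depthR (raw φ)) +_) (length-drop (length (depthR (raw φ))) (depthR (raw ψ))))
    (trans (m+[n∸m] (length (depthR (raw φ))) (length (depthR (raw ψ)))) (cong₂ _⊔_ (depthR-raw φ) (depthR-raw ψ))))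
  depthR-raw (K a φ)   = cong suc (depthR-raw φ)
  depthR-raw (K∞ a φ)  = cong suc (depthR-raw φ)
  depthR-raw ([ φ ] ψ) = trans (length-++ (depthR (raw φ))) (cong₂ _+_ (depthR-raw φ) (depthR-raw ψ))

  nodes-query : ∀ {n l} (φ : Formula n l) o → nodesR (raw φ) o ≡ nodes (query φ (length o))
  nodes-query (atom p)  o = refl
  nodes-query (E a k)   o = cong₂ (λ u v → bare andTag ∷ (litTag , agent a , u) ∷ bare negTag ∷ (litTag , agent a , v) ∷ [])
    (add-numeral k o) (trans (cong increment (add-numeral k o)) (numeral-suc (length o + k)))
  nodes-query (P a k)   o = cong (λ u → (litTag , agent a , u) ∷ []) (add-numeral k o)
  nodes-query (∼ φ)     o = cong (bare negTag ∷_) (nodes-query φ o)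
  nodes-query (φ ∧ ψ)   o = cong₂ (λ u v → bare andTag ∷ u ++ v) (nodes-query φ o) (nodes-query ψ o)
  nodes-query (K a φ)   o = cong₂ (λ u v → bare andTag ∷ (litTag , agent a , u) ∷ (boxTag , agent a , []) ∷ v)
    (trans (cong (λ z → add z o) (add-numeral 0 (depthR (raw φ)))) (trans (add-numeral (length (depthR (raw φ)) + 0) o)
      (cong (λ d → numeral (length o + d)) (trans (+-identityʳ _) (depthR-raw φ))))) (nodes-query φ o)
  nodes-query (K∞ a φ)  o = cong ((boxTag , agent a , []) ∷_) (nodes-query φ o)
  nodes-query ([ φ ] ψ) o = cong₂ (λ u v → bare annTag ∷ u ++ v) (nodes-query φ o)
    (trans (nodes-query ψ (o ++ depthR (raw φ))) (cong (λ m → nodes (query ψ m)) (trans (length-++ o) (cong (length o +_) (depthR-raw φ)))))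

  every-++ : ∀ {X : Set} (p : X → Bool) xs ys → every p (xs ++ ys) ≡ (every p xs && every p ys)
  every-++ p []       ys = refl
  every-++ p (x ∷ xs) ys = trans (cong (p x &&_) (every-++ p xs ys)) (&&-assoc (p x) _ _)

  &&-true : ∀ {a b} → (a && b) ≡ true → a ≡ true × b ≡ true
  &&-true {true} h = refl , h

  &&-intro : ∀ {a b} → a ≡ true → b ≡ true → (a && b) ≡ true
  &&-intro refl refl = refl

  known-agent : ∀ n x → known n x ≡ true → Σ[ a ∈ ℕ ] a < n × x ≡ numeral a
  known-agent (suc m) x h with same x (numeral m) in e
  ... | true  = m , ≤-refl , same⁻ x (numeral m) e
  ... | false with a , a< , e′ ← known-agent m x h = a , m<n⇒m<1+n a< , e′

  known-fin : ∀ n x → known n x ≡ true → Σ[ a ∈ Fin n ] x ≡ agent a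
  known-fin n x h with a , a< , e ← known-agent n x h = fromℕ< a< , trans e (cong numeral (sym (toℕ-fromℕ< a<)))

  agent-known : ∀ {n} (a : Fin n) → known n (agent a) ≡ true
  agent-known {n} a = go n (toℕ a) (toℕ<n a)
    where
    go : ∀ n k → k < n → known n (numeral k) ≡ true
    go (suc m) k (s≤s k≤m) with same (numeral k) (numeral m) in e
    ... | true  = refl
    ... | false with m≤n⇒m<n∨m≡n k≤m
    ...   | inj₁ k<m = go m k k<m
    ...   | inj₂ refl with () ← trans (sym e) (same-refl (numeral k))

  numeral-value : ∀ x → x ≡ numeral (value x)
  numeral-value x = value-injective _ _ (sym (value-numeral (value x)))

  parse : ∀ n l r → every (allowed n l) (tokens r) ≡ true → Σ[ φ ∈ Formula n l ] raw φ ≡ r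
  parse n l (atomR x) h = atom (value x) , cong atomR (sym (numeral-value x))
  parse n l (leafR false x y) h with a , refl ← known-fin n x (proj₁ (&&-true h)) = E a (value y) , cong (leafR false (agent a)) (sym (numeral-value y))
  parse n l (leafR true x y) h with a , refl ← known-fin n x (proj₁ (&&-true h)) = P a (value y) , cong (leafR true (agent a)) (sym (numeral-value y))
  parse n l (negR r) h with φ , refl ← parse n l r h = ∼ φ , refl
  parse n l (binR false r s) h with h₁ , h₂ ← &&-true (trans (sym (every-++ (allowed n l) (tokens r) (tokens s))) h)
    with φ , refl ← parse n l r h₁ | ψ , refl ← parse n l s h₂ = φ ∧ ψ , refl
  parse n EDPAL (binR true r s) h with h₁ , h₂ ← &&-true (trans (sym (every-++ (allowed n EDPAL) (tokens r) (tokens s))) h)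
    with φ , refl ← parse n EDPAL r h₁ | ψ , refl ← parse n EDPAL s h₂ = [ φ ] ψ , refl
  parse n l (modR false x r) h with h₁ , h₂ ← &&-true {known n x} h
    with a , refl ← known-fin n x h₁ | φ , refl ← parse n l r h₂ = K a φ , refl
  parse n l (modR true x r) h with h₁ , h₂ ← &&-true {known n x} h
    with a , refl ← known-fin n x h₁ | φ , refl ← parse n l r h₂ = K∞ a φ , refl

  raw-allowed : ∀ {n l} (φ : Formula n l) → every (allowed n l) (tokens (raw φ)) ≡ true
  raw-allowed (atom p)  = refl
  raw-allowed (E a k)   = &&-intro (agent-known a) refl
  raw-allowed (P a k)   = &&-intro (agent-known a) refl
  raw-allowed (∼ φ)     = raw-allowed φ
  raw-allowed {n} {l} (φ ∧ ψ)   = trans (every-++ (allowed n l) (tokens (raw φ)) _) (&&-intro (raw-allowed φ) (raw-allowed ψ))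
  raw-allowed (K a φ)   = &&-intro (agent-known a) (raw-allowed φ)
  raw-allowed (K∞ a φ)  = &&-intro (agent-known a) (raw-allowed φ)
  raw-allowed {n} {l} ([ φ ] ψ) = trans (every-++ (allowed n l) (tokens (raw φ)) _) (&&-intro (raw-allowed φ) (raw-allowed ψ))

  isEmpty⁻ : ∀ st → isEmpty st ≡ true → st ≡ []
  isEmpty⁻ [] _ = refl

  module _ (n : ℕ) (l : Logic) where
    open Setup n l

    scanned-raw : ∀ r → scanned (encodeR r) ≡ ((true , []) , syms r ʳ++ [])
    scanned-raw r = trans (cong scanned (sym (++-identityʳ (encodeR r)))) (scan-raw r [] [] [])

    tokensOf-raw : ∀ r → tokensOf (encodeR r) ≡ tokens r
    tokensOf-raw r rewrite scanned-raw r | group-raw r [] [] = ++-identityʳ (tokens r)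

    nodesOf-raw : ∀ r → nodesOf (encodeR r) ≡ nodesR r []
    nodesOf-raw r rewrite tokensOf-raw r | desugar-raw r [] [] [] [] = ++-identityʳ (nodesR r [])

    wellFormed⁺ : (φ : Formula n l) → wellFormed (encode φ) ≡ true
    wellFormed⁺ φ rewrite encode-raw φ | tokensOf-raw (raw φ) | scanned-raw (raw φ) = raw-allowed φ

    nodesOf-encode : (φ : Formula n l) → nodesOf (encode φ) ≡ nodes (query φ 0)
    nodesOf-encode φ rewrite encode-raw φ = trans (nodesOf-raw (raw φ)) (nodes-query φ [])

    wellFormed⁻ : ∀ w → wellFormed w ≡ true → Σ[ φ ∈ Formula n l ] encode φ ≡ w
    wellFormed⁻ w h with h₁ , h₂ ← &&-true {proj₁ (proj₁ (scanned w)) && isEmpty (proj₂ (proj₁ (scanned w)))} h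
      with h₃ , h₄ ← &&-true {proj₁ (proj₁ (scanned w))} h₁
      with r , _ , e , refl ← scan-derives w (formula ∷ []) [] (h₃ , isEmpty⁻ _ h₄)
      with φ , e′ ← parse n l r (trans (cong (every (allowed n l)) (trans (sym (tokensOf-raw r)) (cong tokensOf (sym (trans e (++-identityʳ _)))))) h₂) =
      φ , trans (encode-raw φ) (trans (cong encodeR e′) (sym (trans e (++-identityʳ _))))

  -- Satisfaction of queries. The predicate Alive holds of the states that
  -- survive the announcements around.

  module _ {n l} (M : Model n l) where
    open Model M

    Holds : Query n → (S → Set) → S → Set
    Holds (atomQ p)  Alive s = V s p ≡ true
    Holds (litQ a k) Alive s = HasDepthAtLeast l (d a s) k
    Holds (negQ q)   Alive s = ¬ Holds q Alive s
    Holds (andQ q r) Alive s = Holds q Alive s × Holds r Alive s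
    Holds (boxQ a q) Alive s = ∀ t → s ~[ a ] t → Alive t → Holds q Alive t
    Holds (annQ q r) Alive s = Holds q Alive s → Holds r (λ t → Alive t × Holds q Alive t) s

  -- N is M restricted to the states in Alive, with depths lowered by o.
  record View {n l} (M N : Model n l) (Alive : Model.S M → Set) (o : ℕ) : Set where
    private
      module M = Model M
      module N = Model N
    field
      embed  : N.S → M.S
      lives  : ∀ s → Alive (embed s)
      covers : ∀ s → Alive s → Σ[ s′ ∈ N.S ] embed s′ ≡ s
      rel    : ∀ {s t a} → s N.~[ a ] t ⇔ embed s M.~[ a ] embed t
      atoms  : ∀ s p → N.V s p ≡ M.V (embed s) p
      depth  : ∀ a s k → HasDepthAtLeast l (N.d a s) k ⇔ HasDepthAtLeast l (M.d a (embed s)) (o + k)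

  exact : ∀ l x k → HasDepth l x k ⇔ (HasDepthAtLeast l x k × ¬ HasDepthAtLeast l x (suc k))
  exact DBEL x k = mk⇔ (λ { refl → ≤-refl , 1+n≰n }) (λ (h , h′) → ≤-antisym (≤-pred (≰⇒> h′)) h)
  exact EDPAL x k = mk⇔ (λ { refl → ℤ.≤-refl , λ { (ℤ.+≤+ h) → 1+n≰n h } }) (λ (h , h′) → go x h h′)
    where
    go : ∀ x → ℤ.+ k ℤ.≤ x → ¬ (ℤ.+ suc k ℤ.≤ x) → x ≡ ℤ.+ k
    go (ℤ.+ m) (ℤ.+≤+ h) h′ = cong ℤ.+_ (≤-antisym (≤-pred (≰⇒> (λ h″ → h′ (ℤ.+≤+ h″)))) h)

  lower : ∀ x k m → (ℤ.+ m ℤ.≤ x ℤ.- ℤ.+ k) ⇔ (ℤ.+ (k + m) ℤ.≤ x)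
  lower x k m = mk⇔ (λ h → subst (ℤ.+ (k + m) ℤ.≤_) back (ℤ.+-monoʳ-≤ (ℤ.+ k) h))
    (λ h → ℤ.≤-trans (ℤ.≤-reflexive forth) (ℤ.+-monoˡ-≤ (ℤ.- ℤ.+ k) h))
    where
    back : ℤ.+ k ℤ.+ (x ℤ.- ℤ.+ k) ≡ x
    back = trans (ℤ.+-comm (ℤ.+ k) (x ℤ.- ℤ.+ k)) (trans (ℤ.+-assoc x (ℤ.- ℤ.+ k) (ℤ.+ k)) (trans (cong (λ z → x ℤ.+ z) (ℤ.+-inverseˡ (ℤ.+ k))) (ℤ.+-identityʳ x)))
    forth : ℤ.+ m ≡ ℤ.+ (k + m) ℤ.- ℤ.+ k
    forth = sym (trans (cong (λ z → ℤ.+ z ℤ.- ℤ.+ k) (+-comm k m)) (trans (ℤ.+-assoc (ℤ.+ m) (ℤ.+ k) (ℤ.- ℤ.+ k))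
      (trans (cong (λ z → ℤ.+ m ℤ.+ z) (ℤ.+-inverseʳ (ℤ.+ k))) (ℤ.+-identityʳ (ℤ.+ m)))))

  -- Only an announcement changes the view: fewer states survive, and the thresholds rise by
  -- `modalDepth φ`, which compensates for the lowered depths. The model `M` stays fixed, so no
  -- chain of restricted models has to be searched for.
  sat-holds : ∀ {n l} {M N : Model n l} {Alive o} (v : View M N Alive o) (φ : Formula n l) s →
              Sat N s φ ⇔ Holds M (query φ o) Alive (View.embed v s)
  sat-holds v (atom p) s = mk⇔ (trans (sym (View.atoms v s p))) (trans (View.atoms v s p))
  sat-holds {l = l} {M} {N} {o = o} v (E a k) s = mk⇔
    (λ h → let h₁ , h₂ = to (exact l _ k) h in to (depth a s k) h₁ , λ h₃ → h₂ (from (depth a s (suc k)) (subst at (sym (+-suc o k)) h₃)))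
    (λ (h₁ , h₂) → from (exact l _ k) (from (depth a s k) h₁ , λ h₃ → h₂ (subst at (+-suc o k) (to (depth a s (suc k)) h₃))))
    where
    open View v
    at = HasDepthAtLeast l (Model.d M a (embed s))
  sat-holds v (P a k) s = View.depth v a s k
  sat-holds v (∼ φ) s = mk⇔ (λ h h′ → h (from (sat-holds v φ s) h′)) (λ h h′ → h (to (sat-holds v φ s) h′))
  sat-holds v (φ ∧ ψ) s = mk⇔ (λ (h , h′) → to (sat-holds v φ s) h , to (sat-holds v ψ s) h′)
    (λ (h , h′) → from (sat-holds v φ s) h , from (sat-holds v ψ s) h′)
  sat-holds {l = l} {M} {N} {Alive} {o} v (K a φ) s = mk⇔
    (λ (h , h′) → to (depth a s (modalDepth φ)) h , λ t r alive → forward h′ t r (covers t alive))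
    (λ (h , h′) → from (depth a s (modalDepth φ)) h , λ t r → from (sat-holds v φ t) (h′ (embed t) (to rel r) (lives t)))
    where
    open View v
    forward : (∀ t → Model._~[_]_ N s a t → Sat N t φ) → ∀ t → Model._~[_]_ M (embed s) a t → Σ[ t′ ∈ Model.S N ] embed t′ ≡ t → Holds M (query φ o) Alive t
    forward h t r (t′ , refl) = to (sat-holds v φ t′) (h t′ (from rel r))
  sat-holds {l = l} {M} {N} {Alive} {o} v (K∞ a φ) s = mk⇔
    (λ h t r alive → forward h t r (covers t alive))
    (λ h t r → from (sat-holds v φ t) (h (embed t) (to rel r) (lives t)))
    where
    open View v
    forward : (∀ t → Model._~[_]_ N s a t → Sat N t φ) → ∀ t → Model._~[_]_ M (embed s) a t → Σ[ t′ ∈ Model.S N ] embed t′ ≡ t → Holds M (query φ o) Alive t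
    forward h t r (t′ , refl) = to (sat-holds v φ t′) (h t′ (from rel r))
  sat-holds {M = M} {N} {Alive} {o} v ([ φ ] ψ) s = mk⇔
    (λ h h′ → to (sat-holds view ψ (s , from (sat-holds v φ s) h′)) (h (from (sat-holds v φ s) h′)))
    (λ h h′ → from (sat-holds view ψ (s , h′)) (h (to (sat-holds v φ s) h′)))
    where
    open View v
    view : View M (restrict N (λ t → Sat N t φ) (modalDepth φ)) (λ t → Alive t × Holds M (query φ o) Alive t) (o + modalDepth φ)
    view = record
      { embed  = embed ∘ proj₁
      ; lives  = λ (t , h) → lives t , to (sat-holds v φ t) h
      ; covers = λ t (alive , h) → again t h (covers t alive)
      ; rel    = rel
      ; atoms  = λ t → atoms (proj₁ t)
      ; depth  = λ a t k → mk⇔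
          (λ h → subst (at a t) (sym (+-assoc o (modalDepth φ) k)) (to (depth a (proj₁ t) (modalDepth φ + k)) (to (lower _ (modalDepth φ) k) h)))
          (λ h → from (lower _ (modalDepth φ) k) (from (depth a (proj₁ t) (modalDepth φ + k)) (subst (at a t) (+-assoc o (modalDepth φ) k) h)))
      }
      where
      at : ∀ a (t : Σ[ t ∈ Model.S N ] Sat N t φ) → ℕ → Set
      at a t = HasDepthAtLeast EDPAL (Model.d M a (embed (proj₁ t)))
      again : ∀ t → Holds M (query φ o) Alive t → Σ[ t′ ∈ Model.S N ] embed t′ ≡ t → Σ[ u ∈ Σ (Model.S N) (λ t → Sat N t φ) ] embed (proj₁ u) ≡ t
      again t h (t′ , refl) = (t′ , from (sat-holds v φ t′) h) , refl

  identity-view : ∀ {n l} (M : Model n l) → View M M (λ _ → ⊤) 0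
  identity-view M = record
    { embed = λ s → s ; lives = λ _ → tt ; covers = λ s _ → s , refl
    ; rel = mk⇔ (λ r → r) (λ r → r) ; atoms = λ _ _ → refl ; depth = λ _ _ _ → mk⇔ (λ h → h) (λ h → h) }

  HoldsSomewhere : ∀ {n} → Logic → Query n → Set₁
  HoldsSomewhere {n} l q = Σ[ M ∈ Model n l ] Σ[ s ∈ Model.S M ] Holds M q (λ _ → ⊤) s

  satisfiable-query : ∀ {n l} (φ : Formula n l) → Satisfiable φ ⇔ HoldsSomewhere l (query φ 0)
  satisfiable-query φ = mk⇔ (λ (M , s , h) → M , s , to (sat-holds (identity-view M) φ s) h)
                            (λ (M , s , h) → M , s , from (sat-holds (identity-view M) φ s) h)

-- Types as labelled trees, and the types of actual states

module Labellings where

  open Bounds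
  open Terms
  open ListTerms
  open Numerals
  open Parsing
  open Referees
  open Searches
  open Queries
  open Equivalence using (to; from)

  Verdict : Set
  Verdict = Bool × Bool

  -- The referee works on flat lists; inductions on the query need the same data as a tree.
  Labelling : ∀ {n} → Query n → Set
  Labelling (atomQ p)  = Verdict
  Labelling (litQ a k) = Verdict
  Labelling (negQ q)   = Verdict × Labelling q
  Labelling (boxQ a q) = Verdict × Labelling q
  Labelling (andQ q r) = Verdict × Labelling q × Labelling r
  Labelling (annQ q r) = Verdict × Labelling q × Labelling r

  root : ∀ {n} (q : Query n) → Labelling q → Verdict
  root (atomQ p)  v           = v
  root (litQ a k) v           = v
  root (negQ q)   (v , _)     = v
  root (boxQ a q) (v , _)     = v
  root (andQ q r) (v , _ , _) = v
  root (annQ q r) (v , _ , _) = v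

  flat : ∀ {n} (q : Query n) → Labelling q → List (El Label)
  flat (atomQ p)  v           = ((atomTag , numeral p , []) , v) ∷ []
  flat (litQ a k) v           = ((litTag , agent a , numeral k) , v) ∷ []
  flat (negQ q)   (v , x)     = (bare negTag , v) ∷ flat q x
  flat (boxQ a q) (v , x)     = ((boxTag , agent a , []) , v) ∷ flat q x
  flat (andQ q r) (v , x , y) = (bare andTag , v) ∷ flat q x ++ flat r y
  flat (annQ q r) (v , x , y) = (bare annTag , v) ∷ flat q x ++ flat r y

  flat-nodes : ∀ {n} (q : Query n) x → List.map proj₁ (flat q x) ≡ nodes q
  flat-nodes (atomQ p)  v           = refl
  flat-nodes (litQ a k) v           = refl
  flat-nodes (negQ q)   (v , x)     = cong (_ ∷_) (flat-nodes q x)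
  flat-nodes (boxQ a q) (v , x)     = cong (_ ∷_) (flat-nodes q x)
  flat-nodes (andQ q r) (v , x , y) = cong (_ ∷_) (trans (map-++ proj₁ (flat q x) (flat r y)) (cong₂ _++_ (flat-nodes q x) (flat-nodes r y)))
  flat-nodes (annQ q r) (v , x , y) = cong (_ ∷_) (trans (map-++ proj₁ (flat q x) (flat r y)) (cong₂ _++_ (flat-nodes q x) (flat-nodes r y)))

  Unflat : ∀ {n} → Query n → List (El Label) → List (El Token) → Set
  Unflat q τ rest = Σ[ x ∈ Labelling q ] Σ[ τ′ ∈ List (El Label) ] τ ≡ flat q x ++ τ′ × List.map proj₁ τ′ ≡ rest

  unflat : ∀ {n} (q : Query n) τ rest → List.map proj₁ τ ≡ nodes q ++ rest → Unflat q τ rest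
  unflat₂ : ∀ {n} (q r : Query n) τ rest → List.map proj₁ τ ≡ (nodes q ++ nodes r) ++ rest →
    Σ[ x ∈ Labelling q ] Σ[ y ∈ Labelling r ] Σ[ τ′ ∈ List (El Label) ] τ ≡ (flat q x ++ flat r y) ++ τ′ × List.map proj₁ τ′ ≡ rest
  unflat (atomQ p)  ((_ , v) ∷ τ) rest refl = v , τ , refl , refl
  unflat (litQ a k) ((_ , v) ∷ τ) rest refl = v , τ , refl , refl
  unflat (negQ q)   ((nd , v) ∷ τ) rest e with refl ← cong (List.head) e
    with x , τ′ , refl , e′ ← unflat q τ rest (cong (drop 1) e) = (v , x) , τ′ , refl , e′
  unflat (boxQ a q) ((nd , v) ∷ τ) rest e with refl ← cong (List.head) e
    with x , τ′ , refl , e′ ← unflat q τ rest (cong (drop 1) e) = (v , x) , τ′ , refl , e′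
  unflat (andQ q r) ((nd , v) ∷ τ) rest e with refl ← cong (List.head) e
    with x , y , τ′ , refl , e′ ← unflat₂ q r τ rest (cong (drop 1) e) = (v , x , y) , τ′ , refl , e′
  unflat (annQ q r) ((nd , v) ∷ τ) rest e with refl ← cong (List.head) e
    with x , y , τ′ , refl , e′ ← unflat₂ q r τ rest (cong (drop 1) e) = (v , x , y) , τ′ , refl , e′
  unflat₂ q r τ rest e
    with x , τ₁ , refl , e₁ ← unflat q τ (nodes r ++ rest) (trans e (++-assoc (nodes q) _ _))
    with y , τ₂ , refl , e₂ ← unflat r τ₁ rest e₁ = x , y , τ₂ , sym (++-assoc (flat q x) _ _) , e₂

  data Pos {n} : Query n → Query n → Set where
    here  : ∀ {q} → Pos q q
    negP  : ∀ {q p} → Pos q p → Pos (negQ q) p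
    boxP  : ∀ {a q p} → Pos q p → Pos (boxQ a q) p
    andˡ  : ∀ {q r p} → Pos q p → Pos (andQ q r) p
    andʳ  : ∀ {q r p} → Pos r p → Pos (andQ q r) p
    annˡ  : ∀ {q r p} → Pos q p → Pos (annQ q r) p
    annʳ  : ∀ {q r p} → Pos r p → Pos (annQ q r) p

  index : ∀ {n} {q p : Query n} → Pos q p → ℕ
  index here                    = 0
  index (negP π)                = suc (index π)
  index (boxP π)                = suc (index π)
  index (andˡ π)                = suc (index π)
  index (andʳ {q = q} π)        = suc (length (nodes q) + index π)
  index (annˡ π)                = suc (index π)
  index (annʳ {q = q} π)        = suc (length (nodes q) + index π)

  at : ∀ {n} {q p : Query n} → Pos q p → Labelling q → Labelling p
  at here     x           = x
  at (negP π) (_ , x)     = at π x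
  at (boxP π) (_ , x)     = at π x
  at (andˡ π) (_ , x , y) = at π x
  at (andʳ π) (_ , x , y) = at π y
  at (annˡ π) (_ , x , y) = at π x
  at (annʳ π) (_ , x , y) = at π y

  drop-length+ : ∀ {X : Set} (xs : List X) {ys} k → drop (length xs + k) (xs ++ ys) ≡ drop k ys
  drop-length+ []       k = refl
  drop-length+ (x ∷ xs) k = drop-length+ xs k

  flat-length : ∀ {n} (q : Query n) x → length (flat q x) ≡ length (nodes q)
  flat-length q x = trans (sym (length-map proj₁ (flat q x))) (cong length (flat-nodes q x))

  drop-index : ∀ {n} {q p : Query n} (π : Pos q p) x ρ → Σ[ σ ∈ List (El Label) ] drop (index π) (flat q x ++ ρ) ≡ flat p (at π x) ++ σ
  drop-index here x ρ = ρ , refl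
  drop-index (negP π) (_ , x) ρ = drop-index π x ρ
  drop-index (boxP π) (_ , x) ρ = drop-index π x ρ
  drop-index (andˡ {q} {r} π) (_ , x , y) ρ rewrite ++-assoc (flat q x) (flat r y) ρ = drop-index π x (flat r y ++ ρ)
  drop-index (andʳ {q} {r} π) (_ , x , y) ρ rewrite ++-assoc (flat q x) (flat r y) ρ | sym (flat-length q x)
    | drop-length+ (flat q x) {flat r y ++ ρ} (index π) = drop-index π y ρ
  drop-index (annˡ {q} {r} π) (_ , x , y) ρ rewrite ++-assoc (flat q x) (flat r y) ρ = drop-index π x (flat r y ++ ρ)
  drop-index (annʳ {q} {r} π) (_ , x , y) ρ rewrite ++-assoc (flat q x) (flat r y) ρ | sym (flat-length q x)
    | drop-length+ (flat q x) {flat r y ++ ρ} (index π) = drop-index π y ρ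

  Located : ∀ {n} → Query n → ℕ → Set
  Located {n} q k = Σ[ p ∈ Query n ] Σ[ π ∈ Pos q p ] index π ≡ k

  private
    side : ∀ k m n → k < m + n → k < m ⊎ Σ[ j ∈ ℕ ] m + j ≡ k × j < n
    side k zero    n h = inj₂ (k , refl , h)
    side zero    (suc m) n h = inj₁ (s≤s z≤n)
    side (suc k) (suc m) n (s≤s h) with side k m n h
    ... | inj₁ k<m = inj₁ (s≤s k<m)
    ... | inj₂ (j , refl , j<n) = inj₂ (j , refl , j<n)

  locate : ∀ {n} (q : Query n) k → k < length (nodes q) → Located q k
  locate q zero h = q , here , refl
  locate (negQ q)   (suc k) (s≤s h) with p , π , refl ← locate q k h = p , negP π , refl
  locate (boxQ a q) (suc k) (s≤s h) with p , π , refl ← locate q k h = p , boxP π , refl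
  locate (andQ q r) (suc k) (s≤s h) with side k (length (nodes q)) _ (subst (k <_) (length-++ (nodes q)) h)
  ... | inj₁ h′ with p , π , refl ← locate q k h′ = p , andˡ π , refl
  ... | inj₂ (j , refl , h′) with p , π , refl ← locate r j h′ = p , andʳ π , refl
  locate (annQ q r) (suc k) (s≤s h) with side k (length (nodes q)) _ (subst (k <_) (length-++ (nodes q)) h)
  ... | inj₁ h′ with p , π , refl ← locate q k h′ = p , annˡ π , refl
  ... | inj₂ (j , refl , h′) with p , π , refl ← locate r j h′ = p , annʳ π , refl
  locate (atomQ p)  (suc k) (s≤s ())
  locate (litQ a m) (suc k) (s≤s ())

  flat-root : ∀ {n} (q : Query n) x ρ → Σ[ nd ∈ El Token ] Σ[ σ ∈ List (El Label) ] flat q x ++ ρ ≡ (nd , root q x) ∷ σ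
  flat-root (atomQ p)  x           ρ = _ , _ , refl
  flat-root (litQ a k) x           ρ = _ , _ , refl
  flat-root (negQ q)   (v , x)     ρ = _ , _ , refl
  flat-root (boxQ a q) (v , x)     ρ = _ , _ , refl
  flat-root (andQ q r) (v , x , y) ρ = _ , _ , refl
  flat-root (annQ q r) (v , x , y) ρ = _ , _ , refl

  module Trees (l : Logic) where
    open Local l

    okTree : ∀ {n} (q : Query n) → Labelling q → Bool
    okTree (atomQ p)  v = true
    okTree (litQ a k) (t , c) = not (natural && isZero (numeral k)) || t
    okTree (negQ q) ((t , c) , x) = let t₁ , c₁ = root q x in okTree q x && ((t == not t₁) && (c₁ == c))
    okTree (boxQ a q) ((t , c) , x) = let t₁ , c₁ = root q x in okTree q x && ((not t || (not c₁ || t₁)) && (c₁ == c))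
    okTree (andQ q r) ((t , c) , x , y) = let t₁ , c₁ = root q x ; t₂ , c₂ = root r y in
      okTree r y && (okTree q x && ((t == (t₁ && t₂)) && ((c₁ == c) && (c₂ == c))))
    okTree (annQ q r) ((t , c) , x , y) = let t₁ , c₁ = root q x ; t₂ , c₂ = root r y in
      okTree r y && (okTree q x && ((t == (not t₁ || t₂)) && ((c₁ == c) && (c₂ == (c && t₁)))))

    private
      Ev : Bool → List Verdict → List (El Label) → (Bool × List Verdict) × List Bool
      Ev ok st ρ = Evaluator.run (ok , st) [] ρ

      step-ev : ∀ e ok st ρ {k new} → locally (keyOf e) (take 2 st) ≡ (k , new , []) →
                Ev ok st (e ∷ ρ) ≡ Ev (ok && k) (new ++ drop 2 st) ρ
      step-ev e ok st ρ h rewrite keyT-⟦⟧ e | h = refl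

      rest₁ : ∀ (v : Verdict) st → (v ∷ take 1 st) ++ drop 1 st ≡ v ∷ st
      rest₁ v st = cong (v ∷_) (take++drop≡id 1 st)

      rest₂ : ∀ (v : Verdict) st → (v ∷ take 2 st) ++ drop 2 st ≡ v ∷ st
      rest₂ v st = cong (v ∷_) (take++drop≡id 2 st)

      ev-cong : ∀ {ok ok′ st st′ ρ} → ok ≡ ok′ → st ≡ st′ → Ev ok st ρ ≡ Ev ok′ st′ ρ
      ev-cong refl refl = refl

    evaluate : ∀ {n} (q : Query n) x ok st ρ → Ev ok st (flat q x ʳ++ ρ) ≡ Ev (ok && okTree q x) (root q x ∷ st) ρ
    evaluate (atomQ p) v ok st ρ = trans (step-ev ((atomTag , numeral p , []) , v) ok st ρ refl) (ev-cong {ok && true} {ρ = ρ} refl (rest₂ v st))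
    evaluate (litQ a k) v ok st ρ = trans (step-ev ((litTag , agent a , numeral k) , v) ok st ρ refl) (ev-cong {ok && okTree (litQ a k) v} {ρ = ρ} refl (rest₂ v st))
    evaluate (negQ q) (v , x) ok st ρ = trans (evaluate q x ok st ((bare negTag , v) ∷ ρ))
      (trans (step-ev (bare negTag , v) (ok && okTree q x) (root q x ∷ st) ρ refl) (ev-cong {ρ = ρ} (sym (&&-assoc ok (okTree q x) _)) (rest₁ v st)))
    evaluate (boxQ a q) (v , x) ok st ρ = trans (evaluate q x ok st (((boxTag , agent a , []) , v) ∷ ρ))
      (trans (step-ev ((boxTag , agent a , []) , v) (ok && okTree q x) (root q x ∷ st) ρ refl) (ev-cong {ρ = ρ} (sym (&&-assoc ok (okTree q x) _)) (rest₁ v st)))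
    evaluate (andQ q r) (v , x , y) ok st ρ rewrite ++-ʳ++ (flat q x) {flat r y} {(bare andTag , v) ∷ ρ} =
      trans (evaluate r y ok st (flat q x ʳ++ ((bare andTag , v) ∷ ρ)))
      (trans (evaluate q x (ok && okTree r y) (root r y ∷ st) ((bare andTag , v) ∷ ρ))
        (trans (step-ev (bare andTag , v) ((ok && okTree r y) && okTree q x) (root q x ∷ root r y ∷ st) ρ refl)
          (ev-cong {ρ = ρ} (trans (sym (&&-assoc (ok && okTree r y) (okTree q x) _)) (sym (&&-assoc ok (okTree r y) _))) refl)))
    evaluate (annQ q r) (v , x , y) ok st ρ rewrite ++-ʳ++ (flat q x) {flat r y} {(bare annTag , v) ∷ ρ} =
      trans (evaluate r y ok st (flat q x ʳ++ ((bare annTag , v) ∷ ρ)))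
      (trans (evaluate q x (ok && okTree r y) (root r y ∷ st) ((bare annTag , v) ∷ ρ))
        (trans (step-ev (bare annTag , v) ((ok && okTree r y) && okTree q x) (root q x ∷ root r y ∷ st) ρ refl)
          (ev-cong {ρ = ρ} (trans (sym (&&-assoc (ok && okTree r y) (okTree q x) _)) (sym (&&-assoc ok (okTree r y) _))) refl)))

    open Coherent l

    coherent-tree : ∀ {n} (q : Query n) x → coherent (flat q x) ≡ (okTree q x && (proj₂ (root q x) && consistent (flat q x)))
    coherent-tree q x = cong₂ _&&_ (cong (proj₁ ∘ proj₁) (evaluate q x true [] []))
      (cong (_&& consistent (flat q x)) (alive (flat-root q x [])))
      where
      alive : (Σ[ nd ∈ El Token ] Σ[ σ ∈ List (El Label) ] flat q x ++ [] ≡ (nd , root q x) ∷ σ) → rootAlive (flat q x) ≡ proj₂ (root q x)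
      alive (nd , σ , e) = cong rootAlive (trans (sym (++-identityʳ (flat q x))) e)

  agent-injective : ∀ {n} (a b : Fin n) → agent a ≡ agent b → a ≡ b
  agent-injective a b e = toℕ-injective (trans (sym (value-numeral (toℕ a))) (trans (cong value e) (value-numeral (toℕ b))))

  numeral-injective : ∀ j k → numeral j ≡ numeral k → j ≡ k
  numeral-injective j k e = trans (sym (value-numeral j)) (trans (cong value e) (value-numeral k))

  -- Agreement of two types on the boxes of an agent

  Agree : Digits → List (El Label) → List (El Label) → Set
  Agree x []      []        = ⊤
  Agree x (e ∷ τ) (e′ ∷ τ′) = boxValue x e ≡ boxValue x e′ × Agree x τ τ′
  Agree x _       _         = ⊥

  agree-values : ∀ x τ τ′ o → Agree x τ τ′ → accumulate (λ e _ → boxValue x e) o τ ≡ accumulate (λ e _ → boxValue x e) o τ′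
  agree-values x []      []        o a = refl
  agree-values x (e ∷ τ) (e′ ∷ τ′) o (h , a) rewrite h = agree-values x τ τ′ _ a

  -- Both types contribute values at the same nodes, so equality of the final lists can be peeled
  -- off node by node, from the last one back. The accumulators differ on the way and are therefore
  -- general.
  values-agree : ∀ x τ τ′ o o′ → List.map proj₁ τ ≡ List.map proj₁ τ′ →
    accumulate (λ e _ → boxValue x e) o τ ≡ accumulate (λ e _ → boxValue x e) o′ τ′ → Agree x τ τ′ × o ≡ o′
  values-agree x []      []        o o′ h e = tt , e
  values-agree x (((g , z , y) , t , _) ∷ τ) (((g′ , z′ , y′) , t′ , _) ∷ τ′) o o′ h e with refl ← cong List.head h
    with a , e′ ← values-agree x τ τ′ _ _ (cong (drop 1) h) e with isBox g && same x z
  ... | false = (refl , a) , e′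
  ... | true with refl ← e′ = (refl , a) , refl

  agree-++ : ∀ x τ {τ′ σ σ′} → Agree x τ τ′ → Agree x σ σ′ → Agree x (τ ++ σ) (τ′ ++ σ′)
  agree-++ x []      {[]}      a       b = b
  agree-++ x (e ∷ τ) {e′ ∷ τ′} (h , a) b = h , agree-++ x τ a b

  agree-split : ∀ {n} x (q : Query n) y y′ {σ σ′} → Agree x (flat q y ++ σ) (flat q y′ ++ σ′) → Agree x (flat q y) (flat q y′) × Agree x σ σ′
  agree-split x q y y′ = go (flat q y) (flat q y′) (trans (flat-length q y) (sym (flat-length q y′)))
    where
    go : ∀ τ τ′ {σ σ′} → length τ ≡ length τ′ → Agree x (τ ++ σ) (τ′ ++ σ′) → Agree x τ τ′ × Agree x σ σ′
    go []      []        h a       = tt , a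
    go (e ∷ τ) (e′ ∷ τ′) h (b , a) = let c , d = go τ τ′ (suc-injective h) a in (b , c) , d

  -- The source of all choices of truth values in the soundness proof.
  decide : ∀ (A : Set) → ¬ ¬ (Σ[ b ∈ Bool ] Reflects A b)
  decide A k = k (false , ofⁿ λ p → k (true , ofʸ p))

  ==-true : ∀ {a b} → a ≡ b → (a == b) ≡ true
  ==-true {true}  refl = refl
  ==-true {false} refl = refl

  ==-eq : ∀ {a b} → (a == b) ≡ true → a ≡ b
  ==-eq {true}  {true}  h = refl
  ==-eq {false} {false} h = refl

  module Soundness {n l} (M : Model n l) where
    open Model M
    open Trees l
    open Coherent l
    open Local l

    RealV : Verdict → Set → Set → Set
    RealV (t , c) Φ A = Reflects Φ t × Reflects A c

    Real : (q : Query n) → (S → Set) → S → Labelling q → Set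
    Real q@(atomQ p)  A s v = RealV v (Holds M q A s) (A s)
    Real q@(litQ a k) A s v = RealV v (Holds M q A s) (A s)
    Real q@(negQ r)   A s (v , x) = RealV v (Holds M q A s) (A s) × Real r A s x
    Real q@(boxQ a r) A s (v , x) = RealV v (Holds M q A s) (A s) × Real r A s x
    Real q@(andQ r r′) A s (v , x , y) = RealV v (Holds M q A s) (A s) × Real r A s x × Real r′ A s y
    Real q@(annQ r r′) A s (v , x , y) = RealV v (Holds M q A s) (A s) × Real r A s x × Real r′ (λ t → A t × Holds M r A t) s y

    real-root : ∀ q {A s x} → Real q A s x → RealV (root q x) (Holds M q A s) (A s)
    real-root (atomQ p)  h = h
    real-root (litQ a k) h = h
    real-root (negQ q)   h = proj₁ h
    real-root (boxQ a q) h = proj₁ h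
    real-root (andQ q r) h = proj₁ h
    real-root (annQ q r) h = proj₁ h

    verdicts : ∀ Φ A → ¬ ¬ (Σ[ v ∈ Verdict ] RealV v Φ A)
    verdicts Φ A k = decide Φ λ (t , h) → decide A λ (c , h′) → k ((t , c) , h , h′)

    real : ∀ q A s → ¬ ¬ (Σ[ x ∈ Labelling q ] Real q A s x)
    real q@(atomQ p)  A s k = verdicts (Holds M q A s) (A s) k
    real q@(litQ a m) A s k = verdicts (Holds M q A s) (A s) k
    real q@(negQ r)   A s k = verdicts (Holds M q A s) (A s) λ (v , h) → real r A s λ (x , h′) → k ((v , x) , h , h′)
    real q@(boxQ a r) A s k = verdicts (Holds M q A s) (A s) λ (v , h) → real r A s λ (x , h′) → k ((v , x) , h , h′)
    real q@(andQ r r′) A s k = verdicts (Holds M q A s) (A s) λ (v , h) → real r A s λ (x , h′) → real r′ A s λ (y , h″) → k ((v , x , y) , h , h′ , h″)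
    real q@(annQ r r′) A s k = verdicts (Holds M q A s) (A s) λ (v , h) → real r A s λ (x , h′) →
      real r′ (λ t → A t × Holds M r A t) s λ (y , h″) → k ((v , x , y) , h , h′ , h″)

    zero-literal : ∀ l {x : Depth l} k t → Reflects (HasDepthAtLeast l x k) t → (not (not (hasAnnouncements l) && isZero (numeral k)) || t) ≡ true
    zero-literal EDPAL k t h = refl
    zero-literal DBEL k true h with isZero (numeral k)
    ... | true  = refl
    ... | false = refl
    zero-literal DBEL k false (ofⁿ h) with numeral k | value-numeral k
    ... | []    | refl = ⊥-elim (h z≤n)
    ... | _ ∷ _ | e    = refl

    real-ok : ∀ q A s x → Real q A s x → okTree q x ≡ true
    real-ok (atomQ p)  A s v h = refl
    real-ok (litQ a k) A s (t , c) (h , _) = zero-literal l k t h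
    real-ok (negQ q) A s ((t , c) , x) ((h , c≡) , r) = let h₁ , c₁ = real-root q r in
      &&-intro (real-ok q A s x r) (&&-intro (==-true (det h (¬-reflects h₁))) (==-true (det c₁ c≡)))
    real-ok (boxQ a q) A s ((t , c) , x) ((h , c≡) , r) = let h₁ , c₁ = real-root q r in
      &&-intro (real-ok q A s x r) (&&-intro (reflexive t (proj₂ (root q x)) (proj₁ (root q x)) h c₁ h₁) (==-true (det c₁ c≡)))
      where
      reflexive : ∀ t c₁ t₁ → Reflects (Holds M (boxQ a q) A s) t → Reflects (A s) c₁ → Reflects (Holds M q A s) t₁ → (not t || (not c₁ || t₁)) ≡ true
      reflexive false c₁    t₁    h k m = refl
      reflexive true  false t₁    h k m = refl
      reflexive true  true  true  h k m = refl
      reflexive true  true  false (ofʸ h) (ofʸ k) (ofⁿ m) = ⊥-elim (m (h s (IsEquivalence.refl (~-equivalence a)) k))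
    real-ok (andQ q r) A s ((t , c) , x , y) ((h , c≡) , hq , hr) = let h₁ , c₁ = real-root q hq ; h₂ , c₂ = real-root r hr in
      &&-intro (real-ok r A s y hr) (&&-intro (real-ok q A s x hq)
        (&&-intro (==-true (det h (h₁ ×-reflects h₂))) (&&-intro (==-true (det c₁ c≡)) (==-true (det c₂ c≡)))))
    real-ok (annQ q r) A s ((t , c) , x , y) ((h , c≡) , hq , hr) = let h₁ , c₁ = real-root q hq ; h₂ , c₂ = real-root r hr in
      &&-intro (real-ok r _ s y hr) (&&-intro (real-ok q A s x hq)
        (&&-intro (==-true (det h (h₁ →-reflects h₂))) (&&-intro (==-true (det c₁ c≡)) (==-true (det c₂ (c≡ ×-reflects h₁))))))

    -- What `conflict` can see of a node: the truth behind atoms and depth literals, and for any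
    -- other node only that its tag never takes part in a conflict.
    data Fact (s : S) : El Label → Set where
      atomF  : ∀ p {t c} → Reflects (V s p ≡ true) t → Fact s ((atomTag , numeral p , []) , t , c)
      litF   : ∀ a k {t c} → Reflects (HasDepthAtLeast l (d a s) k) t → Fact s ((litTag , agent a , numeral k) , t , c)
      otherF : ∀ a b g {x v} → (not a && not g) ≡ false → Fact s (((a , b , g) , x) , v)

    facts : ∀ q A s x → Real q A s x → All (Fact s) (flat q x)
    facts (atomQ p)  A s v (h , _) = atomF p h ∷ []
    facts (litQ a k) A s v (h , _) = litF a k h ∷ []
    facts (negQ q)   A s (v , x) (_ , r) = otherF false true true refl ∷ facts q A s x r
    facts (boxQ a q) A s (v , x) (_ , r) = otherF true true false refl ∷ facts q A s x r
    facts (andQ q r) A s (v , x , y) (_ , hq , hr) = otherF true false false refl ∷ ++⁺ (facts q A s x hq) (facts r A s y hr)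
    facts (annQ q r) A s (v , x , y) (_ , hq , hr) = otherF true true true refl ∷ ++⁺ (facts q A s x hq) (facts r _ s y hr)

    weaker : ∀ l (x : Depth l) {j k} → j ≤ k → HasDepthAtLeast l x k → HasDepthAtLeast l x j
    weaker DBEL  x h h′ = ≤-trans h h′
    weaker EDPAL x h h′ = ℤ.≤-trans (ℤ.+≤+ h) h′

    no-conflict : ∀ {s e e′} → Fact s e → Fact s e′ → conflict e e′ ≡ false
    no-conflict (atomF p {false} h) _ = refl
    no-conflict (atomF p {true} h) (atomF p′ {true} h′) = refl
    no-conflict (atomF p {true} (ofʸ h)) (atomF p′ {false} (ofⁿ h′)) with same (numeral p) (numeral p′) in e
    ... | false = refl
    ... | true with refl ← numeral-injective p p′ (same⁻ (numeral p) (numeral p′) e) = ⊥-elim (h′ h)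
    no-conflict (atomF p {true} h) (litF a k {true} _) = refl
    no-conflict (atomF p {true} h) (litF a k {false} _) = refl
    no-conflict (litF a k {false} h) _ = refl
    no-conflict (litF a k {true} h) (atomF p {true} _) = refl
    no-conflict (litF a k {true} h) (atomF p {false} _) = refl
    no-conflict (litF a k {true} h) (litF a′ k′ {true} h′) = refl
    no-conflict (litF a k {true} (ofʸ h)) (litF a′ k′ {false} (ofⁿ h′)) with same (agent a) (agent a′) in e | atLeast (numeral k) (numeral k′) in f
    ... | false | _ = refl
    ... | true | false = refl
    ... | true | true with refl ← agent-injective a a′ (same⁻ (agent a) (agent a′) e) =
      ⊥-elim (h′ (weaker l _ (subst₂ _≤_ (value-numeral k′) (value-numeral k) (atLeast⁻ (numeral k) (numeral k′) f)) h))
    no-conflict {e′ = e′} (otherF a b g {v = t , c} h) k rewrite h = dull (t && not (proj₁ (proj₂ e′)))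
      where
      dull : ∀ x → (x && false) ≡ false
      dull false = refl
      dull true  = refl
    no-conflict {e = ((a , b , c) , _) , t , _} {e′} _ (otherF a′ b′ g′ {v = t′ , c′} h) rewrite h = dull (t && not t′) (not a && not c)
      where
      dull : ∀ x y {z w} → (x && ((y && false) && z) && w) ≡ false
      dull false y     = refl
      dull true  false = refl
      dull true  true  = refl

    every-All : ∀ {X : Set} {P : X → Set} (p : X → Bool) {xs} → (∀ {x} → P x → p x ≡ true) → All P xs → every p xs ≡ true
    every-All p h []       = refl
    every-All p h (k ∷ ks) = &&-intro (h k) (every-All p h ks)

    real-coherent : ∀ q {s x} → Real q (λ _ → ⊤) s x → coherent (flat q x) ≡ true
    real-coherent q {s} {x} r = trans (coherent-tree q x) (&&-intro (real-ok q _ s x r) (&&-intro (det (proj₂ (real-root q r)) (ofʸ tt))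
      (every-All _ (λ k → every-All _ (λ k′ → cong not (no-conflict k k′)) fs) fs)))
      where fs = facts q _ s x r

    -- Atoms and depth literals are decidable, and the connectives are all negative, so a double
    -- negation can be pushed inwards and removed.
    holds-stable : ∀ q A s → ¬ ¬ Holds M q A s → Holds M q A s
    holds-stable (atomQ p)  A s h = decidable-stable (V s p ≟ᵇ true) h
    holds-stable (litQ a k) A s h = stable l h
      where
      stable : ∀ l {x : Depth l} → ¬ ¬ HasDepthAtLeast l x k → HasDepthAtLeast l x k
      stable DBEL  {x} h = decidable-stable (k ≤? x) h
      stable EDPAL {x} h = decidable-stable (ℤ.+ k ℤ.≤? x) h
    holds-stable (negQ q)   A s h = λ k → h (λ k′ → k′ k)
    holds-stable (andQ q r) A s h = holds-stable q A s (λ k → h (k ∘ proj₁)) , holds-stable r A s (λ k → h (k ∘ proj₂))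
    holds-stable (boxQ a q) A s h = λ t r alive → holds-stable q A t (λ k → h (λ k′ → k (k′ t r alive)))
    holds-stable (annQ q r) A s h = λ k → holds-stable r _ s (λ k′ → h (λ k″ → k′ (k″ k)))

    -- A box of agent `b` depends only on the class of its state, which `s` and `t` share, and on
    -- the surviving states, which do not depend on the state at all.
    real-agree : ∀ b q A {s t x y} → s ~[ b ] t → Real q A s x → Real q A t y → Agree (agent b) (flat q x) (flat q y)
    real-agree b (atomQ p)  A r h k = refl , tt
    real-agree b (litQ a m) A r h k = refl , tt
    real-agree b (negQ q)   A r (_ , h) (_ , k) = refl , real-agree b q A r h k
    real-agree b (andQ q q′) A {x = _ , x , _} r (_ , h , h′) (_ , k , k′) = refl , agree-++ (agent b) (flat q x) (real-agree b q A r h k) (real-agree b q′ A r h′ k′)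
    real-agree b (annQ q q′) A {x = _ , x , _} r (_ , h , h′) (_ , k , k′) = refl , agree-++ (agent b) (flat q x) (real-agree b q A r h k) (real-agree b q′ _ r h′ k′)
    real-agree b (boxQ a q) A {s} {t} {(t₁ , c₁) , _} {(t₂ , c₂) , _} r ((v , _) , h) ((w , _) , k) = boxes , real-agree b q A r h k
      where
      open IsEquivalence (~-equivalence b) using () renaming (sym to ~-sym; trans to ~-trans)
      transfer : ∀ {s t} → s ~[ b ] t → Holds M (boxQ b q) A s → Holds M (boxQ b q) A t
      transfer r h u r′ = h u (~-trans r r′)
      reflects-transfer : ∀ {a} {A B : Set} → (A → B) → (B → A) → Reflects A a → Reflects B a
      reflects-transfer f g (ofʸ h) = ofʸ (f h)
      reflects-transfer f g (ofⁿ h) = ofⁿ (h ∘ g)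
      boxes : boxValue (agent b) ((boxTag , agent a , []) , t₁ , c₁) ≡ boxValue (agent b) ((boxTag , agent a , []) , t₂ , c₂)
      boxes with same (agent b) (agent a) in e
      ... | false = refl
      ... | true with refl ← agent-injective b a (same⁻ (agent b) (agent a) e) =
        cong (_∷ []) (det (reflects-transfer {t₁} (transfer r) (transfer (~-sym r)) v) w)

    aliveAt : ∀ {q p : Query n} → Pos q p → (S → Set) → S → Set
    aliveAt here A = A
    aliveAt (negP π) A = aliveAt π A
    aliveAt (boxP π) A = aliveAt π A
    aliveAt (andˡ π) A = aliveAt π A
    aliveAt (andʳ π) A = aliveAt π A
    aliveAt (annˡ π) A = aliveAt π A
    aliveAt (annʳ {q = q} π) A = aliveAt π (λ t → A t × Holds M q A t)

    real-at : ∀ {q p} (π : Pos q p) {A s x} → Real q A s x → Real p (aliveAt π A) s (at π x)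
    real-at here h = h
    real-at (negP π) h = real-at π (proj₂ h)
    real-at (boxP π) h = real-at π (proj₂ h)
    real-at (andˡ π) h = real-at π (proj₁ (proj₂ h))
    real-at (andʳ π) h = real-at π (proj₂ (proj₂ h))
    real-at (annˡ π) h = real-at π (proj₁ (proj₂ h))
    real-at (annʳ π) h = real-at π (proj₂ (proj₂ h))

  drop-short : ∀ {X : Set} (xs : List X) k {y ys} → drop k xs ≡ y ∷ ys → k < length xs
  drop-short (x ∷ xs) zero    h = s≤s z≤n
  drop-short (x ∷ xs) (suc k) h = s≤s (drop-short xs k h)
  drop-short []       (suc k) ()

-- A query that holds somewhere wins the game

module GameSoundness where

  open Bounds
  open Terms
  open ListTerms
  open Numerals
  open Parsing
  open Referees
  open Odometers
  open Searches
  open Queries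
  open Labellings
  open Equivalence using (to; from)

  blank-nodes : ∀ nds → List.map proj₁ (List.map blankLabel nds) ≡ nds
  blank-nodes []         = refl
  blank-nodes (nd ∷ nds) = cong (nd ∷_) (blank-nodes nds)

  bestType-const : ∀ nds {f} → (∀ τ → f τ ≡ true) → bestType nds f ≡ true
  bestType-const nds {f} h = subst (λ nds → bestType nds f ≡ true) (blank-nodes nds) (bestType-any (List.map blankLabel nds) f (h _))

  same-true : ∀ {xs ys} → xs ≡ ys → same xs ys ≡ true
  same-true {xs} refl = same-refl xs

  module SoundGame {n l} (M : Model n l) (q : Query n) where
    open Model M
    open Soundness M
    open Coherent l
    open Referee l
    open Game l

    private
      W : ℕ → El Play → Bool
      W = value-of (nodes q)

    won-value : ∀ m {p} → W m (false , true , p) ≡ true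
    won-value zero = refl
    won-value (suc m) {p} = bestMarks-all (nodes q) _ λ us _ → bestType-const (nodes q) (λ τ → won-value m {p})

    private
      Good : ℕ → Set
      Good m = ∀ s x ag → Real q (λ _ → ⊤) s x → W m (true , true , ag , flat q x) ≡ true

      module Respond (m : ℕ) (good : Good m) (s : S) (x : Labelling q) (ag : List Digits) (r : Real q (λ _ → ⊤) s x) (us : List Bool) where

        reply : List (El Label) → El Label → Bool
        reply τ e = W m (answer ag (flat q x) us τ e)

        -- The answer to a challenge is the actual type of a successor that refutes the box. Neither
        -- the successor nor its type can be produced outright, but the goal is an equation between
        -- Booleans, so both may be used under double negation.
        boxed : ∀ b p (π : Pos q (boxQ b p)) {e σ} ρ → index π ≡ lead us → flat (boxQ b p) (at π x) ++ ρ ≡ e ∷ σ →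
                demand ag e ≡ true → bestType (nodes q) (λ τ → reply τ e) ≡ true
        boxed b p π ρ i refl dem with at π x | real-at π r
        boxed b p π ρ i refl ()  | (true , _) , _  | _
        boxed b p π ρ i refl dem | (false , c) , y | (ofⁿ fails , _) , _ =
          decidable-stable (_ ≟ᵇ true) λ nope → fails λ t rel alive → holds-stable p A t λ bad →
            real q (λ _ → ⊤) t λ (z , rz) → nope (subst (λ nds → bestType nds (λ τ → reply τ e) ≡ true) (flat-nodes q z)
              (bestType-any (flat q z) _ (wins t rel alive bad z rz)))
          where
          A = aliveAt π (λ _ → ⊤)
          e : El Label
          e = (boxTag , agent b , []) , false , c
          child : ∀ t z → A t → ¬ Holds M p A t → Real q (λ _ → ⊤) t z → childFails (select us (flat q z)) ≡ true
          child t z alive bad rz with σ , e₁ ← drop-index π z [] with at π z | real-at π rz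
          ... | v , y′ | _ , ry with nd , σ′ , e₂ ← flat-root p y′ σ =
            trans (cong childFails (trans (trans (cong (λ k → drop k (flat q z)) (sym i)) (cong (drop (index π)) (sym (++-identityʳ (flat q z)))))
              (trans e₁ (cong (((boxTag , agent b , []) , v) ∷_) e₂))))
              (&&-intro (cong not (det (proj₁ (real-root p ry)) (ofⁿ bad))) (det (proj₂ (real-root p ry)) (ofʸ alive)))
          wins : ∀ t → s ~[ b ] t → A t → ¬ Holds M p A t → ∀ z → Real q (λ _ → ⊤) t z → reply (flat q z) e ≡ true
          wins t rel alive bad z rz rewrite dem
            | &&-intro (real-coherent q rz) (&&-intro (same-true (agree-values (agent b) (flat q x) (flat q z) [] (real-agree b q _ rel r rz))) (child t z alive bad rz)) =
            good t z (agent b ∷ []) rz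

        anywhere : ∀ {p} (π : Pos q p) {e σ} ρ → index π ≡ lead us → flat p (at π x) ++ ρ ≡ e ∷ σ →
                   demand ag e ≡ true → bestType (nodes q) (λ τ → reply τ e) ≡ true
        anywhere {boxQ b p}  π ρ i h dem = boxed b p π ρ i h dem
        anywhere {atomQ _}   π ρ i refl ()
        anywhere {litQ _ _}  π ρ i refl ()
        anywhere {negQ _}    π ρ i refl ()
        anywhere {andQ _ _}  π ρ i refl ()
        anywhere {annQ _ _}  π ρ i refl ()

        respond : ∀ τ₀ → select us (flat q x) ≡ τ₀ → bestType (nodes q) (λ τ → W m (caseList τ₀ won (λ e _ → answer ag (flat q x) us τ e))) ≡ true
        respond []      h = bestType-const (nodes q) (λ _ → won-value m)
        respond (e ∷ σ) h with demand ag e in dem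
        ... | false = bestType-const (nodes q) (λ _ → won-value m)
        ... | true with p , π , i ← locate q (lead us) (subst (lead us <_) (flat-length q x) (drop-short (flat q x) (lead us) h))
          with ρ , e₁ ← drop-index π x [] =
          subst (λ d → bestType (nodes q) (λ τ → W m (if d then (if coherent τ && (same (boxValues (proj₁ (proj₂ (proj₁ e))) (flat q x)) (boxValues (proj₁ (proj₂ (proj₁ e))) τ) && childFails (select us τ))
              then (true , true , proj₁ (proj₂ (proj₁ e)) ∷ [] , τ) else lost) else won)) ≡ true) dem
            (anywhere π ρ i (trans (sym e₁) (trans (cong (drop (index π)) (++-identityʳ (flat q x))) (trans (cong (λ k → drop k (flat q x)) i) h))) dem)

    good : ∀ m → Good m
    good zero    s x ag r = refl
    good (suc m) s x ag r = bestMarks-all (nodes q) _ λ us _ → Respond.respond m (good m) s x ag r us (select us (flat q x)) refl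

    sound : ∀ m s → Holds M q (λ _ → ⊤) s → W (suc m) (play []) ≡ true
    sound m s h = decidable-stable (_ ≟ᵇ true) λ nope → real q (λ _ → ⊤) s λ (x , r) → nope (bestMarks-all (nodes q) _ λ us _ →
      subst (λ nds → bestType nds (λ τ → W m (rule (us , τ) (play []))) ≡ true) (flat-nodes q x) (bestType-any (flat q x) _ (wins us x r)))
      where
      head-holds : ∀ x → Real q (λ _ → ⊤) s x → rootHolds (flat q x) ≡ true
      head-holds x r with nd , σ , e ← flat-root q x [] = trans (cong rootHolds (trans (sym (++-identityʳ (flat q x))) e))
        (&&-intro (det (proj₁ (real-root q r)) (ofʸ h)) (det (proj₂ (real-root q r)) (ofʸ tt)))
      wins : ∀ us x → Real q (λ _ → ⊤) s x → W m (rule (us , flat q x) (play [])) ≡ true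
      wins us x r rewrite &&-intro (real-coherent q r) (head-holds x r) = good m s x [] r

-- A won game yields a model

module GameCompleteness where

  open Bounds
  open Terms
  open ListTerms
  open Numerals
  open Parsing
  open Referees
  open Odometers
  open Searches
  open Queries
  open Labellings
  open GameSoundness
  open Equivalence using (to; from)

  some : ∀ {X : Set} → (X → Bool) → List X → Bool
  some f []       = false
  some f (x ∷ xs) = if f x then true else some f xs

  some-elem : ∀ {X : Set} (f : X → Bool) xs k {y ys} → drop k xs ≡ y ∷ ys → f y ≡ true → some f xs ≡ true
  some-elem f (x ∷ xs) zero    refl h rewrite h = refl
  some-elem f (x ∷ xs) (suc k) e    h with f x
  ... | true  = refl
  ... | false = some-elem f xs k e h

  some-witness : ∀ {X : Set} (f : X → Bool) xs → some f xs ≡ true → Σ[ k ∈ ℕ ] Σ[ y ∈ X ] Σ[ ys ∈ List X ] drop k xs ≡ y ∷ ys × f y ≡ true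
  some-witness f (x ∷ xs) h with f x in e
  ... | true  = 0 , x , xs , refl , e
  ... | false with k , y , ys , e′ , h′ ← some-witness f xs h = suc k , y , ys , e′ , h′

  every-elem : ∀ {X : Set} (f : X → Bool) xs k {y ys} → every f xs ≡ true → drop k xs ≡ y ∷ ys → f y ≡ true
  every-elem f (x ∷ xs) zero    h refl = proj₁ (&&-true h)
  every-elem f (x ∷ xs) (suc k) h e    = every-elem f xs k (proj₂ (&&-true {f x} h)) e

  consistent-elem : ∀ τ j k {e e′ σ σ′} → consistent τ ≡ true → drop j τ ≡ e ∷ σ → drop k τ ≡ e′ ∷ σ′ → conflict e e′ ≡ true → ⊥
  consistent-elem τ j k {e} {e′} h p p′ c with every-elem _ τ k (every-elem _ τ j h p) p′
  ... | h′ rewrite c with () ← h′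

  marks : ∀ k n → k < n → Σ[ us ∈ List Bool ] length us ≡ n × lead us ≡ k
  marks zero    (suc n) h = true ∷ List.replicate n false , cong suc (Data.List.Properties.length-replicate n) , refl
    where import Data.List.Properties
  marks (suc k) (suc n) (s≤s h) with us , e , e′ ← marks k n h = false ∷ us , cong suc e , cong suc e′

  infixr 5 _∙_
  _∙_ : ∀ {n} {q r p : Query n} → Pos q r → Pos r p → Pos q p
  here   ∙ ρ = ρ
  negP π ∙ ρ = negP (π ∙ ρ)
  boxP π ∙ ρ = boxP (π ∙ ρ)
  andˡ π ∙ ρ = andˡ (π ∙ ρ)
  andʳ π ∙ ρ = andʳ (π ∙ ρ)
  annˡ π ∙ ρ = annˡ (π ∙ ρ)
  annʳ π ∙ ρ = annʳ (π ∙ ρ)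

  at-∙ : ∀ {n} {q r p : Query n} (π : Pos q r) (ρ : Pos r p) x → at (π ∙ ρ) x ≡ at ρ (at π x)
  at-∙ here     ρ x           = refl
  at-∙ (negP π) ρ (_ , x)     = at-∙ π ρ x
  at-∙ (boxP π) ρ (_ , x)     = at-∙ π ρ x
  at-∙ (andˡ π) ρ (_ , x , y) = at-∙ π ρ x
  at-∙ (andʳ π) ρ (_ , x , y) = at-∙ π ρ y
  at-∙ (annˡ π) ρ (_ , x , y) = at-∙ π ρ x
  at-∙ (annʳ π) ρ (_ , x , y) = at-∙ π ρ y

  -- For announcements the ranks add up: which states are alive in the right operand depends on the
  -- truth of the left one, which is reliable only while `rank q` rounds remain.
  rank : ∀ {n} → Query n → ℕ
  rank (atomQ p)  = 0
  rank (litQ a k) = 0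
  rank (negQ q)   = rank q
  rank (boxQ a q) = suc (rank q)
  rank (andQ q r) = rank q ⊔ rank r
  rank (annQ q r) = rank q + rank r

  rank≤nodes : ∀ {n} (q : Query n) → rank q ≤ length (nodes q)
  rank≤nodes (atomQ p)  = z≤n
  rank≤nodes (litQ a k) = z≤n
  rank≤nodes (negQ q)   = m≤n⇒m≤1+n (rank≤nodes q)
  rank≤nodes (boxQ a q) = s≤s (rank≤nodes q)
  rank≤nodes (andQ q r) rewrite length-++ (nodes q) {nodes r} =
    m≤n⇒m≤1+n (≤-trans (m⊔n≤m+n (rank q) (rank r)) (+-mono-≤ (rank≤nodes q) (rank≤nodes r)))
  rank≤nodes (annQ q r) rewrite length-++ (nodes q) {nodes r} =
    m≤n⇒m≤1+n (+-mono-≤ (rank≤nodes q) (rank≤nodes r))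

  agree-refl : ∀ x τ → Agree x τ τ
  agree-refl x []      = tt
  agree-refl x (e ∷ τ) = refl , agree-refl x τ

  agree-at : ∀ {n} x {q p : Query n} (π : Pos q p) y y′ → Agree x (flat q y) (flat q y′) → Agree x (flat p (at π y)) (flat p (at π y′))
  agree-at x here     y           y′             a = a
  agree-at x (negP π) (_ , y)     (_ , y′)       a = agree-at x π y y′ (proj₂ a)
  agree-at x (boxP π) (_ , y)     (_ , y′)       a = agree-at x π y y′ (proj₂ a)
  agree-at x (andˡ {q} π) (_ , y , z) (_ , y′ , z′) a = agree-at x π y y′ (proj₁ (agree-split x q y y′ (proj₂ a)))
  agree-at x (andʳ {q} π) (_ , y , z) (_ , y′ , z′) a = agree-at x π z z′ (proj₂ (agree-split x q y y′ (proj₂ a)))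
  agree-at x (annˡ {q} π) (_ , y , z) (_ , y′ , z′) a = agree-at x π y y′ (proj₁ (agree-split x q y y′ (proj₂ a)))
  agree-at x (annʳ {q} π) (_ , y , z) (_ , y′ , z′) a = agree-at x π z z′ (proj₂ (agree-split x q y y′ (proj₂ a)))

  agree-box : ∀ {n} (b : Fin n) (q : Query n) y y′ → Agree (agent b) (flat (boxQ b q) y) (flat (boxQ b q) y′) → proj₁ (proj₁ y) ≡ proj₁ (proj₁ y′)
  agree-box b q ((t , _) , _) ((t′ , _) , _) (h , _) rewrite same-refl (agent b) with refl ← h = refl

  -- Depths of the constructed model: the largest threshold that holds

  deepest : ∀ l → Depth l
  deepest DBEL  = 0
  -- If no literal of an agent is true, even `P a 0` has to fail, hence depth minus one.
  deepest EDPAL = -[1+ 0 ]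

  joinDepth : ∀ l → Depth l → Depth l → Depth l
  joinDepth DBEL  = _⊔_
  joinDepth EDPAL = ℤ._⊔_

  depthOf : ∀ l → ℕ → Depth l
  depthOf DBEL  k = k
  depthOf EDPAL k = ℤ.+ k

  depthOf⁺ : ∀ l {j k} → k ≤ j → HasDepthAtLeast l (depthOf l j) k
  depthOf⁺ DBEL  h = h
  depthOf⁺ EDPAL h = ℤ.+≤+ h

  depthOf⁻ : ∀ l {j k} → HasDepthAtLeast l (depthOf l j) k → k ≤ j
  depthOf⁻ DBEL  h = h
  depthOf⁻ EDPAL (ℤ.+≤+ h) = h

  join-left : ∀ l x y {k} → HasDepthAtLeast l x k → HasDepthAtLeast l (joinDepth l x y) k
  join-left DBEL  x y h = ≤-trans h (m≤m⊔n x y)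
  join-left EDPAL x y h = ℤ.≤-trans h (ℤ.i≤i⊔j x y)

  join-right : ∀ l x y {k} → HasDepthAtLeast l y k → HasDepthAtLeast l (joinDepth l x y) k
  join-right DBEL  x y h = ≤-trans h (m≤n⊔m x y)
  join-right EDPAL x y h = ℤ.≤-trans h (ℤ.i≤j⊔i x y)

  join-either : ∀ l x y {k} → HasDepthAtLeast l (joinDepth l x y) k → HasDepthAtLeast l x k ⊎ HasDepthAtLeast l y k
  join-either DBEL x y h with ⊔-sel x y
  ... | inj₁ e rewrite e = inj₁ h
  ... | inj₂ e rewrite e = inj₂ h
  join-either EDPAL x y h with ℤ.⊔-sel x y
  ... | inj₁ e rewrite e = inj₁ h
  ... | inj₂ e rewrite e = inj₂ h

  falseLit : Digits → Digits → El Label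
  falseLit x y = (litTag , x , y) , false , false

  -- A conflict with a false `P x 0` singles out the true depth literals of agent `x`, whatever
  -- their threshold; the depth is the maximum of these.
  thresholds : ∀ l → Digits → List (El Label) → Depth l
  thresholds l x []      = deepest l
  thresholds l x (e ∷ τ) = if conflict e (falseLit x []) then joinDepth l (depthOf l (value (proj₂ (proj₂ (proj₁ e))))) (thresholds l x τ) else thresholds l x τ

  conflict-split : ∀ e x k → conflict e (falseLit x (numeral k)) ≡ (conflict e (falseLit x []) && atLeast (proj₂ (proj₂ (proj₁ e))) (numeral k))
  conflict-split (((a , b , c) , z , y) , t , _) x k = go (t && true) ((not a && not c) && true) _ (same z x) (any y)
    where
    any : ∀ y → atLeast y [] ≡ true
    any []      = refl
    any (_ ∷ _) = refl
    go : ∀ t u v w {z s} → s ≡ true → (t && ((u && v) && (w && z))) ≡ ((t && ((u && v) && (w && s))) && z)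
    go false u v w refl = refl
    go true false v w refl = refl
    go true true false w refl = refl
    go true true true false refl = refl
    go true true true true refl = refl

  conflict-threshold : ∀ x e k → conflict e (falseLit x (numeral k)) ≡ true → conflict e (falseLit x []) ≡ true × k ≤ value (proj₂ (proj₂ (proj₁ e)))
  conflict-threshold x e k h = let h₁ , h₂ = &&-true (trans (sym (conflict-split e x k)) h) in
    h₁ , subst (_≤ _) (value-numeral k) (atLeast⁻ (proj₂ (proj₂ (proj₁ e))) (numeral k) h₂)

  thresholds-lower : ∀ l x τ j {e σ k} → drop j τ ≡ e ∷ σ → conflict e (falseLit x (numeral k)) ≡ true → HasDepthAtLeast l (thresholds l x τ) k
  thresholds-lower l x (e ∷ τ) zero {k = k} refl h with h₁ , h₂ ← conflict-threshold x e k h rewrite h₁ = join-left l _ _ (depthOf⁺ l h₂)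
  thresholds-lower l x (e ∷ τ) (suc j) p h with conflict e (falseLit x [])
  ... | true  = join-right l _ _ (thresholds-lower l x τ j p h)
  ... | false = thresholds-lower l x τ j p h

  thresholds-attained : ∀ l x τ {k} → HasDepthAtLeast l (thresholds l x τ) k →
    HasDepthAtLeast l (deepest l) k ⊎ (Σ[ j ∈ ℕ ] Σ[ e ∈ El Label ] Σ[ σ ∈ List (El Label) ] drop j τ ≡ e ∷ σ × conflict e (falseLit x (numeral k)) ≡ true)
  thresholds-attained l x []      h = inj₁ h
  thresholds-attained l x (e ∷ τ) {k} h with conflict e (falseLit x []) in c
  ... | false with thresholds-attained l x τ h
  ...   | inj₁ h′ = inj₁ h′
  ...   | inj₂ (j , e′ , σ , p , c′) = inj₂ (suc j , e′ , σ , p , c′)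
  thresholds-attained l x (e ∷ τ) {k} h | true with join-either l _ _ h
  ... | inj₁ h′ = inj₂ (0 , e , τ , refl , trans (conflict-split e x k) (&&-intro c
          (atLeast⁺ (proj₂ (proj₂ (proj₁ e))) (numeral k) (subst (_≤ _) (sym (value-numeral k)) (depthOf⁻ l h′)))))
  ... | inj₂ h″ with thresholds-attained l x τ h″
  ...   | inj₁ h′ = inj₁ h′
  ...   | inj₂ (j , e′ , σ , p , c′) = inj₂ (suc j , e′ , σ , p , c′)

  ⇔-true : ∀ {A : Set} {b c} → b ≡ c → A ⇔ (b ≡ true) → A ⇔ (c ≡ true)
  ⇔-true refl h = h

  module CompleteGame {n} (l : Logic) (q : Query n) (N : ℕ) where
    open Trees l
    open Local l
    open Coherent l
    open Referee l
    open Game l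

    private
      W : ℕ → El Play → Bool
      W = value-of (nodes q)

      reply : ∀ m p → W (suc m) p ≡ true → ∀ us → length us ≡ length (nodes q) → Σ[ x ∈ Labelling q ] W m (rule (us , flat q x) p) ≡ true
      reply m p h us e with τ , nd , h′ ← bestType-∃ (nodes q) (λ τ → W m (rule (us , τ) p)) (bestMarks-∀ (nodes q) _ h us e)
        with x , [] , refl , _ ← unflat q τ [] (trans nd (sym (++-identityʳ (nodes q)))) =
        x , subst (λ τ → W m (rule (us , τ) p) ≡ true) (++-identityʳ (flat q x)) h′

      lost-value : ∀ m {p} → W m (false , false , p) ≡ true → ⊥
      lost-value (suc m) {p} h with x , h′ ← reply m (false , false , p) h (List.map (λ _ → false) (nodes q)) (length-map _ (nodes q)) = lost-value m {p} h′

    module _ (x₀ : Labelling q) (coherent₀ : coherent (flat q x₀) ≡ true) (root₀ : proj₁ (root q x₀) ≡ true)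
             (wins₀ : W N (true , true , [] , flat q x₀) ≡ true) where

      -- The index `m` counts the rounds that remain. A state keeps the whole play and not only its
      -- last type, so that the parent in the tree of plays can be read off.
      data World : ℕ → List Digits → Labelling q → Set where
        start : World N [] x₀
        child : ∀ {m ag x} → World (suc m) ag x → (b : Fin n) (y : Labelling q) → moved ag (agent b) ≡ false →
                Agree (agent b) (flat q x) (flat q y) → coherent (flat q y) ≡ true →
                W m (true , true , agent b ∷ [] , flat q y) ≡ true → World m (agent b ∷ []) y

      State : Set
      State = Σ[ m ∈ ℕ ] Σ[ ag ∈ List Digits ] Σ[ x ∈ Labelling q ] World m ag x

      level : State → ℕ
      level = proj₁

      lab : State → Labelling q
      lab s = proj₁ (proj₂ (proj₂ s))

      coherence : ∀ s → coherent (flat q (lab s)) ≡ true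
      coherence (_ , _ , _ , start) = coherent₀
      coherence (_ , _ , _ , child _ _ _ _ _ h _) = h

      winning : ∀ {m ag x} → World m ag x → W m (true , true , ag , flat q x) ≡ true
      winning start = wins₀
      winning (child _ _ _ _ _ _ h) = h

      -- The state from which the b-cluster of a state was spawned.
      rep : Fin n → State → State
      rep b s@(_ , _ , _ , start) = s
      rep b s@(_ , _ , _ , child w b′ _ _ _ _ _) with b Fin.≟ b′
      ... | Dec.yes _ = _ , _ , _ , w
      ... | Dec.no  _ = s

      rep-child : ∀ {m ag x} (w : World (suc m) ag x) b y h a c v → rep b (_ , _ , _ , child w b y h a c v) ≡ (_ , _ , _ , w)
      rep-child w b y h a c v with b Fin.≟ b
      ... | Dec.yes _ = refl
      ... | Dec.no ¬e = ⊥-elim (¬e refl)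

      rep-moved : ∀ b s → moved (proj₁ (proj₂ (rep b s))) (agent b) ≡ false
      rep-moved b (_ , _ , _ , start) = refl
      rep-moved b (_ , _ , _ , child w b′ y h a c v) with b Fin.≟ b′
      ... | Dec.yes refl = h
      ... | Dec.no ¬e with same (agent b) (agent b′) in e
      ...   | false = refl
      ...   | true  = ⊥-elim (¬e (agent-injective b b′ (same⁻ (agent b) (agent b′) e)))

      rep-agree : ∀ b s → Agree (agent b) (flat q (lab (rep b s))) (flat q (lab s))
      rep-agree b (_ , _ , _ , start) = agree-refl (agent b) (flat q x₀)
      rep-agree b (_ , _ , _ , child w b′ y h a c v) with b Fin.≟ b′
      ... | Dec.yes refl = a
      ... | Dec.no ¬e = agree-refl (agent b) (flat q y)

      level≤rep : ∀ b s → level s ≤ level (rep b s)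
      level≤rep b (_ , _ , _ , start) = ≤-refl
      level≤rep b (_ , _ , _ , child w b′ y h a c v) with b Fin.≟ b′
      ... | Dec.yes refl = n≤1+n _
      ... | Dec.no ¬e = ≤-refl

      rep≤level : ∀ b s → level (rep b s) ≤ suc (level s)
      rep≤level b (_ , _ , _ , start) = n≤1+n _
      rep≤level b (_ , _ , _ , child w b′ y h a c v) with b Fin.≟ b′
      ... | Dec.yes refl = ≤-refl
      ... | Dec.no ¬e = n≤1+n _

      -- Relating states with equal representatives gives equivalence relations by construction. As
      -- no agent moves twice in a row, a parent is its own representative for the agent of its
      -- child, so clusters consist of one state and its children.
      model : Model n l
      model = record
        { S = State
        ; _~[_]_ = λ s b t → rep b s ≡ rep b t
        ; ~-equivalence = λ b → record { refl = refl ; sym = sym ; trans = trans }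
        ; V = λ s p → some (λ e → conflict e ((atomTag , numeral p , []) , false , false)) (flat q (lab s))
        ; d = λ a s → thresholds l (agent a) (flat q (lab s))
        }

      ok-parts : ∀ s → okTree q (lab s) ≡ true × proj₂ (root q (lab s)) ≡ true × consistent (flat q (lab s)) ≡ true
      ok-parts s = let h₁ , h₂ = &&-true {okTree q (lab s)} (trans (sym (coherent-tree q (lab s))) (coherence s)) in h₁ , &&-true h₂

      ok-at : ∀ {r p : Query n} (π : Pos r p) x → okTree r x ≡ true → okTree p (at π x) ≡ true
      ok-at here     x h = h
      ok-at (negP {q} π) (_ , x) h = ok-at π x (proj₁ (&&-true {okTree q x} h))
      ok-at (boxP {q = q} π) (_ , x) h = ok-at π x (proj₁ (&&-true {okTree q x} h))
      ok-at (andˡ {q} {r} π) (_ , x , y) h = ok-at π x (proj₁ (&&-true {okTree q x} (proj₂ (&&-true {okTree r y} h))))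
      ok-at (andʳ {q} {r} π) (_ , x , y) h = ok-at π y (proj₁ (&&-true {okTree r y} h))
      ok-at (annˡ {q} {r} π) (_ , x , y) h = ok-at π x (proj₁ (&&-true {okTree q x} (proj₂ (&&-true {okTree r y} h))))
      ok-at (annʳ {q} {r} π) (_ , x , y) h = ok-at π y (proj₁ (&&-true {okTree r y} h))

      private
        T : ∀ {p} → Pos q p → State → Bool
        T {p} π s = proj₁ (root p (at π (lab s)))

        C : ∀ {p} → Pos q p → State → Bool
        C {p} π s = proj₂ (root p (at π (lab s)))

        ok : ∀ {p} (π : Pos q p) s → okTree p (at π (lab s)) ≡ true
        ok π s = ok-at π (lab s) (proj₁ (ok-parts s))

        elem : ∀ {p} (π : Pos q p) s → Σ[ nd ∈ El Token ] Σ[ σ ∈ List (El Label) ] drop (index π) (flat q (lab s)) ≡ (nd , root p (at π (lab s))) ∷ σ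
        elem {p} π s with ρ , e ← drop-index π (lab s) [] with nd , σ , e′ ← flat-root p (at π (lab s)) ρ =
          nd , σ , trans (cong (drop (index π)) (sym (++-identityʳ (flat q (lab s))))) (trans e e′)

        child-root : ∀ {r p} (π : Pos q r) (ρ : Pos r p) s → root p (at (π ∙ ρ) (lab s)) ≡ root p (at ρ (at π (lab s)))
        child-root {p = p} π ρ s = cong (root p) (at-∙ π ρ (lab s))

        -- Labels are trusted only at states with at least `c` rounds left; nearer to the end a
        -- false box may lack a refuting successor.
        Alive : ∀ {p} → Pos q p → (State → Set) → ℕ → Set
        Alive π A c = ∀ s → c ≤ level s → A s ⇔ (C π s ≡ true)

        Truth : ∀ {p} → Pos q p → (State → Set) → ℕ → Set
        Truth {p} π A c = ∀ s → c ≤ level s → Holds model p A s ⇔ (T π s ≡ true)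

        atom-truth : ∀ p (π : Pos q (atomQ p)) s → (Model.V model s p ≡ true) ⇔ (T π s ≡ true)
        atom-truth p π s with ρ , e ← drop-index π (lab s) [] | at π (lab s)
        ... | t , c = mk⇔ (forward t refl) (backward t refl)
          where
          τ = flat q (lab s)
          found : drop (index π) τ ≡ ((atomTag , numeral p , []) , t , c) ∷ ρ
          found = trans (cong (drop (index π)) (sym (++-identityʳ τ))) e
          forward : ∀ t′ → t ≡ t′ → Model.V model s p ≡ true → t′ ≡ true
          forward true  _    _ = refl
          forward false refl h with j , e , σ , e₁ , c′ ← some-witness _ τ h =
            ⊥-elim (consistent-elem τ j (index π) (proj₂ (proj₂ (ok-parts s))) e₁ found c′)
          backward : ∀ t′ → t ≡ t′ → t′ ≡ true → Model.V model s p ≡ true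
          backward true refl _ = some-elem _ τ (index π) found (&&-intro (same-refl (numeral p)) refl)

        lit-truth : ∀ a k (π : Pos q (litQ a k)) s → HasDepthAtLeast l (Model.d model a s) k ⇔ (T π s ≡ true)
        lit-truth a k π s with ρ , e ← drop-index π (lab s) [] | at π (lab s) | ok π s
        ... | t , c | good = mk⇔ (forward t refl) (backward t refl)
          where
          τ = flat q (lab s)
          found : drop (index π) τ ≡ ((litTag , agent a , numeral k) , t , c) ∷ ρ
          found = trans (cong (drop (index π)) (sym (++-identityʳ τ))) e
          base : ∀ l → HasDepthAtLeast l (deepest l) k → (not (not (hasAnnouncements l) && isZero (numeral k)) || false) ≡ true → ⊥
          base DBEL z≤n ()
          base EDPAL () _
          forward : ∀ t′ → t ≡ t′ → HasDepthAtLeast l (Model.d model a s) k → t′ ≡ true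
          forward true  _    _ = refl
          forward false refl h with thresholds-attained l (agent a) τ h
          ... | inj₁ h′ = ⊥-elim (base l h′ good)
          ... | inj₂ (j , e , σ , e₁ , c′) = ⊥-elim (consistent-elem τ j (index π) (proj₂ (proj₂ (ok-parts s))) e₁ found c′)
          backward : ∀ t′ → t ≡ t′ → t′ ≡ true → HasDepthAtLeast l (Model.d model a s) k
          backward true refl _ = thresholds-lower l (agent a) τ (index π) found
            (&&-intro (same-refl (agent a)) (atLeast⁺ (numeral k) (numeral k) ≤-refl))

      -- The truth lemma, with `c` the number of rounds from which the survival flags are right. An
      -- announcement passes `c + rank p` on to its right operand, and a box spends one round.
      truth : ∀ p (π : Pos q p) A c → Alive π A c → Truth π A (c + rank p)
      truth (atomQ p) π A c H s _ = atom-truth p π s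
      truth (litQ a k) π A c H s _ = lit-truth a k π s
      truth (negQ p) π A c H s h = mk⇔ (λ nope → negate (ih .to) nope) (λ e → λ yes′ → contra e (ih .to yes′))
        where
        π′ = π ∙ negP here
        parts : ∀ s → (T π s == not (T π′ s)) ≡ true × (C π′ s == C π s) ≡ true
        parts s = subst (λ v → (T π s == not (proj₁ v)) ≡ true × (proj₂ v == C π s) ≡ true) (sym (child-root π (negP here) s))
          (&&-true (proj₂ (&&-true {okTree p (proj₂ (at π (lab s)))} (ok π s))))
        ih : Holds model p A s ⇔ (T π′ s ≡ true)
        ih = truth p π′ A c (λ s h → ⇔-true (sym (==-eq (proj₂ (parts s)))) (H s h)) s h
        negate : (Holds model p A s → T π′ s ≡ true) → ¬ Holds model p A s → T π s ≡ true
        negate _ nope with T π′ s in e | proj₁ (parts s)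
        ... | true  | _ = ⊥-elim (nope (ih .from e))
        ... | false | k = ==-eq k
        contra : T π s ≡ true → T π′ s ≡ true → ⊥
        contra e e′ with proj₁ (parts s)
        ... | k rewrite e | e′ with () ← k
      truth (andQ p r) π A c H s h = mk⇔
        (λ (hp , hr) → trans (proj₁ (parts s)) (&&-intro (ihp .to hp) (ihr .to hr)))
        (λ e → let e₁ , e₂ = &&-true {T π₁ s} (trans (sym (proj₁ (parts s))) e) in ihp .from e₁ , ihr .from e₂)
        where
        π₁ = π ∙ andˡ here
        π₂ = π ∙ andʳ here
        parts : ∀ s → T π s ≡ (T π₁ s && T π₂ s) × C π₁ s ≡ C π s × C π₂ s ≡ C π s
        parts s = subst₂ (λ v w → T π s ≡ (proj₁ v && proj₁ w) × proj₂ v ≡ C π s × proj₂ w ≡ C π s)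
          (sym (child-root π (andˡ here) s)) (sym (child-root π (andʳ here) s))
          (let z = at π (lab s)
               h₁ , h₂ = &&-true (proj₂ (&&-true {okTree p (proj₁ (proj₂ z))} (proj₂ (&&-true {okTree r (proj₂ (proj₂ z))} (ok π s)))))
               h₃ , h₄ = &&-true h₂ in ==-eq h₁ , ==-eq h₃ , ==-eq h₄)
        ihp = truth p π₁ A c (λ s h → ⇔-true (sym (proj₁ (proj₂ (parts s)))) (H s h)) s (≤-trans (+-monoʳ-≤ c (m≤m⊔n (rank p) (rank r))) h)
        ihr = truth r π₂ A c (λ s h → ⇔-true (sym (proj₂ (proj₂ (parts s)))) (H s h)) s (≤-trans (+-monoʳ-≤ c (m≤n⊔m (rank p) (rank r))) h)
      truth (annQ p r) π A c H s h = mk⇔ forward backward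
        where
        π₁ = π ∙ annˡ here
        π₂ = π ∙ annʳ here
        parts : ∀ s → T π s ≡ (not (T π₁ s) || T π₂ s) × C π₁ s ≡ C π s × C π₂ s ≡ (C π s && T π₁ s)
        parts s = subst₂ (λ v w → T π s ≡ (not (proj₁ v) || proj₁ w) × proj₂ v ≡ C π s × proj₂ w ≡ (C π s && proj₁ v))
          (sym (child-root π (annˡ here) s)) (sym (child-root π (annʳ here) s))
          (let z = at π (lab s)
               h₁ , h₂ = &&-true (proj₂ (&&-true {okTree p (proj₁ (proj₂ z))} (proj₂ (&&-true {okTree r (proj₂ (proj₂ z))} (ok π s)))))
               h₃ , h₄ = &&-true h₂ in ==-eq h₁ , ==-eq h₃ , ==-eq h₄)
        truth-p : Truth π₁ A (c + rank p)
        truth-p = truth p π₁ A c (λ s h → ⇔-true (sym (proj₁ (proj₂ (parts s)))) (H s h))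
        A′ : State → Set
        A′ t = A t × Holds model p A t
        alive′ : Alive π₂ A′ (c + rank p)
        alive′ t k = mk⇔
          (λ (a , hp) → trans (proj₂ (proj₂ (parts t))) (&&-intro (H t (≤-trans (m≤m+n c _) k) .to a) (truth-p t k .to hp)))
          (λ e → let e₁ , e₂ = &&-true {C π t} (trans (sym (proj₂ (proj₂ (parts t)))) e) in H t (≤-trans (m≤m+n c _) k) .from e₁ , truth-p t k .from e₂)
        ihp = truth-p s (≤-trans (+-monoʳ-≤ c (m≤m+n (rank p) (rank r))) h)
        ihr = truth r π₂ A′ (c + rank p) alive′ s (≤-trans (≤-reflexive (+-assoc c (rank p) (rank r))) h)
        forward : (Holds model p A s → Holds model r A′ s) → T π s ≡ true
        forward f with T π₁ s in e₁ | proj₁ (parts s)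
        ... | false | k = k
        ... | true  | k = trans k (ihr .to (f (ihp .from e₁)))
        backward : T π s ≡ true → Holds model p A s → Holds model r A′ s
        backward e hp = ihr .from (trans (sym (trans (proj₁ (parts s)) (cong (λ v → not v || T π₂ s) (ihp .to hp)))) e)
      truth (boxQ b p) π A c H s h = mk⇔ forward backward
        where
        π′ = π ∙ boxP here
        parts : ∀ s → (not (T π s) || (not (C π′ s) || T π′ s)) ≡ true × C π′ s ≡ C π s
        parts s = subst (λ v → (not (T π s) || (not (proj₂ v) || proj₁ v)) ≡ true × proj₂ v ≡ C π s) (sym (child-root π (boxP here) s))
          (let h₁ , h₂ = &&-true (proj₂ (&&-true {okTree p (proj₂ (at π (lab s)))} (ok π s))) in h₁ , ==-eq h₂)
        alive′ : Alive π′ A c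
        alive′ s k = ⇔-true (sym (proj₂ (parts s))) (H s k)
        truth-p : Truth π′ A (c + rank p)
        truth-p = truth p π′ A c alive′
        T-rep : ∀ t → T π (rep b t) ≡ T π t
        T-rep t = agree-box b p (at π (lab (rep b t))) (at π (lab t)) (agree-at (agent b) π (lab (rep b t)) (lab t) (rep-agree b t))
        h′ : suc (c + rank p) ≤ level s
        h′ = ≤-trans (≤-reflexive (sym (+-suc c (rank p)))) h
        -- Members of a cluster have as many rounds left as its representative or one fewer, so
        -- moving within the cluster costs at most the round reserved for the box.
        near : ∀ t → rep b s ≡ rep b t → c + rank p ≤ level t
        near t e = ≤-pred (≤-trans h′ (≤-trans (level≤rep b s) (≤-trans (≤-reflexive (cong level e)) (rep≤level b t))))
        -- The whole cluster shares the label of the box, so the box is also labelled true at `t`,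
        -- and reflexivity there gives the body.
        backward : T π s ≡ true → ∀ t → rep b s ≡ rep b t → A t → Holds model p A t
        backward e t r a with parts t
        ... | k , _ rewrite trans (sym (T-rep t)) (trans (cong (T π) (sym r)) (trans (T-rep s) e))
                          | alive′ t (≤-trans (m≤m+n c _) (near t r)) .to a = truth-p t (near t r) .from k
        forward : (∀ t → rep b s ≡ rep b t → A t → Holds model p A t) → T π s ≡ true
        forward f with T π s in e
        ... | true  = refl
        ... | false = ⊥-elim (refute (rep b s) refl (trans (T-rep s) e))
          where
          -- The challenge is made at the representative, where `b` was not the last agent to move,
          -- so that it is legal. A winning answer is a further member of the cluster at which the
          -- body fails.
          refute : ∀ r → r ≡ rep b s → T π r ≡ false → ⊥
          refute (zero , _) r≡ _ with () ← ≤-trans h′ (≤-trans (level≤rep b s) (≤-reflexive (cong level (sym r≡))))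
          refute (suc m , ag , x , w) r≡ tf
            with us , us-len , us-lead ← marks (index π) (length (nodes q)) (subst (index π <_) (flat-length q x) (drop-short (flat q x) (index π) (proj₂ (proj₂ (elem π (suc m , ag , x , w))))))
            with y , won-y ← reply m (true , true , ag , flat q x) (winning w) us us-len = answered (drop-index π x []) tf
            where
            m≥ : c + rank p ≤ m
            m≥ = ≤-pred (≤-trans h′ (≤-trans (level≤rep b s) (≤-reflexive (cong level (sym r≡)))))
            unmoved : moved ag (agent b) ≡ false
            unmoved = trans (cong (λ r → moved (proj₁ (proj₂ r)) (agent b)) r≡) (rep-moved b s)
            bad-child : (good : (coherent (flat q y) && (same (boxValues (agent b) (flat q x)) (boxValues (agent b) (flat q y)) && childFails (select us (flat q y)))) ≡ true) →
                        W m (true , true , agent b ∷ [] , flat q y) ≡ true → ⊥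
            bad-child good v = contradictory (drop-index π y [])
              where
              g₁ = proj₁ (&&-true {coherent (flat q y)} good)
              g₂ = proj₁ (&&-true (proj₂ (&&-true {coherent (flat q y)} good)))
              g₃ = proj₂ (&&-true {same (boxValues (agent b) (flat q x)) (boxValues (agent b) (flat q y))} (proj₂ (&&-true {coherent (flat q y)} good)))
              agrees : Agree (agent b) (flat q x) (flat q y)
              agrees = proj₁ (values-agree (agent b) (flat q x) (flat q y) [] [] (trans (flat-nodes q x) (sym (flat-nodes q y))) (same⁻ _ _ g₂))
              t : State
              t = m , agent b ∷ [] , y , child w b y unmoved agrees g₁ v
              rel : rep b s ≡ rep b t
              rel = trans (sym r≡) (sym (rep-child w b y unmoved agrees g₁ v))
              contradictory : Σ[ σ ∈ List (El Label) ] drop (index π) (flat q y ++ []) ≡ flat (boxQ b p) (at π y) ++ σ → ⊥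
              contradictory (σ , e₁) with nd , σ′ , e₂ ← flat-root p (proj₂ (at π y)) σ =
                let neg = trans (sym (cong childFails (trans (trans (cong (λ k → drop k (flat q y)) us-lead) (cong (drop (index π)) (sym (++-identityʳ (flat q y)))))
                            (trans e₁ (cong (((boxTag , agent b , []) , proj₁ (at π y)) ∷_) e₂))))) g₃
                    t-false , c-true = &&-true {not (proj₁ (root p (proj₂ (at π y))))} neg
                    a = alive′ t (≤-trans (m≤m+n c _) m≥) .from (trans (cong proj₂ (child-root π (boxP here) t)) c-true)
                    t-true = trans (sym (cong proj₁ (child-root π (boxP here) t))) (truth-p t m≥ .to (f t rel a))
                in absurd t-false t-true
                where
                absurd : ∀ {z} → not z ≡ true → z ≡ true → ⊥
                absurd {false} _ ()
                absurd {true} () _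
            answered : Σ[ σ ∈ List (El Label) ] drop (index π) (flat q x ++ []) ≡ flat (boxQ b p) (at π x) ++ σ → proj₁ (proj₁ (at π x)) ≡ false → ⊥
            answered (σ , e₁) tf = decided (coherent (flat q y) && (same (boxValues (agent b) (flat q x)) (boxValues (agent b) (flat q y)) && childFails (select us (flat q y)))) refl
              (subst (λ d → W m (if d then D else won) ≡ true) demanded (subst (λ σ₀ → W m (caseList σ₀ won (λ e _ → answer ag (flat q x) us (flat q y) e)) ≡ true) selected won-y))
              where
              D = if coherent (flat q y) && (same (boxValues (agent b) (flat q x)) (boxValues (agent b) (flat q y)) && childFails (select us (flat q y)))
                  then (true , true , agent b ∷ [] , flat q y) else lost
              selected : select us (flat q x) ≡ ((boxTag , agent b , []) , proj₁ (at π x)) ∷ (flat p (proj₂ (at π x)) ++ σ)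
              selected = trans (cong (λ k → drop k (flat q x)) us-lead) (trans (cong (drop (index π)) (sym (++-identityʳ (flat q x)))) e₁)
              demanded : demand ag ((boxTag , agent b , []) , proj₁ (at π x)) ≡ true
              demanded = &&-intro (cong not tf) (cong not unmoved)
              decided : ∀ g → (coherent (flat q y) && (same (boxValues (agent b) (flat q x)) (boxValues (agent b) (flat q y)) && childFails (select us (flat q y)))) ≡ g →
                        W m D ≡ true → ⊥
              decided true  e v = bad-child e (subst (λ g → W m (if g then (true , true , agent b ∷ [] , flat q y) else lost) ≡ true) e v)
              decided false e v = lost-value m (subst (λ g → W m (if g then (true , true , agent b ∷ [] , flat q y) else lost) ≡ true) e v)

      holds-start : rank q ≤ N → Holds model q (λ _ → ⊤) (_ , _ , _ , start)
      holds-start h = truth q here (λ _ → ⊤) 0 (λ s _ → mk⇔ (λ _ → proj₁ (proj₂ (ok-parts s))) (λ _ → tt)) (_ , _ , _ , start) h .from root₀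

    complete : rank q ≤ N → W (suc N) (play []) ≡ true → HoldsSomewhere l q
    complete h v with x , v′ ← reply N (true , false , [] , []) v (List.map (λ _ → false) (nodes q)) (length-map _ (nodes q)) =
      decided (coherent (flat q x) && rootHolds (flat q x)) refl v′
      where
      decided : ∀ g → (coherent (flat q x) && rootHolds (flat q x)) ≡ g → W N (if g then (true , true , [] , flat q x) else lost) ≡ true → HoldsSomewhere l q
      decided false e v′ = ⊥-elim (lost-value N v′)
      decided true  e v′ with coh , rh ← &&-true {coherent (flat q x)} e with nd , σ , e′ ← flat-root q x [] =
        model x coh top v′ , _ , holds-start x coh top v′ h
        where
        top : proj₁ (root q x) ≡ true
        top = proj₁ (&&-true {proj₁ (root q x)} (trans (sym (cong rootHolds (trans (sym (++-identityʳ (flat q x))) e′))) rh))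

-- Membership in PSPACE, and templates of formulas for the reduction

module Templates where

  open Bounds
  open Terms
  open Compilation
  open ListTerms
  open Numerals
  open Parsing
  open Referees
  open Odometers
  open Searches
  open Queries
  open Labellings
  open GameSoundness
  open GameCompleteness
  open Equivalence using (to; from)

  module _ (n : ℕ) (l : Logic) where
    open Game l

    accepts⁻ : ∀ (φ : Formula n l) → accepts n (encode φ) ≡ true → Satisfiable φ
    accepts⁻ φ h with h₁ , h₂ ← &&-true {Setup.wellFormed n l (encode φ)} h =
      satisfiable-query φ .from (CompleteGame.complete l q (length (nodes q)) (rank≤nodes q)
        (subst (λ nds → value-of nds (suc (length nds)) (Referee.play l []) ≡ true) (nodesOf-encode n l φ) h₂))
      where q = query φ 0

    accepts⁺ : ∀ (φ : Formula n l) → Satisfiable φ → accepts n (encode φ) ≡ true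
    accepts⁺ φ sat with M , s , h ← satisfiable-query φ .to sat =
      &&-intro (wellFormed⁺ n l φ) (subst (λ nds → value-of nds (suc (length nds)) (Referee.play l []) ≡ true)
        (sym (nodesOf-encode n l φ)) (SoundGame.sound M (query φ 0) (length (nodes (query φ 0))) s h))

    membership : InPSPACE (SAT n l)
    membership = game-inPSPACE n λ w → mk⇔ (yes-instance w) λ { (φ , refl , sat) → accepts⁺ φ sat }
      where
      yes-instance : ∀ w → accepts n w ≡ true → SAT n l w
      yes-instance w h with h₁ , _ ← &&-true {Setup.wellFormed n l w} h with φ , refl ← wellFormed⁻ n l w h₁ =
        φ , refl , accepts⁻ φ h

    -- The coding of formulas need not be shown injective: equal codes are accepted alike.
    SAT-encode : ∀ (φ : Formula n l) → SAT n l (encode φ) ⇔ Satisfiable φ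
    SAT-encode φ = mk⇔ (λ { (ψ , e , sat) → accepts⁻ φ (subst (λ w → accepts n w ≡ true) e (accepts⁺ ψ sat)) }) λ sat → φ , refl , sat

  -- Formula templates: formulas whose iterated parts range over lists, given
  -- as terms, together with programs that write their codes

  ones : ℕ → Digits → Digits
  ones zero    ds = false ∷ ds
  ones (suc k) ds = true ∷ ones k ds

  Kind : Set
  Kind = ℕ × ℕ × ℕ

  kindName : Kind → Digits
  kindName (g , a , b) = ones g (ones a (ones b []))

  -- Names of atoms list five numbers in unary, so they can be written bit by bit.
  name : ℕ → ℕ → Kind → Digits
  name r i κ = ones r (ones i (kindName κ))

  module Template (n′ : ℕ) (l : Logic) where

    n : ℕ
    n = suc (suc n′)

    Fm : Set
    Fm = Formula n l

    named : ℕ → ℕ → Kind → Fm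
    named r i κ = atom (value (name r i κ))

    infixr 7 _⟶_
    _⟶_ : Fm → Fm → Fm
    φ ⟶ ψ = ∼ (φ ∧ ∼ ψ)

    top⊤ : Fm
    top⊤ = atom 0 ⟶ atom 0

    -- For a single agent, iterated boxes collapse to one. The composite of two equivalence
    -- relations need not be transitive and can serve as a step down a tree; being reflexive, it
    -- also reaches the state itself, so its uses are guarded.
    □ : Fm → Fm
    □ φ = K∞ Fin.zero (K∞ (Fin.suc Fin.zero) φ)

    conjoin : ∀ {X : Set} → (X → List X → Fm) → Fm → List X → Fm
    conjoin f φ []      = φ
    conjoin f φ (a ∷ l) = conjoin f (f a l ∧ φ) l

    -- Built from the inside: the last list element gives the outermost layer, so the length of the
    -- rest `l` is the level of a layer. The inner formula occurs only once, which keeps the size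
    -- polynomial.
    nested : ∀ {X : Set} → (X → List X → Fm × Fm) → Fm → List X → Fm
    nested f φ []      = φ
    nested f φ (a ∷ l) = nested f (proj₁ (f a l) ∧ □ (proj₂ (f a l) ⟶ φ)) l

    -- Numbers are lengths of lists. Bodies of `allᵗ` and `nestᵗ` live in the context of an `each`
    -- body: element, rest, and a dummy flag.
    data Tmpl (Γ : Ctx) : Set where
      atomᵗ   : ℕ → Tm Γ (list bool) → Kind → Tmpl Γ
      topᵗ    : Tmpl Γ
      notᵗ □ᵗ : Tmpl Γ → Tmpl Γ
      andᵗ    : Tmpl Γ → Tmpl Γ → Tmpl Γ
      allᵗ    : Tm Γ (list bool) → Tmpl (bool ∷ list bool ∷ bool ∷ Γ) → Tmpl Γ
      nestᵗ   : Tm Γ (list bool) → (body guard : Tmpl (bool ∷ list bool ∷ bool ∷ Γ)) → Tmpl Γ → Tmpl Γ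
      caseᵗ   : Tm Γ (list bool) → Tmpl Γ → Tmpl (bool ∷ list bool ∷ Γ) → Tmpl Γ
      ifᵗ     : Tm Γ bool → Tmpl Γ → Tmpl Γ → Tmpl Γ

    form : ∀ {Γ} → Tmpl Γ → Env Γ → Fm
    form (atomᵗ r t κ) γ     = named r (length (⟦ t ⟧ γ)) κ
    form topᵗ γ              = top⊤
    form (notᵗ t) γ          = ∼ form t γ
    form (□ᵗ t) γ            = □ (form t γ)
    form (andᵗ t u) γ        = form t γ ∧ form u γ
    form (allᵗ t u) γ        = conjoin (λ a l → form u (a , l , false , γ)) top⊤ (⟦ t ⟧ γ)
    form (nestᵗ t u g base) γ = nested (λ a l → form u (a , l , false , γ) , form g (a , l , false , γ)) (form base γ) (⟦ t ⟧ γ)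
    form (caseᵗ t u v) γ     = caseList (⟦ t ⟧ γ) (form u γ) (λ a l → form v (a , l , γ))
    form (ifᵗ t u v) γ       = if ⟦ t ⟧ γ then form u γ else form v γ

    private
      ones-word : ℕ → Word → Word
      ones-word zero    w = w
      ones-word (suc k) w = true ∷ true ∷ ones-word k w

      encode-ones : ∀ k ds → encodeDigits (ones k ds) ≡ ones-word k (true ∷ false ∷ encodeDigits ds)
      encode-ones zero    ds = refl
      encode-ones (suc k) ds = cong (λ w → true ∷ true ∷ w) (encode-ones k ds)

      box-word impl-word : Word
      box-word = true ∷ true ∷ false ∷ encodeℕ 0 ++ true ∷ true ∷ false ∷ encodeℕ 1
      impl-word = false ∷ true ∷ true ∷ true ∷ false ∷ false ∷ []

    -- Polish notation suits a loop that writes in front of its output: the output so far becomes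
    -- the last operand of the chunk. In the clause for `nestᵗ` the chunk ends with a negation tag,
    -- whose operand is the inner formula.
    write : ∀ {Γ} → Tmpl Γ → Tm Γ (list bool)
    write (atomᵗ r t κ) = app (val (false ∷ false ∷ false ∷ ones-word r (true ∷ false ∷ [])))
      (each (val (true ∷ true ∷ [])) (val (true ∷ false ∷ encodeDigits (kindName κ))) t)
    write topᵗ = val (encode top⊤)
    write (notᵗ t) = app (val (false ∷ true ∷ true ∷ [])) (write t)
    write (□ᵗ t) = app (val box-word) (write t)
    write (andᵗ t u) = app (val (true ∷ false ∷ false ∷ [])) (app (write t) (write u))
    write (allᵗ t u) = each (app (val (true ∷ false ∷ false ∷ [])) (write u)) (val (encode top⊤)) t
    write (nestᵗ t u g base) = each (app (val (true ∷ false ∷ false ∷ [])) (app (write u)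
      (app (val (box-word ++ impl-word)) (app (write g) (val (false ∷ true ∷ true ∷ [])))))) (write base) t
    write (caseᵗ t u v) = caseL t (write u) (write v)
    write (ifᵗ t u v) = if t (write u) (write v)

    private
      numeral-name : ∀ ds → encodeℕ (value ds) ≡ encodeDigits ds
      numeral-name ds = trans (encodeℕ-digits (value ds)) (cong encodeDigits (sym (numeral-value ds)))

      ones-word-++ : ∀ k v w → ones-word k v ++ w ≡ ones-word k (v ++ w)
      ones-word-++ zero    v w = refl
      ones-word-++ (suc k) v w = cong (λ u → true ∷ true ∷ u) (ones-word-++ k v w)

      each-false : ∀ {X O : Set} (c : X → List X → Bool → List O) o xs →
        proj₂ (iterate (λ a l f → false , c a l f) false o xs) ≡ accumulate (λ a l → c a l false) o xs
      each-false c o []       = refl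
      each-false c o (a ∷ xs) = each-false c _ xs

      written : ∀ (xs : List Bool) w → proj₂ (iterate (λ _ _ _ → false , true ∷ true ∷ []) false w xs) ≡ ones-word (length xs) w
      written []       w = refl
      written (x ∷ xs) w = trans (written xs (true ∷ true ∷ w)) (shift (length xs) w)
        where
        shift : ∀ k w → ones-word k (true ∷ true ∷ w) ≡ true ∷ true ∷ ones-word k w
        shift zero    w = refl
        shift (suc k) w = cong (λ u → true ∷ true ∷ u) (shift k w)

    write-form : ∀ {Γ} (t : Tmpl Γ) γ → ⟦ write t ⟧ γ ≡ encode (form t γ)
    write-form (atomᵗ r t κ) γ = cong (λ w → false ∷ false ∷ false ∷ w) (trans (cong (ones-word r (true ∷ false ∷ []) ++_) (written (⟦ t ⟧ γ) _))
      (trans (ones-word-++ r _ _) (trans (cong (λ w → ones-word r (true ∷ false ∷ w)) (sym (encode-ones i (kindName κ))))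
        (trans (sym (encode-ones r (ones i (kindName κ)))) (sym (numeral-name (name r i κ)))))))
      where i = length (⟦ t ⟧ γ)
    write-form topᵗ γ = refl
    write-form (notᵗ t) γ = cong (λ w → false ∷ true ∷ true ∷ w) (write-form t γ)
    write-form (□ᵗ t) γ = cong (box-word ++_) (write-form t γ)
    write-form (andᵗ t u) γ = cong₂ (λ v w → true ∷ false ∷ false ∷ v ++ w) (write-form t γ) (write-form u γ)
    write-form (allᵗ t u) γ = trans (each-false _ _ (⟦ t ⟧ γ)) (go top⊤ (⟦ t ⟧ γ))
      where
      go : ∀ φ xs → accumulate (λ a l → true ∷ false ∷ false ∷ ⟦ write u ⟧ (a , l , false , γ)) (encode φ) xs ≡
           encode (conjoin (λ a l → form u (a , l , false , γ)) φ xs)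
      go φ []      = refl
      go φ (a ∷ l) = trans (cong (λ w → accumulate _ (true ∷ false ∷ false ∷ w ++ encode φ) l) (write-form u (a , l , false , γ)))
        (go (form u (a , l , false , γ) ∧ φ) l)
    write-form (nestᵗ t u g base) γ = trans (each-false _ _ (⟦ t ⟧ γ))
      (trans (cong (λ w → accumulate chunk w (⟦ t ⟧ γ)) (write-form base γ)) (go (form base γ) (⟦ t ⟧ γ)))
      where
      chunk : Bool → List Bool → Word
      chunk a l = true ∷ false ∷ false ∷ ⟦ write u ⟧ (a , l , false , γ) ++ ((box-word ++ impl-word) ++ (⟦ write g ⟧ (a , l , false , γ) ++ false ∷ true ∷ true ∷ []))
      pieces : ∀ p q w → (p ++ ((box-word ++ impl-word) ++ (q ++ false ∷ true ∷ true ∷ []))) ++ w ≡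
               p ++ (box-word ++ (impl-word ++ (q ++ (false ∷ true ∷ true ∷ w))))
      pieces p q w = trans (++-assoc p _ w) (cong (λ v → p ++ (box-word ++ (impl-word ++ v))) (++-assoc q _ w))
      go : ∀ φ xs → accumulate chunk (encode φ) xs ≡ encode (nested (λ a l → form u (a , l , false , γ) , form g (a , l , false , γ)) φ xs)
      go φ []      = refl
      go φ (a ∷ l) = trans (cong (λ w → accumulate chunk (true ∷ false ∷ false ∷ w) l)
          (trans (pieces (⟦ write u ⟧ (a , l , false , γ)) (⟦ write g ⟧ (a , l , false , γ)) (encode φ))
            (cong₂ (λ p q → p ++ (box-word ++ (impl-word ++ (q ++ (false ∷ true ∷ true ∷ encode φ)))))
              (write-form u (a , l , false , γ)) (write-form g (a , l , false , γ)))))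
        (go (form u (a , l , false , γ) ∧ □ (form g (a , l , false , γ) ⟶ φ)) l)
    write-form (caseᵗ t u v) γ = go (⟦ t ⟧ γ)
      where
      go : ∀ xs → caseList xs (⟦ write u ⟧ γ) (λ a l → ⟦ write v ⟧ (a , l , γ)) ≡ encode (caseList xs (form u γ) (λ a l → form v (a , l , γ)))
      go []      = write-form u γ
      go (a ∷ l) = write-form v (a , l , γ)
    write-form (ifᵗ t u v) γ = go (⟦ t ⟧ γ)
      where
      go : ∀ b → (if b then ⟦ write u ⟧ γ else ⟦ write v ⟧ γ) ≡ encode (if b then form u γ else form v γ)
      go true  = write-form u γ
      go false = write-form v γ

    impᵗ : ∀ {Γ} → Tmpl Γ → Tmpl Γ → Tmpl Γ
    impᵗ t u = notᵗ (andᵗ t (notᵗ u))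

    listᵗ : ∀ {Γ} {X : Set} → (X → Tmpl Γ) → List X → Tmpl Γ
    listᵗ f []       = topᵗ
    listᵗ f (x ∷ xs) = andᵗ (f x) (listᵗ f xs)

    module Semantics (M : Model n l) where
      open Model M

      top-holds : ∀ s → Sat M s top⊤
      top-holds s (h , h′) = h′ h

      list-elim : ∀ {Γ} {X : Set} (f : X → Tmpl Γ) γ {xs s x} → Sat M s (form (listᵗ f xs) γ) → x ∈ₗ xs → Sat M s (form (f x) γ)
      list-elim f γ (h , _) (here refl) = h
      list-elim f γ (_ , h) (there x∈)  = list-elim f γ h x∈

      list-intro : ∀ {Γ} {X : Set} (f : X → Tmpl Γ) xs {γ s} → (∀ x → Sat M s (form (f x) γ)) → Sat M s (form (listᵗ f xs) γ)
      list-intro f []       {s = s} h = top-holds s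
      list-intro f (x ∷ xs) h = h x , list-intro f xs h

      conjoin-base : ∀ {X : Set} {f : X → List X → Fm} {φ s} xs → Sat M s (conjoin f φ xs) → Sat M s φ
      conjoin-base []       h = h
      conjoin-base (x ∷ xs) h = proj₂ (conjoin-base xs h)

      conjoin-elim : ∀ {X : Set} {f : X → List X → Fm} {φ s} (pre : List X) {a l} → Sat M s (conjoin f φ (pre ++ a ∷ l)) → Sat M s (f a l)
      conjoin-elim []        {l = l} h = proj₁ (conjoin-base l h)
      conjoin-elim (x ∷ pre) h = conjoin-elim pre h

      conjoin-intro : ∀ {X : Set} {f : X → List X → Fm} {φ s} xs → Sat M s φ → (∀ pre a l → xs ≡ pre ++ a ∷ l → Sat M s (f a l)) → Sat M s (conjoin f φ xs)
      conjoin-intro []       h k = h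
      conjoin-intro (x ∷ xs) h k = conjoin-intro xs (k [] x xs refl , h) (λ pre a l e → k (x ∷ pre) a l (cong (x ∷_) e))

      -- Loop bodies know their position only as the length of the rest, so cells are counted from
      -- the end of the list.
      suffix : ∀ {X : Set} (xs : List X) i → i < length xs → Σ[ pre ∈ List X ] Σ[ a ∈ X ] Σ[ l ∈ List X ] xs ≡ pre ++ a ∷ l × length l ≡ i
      suffix (x ∷ xs) i (s≤s i≤) with m≤n⇒m<n∨m≡n i≤
      ... | inj₂ refl = [] , x , xs , refl , refl
      ... | inj₁ i<   with pre , a , l , refl , e ← suffix xs i i< = x ∷ pre , a , l , refl , e

-- Literals of configurations, and the formula of a run

module SavitchFormulas where

  open Bounds
  open Terms
  open ListTerms
  open Numerals
  open Queries
  open Templates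
  open Equivalence using (to; from)

  -- Configurations as sets of literals

  ≡ᵇ-refl : ∀ k → (k ≡ᵇ k) ≡ true
  ≡ᵇ-refl zero    = refl
  ≡ᵇ-refl (suc k) = ≡ᵇ-refl k

  ≡ᵇ-eq : ∀ j k → (j ≡ᵇ k) ≡ true → j ≡ k
  ≡ᵇ-eq zero    zero    h = refl
  ≡ᵇ-eq (suc j) (suc k) h = cong suc (≡ᵇ-eq j k h)

  module Literals (TM : Machine) where
    open Machine TM using (Γ; extraTapes; verdict; δ; stateFinite; Γ-finite) renaming (State to Ctl; start to q₀) public

    m : ℕ
    m = suc extraTapes

    Sym : Set
    Sym = Symbol Γ

    ctlIndex : Ctl → ℕ
    ctlIndex q = toℕ (Inverse.to (proj₂ stateFinite) q)

    inverse-injective : ∀ {A B : Set} (f : A ↔ B) {x y} → Inverse.to f x ≡ Inverse.to f y → x ≡ y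
    inverse-injective f {x} {y} e = trans (sym (Inverse.strictlyInverseʳ f x)) (trans (cong (Inverse.from f) e) (Inverse.strictlyInverseʳ f y))

    ctlIndex-injective : ∀ q q′ → ctlIndex q ≡ ctlIndex q′ → q ≡ q′
    ctlIndex-injective q q′ e = inverse-injective (proj₂ stateFinite) (toℕ-injective e)

    symIndex : Sym → ℕ
    symIndex blank       = 0
    symIndex (bit false) = 1
    symIndex (bit true)  = 2
    symIndex (work g)    = 3 + toℕ (Inverse.to (proj₂ Γ-finite) g)

    symIndex-injective : ∀ c c′ → symIndex c ≡ symIndex c′ → c ≡ c′
    symIndex-injective blank       blank       e = refl
    symIndex-injective (bit false) (bit false) e = refl
    symIndex-injective (bit true)  (bit true)  e = refl
    symIndex-injective (work g)    (work g′)   e = cong work (inverse-injective (proj₂ Γ-finite) (toℕ-injective (suc-injective (suc-injective (suc-injective e)))))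
    symIndex-injective blank       (bit false) ()
    symIndex-injective blank       (bit true)  ()
    symIndex-injective blank       (work g)    ()
    symIndex-injective (bit false) blank       ()
    symIndex-injective (bit false) (bit true)  ()
    symIndex-injective (bit false) (work g)    ()
    symIndex-injective (bit true)  blank       ()
    symIndex-injective (bit true)  (bit false) ()
    symIndex-injective (bit true)  (work g)    ()
    symIndex-injective (work g)    blank       ()
    symIndex-injective (work g)    (bit false) ()
    symIndex-injective (work g)    (bit true)  ()

    enumerate : ∀ {A : Set} → IsFinite A → List A
    enumerate (k , f) = List.map (Inverse.from f) (allFin k)

    enumerate-∈ : ∀ {A : Set} (fin : IsFinite A) x → x ∈ₗ enumerate fin
    enumerate-∈ (k , f) x = subst (_∈ₗ enumerate (k , f)) (Inverse.strictlyInverseʳ f x) (∈-map⁺ (Inverse.from f) (∈-allFin (Inverse.to f x)))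

    ctls : List Ctl
    ctls = enumerate stateFinite

    symbols : List Sym
    symbols = blank ∷ bit false ∷ bit true ∷ List.map work (enumerate Γ-finite)

    symbols-∈ : ∀ c → c ∈ₗ symbols
    symbols-∈ blank       = here refl
    symbols-∈ (bit false) = there (here refl)
    symbols-∈ (bit true)  = there (there (here refl))
    symbols-∈ (work g)    = there (there (there (∈-map⁺ work (enumerate-∈ Γ-finite g))))

    vectors : ∀ k → List (Vec Sym k)
    vectors zero    = [] ∷ []
    vectors (suc k) = cartesianProductWith _∷_ symbols (vectors k)

    vectors-∈ : ∀ {k} (v : Vec Sym k) → v ∈ₗ vectors k
    vectors-∈ []      = here refl
    vectors-∈ (c ∷ v) = ∈-cartesianProductWith⁺ _∷_ (symbols-∈ c) (vectors-∈ v)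

    -- Cells are addressed relative to the head. A move then shifts both sides of the tape, but the
    -- position of the head needs no description.
    data Lit : Set where
      ctlL  : Ctl → Lit
      headL : Fin m → Sym → Lit
      -- the cells right of the head if the flag is set, else those left of it
      sideL : Bool → Fin m → Sym → Lit

    bools : List Bool
    bools = false ∷ true ∷ []

    lits : List Lit
    lits = List.map ctlL ctls ++ cartesianProductWith headL (allFin m) symbols ++
           (cartesianProductWith (sideL false) (allFin m) symbols ++ cartesianProductWith (sideL true) (allFin m) symbols)

    lits-∈ : ∀ x → x ∈ₗ lits
    lits-∈ (ctlL q)          = ∈-++⁺ˡ (∈-map⁺ ctlL (enumerate-∈ stateFinite q))
    lits-∈ (headL τ c)       = ∈-++⁺ʳ (List.map ctlL ctls) (∈-++⁺ˡ (∈-cartesianProductWith⁺ headL (∈-allFin τ) (symbols-∈ c)))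
    lits-∈ (sideL false τ c) = ∈-++⁺ʳ (List.map ctlL ctls) (∈-++⁺ʳ (cartesianProductWith headL (allFin m) symbols)
      (∈-++⁺ˡ (∈-cartesianProductWith⁺ (sideL false) (∈-allFin τ) (symbols-∈ c))))
    lits-∈ (sideL true τ c)  = ∈-++⁺ʳ (List.map ctlL ctls) (∈-++⁺ʳ (cartesianProductWith headL (allFin m) symbols)
      (∈-++⁺ʳ (cartesianProductWith (sideL false) (allFin m) symbols) (∈-cartesianProductWith⁺ (sideL true) (∈-allFin τ) (symbols-∈ c))))

    kind : Lit → Kind
    kind (ctlL q)          = 0 , ctlIndex q , 0
    kind (headL τ c)       = 1 , toℕ τ , symIndex c
    kind (sideL false τ c) = 2 , toℕ τ , symIndex c
    kind (sideL true τ c)  = 3 , toℕ τ , symIndex c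

    cell : List Sym → ℕ → Sym
    cell []       i       = blank
    cell (c ∷ cs) zero    = c
    cell (c ∷ cs) (suc i) = cell cs i

    cell-beyond : ∀ cs i → length cs ≤ i → cell cs i ≡ blank
    cell-beyond []       i       h       = refl
    cell-beyond (c ∷ cs) (suc i) (s≤s h) = cell-beyond cs i h

    side : Bool → Tape Γ → ℕ → Sym
    side false t = cell (Tape.leftward t)
    side true  t = cell (Tape.rightward t)

    nthTape : ∀ {k} → Vec (Tape Γ) k → ℕ → Tape Γ
    nthTape []       a       = blankTape
    nthTape (t ∷ ts) zero    = t
    nthTape (t ∷ ts) (suc a) = nthTape ts a

    nthTape-lookup : ∀ {k} (ts : Vec (Tape Γ) k) τ → nthTape ts (toℕ τ) ≡ Vec.lookup ts τ
    nthTape-lookup (t ∷ ts) Fin.zero    = refl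
    nthTape-lookup (t ∷ ts) (Fin.suc τ) = nthTape-lookup ts τ

    Conf : Set
    Conf = Config TM

    -- Defined on all kinds, including those that name no literal, so that it can serve as part of a
    -- valuation. Control and heads are recorded at cell 0 only.
    bitOf : Conf → ℕ → Kind → Bool
    bitOf C i (0 , a , b) = (i ≡ᵇ 0) && (ctlIndex (Config.state C) ≡ᵇ a)
    bitOf C i (1 , a , b) = (i ≡ᵇ 0) && (symIndex (Tape.head (nthTape (Config.tapes C) a)) ≡ᵇ b)
    bitOf C i (2 , a , b) = symIndex (side false (nthTape (Config.tapes C) a) i) ≡ᵇ b
    bitOf C i (_ , a , b) = symIndex (side true (nthTape (Config.tapes C) a) i) ≡ᵇ b

    on : Conf → ℕ → Lit → Bool
    on C i x = bitOf C i (kind x)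

    Describes : Conf → ℕ → Lit → Set
    Describes C i (ctlL q)      = i ≡ 0 × Config.state C ≡ q
    Describes C i (headL τ c)   = i ≡ 0 × Tape.head (Vec.lookup (Config.tapes C) τ) ≡ c
    Describes C i (sideL b τ c) = side b (Vec.lookup (Config.tapes C) τ) i ≡ c

    describes : ∀ C i x → on C i x ≡ true → Describes C i x
    describes C i (ctlL q) h = let h₁ , h₂ = &&-true {i ≡ᵇ 0} h in ≡ᵇ-eq i 0 h₁ , ctlIndex-injective _ q (≡ᵇ-eq _ _ h₂)
    describes C i (headL τ c) h rewrite nthTape-lookup (Config.tapes C) τ =
      let h₁ , h₂ = &&-true {i ≡ᵇ 0} h in ≡ᵇ-eq i 0 h₁ , symIndex-injective _ c (≡ᵇ-eq _ _ h₂)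
    describes C i (sideL false τ c) h rewrite nthTape-lookup (Config.tapes C) τ = symIndex-injective _ c (≡ᵇ-eq _ _ h)
    describes C i (sideL true τ c)  h rewrite nthTape-lookup (Config.tapes C) τ = symIndex-injective _ c (≡ᵇ-eq _ _ h)

    described : ∀ C i x → Describes C i x → on C i x ≡ true
    described C i (ctlL q) (refl , refl) = ≡ᵇ-refl (ctlIndex q)
    described C i (headL τ c) (refl , refl) rewrite nthTape-lookup (Config.tapes C) τ = ≡ᵇ-refl (symIndex c)
    described C i (sideL false τ c) refl rewrite nthTape-lookup (Config.tapes C) τ = ≡ᵇ-refl (symIndex c)
    described C i (sideL true τ c)  refl rewrite nthTape-lookup (Config.tapes C) τ = ≡ᵇ-refl (symIndex c)

    -- The side of the tape that a move pushes a cell to.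
    pushed : Sym × Move → Bool → Set
    pushed (c , left)  b = b ≡ true
    pushed (c , stay)  b = ⊥
    pushed (c , right) b = b ≡ false

    shift-first : ∀ t c mv b → pushed (c , mv) b → side b (writeMove t (c , mv)) 0 ≡ c
    shift-first (tape [] x rs)       c left  _ refl = refl
    shift-first (tape (_ ∷ _) x rs)  c left  _ refl = refl
    shift-first (tape ls x [])       c right _ refl = refl
    shift-first (tape ls x (_ ∷ _))  c right _ refl = refl

    shift-push : ∀ t c mv b → pushed (c , mv) b → ∀ i → side b (writeMove t (c , mv)) (suc i) ≡ side b t i
    shift-push (tape [] x rs)       c left  _ refl i = refl
    shift-push (tape (_ ∷ _) x rs)  c left  _ refl i = refl
    shift-push (tape ls x [])       c right _ refl i = refl
    shift-push (tape ls x (_ ∷ _))  c right _ refl i = refl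

    shift-pop : ∀ t c mv b → pushed (c , mv) b → ∀ i → side (not b) (writeMove t (c , mv)) i ≡ side (not b) t (suc i)
    shift-pop (tape [] x rs)       c left  _ refl i = refl
    shift-pop (tape (_ ∷ _) x rs)  c left  _ refl i = refl
    shift-pop (tape ls x [])       c right _ refl i = refl
    shift-pop (tape ls x (_ ∷ _))  c right _ refl i = refl

    shift-head : ∀ t c mv b → pushed (c , mv) b → Tape.head (writeMove t (c , mv)) ≡ side (not b) t 0
    shift-head (tape [] x rs)       c left  _ refl = refl
    shift-head (tape (_ ∷ _) x rs)  c left  _ refl = refl
    shift-head (tape ls x [])       c right _ refl = refl
    shift-head (tape ls x (_ ∷ _))  c right _ refl = refl

    heads-of : Conf → Vec Sym m
    heads-of C = Vec.map Tape.head (Config.tapes C)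

    step-halted : ∀ C {b} → verdict (Config.state C) ≡ just b → step TM C ≡ C
    step-halted (config q ts) e with verdict q
    step-halted (config q ts) refl | just _ = refl

    step-running : ∀ C → verdict (Config.state C) ≡ nothing →
      step TM C ≡ config (proj₁ (δ (Config.state C) (heads-of C)))
                         (Vec.zipWith writeMove (Config.tapes C) (proj₂ (δ (Config.state C) (heads-of C))))
    step-running (config q ts) e with verdict q
    step-running (config q ts) refl | nothing = refl

    bounded-sides : ∀ {N} (C : Conf) → Vec.sum (Vec.map tapeSize (Config.tapes C)) ≤ N → ∀ b (τ : Fin m) i → N ≤ i → side b (Vec.lookup (Config.tapes C) τ) i ≡ blank
    bounded-sides {N} C h b τ i N≤ = within b (Vec.lookup (Config.tapes C) τ) (≤-trans (part (Config.tapes C) τ) (≤-trans h N≤))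
      where
      part : ∀ {k} (ts : Vec (Tape Γ) k) τ → tapeSize (Vec.lookup ts τ) ≤ Vec.sum (Vec.map tapeSize ts)
      part (t ∷ ts) Fin.zero    = m≤m+n _ _
      part (t ∷ ts) (Fin.suc τ) = ≤-trans (part ts τ) (m≤n+m _ (tapeSize t))
      within : ∀ b t → tapeSize t ≤ i → side b t i ≡ blank
      within false (tape ls x rs) h = cell-beyond ls i (≤-trans (m≤m+n (length ls) _) h)
      within true  (tape ls x rs) h = cell-beyond rs i (≤-trans (n≤1+n _) (≤-trans (m≤n+m _ (length ls)) h))

    other : ∀ b b′ → b′ ≡ b ⊎ b′ ≡ not b
    other false false = inj₁ refl
    other false true  = inj₂ refl
    other true  false = inj₂ refl
    other true  true  = inj₁ refl

    module Savitch (n′ : ℕ) (l : Logic) (p : Polynomial) where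
      open Template n′ l

      Γw Δ : Ctx
      Γw = list bool ∷ []
      Δ = bool ∷ list bool ∷ bool ∷ Γw

      up : ∀ {Θ} {A} → Tm Θ A → Tm (bool ∷ list bool ∷ bool ∷ Θ) A
      up = wk (skip⊆ (skip⊆ (skip⊆ all)))

      mulT : ∀ {Θ} → Tm Θ (list bool) → Tm Θ (list bool) → Tm Θ (list bool)
      mulT t u = each (up u) (val []) t

      polyT : Polynomial → Tm Γw (list bool)
      polyT []      = val []
      polyT (a ∷ q) = app (val (List.replicate a true)) (mulT v0 (polyT q))

      -- Unary numbers: the space bound, the number of cell indices from 0 up to it, and the number
      -- of bits that describe a configuration. With that many halvings, the formula covers as many
      -- steps as there are descriptions.
      spaceT cellsT levelsT : Tm Γw (list bool)
      spaceT  = polyT p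
      cellsT  = cons (val true) spaceT
      levelsT = mulT cellsT (val (List.replicate (length lits) true))

      x y z : ∀ {Θ} → Tm Θ (list bool) → Lit → Tmpl Θ
      x i a = atomᵗ 0 i (kind a)
      y i a = atomᵗ 1 i (kind a)
      z i a = atomᵗ 2 i (kind a)

      none′ : ∀ {Θ} → Tm Θ (list bool)
      none′ = val []

      next : ∀ {Θ} → Tm Θ (list bool) → Tm Θ (list bool)
      next = cons (val true)

      copyᵗ : Lit → Tmpl Δ
      copyᵗ a = impᵗ (x v1 a) (y v1 a)

      keepᵗ : Tmpl Γw
      keepᵗ = allᵗ cellsT (listᵗ copyᵗ lits)

      sidesᵗ : Fin m → Bool → Tmpl Δ
      sidesᵗ τ b = listᵗ (λ d → copyᵗ (sideL b τ d)) symbols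

      stayᵗ : Fin m → Sym → Tmpl Γw
      stayᵗ τ c = andᵗ (y none′ (headL τ c)) (allᵗ cellsT (listᵗ (sidesᵗ τ) bools))

      enterᵗ : Fin m → Bool → Sym → Tmpl Γw
      enterᵗ τ b d = impᵗ (x none′ (sideL (not b) τ d)) (y none′ (headL τ d))

      moveᵗ : Fin m → Bool → Sym → Tmpl Δ
      moveᵗ τ b d = andᵗ (impᵗ (x (next v1) (sideL (not b) τ d)) (y v1 (sideL (not b) τ d)))
                         (impᵗ (x v1 (sideL b τ d)) (y (next v1) (sideL b τ d)))

      shiftᵗ : Fin m → Sym → Bool → Tmpl Γw
      -- On the side that is popped, the last tracked cell is refilled from beyond the space bound,
      -- where everything is blank.
      shiftᵗ τ c b = andᵗ (y none′ (sideL b τ c)) (andᵗ (y spaceT (sideL (not b) τ blank))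
        (andᵗ (listᵗ (enterᵗ τ b) symbols) (allᵗ cellsT (listᵗ (moveᵗ τ b) symbols))))

      tapeᵗ : Fin m → Sym × Move → Tmpl Γw
      tapeᵗ τ (c , left)  = shiftᵗ τ c true
      tapeᵗ τ (c , stay)  = stayᵗ τ c
      tapeᵗ τ (c , right) = shiftᵗ τ c false

      scanᵗ : Vec Sym m → Fin m → Tmpl Γw
      scanᵗ hs τ = x none′ (headL τ (Vec.lookup hs τ))

      actᵗ : Ctl → Vec Sym m → Fin m → Tmpl Γw
      actᵗ q hs τ = tapeᵗ τ (Vec.lookup (proj₂ (δ q hs)) τ)

      thenᵗ : (q : Ctl) → Maybe Bool → Vec Sym m → Tmpl Γw
      thenᵗ q (just _) hs = keepᵗ
      thenᵗ q nothing  hs = andᵗ (y none′ (ctlL (proj₁ (δ q hs)))) (listᵗ (actᵗ q hs) (allFin m))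

      ruleᵗ : Ctl → Vec Sym m → Tmpl Γw
      ruleᵗ q hs = impᵗ (andᵗ (x none′ (ctlL q)) (listᵗ (scanᵗ hs) (allFin m))) (thenᵗ q (verdict q) hs)

      stepᵗ : Tmpl Γw
      stepᵗ = listᵗ (λ q → listᵗ (ruleᵗ q) (vectors m)) ctls

      levelᵗ branchᵗ : ∀ {Θ} → Tm Θ (list bool) → Tmpl Θ
      levelᵗ i  = atomᵗ 3 i (0 , 0 , 0)
      branchᵗ _ = atomᵗ 4 none′ (0 , 0 , 0)

      childᵗ : ∀ {Θ} → Bool → Tm Θ (list bool) → Tmpl Θ
      childᵗ true  i = andᵗ (levelᵗ i) (branchᵗ i)
      childᵗ false i = andᵗ (levelᵗ i) (notᵗ (branchᵗ i))

      -- The first child leads from `x` to `z`, the second from `z` to `y`. Starts are handed down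
      -- as positive literals. Ends have to come back up, which a box achieves only in
      -- contraposition: a literal missing above is missing at the end of the child.
      linkᵗ : Lit → Tmpl (bool ∷ list bool ∷ bool ∷ Δ)
      linkᵗ a = andᵗ (impᵗ (x v1 a) (□ᵗ (impᵗ (childᵗ false lv) (x v1 a))))
               (andᵗ (impᵗ (notᵗ (z v1 a)) (□ᵗ (impᵗ (childᵗ false lv) (notᵗ (y v1 a)))))
               (andᵗ (impᵗ (z v1 a) (□ᵗ (impᵗ (childᵗ true lv) (x v1 a))))
                     (impᵗ (notᵗ (y v1 a)) (□ᵗ (impᵗ (childᵗ true lv) (notᵗ (y v1 a)))))))
        where
        lv : Tm (bool ∷ list bool ∷ bool ∷ Δ) (list bool)
        lv = next v4

      splitᵗ : Tmpl Δ
      splitᵗ = andᵗ (notᵗ (□ᵗ (notᵗ (childᵗ false (next v1))))) (andᵗ (notᵗ (□ᵗ (notᵗ (childᵗ true (next v1)))))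
                 (allᵗ (up cellsT) (listᵗ linkᵗ lits)))

      reachᵗ : Tmpl Γw
      reachᵗ = nestᵗ levelsT splitᵗ (levelᵗ (next v1)) stepᵗ

      inputᵗ : Bool → Tmpl Δ
      inputᵗ b = caseᵗ v1 (x none′ (headL Fin.zero (bit b))) (x v1 (sideL true Fin.zero (bit b)))

      leftᵗ : Fin m → Tmpl Δ
      leftᵗ τ = x v1 (sideL false τ blank)

      extraᵗ : Fin extraTapes → Tmpl Γw
      extraᵗ τ = andᵗ (x none′ (headL (Fin.suc τ) blank)) (allᵗ cellsT (x v1 (sideL true (Fin.suc τ) blank)))

      emptyᵗ : Tmpl Γw
      emptyᵗ = caseᵗ v0 (x none′ (headL Fin.zero blank)) topᵗ

      letterᵗ beyondᵗ : Tmpl Δ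
      letterᵗ = ifᵗ v0 (inputᵗ true) (inputᵗ false)
      -- The first letter is under the head, so the blanks on the right begin at the length of the
      -- tail of the word.
      beyondᵗ = x (app (up (caseL v0 (val []) v1)) v1) (sideL true Fin.zero blank)

      initᵗ : Tmpl Γw
      initᵗ = andᵗ (x none′ (ctlL q₀)) (andᵗ (allᵗ cellsT (listᵗ leftᵗ (allFin m))) (andᵗ (listᵗ extraᵗ (allFin extraTapes))
             -- After reversal, the number of letters that follow one in the list is its position in
             -- the word.
             (andᵗ emptyᵗ (andᵗ (allᵗ (revT v0) letterᵗ) (allᵗ cellsT beyondᵗ)))))

      -- A model may contain more literals than the true run but never fewer. An accepting literal
      -- at the end would thus prove nothing; instead the states that do not accept are excluded.
      rejectᵗ : Ctl → Maybe Bool → Tmpl Γw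
      rejectᵗ q (just true) = topᵗ
      rejectᵗ q _           = notᵗ (y none′ (ctlL q))

      formulaᵗ : Tmpl Γw
      formulaᵗ = andᵗ initᵗ (andᵗ (listᵗ (λ q → rejectᵗ q (verdict q)) ctls) reachᵗ)

      formulaOf : Word → Fm
      formulaOf w = form formulaᵗ (w , tt)

      accumulate-length : ∀ {X O : Set} (o ys : List O) (xs : List X) → length (accumulate (λ _ _ → ys) o xs) ≡ length xs * length ys + length o
      accumulate-length o ys []       = refl
      accumulate-length o ys (_ ∷ xs) = trans (accumulate-length (ys ++ o) ys xs) (trans (cong (length xs * length ys +_) (length-++ ys))
        (trans (sym (+-assoc (length xs * length ys) (length ys) (length o))) (cong (_+ length o) (+-comm (length xs * length ys) (length ys)))))

      mulT-length : ∀ {Θ} (t u : Tm Θ (list bool)) γ → length (⟦ mulT t u ⟧ γ) ≡ length (⟦ t ⟧ γ) * length (⟦ u ⟧ γ)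
      mulT-length t u γ = trans (cong length (accumulate-iterate (λ a l f → ⟦ u ⟧ (thin all γ)) (λ _ _ → ⟦ u ⟧ γ) (λ _ _ _ → cong ⟦ u ⟧ (thin-all γ)) false [] (⟦ t ⟧ γ)))
        (trans (accumulate-length [] (⟦ u ⟧ γ) (⟦ t ⟧ γ)) (+-identityʳ _))

      module _ (w : Word) where

        polyT-length : ∀ q → length (⟦ polyT q ⟧ (w , tt)) ≡ eval q (length w)
        polyT-length []      = refl
        polyT-length (a ∷ q) = trans (length-++ (List.replicate a true)) (cong₂ _+_ (length-replicate a)
          (trans (mulT-length v0 (polyT q) (w , tt)) (cong (length w *_) (polyT-length q))))

        N K# : ℕ
        N = eval p (length w)
        K# = suc N * length lits

        space-length : length (⟦ spaceT ⟧ (w , tt)) ≡ N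
        space-length = polyT-length p

        levels-length : length (⟦ levelsT ⟧ (w , tt)) ≡ K#
        levels-length = trans (mulT-length cellsT (val (List.replicate (length lits) true)) (w , tt))
          (cong₂ _*_ (cong suc space-length) (length-replicate (length lits)))

    polyTime-formula : ∀ n′ l p → PolyTime (λ w → encode (Savitch.formulaOf n′ l p w))
    polyTime-formula n′ l p = let T′ , q , h = polyTime′ in T′ , q , λ w → let t , t≤ , v , o = h w in
      t , t≤ , v , trans o (Template.write-form n′ l (Savitch.formulaᵗ n′ l p) (w , tt))
      where
      polyTime′ = Compilation.polyTime (Template.write n′ l (Savitch.formulaᵗ n′ l p))

-- Satisfiability implies acceptance

module FormulaSoundness where

  open Bounds
  open Terms
  open ListTerms
  open Numerals
  open Queries
  open Templates
  open SavitchFormulas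
  open Equivalence using (to; from)

  stable : ∀ {b} → ¬ ¬ b ≡ true → b ≡ true
  stable {true}  h = refl
  stable {false} h = ⊥-elim (h λ ())

  split-ʳ++ : ∀ {X : Set} (w pre : List X) {a k} → w ʳ++ [] ≡ pre ++ a ∷ k → w ≡ k ʳ++ (a ∷ (pre ʳ++ []))
  split-ʳ++ w pre e = trans (trans (sym (++-identityʳ w)) (sym (ʳ++-ʳ++ w))) (trans (cong (_ʳ++ []) e) (++-ʳ++ pre))

  module Correctness (TM : Machine) (n′ : ℕ) (l : Logic) (p : Polynomial) where
    open Literals TM public
    open Savitch n′ l p public
    open Template n′ l public

    cell-bits-ʳ++ : ∀ (k : Word) v j → cell (List.map bit (k ʳ++ v)) (length k + j) ≡ cell (List.map bit v) j
    cell-bits-ʳ++ []      v j = refl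
    cell-bits-ʳ++ (b ∷ k) v j = trans (cong (cell (List.map bit (k ʳ++ (b ∷ v)))) (sym (+-suc (length k) j))) (cell-bits-ʳ++ k (b ∷ v) (suc j))

    contents-input : ∀ w i → cell (Tape.head (inputTape w) ∷ Tape.rightward (inputTape w)) i ≡ cell (List.map bit w) i
    contents-input []      zero    = refl
    contents-input []      (suc i) = refl
    contents-input (b ∷ w) i       = refl

    kid : Bool → ℕ → Fm
    kid true  i = named 3 i (0 , 0 , 0) ∧ named 4 0 (0 , 0 , 0)
    kid false i = named 3 i (0 , 0 , 0) ∧ ∼ named 4 0 (0 , 0 , 0)

    linked : ℕ → ℕ → Bool → ℕ → ℕ → Lit → Fm
    linked r r′ c j i a = (named r i (kind a) ⟶ □ (kid c j ⟶ named 0 i (kind a))) ∧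
                          (∼ named r′ i (kind a) ⟶ □ (kid c j ⟶ ∼ named 1 i (kind a)))

    kid-level : ∀ c {i} (M : Model n l) s → Sat M s (kid c i) → Sat M s (named 3 i (0 , 0 , 0))
    kid-level true  M s = proj₁
    kid-level false M s = proj₁

    module Soundness (M : Model n l) where
      open Model M
      open Semantics M public

      At : ℕ → S → ℕ → Lit → Set
      At r s i a = V s (value (name r i (kind a))) ≡ true

      -- Implications are negated conjunctions, so they are eliminated only towards stable goals.
      imp-elim : ∀ {A B : Set} {b} → ¬ (A × ¬ B) → A → (B → b ≡ true) → b ≡ true
      imp-elim h x k = stable λ no → h (x , λ y → no (k y))

      all-elim : ∀ {Θ} (t : Tm Θ (list bool)) u γ {s} i → Sat M s (form (allᵗ t u) γ) → i < length (⟦ t ⟧ γ) →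
        Σ[ pre ∈ Word ] Σ[ a ∈ Bool ] Σ[ k ∈ Word ] (⟦ t ⟧ γ ≡ pre ++ a ∷ k × length k ≡ i × Sat M s (form u (a , k , false , γ)))
      all-elim t u γ {s} i h i< with pre , a , k , e , e′ ← suffix (⟦ t ⟧ γ) i i< =
        pre , a , k , e , e′ , conjoin-elim {f = λ a k → form u (a , k , false , γ)} pre
          (subst (λ xs → Sat M s (conjoin (λ a k → form u (a , k , false , γ)) top⊤ xs)) e h)

      AtInput : S → ℕ → Sym → Set
      AtInput s zero    c = At 0 s 0 (headL Fin.zero c)
      AtInput s (suc i) c = At 0 s i (sideL true Fin.zero c)

      at-input : ∀ b k f w s → Sat M s (form letterᵗ (b , k , f , w , tt)) ≡ AtInput s (length k) (bit b)
      at-input true  []      f w s = refl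
      at-input true  (c ∷ k) f w s = refl
      at-input false []      f w s = refl
      at-input false (c ∷ k) f w s = refl

      module _ (w : Word) where

        cells-length : length (⟦ cellsT ⟧ (w , tt)) ≡ suc (N w)
        cells-length = cong suc (space-length w)

        cell-elim : ∀ u {s} i → Sat M s (form (allᵗ cellsT u) (w , tt)) → i ≤ N w →
          Σ[ a ∈ Bool ] Σ[ k ∈ Word ] (length k ≡ i × Sat M s (form u (a , k , false , w , tt)))
        cell-elim u i h i≤ = let _ , a , k , _ , e , g = all-elim cellsT u (w , tt) i h (subst (suc i ≤_) (sym cells-length) (s≤s i≤)) in a , k , e , g

        Sup : ℕ → S → Conf → Set
        Sup r s C = ∀ i a → i ≤ N w → on C i a ≡ true → At r s i a

        TapeSup : ℕ → S → Fin m → Tape Γ → Set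
        TapeSup r s τ t = At r s 0 (headL τ (Tape.head t)) × (∀ b i → i ≤ N w → At r s i (sideL b τ (side b t i)))

        sup-ctl : ∀ {r s C} → Sup r s C → At r s 0 (ctlL (Config.state C))
        sup-ctl {C = C} h = h 0 (ctlL (Config.state C)) z≤n (described C 0 (ctlL _) (refl , refl))

        sup-tape : ∀ {r s C} → Sup r s C → ∀ τ → TapeSup r s τ (Vec.lookup (Config.tapes C) τ)
        sup-tape {C = C} h τ = h 0 (headL τ (Tape.head (Vec.lookup (Config.tapes C) τ))) z≤n (described C 0 (headL τ _) (refl , refl)) , λ b i i≤ → h i (sideL b τ (side b (Vec.lookup (Config.tapes C) τ) i)) i≤ (described C i (sideL b τ _) refl)

        sup-intro : ∀ {r s C} → At r s 0 (ctlL (Config.state C)) → (∀ τ → TapeSup r s τ (Vec.lookup (Config.tapes C) τ)) → Sup r s C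
        sup-intro {C = C} hq ht i (ctlL q) i≤ h with refl , refl ← describes C i (ctlL q) h = hq
        sup-intro {C = C} hq ht i (headL τ c) i≤ h with refl , refl ← describes C i (headL τ c) h = proj₁ (ht τ)
        sup-intro {C = C} hq ht i (sideL b τ c) i≤ h with refl ← describes C i (sideL b τ c) h = proj₂ (ht τ) b i i≤

        Blank : Tape Γ → Set
        Blank t = ∀ b i → N w ≤ i → side b t i ≡ blank

        shift-sound : ∀ {s τ} t c mv b → pushed (c , mv) b → Blank t → TapeSup 0 s τ t → Sat M s (form (shiftᵗ τ c b) (w , tt)) →
          TapeSup 1 s τ (writeMove t (c , mv))
        shift-sound {s} {τ} t c mv b pb blanks (sup-h , sup-s) (y-first , y-blank , y-head , y-cells) = head-at , side-at
          where
          head-at : At 1 s 0 (headL τ (Tape.head (writeMove t (c , mv))))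
          head-at rewrite shift-head t c mv b pb = imp-elim (list-elim (enterᵗ τ b) (w , tt) y-head (symbols-∈ (side (not b) t 0))) (sup-s (not b) 0 z≤n) λ h → h
          kept : ∀ i → i ≤ N w → At 1 s i (sideL b τ (side b (writeMove t (c , mv)) i))
          kept zero    i≤ rewrite shift-first t c mv b pb = y-first
          kept (suc i) i≤ rewrite shift-push t c mv b pb i with a , k , refl , h ← cell-elim (listᵗ (moveᵗ τ b) symbols) i y-cells (≤-trans (n≤1+n i) i≤) =
            imp-elim (proj₂ (list-elim (moveᵗ τ b) (a , k , false , w , tt) h (symbols-∈ (side b t i)))) (sup-s b i (≤-trans (n≤1+n i) i≤)) λ h → h
          taken : ∀ i → i ≤ N w → At 1 s i (sideL (not b) τ (side (not b) (writeMove t (c , mv)) i))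
          taken i i≤ rewrite shift-pop t c mv b pb i with m≤n⇒m<n∨m≡n i≤
          ... | inj₁ i< with a , k , refl , h ← cell-elim (listᵗ (moveᵗ τ b) symbols) i y-cells i≤ =
            imp-elim (proj₁ (list-elim (moveᵗ τ b) (a , k , false , w , tt) h (symbols-∈ (side (not b) t (suc i))))) (sup-s (not b) (suc i) i<) λ h → h
          ... | inj₂ refl rewrite blanks (not b) (suc i) (n≤1+n i) = subst (λ j → At 1 s j (sideL (not b) τ blank)) (space-length w) y-blank
          side-at : ∀ b′ i → i ≤ N w → At 1 s i (sideL b′ τ (side b′ (writeMove t (c , mv)) i))
          side-at b′ i i≤ with other b b′
          ... | inj₁ refl = kept i i≤
          ... | inj₂ refl = taken i i≤

        bools-∈ : ∀ b → b ∈ₗ bools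
        bools-∈ false = here refl
        bools-∈ true  = there (here refl)

        tape-sound : ∀ {s τ} t act → Blank t → TapeSup 0 s τ t → Sat M s (form (tapeᵗ τ act) (w , tt)) → TapeSup 1 s τ (writeMove t act)
        tape-sound t (c , left)  blanks sup h = shift-sound t c left true refl blanks sup h
        tape-sound t (c , right) blanks sup h = shift-sound t c right false refl blanks sup h
        tape-sound {s} {τ} (tape ls x rs) (c , stay) blanks (_ , sup) (y-head , y-cells) = y-head , sides
          where
          sides : ∀ b i → i ≤ N w → At 1 s i (sideL b τ (side b (tape ls c rs) i))
          sides false i i≤ with a , k , refl , h ← cell-elim (listᵗ (sidesᵗ τ) bools) i y-cells i≤ =
            imp-elim (list-elim (λ d → copyᵗ (sideL false τ d)) (a , k , false , w , tt) (list-elim (sidesᵗ τ) (a , k , false , w , tt) {bools} h (bools-∈ false)) (symbols-∈ (cell ls i))) (sup false i i≤) λ h → h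
          sides true  i i≤ with a , k , refl , h ← cell-elim (listᵗ (sidesᵗ τ) bools) i y-cells i≤ =
            imp-elim (list-elim (λ d → copyᵗ (sideL true τ d)) (a , k , false , w , tt) (list-elim (sidesᵗ τ) (a , k , false , w , tt) {bools} h (bools-∈ true)) (symbols-∈ (cell rs i))) (sup true i i≤) λ h → h

        then-sound : ∀ {s} C v → verdict (Config.state C) ≡ v → (∀ τ → Blank (Vec.lookup (Config.tapes C) τ)) → Sup 0 s C →
          Sat M s (form (thenᵗ (Config.state C) v (heads-of C)) (w , tt)) → Sup 1 s (step TM C)
        then-sound {s} C (just _) e blanks sup h i a i≤ o rewrite step-halted C e with b , k , refl , g ← cell-elim (listᵗ copyᵗ lits) i h i≤ =
          imp-elim (list-elim copyᵗ (b , k , false , w , tt) g (lits-∈ a)) (sup i a i≤ o) λ h → h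
        then-sound {s} C nothing e blanks sup (y-ctl , y-tapes) rewrite step-running C e =
          sup-intro {1} {s} {config (proj₁ (δ (Config.state C) (heads-of C))) (Vec.zipWith writeMove (Config.tapes C) acts)} y-ctl λ τ →
            subst (TapeSup 1 s τ) (sym (lookup-zipWith writeMove τ (Config.tapes C) acts))
              (tape-sound {s} {τ} (Vec.lookup (Config.tapes C) τ) (Vec.lookup acts τ) (blanks τ) (sup-tape {0} {s} {C} sup τ) (list-elim (actᵗ (Config.state C) (heads-of C)) (w , tt) y-tapes (∈-allFin τ)))
          where acts = proj₂ (δ (Config.state C) (heads-of C))

        step-sound : ∀ {s} C → (∀ τ → Blank (Vec.lookup (Config.tapes C) τ)) → Sat M s (form stepᵗ (w , tt)) → Sup 0 s C → Sup 1 s (step TM C)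
        step-sound {s} C blanks h sup i a i≤ o = imp-elim rule
          (sup-ctl {0} {s} {C} sup , list-intro (scanᵗ (heads-of C)) (allFin m) λ τ → subst (λ c → At 0 s 0 (headL τ c)) (sym (lookup-map τ Tape.head (Config.tapes C))) (proj₁ (sup-tape {0} {s} {C} sup τ)))
          λ g → then-sound C _ refl blanks sup g i a i≤ o
          where
          rule : Sat M s (form (ruleᵗ (Config.state C) (heads-of C)) (w , tt))
          rule = list-elim (ruleᵗ (Config.state C)) (w , tt) (list-elim (λ q → listᵗ (ruleᵗ q) (vectors m)) (w , tt) h (enumerate-∈ stateFinite (Config.state C))) (vectors-∈ (heads-of C))

        -- Suppose a literal of `D` is missing at the end. Then the links make it missing at the end
        -- of every child of this kind. But some child exists, received all literals of `C`, and
        -- therefore has those of `D`. The existence of the child is only known negatively, which is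
        -- enough for a refutation.
        half : ∀ {s} r r′ c j {C D} → ¬ (Sat M s (□ (∼ kid c j))) → (∀ i a → i ≤ N w → Sat M s (linked r r′ c j i a)) →
          (∀ u → s ~[ Fin.zero ] u → ∀ v → u ~[ Fin.suc Fin.zero ] v → Sat M v (kid c j) → Sup 0 v C → Sup 1 v D) → Sup r s C → Sup r′ s D
        half {s} r r′ c j {C} seed link reach sup i a i≤ o = stable λ no → seed λ u su v uv k →
          proj₂ (link i a i≤) (no , λ box → box u su v uv (k , λ n-y → n-y (reach u su v uv k (descend u su v uv k) i a i≤ o)))
          where
          descend : ∀ u → s ~[ Fin.zero ] u → ∀ v → u ~[ Fin.suc Fin.zero ] v → Sat M v (kid c j) → Sup 0 v C
          descend u su v uv k i a i≤ o = imp-elim (proj₁ (link i a i≤)) (sup i a i≤ o) λ box → stable λ n-x → box u su v uv (k , n-x)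

        -- Quantified over all starting times, because the same subformula describes both halves of
        -- a block.
        Reach : ℕ → S → Set
        Reach k s = ∀ t → Sup 0 s (after TM t w) → Sup 1 s (after TM (2 ^ k + t) w)

        layer : Bool → Word → Fm × Fm
        layer a k = form splitᵗ (a , k , false , w , tt) , form (levelᵗ (next v1)) (a , k , false , w , tt)

        split-sound : ∀ {s} φ k a js → (∀ v → Sat M v φ → Reach k v) → Sat M s (proj₁ (layer a js) ∧ □ (proj₂ (layer a js) ⟶ φ)) → Reach (suc k) s
        split-sound {s} φ k a js ih ((seed₀ , seed₁ , links) , guard) t sup =
          subst (λ j → Sup 1 s (after TM j w)) (arith t)
            (half 2 1 true (suc (length js)) {after TM (2 ^ k + t) w} {after TM (2 ^ k + (2 ^ k + t)) w} seed₁ (λ i a i≤ → proj₂ (link i a i≤)) (descend (2 ^ k + t) true)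
              (half 0 2 false (suc (length js)) {after TM t w} {after TM (2 ^ k + t) w} seed₀ (λ i a i≤ → proj₁ (link i a i≤)) (descend t false) sup))
          where
          arith : ∀ t → 2 ^ k + (2 ^ k + t) ≡ 2 ^ suc k + t
          arith t = trans (sym (+-assoc (2 ^ k) (2 ^ k) t)) (cong (_+ t) (cong (2 ^ k +_) (sym (+-identityʳ (2 ^ k)))))
          link : ∀ i b → i ≤ N w → Sat M s (linked 0 2 false (suc (length js)) i b) × Sat M s (linked 2 1 true (suc (length js)) i b)
          link i b i≤ with _ , c , is , _ , refl , h ← all-elim (up cellsT) (listᵗ linkᵗ lits) (a , js , false , w , tt) i links (subst (suc i ≤_) (sym cells-length) (s≤s i≤))
            with h₁ , h₂ , h₃ , h₄ ← list-elim linkᵗ (c , is , false , a , js , false , w , tt) h (lits-∈ b) = (h₁ , h₂) , (h₃ , h₄)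
          descend : ∀ t c u → s ~[ Fin.zero ] u → ∀ v → u ~[ Fin.suc Fin.zero ] v → Sat M v (kid c (suc (length js))) →
            Sup 0 v (after TM t w) → Sup 1 v (after TM (2 ^ k + t) w)
          descend t c u su v uv h sup i b i≤ o = stable λ no → guard u su v uv (kid-level c M v h , λ hφ → no (ih v hφ t sup i b i≤ o))

        nested-sound : ∀ xs φ k → (∀ s → Sat M s φ → Reach k s) → ∀ s → Sat M s (nested layer φ xs) → Reach (length xs + k) s
        nested-sound []       φ k ih s h = ih s h
        nested-sound (a ∷ xs) φ k ih s h = subst (λ j → Reach j s) (+-suc (length xs) k)
          (nested-sound xs _ (suc k) (λ v → split-sound φ k a xs ih) s h)

      letters : ∀ w {s} → Sat M s (form (allᵗ (revT v0) letterᵗ) (w , tt)) → ∀ i → i < length w → AtInput s i (cell (List.map bit w) i)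
      letters w {s} h i i< with pre , a , k , e , refl , g ← all-elim (revT v0) letterᵗ (w , tt) i h
        (subst (suc i ≤_) (sym (trans (cong length (iterate-rev [] w)) (length-reverse w))) i<) =
          subst (AtInput s (length k)) (sym letter) (subst (λ A → A) (at-input a k false w s) g)
        where
        letter : cell (List.map bit w) (length k) ≡ bit a
        letter = trans (cong₂ (λ v i → cell (List.map bit v) i) (split-ʳ++ w pre (trans (sym (iterate-rev [] w)) e)) (sym (+-identityʳ (length k)))) (cell-bits-ʳ++ k _ 0)

      init-sound : ∀ w {s} → Sat M s (form initᵗ (w , tt)) → Sup w 0 s (initial TM w)
      init-sound w {s} (ctl , lefts , others , empty , input , beyond) = sup-intro w {0} {s} {initial TM w} ctl tapes
        where
        head-at : ∀ w → Sat M s (form emptyᵗ (w , tt)) →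
          (∀ i → i < length w → AtInput s i (cell (List.map bit w) i)) → At 0 s 0 (headL Fin.zero (Tape.head (inputTape w)))
        head-at []      h k = h
        head-at (b ∷ w) h k = k 0 (s≤s z≤n)
        left-at : ∀ τ i → i ≤ N w → At 0 s i (sideL false τ blank)
        left-at τ i i≤ with a , k , refl , h ← cell-elim w (listᵗ leftᵗ (allFin m)) i lefts i≤ = list-elim leftᵗ (a , k , false , w , tt) h (∈-allFin τ)
        room : ∀ w i → length w ≤ suc i → length (caseList w [] (λ _ v → v)) ≤ i
        room []      i h       = z≤n
        room (b ∷ w) i (s≤s h) = h
        tapes : ∀ τ → TapeSup w 0 s τ (Vec.lookup (Config.tapes (initial TM w)) τ)
        tapes Fin.zero = head-at w empty (letters w input) , sides
          where
          right-at : ∀ i → i ≤ N w → At 0 s i (sideL true Fin.zero (cell (List.map bit w) (suc i)))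
          right-at i i≤ with <-≤-connex (suc i) (length w)
          ... | inj₁ i< = letters w input (suc i) i<
          ... | inj₂ w≤ rewrite cell-beyond (List.map bit w) (suc i) (subst (_≤ suc i) (sym (length-map bit w)) w≤)
            with _ , k , e , h ← cell-elim w beyondᵗ (i ∸ length (caseList w [] (λ _ v → v))) beyond (≤-trans (m∸n≤m i (length (caseList w [] (λ _ v → v)))) i≤) =
              subst (λ j → At 0 s j (sideL true Fin.zero blank))
                (trans (length-++ (caseList w [] (λ _ v → v))) (trans (cong (length (caseList w [] (λ _ v → v)) +_) e) (m+[n∸m]≡n (room w i w≤)))) h
          sides : ∀ b i → i ≤ N w → At 0 s i (sideL b Fin.zero (side b (inputTape w) i))
          sides true  i i≤ = subst (λ c → At 0 s i (sideL true Fin.zero c)) (sym (contents-input w (suc i))) (right-at i i≤)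
          sides false i i≤ = subst (λ c → At 0 s i (sideL false Fin.zero c)) (sym (blank-left w)) (left-at Fin.zero i i≤)
            where
            blank-left : ∀ w → side false (inputTape w) i ≡ blank
            blank-left []      = refl
            blank-left (_ ∷ _) = refl
        tapes (Fin.suc τ) rewrite lookup-replicate τ (blankTape {Γ}) = proj₁ extra , sides
          where
          extra = list-elim extraᵗ (w , tt) others (∈-allFin τ)
          sides : ∀ b i → i ≤ N w → At 0 s i (sideL b (Fin.suc τ) (side b blankTape i))
          sides false i i≤ = left-at (Fin.suc τ) i i≤
          sides true  i i≤ with _ , k , refl , h ← cell-elim w (x v1 (sideL true (Fin.suc τ) blank)) i (proj₂ extra) i≤ = h

    module _ (bounded : RunsInSpace TM p) where

      sides-blank : ∀ w t b (τ : Fin m) i → N w ≤ i → side b (Vec.lookup (Config.tapes (after TM t w)) τ) i ≡ blank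
      sides-blank w t = bounded-sides (after TM t w) (bounded w t)

      satisfiable-accepts : ∀ w → Satisfiable (formulaOf w) → verdictAfter TM (2 ^ K# w) w ≡ just true
      satisfiable-accepts w (M , s , init , rejects , reach) = accepting _ refl
        where
        open Soundness M
        final : Sup w 1 s (after TM (2 ^ K# w) w)
        final = subst (λ j → Sup w 1 s (after TM j w)) (trans (+-identityʳ _) (cong (2 ^_) (trans (+-identityʳ _) (levels-length w))))
          (nested-sound w (⟦ levelsT ⟧ (w , tt)) (form stepᵗ (w , tt)) 0
            (λ v h t → step-sound w (after TM t w) (λ τ b i → sides-blank w t b τ i) h) s reach 0 (init-sound w init))
        accepting : ∀ v → verdictAfter TM (2 ^ K# w) w ≡ v → v ≡ just true
        accepting v e with v | subst (λ v → Sat M s (form (rejectᵗ (Config.state (after TM (2 ^ K# w) w)) v) (w , tt))) e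
          (list-elim (λ q → rejectᵗ q (verdict q)) (w , tt) rejects (enumerate-∈ stateFinite _))
        ... | just true  | _ = refl
        ... | just false | h = ⊥-elim (h (sup-ctl w {1} {C = after TM (2 ^ K# w) w} final))
        ... | nothing    | h = ⊥-elim (h (sup-ctl w {1} {C = after TM (2 ^ K# w) w} final))

-- Acceptance implies satisfiability

module FormulaCompleteness where

  open Bounds
  open Terms
  open ListTerms
  open Numerals
  open Queries
  open Templates
  open SavitchFormulas
  open FormulaSoundness
  open Equivalence using (to; from)

  readOnes : Digits → ℕ × Digits
  readOnes []           = 0 , []
  readOnes (false ∷ ds) = 0 , ds
  readOnes (true ∷ ds)  = suc (proj₁ (readOnes ds)) , proj₂ (readOnes ds)

  readOnes-ones : ∀ k ds → readOnes (ones k ds) ≡ (k , ds)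
  readOnes-ones zero    ds = refl
  readOnes-ones (suc k) ds rewrite readOnes-ones k ds = refl

  -- Decoding names allows the valuation to be defined on all atoms at once.
  readName : Digits → ℕ × ℕ × Kind
  readName ds = let r , ds = readOnes ds ; i , ds = readOnes ds ; g , ds = readOnes ds ; a , ds = readOnes ds ; b , _ = readOnes ds in r , i , g , a , b

  readName-name : ∀ r i κ → readName (name r i κ) ≡ (r , i , κ)
  readName-name r i (g , a , b)
    rewrite readOnes-ones r (ones i (kindName (g , a , b))) | readOnes-ones i (kindName (g , a , b))
          | readOnes-ones g (ones a (ones b [])) | readOnes-ones a (ones b []) | readOnes-ones b [] = refl

  vec-ext : ∀ {X : Set} {k} (u v : Vec X k) → (∀ τ → Vec.lookup u τ ≡ Vec.lookup v τ) → u ≡ v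
  vec-ext u v h = trans (sym (tabulate∘lookup u)) (trans (tabulate-cong h) (tabulate∘lookup v))

  depth₀ : ∀ l → Depth l
  depth₀ DBEL  = 0
  depth₀ EDPAL = ℤ.+ 0

  module Converse (TM : Machine) (n′ : ℕ) (l : Logic) (p : Polynomial) where
    open Correctness TM n′ l p public

    module Introduction (M : Model n l) where
      open Soundness M public
      open Model M

      all-intro : ∀ {Θ} (t : Tm Θ (list bool)) u γ {s} → (∀ pre a k → ⟦ t ⟧ γ ≡ pre ++ a ∷ k → Sat M s (form u (a , k , false , γ))) → Sat M s (form (allᵗ t u) γ)
      all-intro t u γ {s} h = conjoin-intro (⟦ t ⟧ γ) (top-holds s) h

      module _ (w : Word) {s : S} where

        shift-complete : ∀ τ t c mv b → pushed (c , mv) b → (∀ b i → N w ≤ i → side b (writeMove t (c , mv)) i ≡ blank) →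
          (∀ b i c → At 0 s i (sideL b τ c) → side b t i ≡ c) → At 1 s 0 (headL τ (Tape.head (writeMove t (c , mv)))) →
          (∀ b i → At 1 s i (sideL b τ (side b (writeMove t (c , mv)) i))) → Sat M s (form (shiftᵗ τ c b) (w , tt))
        shift-complete τ t c mv b pb blanks x-side y-head y-side =
          subst (λ c → At 1 s 0 (sideL b τ c)) (shift-first t c mv b pb) (y-side b 0) ,
          subst (λ c → At 1 s (length (⟦ spaceT ⟧ (w , tt))) (sideL (not b) τ c)) (blanks (not b) _ (≤-reflexive (sym (space-length w)))) (y-side (not b) _) ,
          list-intro (enterᵗ τ b) symbols (λ d → λ { (h , no) → no (subst (λ c → At 1 s 0 (headL τ c)) (trans (shift-head t c mv b pb) (x-side (not b) 0 d h)) y-head) }) ,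
          all-intro cellsT (listᵗ (moveᵗ τ b) symbols) (w , tt) λ _ a k _ → list-intro (moveᵗ τ b) symbols {a , k , false , w , tt} λ d →
            (λ { (h , no) → no (subst (λ c → At 1 s (length k) (sideL (not b) τ c)) (trans (shift-pop t c mv b pb (length k)) (x-side (not b) (suc (length k)) d h)) (y-side (not b) (length k))) }) ,
            (λ { (h , no) → no (subst (λ c → At 1 s (suc (length k)) (sideL b τ c)) (trans (shift-push t c mv b pb (length k)) (x-side b (length k) d h)) (y-side b (suc (length k)))) })

        tape-complete : ∀ τ t act → (∀ b i → N w ≤ i → side b (writeMove t act) i ≡ blank) →
          (∀ b i c → At 0 s i (sideL b τ c) → side b t i ≡ c) → At 1 s 0 (headL τ (Tape.head (writeMove t act))) →
          (∀ b i → At 1 s i (sideL b τ (side b (writeMove t act) i))) → Sat M s (form (tapeᵗ τ act) (w , tt))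
        tape-complete τ t (c , left)  = shift-complete τ t c left true refl
        tape-complete τ t (c , right) = shift-complete τ t c right false refl
        tape-complete τ (tape ls x rs) (c , stay) blanks x-side y-head y-side = y-head ,
          all-intro cellsT (listᵗ (sidesᵗ τ) bools) (w , tt) λ _ a k _ → list-intro (sidesᵗ τ) bools {a , k , false , w , tt} λ
            { false → list-intro (λ d → copyᵗ (sideL false τ d)) symbols {a , k , false , w , tt} λ d → λ { (h , no) → no (subst (λ c → At 1 s (length k) (sideL false τ c)) (x-side false (length k) d h) (y-side false (length k))) }
            ; true  → list-intro (λ d → copyᵗ (sideL true τ d)) symbols {a , k , false , w , tt} λ d → λ { (h , no) → no (subst (λ c → At 1 s (length k) (sideL true τ c)) (x-side true (length k) d h) (y-side true (length k))) } }

        module _ (C : Conf) (blanks : ∀ b (τ : Fin m) i → N w ≤ i → side b (Vec.lookup (Config.tapes (step TM C)) τ) i ≡ blank)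
                 (x⁻ : ∀ i a → At 0 s i a → Describes C i a) (y⁺ : ∀ i a → Describes (step TM C) i a → At 1 s i a) where

          then-complete : ∀ v → verdict (Config.state C) ≡ v → Sat M s (form (thenᵗ (Config.state C) v (heads-of C)) (w , tt))
          then-complete (just _) e = all-intro cellsT (listᵗ copyᵗ lits) (w , tt) λ _ a k _ → list-intro copyᵗ lits {a , k , false , w , tt} λ a →
            λ { (h , no) → no (y⁺ (length k) a (subst (λ C → Describes C (length k) a) (sym (step-halted C e)) (x⁻ (length k) a h))) }
          then-complete nothing e = y⁺ 0 (ctlL _) (refl , cong Config.state (step-running C e)) ,
            list-intro (actᵗ (Config.state C) (heads-of C)) (allFin m) λ τ →
              tape-complete τ (Vec.lookup (Config.tapes C) τ) (Vec.lookup acts τ)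
                (λ b i N≤ → trans (cong (λ t → side b t i) (sym (moved τ))) (blanks b τ i N≤))
                (λ b i c → x⁻ i (sideL b τ c))
                (y⁺ 0 (headL τ _) (refl , cong Tape.head (moved τ)))
                (λ b i → y⁺ i (sideL b τ _) (cong (λ t → side b t i) (moved τ)))
            where
            acts = proj₂ (δ (Config.state C) (heads-of C))
            moved : ∀ τ → Vec.lookup (Config.tapes (step TM C)) τ ≡ writeMove (Vec.lookup (Config.tapes C) τ) (Vec.lookup acts τ)
            moved τ = trans (cong (λ C → Vec.lookup (Config.tapes C) τ) (step-running C e)) (lookup-zipWith writeMove τ (Config.tapes C) acts)

          step-complete : Sat M s (form stepᵗ (w , tt))
          step-complete = list-intro (λ q → listᵗ (ruleᵗ q) (vectors m)) ctls λ q → list-intro (ruleᵗ q) (vectors m) λ hs → rule q hs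
            where
            rule : ∀ q hs → Sat M s (form (ruleᵗ q hs) (w , tt))
            rule q hs ((x-ctl , x-heads) , no) with refl ← proj₂ (x⁻ 0 (ctlL q) x-ctl)
              with refl ← vec-ext (heads-of C) hs (λ τ → trans (lookup-map τ Tape.head (Config.tapes C))
                (proj₂ (x⁻ 0 (headL τ (Vec.lookup hs τ)) (list-elim (scanᵗ hs) (w , tt) x-heads (∈-allFin τ))))) = no (then-complete _ refl)

        module _ (x⁺ : ∀ i a → Describes (initial TM w) i a → At 0 s i a) where

          left-blank : ∀ τ i → side false (Vec.lookup (Config.tapes (initial TM w)) τ) i ≡ blank
          left-blank Fin.zero    i = go w
            where
            go : ∀ w → side false (inputTape w) i ≡ blank
            go []      = refl
            go (_ ∷ _) = refl
          left-blank (Fin.suc τ) i = cong (λ t → side false t i) (lookup-replicate τ blankTape)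

          input-complete : ∀ i c → cell (List.map bit w) i ≡ c → AtInput s i c
          input-complete zero    c e = x⁺ 0 (headL Fin.zero c) (refl , trans (contents-input w 0) e)
          input-complete (suc i) c e = x⁺ i (sideL true Fin.zero c) (trans (contents-input w (suc i)) e)

          init-complete : Sat M s (form initᵗ (w , tt))
          init-complete = x⁺ 0 (ctlL q₀) (refl , refl) ,
            all-intro cellsT (listᵗ leftᵗ (allFin m)) (w , tt) (λ _ a k _ → list-intro leftᵗ (allFin m) {a , k , false , w , tt} λ τ → x⁺ (length k) (sideL false τ blank) (left-blank τ (length k))) ,
            list-intro extraᵗ (allFin extraTapes) (λ τ → x⁺ 0 (headL (Fin.suc τ) blank) (refl , cong Tape.head (lookup-replicate τ blankTape)) ,
              all-intro cellsT (x v1 (sideL true (Fin.suc τ) blank)) (w , tt) λ _ a k _ → x⁺ (length k) (sideL true (Fin.suc τ) blank) (cong (λ t → side true t (length k)) (lookup-replicate τ blankTape))) ,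
            empty w (input-complete 0 blank) ,
            all-intro (revT v0) letterᵗ (w , tt) (λ pre a k e → subst (λ A → A) (sym (at-input a k false w s))
              (input-complete (length k) (bit a) (trans (cong₂ (λ v i → cell (List.map bit v) i) (split-ʳ++ w pre (trans (sym (iterate-rev [] w)) e)) (sym (+-identityʳ (length k)))) (cell-bits-ʳ++ k _ 0)))) ,
            all-intro cellsT beyondᵗ (w , tt) (λ _ a k _ → input-complete (suc (length (caseList w [] (λ _ v → v) ++ k))) blank
              (cell-beyond (List.map bit w) _ (subst (_≤ suc (length (caseList w [] (λ _ v → v) ++ k))) (sym (length-map bit w)) (past w k))))
            where
            empty : ∀ w → (cell (List.map bit w) 0 ≡ blank → AtInput s 0 blank) → Sat M s (form emptyᵗ (w , tt))
            empty []      h = h refl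
            empty (_ ∷ _) h = top-holds s
            past : ∀ w k → length w ≤ suc (length (caseList w [] (λ _ v → v) ++ k))
            past []      k = z≤n
            past (b ∷ w) k = s≤s (≤-trans (m≤m+n (length w) (length k)) (≤-reflexive (sym (length-++ w))))

    module Tree (bounded : RunsInSpace TM p) (w : Word) where

      Path : Set
      Path = List Bool

      height : ℕ
      height = K# w

      -- A path of length j is the block of 2 ^ (height ∸ j) steps reached from [] by halving.
      time : Path → ℕ
      time []      = 0
      time (b ∷ q) = (if b then 2 ^ (height ∸ suc (length q)) else 0) + time q

      branch : Path → Bool
      branch []      = false
      branch (b ∷ _) = b

      -- The registers are those of the formula: start, end and middle of the block, then the level,
      -- which intermediate states lack, and the side of the last branching.
      label : Path × Bool → ℕ → ℕ → Kind → Bool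
      label (q , _)   0 i κ = bitOf (after TM (time q) w) i κ
      label (q , _)   1 i κ = bitOf (after TM (2 ^ (height ∸ length q) + time q) w) i κ
      label (q , _)   2 i κ = bitOf (after TM (2 ^ (height ∸ suc (length q)) + time q) w) i κ
      label (q , mid) 3 i κ = not mid && (i ≡ᵇ length q)
      label (q , _)   _ i κ = branch q

      -- The states (q , true) are intermediate, so that the second agent separates a path from
      -- itself only through its parent and □ leads from q to both of its children.
      rep : Fin n → Path × Bool → Path
      rep Fin.zero           (q , _)     = q
      rep (Fin.suc Fin.zero) (q , false) = List.drop 1 q
      rep (Fin.suc _)        (q , _)     = q

      opaque
        value-at : Path × Bool → ℕ → Bool
        value-at s k = let r , i , κ = readName (numeral k) in label s r i κ

        V-name : ∀ s r i κ → value-at s (value (name r i κ)) ≡ label s r i κ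
        V-name s r i κ = cong (λ (r , i , κ) → label s r i κ) (trans (cong readName (sym (numeral-value (name r i κ)))) (readName-name r i κ))

      tree : Model n l
      tree = record
        { S             = Path × Bool
        ; _~[_]_        = λ s a t → rep a s ≡ rep a t
        ; ~-equivalence = λ a → record { refl = refl ; sym = sym ; trans = trans }
        ; V             = value-at
        ; d             = λ _ _ → depth₀ l
        }

      open Introduction tree

      At⁺ : ∀ s r i κ → label s r i κ ≡ true → value-at s (value (name r i κ)) ≡ true
      At⁺ s r i κ = trans (V-name s r i κ)

      At⁻ : ∀ s r i κ → value-at s (value (name r i κ)) ≡ true → label s r i κ ≡ true
      At⁻ s r i κ = trans (sym (V-name s r i κ))

      level-of : ∀ s i → Sat tree s (named 3 i (0 , 0 , 0)) → Σ[ q ∈ Path ] s ≡ (q , false) × length q ≡ i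
      level-of (q , false) i h = q , refl , sym (≡ᵇ-eq i _ (At⁻ (q , false) 3 i (0 , 0 , 0) h))
      level-of (q , true)  i h with () ← At⁻ (q , true) 3 i (0 , 0 , 0) h

      kid-holds : ∀ c q → Sat tree (c ∷ q , false) (kid c (suc (length q)))
      kid-holds true  q = At⁺ (true ∷ q , false) 3 (suc (length q)) (0 , 0 , 0) (≡ᵇ-refl (suc (length q))) , At⁺ (true ∷ q , false) 4 0 (0 , 0 , 0) refl
      kid-holds false q = At⁺ (false ∷ q , false) 3 (suc (length q)) (0 , 0 , 0) (≡ᵇ-refl (suc (length q))) , λ h → case-false (At⁻ (false ∷ q , false) 4 0 (0 , 0 , 0) h)
        where
        case-false : ¬ false ≡ true
        case-false ()

      kid-branch : ∀ c b q i → Sat tree (b ∷ q , false) (kid c i) → b ≡ c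
      kid-branch true  true  q i h = refl
      kid-branch true  false q i (_ , h) with () ← At⁻ (false ∷ q , false) 4 0 (0 , 0 , 0) h
      kid-branch false false q i h = refl
      kid-branch false true  q i (_ , h) = ⊥-elim (h (At⁺ (true ∷ q , false) 4 0 (0 , 0 , 0) refl))

      -- The second agent leads from `(q , true)` to the children of `q`, but from `(q , false)` to
      -- the siblings of `q`, which the level rules out. Between the two children the branch atom
      -- decides.
      kid-is : ∀ c q u v → rep Fin.zero (q , false) ≡ rep Fin.zero u → rep (Fin.suc Fin.zero) u ≡ rep (Fin.suc Fin.zero) v →
        Sat tree v (kid c (suc (length q))) → v ≡ (c ∷ q , false)
      kid-is c q u v qu uv h with level-of v (suc (length q)) (kid-level c tree v h)
      ... | b ∷ r , refl , e = cong₂ (λ b r → b ∷ r , false) (kid-branch c b r (suc (length q)) h) (parent u qu uv)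
        where
        parent : ∀ u → rep Fin.zero (q , false) ≡ rep Fin.zero u → rep (Fin.suc Fin.zero) u ≡ r → r ≡ q
        parent (_ , true)      refl e′   = sym e′
        parent ([] , false)    refl e′   = sym e′
        parent (_ ∷ _ , false) refl refl = ⊥-elim (<-irrefl (suc-injective e) (n<1+n (length r)))

      Level : ℕ → Fm → Set
      Level j φ = ∀ q → length q ≡ j → Sat tree (q , false) φ

      box-kid : ∀ c q ψ → Sat tree (c ∷ q , false) ψ → Sat tree (q , false) (□ (kid c (suc (length q)) ⟶ ψ))
      box-kid c q ψ h u qu v uv (k , no) with refl ← kid-is c q u v qu uv k = no h

      split-complete : ∀ φ a js → length js < height → Level (suc (length js)) φ → Level (length js) (proj₁ (layer w a js) ∧ □ (proj₂ (layer w a js) ⟶ φ))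
      split-complete φ a js j<height hφ q e = (seed false , seed true , all-intro (up cellsT) (listᵗ linkᵗ lits) (a , js , false , w , tt)
          λ _ b k _ → list-intro linkᵗ lits {b , k , false , a , js , false , w , tt} λ x → links (length k) x) , guarded
        where
        seed : ∀ c → ¬ Sat tree (q , false) (□ (∼ kid c (suc (length js))))
        seed c box rewrite sym e = box (q , true) refl (c ∷ q , false) refl (kid-holds c q)
        box : ∀ c ψ → Sat tree (c ∷ q , false) ψ → Sat tree (q , false) (□ (kid c (suc (length js)) ⟶ ψ))
        box rewrite sym e = λ c → box-kid c q
        doubled : ∀ t → 2 ^ (height ∸ suc (length q)) + (2 ^ (height ∸ suc (length q)) + t) ≡ 2 ^ (height ∸ length q) + t
        doubled t rewrite +-∸-assoc 1 (subst (λ j → suc j ≤ height) (sym e) j<height) | +-identityʳ (2 ^ (height ∸ suc (length q))) =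
          sym (+-assoc (2 ^ (height ∸ suc (length q))) (2 ^ (height ∸ suc (length q))) t)
        pass : ∀ r r′ c i a → label (q , false) r i (kind a) ≡ label (c ∷ q , false) r′ i (kind a) → At r (q , false) i a → At r′ (c ∷ q , false) i a
        pass r r′ c i a e h = At⁺ (c ∷ q , false) r′ i (kind a) (trans (sym e) (At⁻ (q , false) r i (kind a) h))
        pull : ∀ r r′ c i a → label (q , false) r i (kind a) ≡ label (c ∷ q , false) r′ i (kind a) → ¬ At r (q , false) i a → ¬ At r′ (c ∷ q , false) i a
        pull r r′ c i a e h h′ = h (At⁺ (q , false) r i (kind a) (trans e (At⁻ (c ∷ q , false) r′ i (kind a) h′)))
        -- In the tree each link relates labels that read the same configuration at the same time.
        -- Only for the end of the second half is this not immediate: two half blocks make up the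
        -- block.
        links : ∀ i a → Sat tree (q , false) (named 0 i (kind a) ⟶ □ (kid false (suc (length js)) ⟶ named 0 i (kind a))) ×
                        Sat tree (q , false) (∼ named 2 i (kind a) ⟶ □ (kid false (suc (length js)) ⟶ ∼ named 1 i (kind a))) ×
                        Sat tree (q , false) (named 2 i (kind a) ⟶ □ (kid true (suc (length js)) ⟶ named 0 i (kind a))) ×
                        Sat tree (q , false) (∼ named 1 i (kind a) ⟶ □ (kid true (suc (length js)) ⟶ ∼ named 1 i (kind a)))
        links i a = (λ { (h , no) → no (box false (named 0 i (kind a)) (pass 0 0 false i a refl h)) }) ,
                    (λ { (h , no) → no (box false (∼ named 1 i (kind a)) (pull 2 1 false i a refl h)) }) ,
                    (λ { (h , no) → no (box true (named 0 i (kind a)) (pass 2 0 true i a refl h)) }) ,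
                    (λ { (h , no) → no (box true (∼ named 1 i (kind a)) (pull 1 1 true i a (cong (λ t → bitOf (after TM t w) i (kind a)) (sym (doubled (time q)))) h)) })
        guarded : Sat tree (q , false) (□ (proj₂ (layer w a js) ⟶ φ))
        guarded u qu v uv (h , no) with r , refl , e′ ← level-of v (suc (length js)) h = no (hφ r e′)

      nested-complete : ∀ xs φ → length xs ≤ height → Level (length xs) φ → Level 0 (nested (layer w) φ xs)
      nested-complete []       φ h hφ = hφ
      nested-complete (a ∷ xs) φ h hφ = nested-complete xs _ (≤-trans (n≤1+n _) h) (split-complete φ a xs h hφ)

      leaf : Level height (form stepᵗ (w , tt))
      leaf q e = step-complete w (after TM (time q) w) (λ b τ i → sides-blank bounded w (suc (time q)) b τ i)
        (λ i a h → describes _ i a (At⁻ (q , false) 0 i (kind a) h))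
        (λ i a h → At⁺ (q , false) 1 i (kind a) (trans (cong (λ t → bitOf (after TM (2 ^ t + time q) w) i (kind a)) (trans (cong (height ∸_) e) (n∸n≡0 height))) (described _ i a h)))

      accepts-satisfiable : verdictAfter TM (2 ^ height) w ≡ just true → Satisfiable (formulaOf w)
      accepts-satisfiable acc = tree , ([] , false) ,
        init-complete w (λ i a h → At⁺ ([] , false) 0 i (kind a) (described _ i a h)) ,
        list-intro (λ q → rejectᵗ q (verdict q)) ctls (λ q → reject q (verdict q) refl) ,
        nested-complete (⟦ levelsT ⟧ (w , tt)) (form stepᵗ (w , tt)) (≤-reflexive (levels-length w)) (subst (λ j → Level j (form stepᵗ (w , tt))) (sym (levels-length w)) leaf) [] refl
        where
        rejected : ∀ q v → verdict q ≡ v → ¬ v ≡ just true → ¬ At 1 ([] , false) 0 (ctlL q)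
        rejected q v e ne h with refl ← proj₂ (describes (after TM (2 ^ height + 0) w) 0 (ctlL q) (At⁻ ([] , false) 1 0 (kind (ctlL q)) h)) =
          ne (trans (sym e) (trans (cong (λ t → verdictAfter TM t w) (+-identityʳ (2 ^ height))) acc))
        reject : ∀ q v → verdict q ≡ v → Sat tree ([] , false) (form (rejectᵗ q v) (w , tt))
        reject q (just true)  e = top-holds ([] , false)
        reject q (just false) e = rejected q (just false) e λ ()
        reject q nothing      e = rejected q nothing e λ ()

-- Runs in bounded space halt early or never

module Halting where

  open Bounds
  open Terms
  open ListTerms
  open Numerals
  open Queries
  open Templates
  open SavitchFormulas
  open FormulaSoundness
  open FormulaCompleteness
  open Equivalence using (to; from)

  module Bounded (TM : Machine) (p : Polynomial) (bounded : RunsInSpace TM p) (w : Word) where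
    open Literals TM

    N S# : ℕ
    N = eval p (length w)
    S# = suc N * length lits

    -- Equality up to trailing blanks: the lists of a tape also record how far the head has been,
    -- which neither the literals show nor the machine notices.
    SameTape : Tape Γ → Tape Γ → Set
    SameTape t t′ = Tape.head t ≡ Tape.head t′ × (∀ b i → side b t i ≡ side b t′ i)

    Same : Conf → Conf → Set
    Same C D = Config.state C ≡ Config.state D × (∀ τ → SameTape (Vec.lookup (Config.tapes C) τ) (Vec.lookup (Config.tapes D) τ))

    shift-same : ∀ {t t′} c mv b → pushed (c , mv) b → SameTape t t′ → SameTape (writeMove t (c , mv)) (writeMove t′ (c , mv))
    shift-same {t} {t′} c mv b pb (_ , h) = trans (shift-head t c mv b pb) (trans (h (not b) 0) (sym (shift-head t′ c mv b pb))) , sides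
      where
      kept : ∀ i → side b (writeMove t (c , mv)) i ≡ side b (writeMove t′ (c , mv)) i
      kept zero    = trans (shift-first t c mv b pb) (sym (shift-first t′ c mv b pb))
      kept (suc i) = trans (shift-push t c mv b pb i) (trans (h b i) (sym (shift-push t′ c mv b pb i)))
      sides : ∀ b′ i → side b′ (writeMove t (c , mv)) i ≡ side b′ (writeMove t′ (c , mv)) i
      sides b′ i with other b b′
      ... | inj₁ refl = kept i
      ... | inj₂ refl = trans (shift-pop t c mv b pb i) (trans (h (not b) (suc i)) (sym (shift-pop t′ c mv b pb i)))

    write-same : ∀ {t t′} act → SameTape t t′ → SameTape (writeMove t act) (writeMove t′ act)
    write-same (c , left)  h = shift-same c left true refl h
    write-same (c , right) h = shift-same c right false refl h
    write-same {tape _ _ _} {tape _ _ _} (c , stay) (_ , h) = refl , λ { false → h false ; true → h true }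

    step-same : ∀ C D → Same C D → Same (step TM C) (step TM D)
    step-same C D h@(e , tapes-same) = by (verdict (Config.state C)) refl
      where
      heads-same : heads-of C ≡ heads-of D
      heads-same = vec-ext _ _ λ τ → trans (lookup-map τ Tape.head (Config.tapes C)) (trans (proj₁ (tapes-same τ)) (sym (lookup-map τ Tape.head (Config.tapes D))))
      move-same : δ (Config.state C) (heads-of C) ≡ δ (Config.state D) (heads-of D)
      move-same = cong₂ δ e heads-same
      acts : Conf → Vec (Sym × Move) m
      acts C = proj₂ (δ (Config.state C) (heads-of C))
      moved : ∀ C → verdict (Config.state C) ≡ nothing → ∀ τ → Vec.lookup (Config.tapes (step TM C)) τ ≡ writeMove (Vec.lookup (Config.tapes C) τ) (Vec.lookup (acts C) τ)
      moved C e τ = trans (cong (λ C → Vec.lookup (Config.tapes C) τ) (step-running C e)) (lookup-zipWith writeMove τ (Config.tapes C) (acts C))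
      by : ∀ v → verdict (Config.state C) ≡ v → Same (step TM C) (step TM D)
      by (just b) ev = subst₂ Same (sym (step-halted C ev)) (sym (step-halted D (trans (cong verdict (sym e)) ev))) h
      by nothing  ev = trans (cong Config.state (step-running C ev)) (trans (cong proj₁ move-same) (sym (cong Config.state (step-running D ev′)))) ,
        λ τ → subst₂ SameTape (sym (moved C ev τ))
          (trans (cong (λ d → writeMove (Vec.lookup (Config.tapes D) τ) (Vec.lookup (proj₂ d) τ)) move-same) (sym (moved D ev′ τ)))
          (write-same (Vec.lookup (acts C) τ) (tapes-same τ))
        where
        ev′ : verdict (Config.state D) ≡ nothing
        ev′ = trans (cong verdict (sym e)) ev

    on-same : ∀ s t → (∀ i a → i ≤ N → on (after TM s w) i a ≡ on (after TM t w) i a) → Same (after TM s w) (after TM t w)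
    on-same s t h = proj₂ (across 0 z≤n (ctlL _) (refl , refl)) , λ τ → proj₂ (across 0 z≤n (headL τ _) (refl , refl)) , sides τ
      where
      C D : Conf
      C = after TM s w
      D = after TM t w
      across : ∀ i → i ≤ N → ∀ a → Describes D i a → Describes C i a
      across i i≤ a d = describes C i a (trans (h i a i≤) (described D i a d))
      sides : ∀ τ b i → side b (Vec.lookup (Config.tapes C) τ) i ≡ side b (Vec.lookup (Config.tapes D) τ) i
      sides τ b i with ≤-total i N
      ... | inj₁ i≤ = across i i≤ (sideL b τ _) refl
      ... | inj₂ N≤ = trans (bounded-sides C (bounded w s) b τ i N≤) (sym (bounded-sides D (bounded w t) b τ i N≤))

    flag : Bool → Fin 2
    flag false = Fin.zero
    flag true  = Fin.suc Fin.zero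

    flag-injective : ∀ a b → flag a ≡ flag b → a ≡ b
    flag-injective false false e = refl
    flag-injective true  true  e = refl

    flags : Conf → Fin S# → Fin 2
    flags C k = let i , j = Fin.remQuot {suc N} (length lits) k in flag (on C (toℕ i) (List.lookup lits j))

    row : ∀ {i} → i ≤ N → Fin (suc N)
    row i≤ = Fin.fromℕ< (s≤s i≤)

    column : Lit → Fin (length lits)
    column a = Any.index (lits-∈ a)

    flags-at : ∀ C i a (i≤ : i ≤ N) → flags C (Fin.combine (row i≤) (column a)) ≡ flag (on C i a)
    flags-at C i a i≤ = trans (cong (λ k → flag (on C (toℕ (proj₁ k)) (List.lookup lits (proj₂ k)))) (remQuot-combine (row i≤) (column a)))
      (cong₂ (λ i a → flag (on C i a)) (toℕ-fromℕ< (s≤s i≤)) (sym (lookup-index (lits-∈ a))))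

    pack : Conf → Fin (2 ^ S#)
    pack C = Fin.funToFin (flags C)

    code-flags : ∀ C D → pack C ≡ pack D → ∀ k → flags C k ≡ flags D k
    code-flags C D e k = trans (sym (finToFun-funToFin (flags C) k)) (trans (cong (λ c → Fin.finToFun c k) e) (finToFun-funToFin (flags D) k))

    code-same : ∀ s t → pack (after TM s w) ≡ pack (after TM t w) → Same (after TM s w) (after TM t w)
    code-same s t e = on-same s t λ i a i≤ → flag-injective (on C i a) (on D i a)
      (trans (sym (flags-at C i a i≤)) (trans (code-flags C D e (Fin.combine (row i≤) (column a))) (flags-at D i a i≤)))
      where
      C D : Conf
      C = after TM s w
      D = after TM t w

    after-same : ∀ k s t → Same (after TM s w) (after TM t w) → Same (after TM (k + s) w) (after TM (k + t) w)
    after-same zero    s t h = h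
    after-same (suc k) s t h = step-same _ _ (after-same k s t h)

    stays-halted : ∀ k t {b} → verdictAfter TM t w ≡ just b → verdictAfter TM (k + t) w ≡ just b
    stays-halted zero    t e = e
    stays-halted (suc k) t e = trans (cong (verdict ∘ Config.state) (step-halted (after TM (k + t) w) (stays-halted k t e))) (stays-halted k t e)

    opaque
      repetition : ∀ {k} (f : ℕ → Fin k) → Σ[ s ∈ ℕ ] Σ[ t ∈ ℕ ] (s < t × t ≤ k × f s ≡ f t)
      repetition {k} f with i , j , i<j , e ← pigeonhole (n<1+n k) (λ t → f (toℕ t)) = toℕ i , toℕ j , i<j , ≤-pred (toℕ<n j) , e

    -- A run of at least `2 ^ S#` steps visits two configurations with the same literals, and
    -- cutting out the part between them gives an earlier time with the same verdict. Once halted,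
    -- the machine keeps its verdict up to time `2 ^ S#`.
    halts-early : ∀ {b} t → verdictAfter TM t w ≡ just b → verdictAfter TM (2 ^ S#) w ≡ just b
    halts-early {b} = <-rec _ λ t ih e → case t ih e (≤-total t (2 ^ S#))
      where
      case : ∀ t → (∀ {j} → j < t → verdictAfter TM j w ≡ just b → verdictAfter TM (2 ^ S#) w ≡ just b) →
        verdictAfter TM t w ≡ just b → t ≤ 2 ^ S# ⊎ 2 ^ S# ≤ t → verdictAfter TM (2 ^ S#) w ≡ just b
      case t ih e (inj₁ t≤) = subst (λ j → verdictAfter TM j w ≡ just b) (m∸n+n≡m t≤) (stays-halted (2 ^ S# ∸ t) t e)
      case t ih e (inj₂ t≥) with i , j , i<j , j≤ , same ← repetition (λ t → pack (after TM t w)) =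
        ih (subst (t ∸ j + i <_) (m∸n+n≡m (≤-trans j≤ t≥)) (+-monoʳ-< (t ∸ j) i<j))
          (trans (cong verdict (proj₁ (after-same (t ∸ j) i j (code-same i j same)))) (trans (cong (λ t → verdictAfter TM t w) (m∸n+n≡m (≤-trans j≤ t≥))) e))

-- Hardness and the theorem

open Bounds
open Terms
open ListTerms
open Numerals
open Queries
open Templates
open SavitchFormulas
open FormulaSoundness
open FormulaCompleteness
open Halting
open Equivalence using (to; from)

-- The formula speaks of the configuration after exactly `2 ^ K#` steps. As a decider halts on every
-- input, and early, the verdict found there is its decision.
hardness : ∀ n′ l → PSPACE-hard (SAT (suc (suc n′)) l)
hardness n′ l L (TM , p , decides , bounded) = (λ w → encode (formulaOf w)) , Literals.polyTime-formula TM n′ l p ,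
  λ w → mk⇔ (λ w∈ → SAT-encode n l (formulaOf w) .from (Tree.accepts-satisfiable bounded w (yes-halts w w∈)))
            (λ h → sat-member w (satisfiable-accepts bounded w (SAT-encode n l (formulaOf w) .to h)))
  where
  open Converse TM n′ l p
  yes-halts : ∀ w → L w → verdictAfter TM (2 ^ K# w) w ≡ just true
  yes-halts w w∈ with t , b , e , h ← decides w with refl ← h .from w∈ = Bounded.halts-early TM p bounded w t e
  sat-member : ∀ w → verdictAfter TM (2 ^ K# w) w ≡ just true → L w
  sat-member w acc with t , b , e , h ← decides w =
    h .to (just-injective (trans (sym (Bounded.halts-early TM p bounded w t e)) acc))

theorem5p1 : ∀ (n : ℕ) → 2 ≤ n →
  PSPACE-complete (SAT n DBEL) × PSPACE-complete (SAT n EDPAL)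
theorem5p1 (suc (suc n′)) (s≤s (s≤s z≤n)) = (membership _ DBEL , hardness n′ DBEL) , (membership _ EDPAL , hardness n′ EDPAL)
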